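{- Define the integers $pp_i(n)$ ($i=1,2,3,4$, $n\ge 1$) by the power series identities (in $q$, $|q|<1$) $$\sum_{n\ge1}pp_1(n)q^n=\sum_{n=1}^\infty \frac{q^n}{(q^n;q)_\infty (q^n;q)_{n+1}},\qquad \sum_{n\ge1}pp_2(n)q^n=\sum_{n=1}^\infty \frac{q^{2n}}{(q^n;q)_\infty (q^n;q)_{n+1}},$$ $$\sum_{n\ge1}pp_3(n)q^n=\sum_{n=1}^\infty \frac{q^{n^2+n}}{(q^n;q)_\infty (q^n;q)_{n+1}},\qquad \sum_{n\ge1}pp_4(n)q^n=\sum_{n=1}^\infty \frac{q^{n^2}}{(q^n;q)_\infty (q^n;q)_{n+1}}.$$ Then for all $n\ge 0$ (with $pp_i(0)=0$): $pp_1(3n)\equiv 0 \pmod 3$, $pp_2(3n+1)\equiv 0\pmod 3$, $pp_2(5n+1)\equiv 0\pmod 5$, $pp_3(5n+4)\equiv 0\pmod 5$, $pp_3(7n+1)\equiv 0\pmod 7$, and $pp_4(5n+4)\equiv 0\pmod 5$.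
   Context: $(a;q)_n=\prod_{j=0}^{n-1}(1-aq^j)$ and $(a;q)_\infty=\prod_{j=0}^{\infty}(1-aq^j)$. -}

module Defs where

open import Data.Nat using (ℕ; zero; suc; _+_; _*_; _∸_; _≤?_)
open import Data.Nat.Divisibility using (_∣?_)
open import Data.Bool using (if_then_else_)
open import Relation.Nullary.Decidable using (⌊_⌋)

Series : Set
Series = ℕ → ℕ

sumTo : ℕ → (ℕ → ℕ) → ℕ
sumTo zero    f = 0
sumTo (suc K) f = sumTo K f + f K

_⊛_ : Series → Series → Series
(f ⊛ g) m = sumTo (suc m) (λ k → f k * g (m ∸ k))

one : Series
one zero    = 1
one (suc _) = 0

-- 1/(1 - q^j) = Σ_k q^{jk}   (used only for j ≥ 1)
geom : ℕ → Series
geom j m = if ⌊ j ∣? m ⌋ then 1 else 0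

invPoch : ℕ → ℕ → Series
invPoch a zero    = one
invPoch a (suc k) = invPoch a k ⊛ geom (a + k)

-- 1/(q^a;q)_∞ : the coefficient of q^m only depends on the factors
-- 1/(1-q^j) with j ≤ m, so it equals the coefficient of the finite
-- product over j = a, …, a+m (exact, for a ≥ 1).
invPochInf : ℕ → Series
invPochInf a m = invPoch a (suc m) m

shift : ℕ → Series → Series
shift e f m with e ≤? m
... | Relation.Nullary.Decidable.yes _ = f (m ∸ e)
... | Relation.Nullary.Decidable.no  _ = 0

term : ℕ → ℕ → Series
term e n = shift e (invPochInf n ⊛ invPoch n (suc n))

expo : ℕ → ℕ → ℕ
expo 1 n = n
expo 2 n = 2 * n
expo 3 n = n * n + n
expo 4 n = n * n
expo _ n = n

-- pp_i(m) = coefficient of q^m in Σ_{n≥1} q^{expo i n}/((q^n;q)_∞ (q^n;q)_{n+1}).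
-- Since expo i n ≥ n, the summands with n > m do not contribute to q^m,
-- so the sum over n = 1..m is exact.  In particular pp_i(0) = 0.
pp : ℕ → ℕ → ℕ
pp i m = sumTo m (λ k → term (expo i (suc k)) (suc k) m)

{-# OPTIONS --safe #-}
module Submission where

-- Put E = (q;q)_∞, T_j = j(j+1)/2 and b_n = (q)_{n-1}² / (q)_{2n}, so that E P_i = Σ q^{expo i n} b_n for the generating
-- function P_i of pp i. Moments of the unit Bailey pair give b_n = - Σ_j (-1)^j T_j q^{j(j-1)/2} / ((q)_{n-j} (q)_{n+j}).
-- Interchanging the summations turns E² P_3 and E² P_4 into theta series, and E³ P_1 and E³ P_2 into Hecke-type double sums,
-- all weighted by triangular numbers; with weight 1 the same computation yields E itself, E² and (Jacobi) E³.
-- Modulo a prime ℓ the weights only depend on residues and E^ℓ is a series in q^ℓ, so P_i vanishes on a residue class of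
-- exponents as soon as a product of such series does. Modulo 3, and modulo 5 for P_3 and P_4, no term of the product falls
-- into the class. For P_2 modulo 5 the contributions cancel by linear relations between the residue pieces H a b of the
-- Hecke sum: three reparametrisations of ℤ³ express J H a b through products with theta series, see J-H and Y-κ.
-- For P_3 modulo 7 they cancel by product relations between residue pieces of theta series, among them Klein's quartic.

-- The pieces `H a b` belong to an indefinite form and show no relation term by term. The extra
-- variable c of `J` supplies one: from 3 tri c + tri i + tri k + 2ik a term tri n splits off in
-- three directions, and the cuts of the three resulting cones telescope to the cut of `H`. The
-- restriction c ≡ 1 keeps `J` alive, since over all c the reflection c ↦ 1 - c would cancel it.
-- These relations are proved after multiplication by `J`, whose constant term is -1, so that it can
-- be cancelled; the product relations modulo 7 are cleared of denominators in the same way by theta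
-- series with lowest coefficient 1. The powers of E are dictated by arithmetic. E³ P_2 is completed
-- by powers of E³, a plain theta series, and (E³)^4 is the first that brings the total exponent,
-- 15, to a multiple of 5; this is why the relations for P_2 have degree four in the theta pieces.
-- For P_3 and P_4 modulo 5 one factor E³ suffices, and modulo 7 the completing factor is E^5 = E²
-- E³, with Euler's and Jacobi's series for the two factors.

module Proof where
  open import Level using (0ℓ)
  open import Algebra.Bundles using (CommutativeRing)
  import Algebra.Solver.Ring as RingSolver
  open import Algebra.Solver.Ring.AlmostCommutativeRing using (fromCommutativeRing; _-Raw-AlmostCommutative⟶_)
  open import Data.Empty using (⊥; ⊥-elim)
  open import Data.Fin using (Fin; toℕ; fromℕ<)
  open import Data.Fin.Properties using (all?; toℕ-fromℕ<)
  open import Data.Integer as ℤ using (ℤ; +_; -[1+_]; _+_; _*_; -_; _-_; ∣_∣)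
  open import Data.Integer.DivMod using (_%ℕ_; _/ℕ_; n%ℕd<d; a≡a%ℕn+[a/ℕn]*n)
  open import Data.Integer.Divisibility.Signed as ℤD using (divides; _∣?_; ∣⇒∣ᵤ) renaming (_∣_ to _∣ᶻ_)
  import Data.Integer.Properties as ℤP
  open import Data.Integer.Tactic.RingSolver using (solve-∀)
  open import Data.List using (List; []; _∷_; _++_; map; cartesianProduct; deduplicate; upTo; downFrom)
  import Data.List.Membership.DecPropositional as DecMem
  open import Data.List.Membership.Propositional using (_∈_; _∉_)
  import Data.List.Membership.Propositional.Properties as ∈P
  open import Data.List.Relation.Unary.All as All using (All; []; _∷_)
  open import Data.List.Relation.Unary.AllPairs using ([]; _∷_)
  open import Data.List.Relation.Unary.Any using (here; there)
  open import Data.List.Relation.Unary.Unique.DecPropositional.Properties using (deduplicate-!)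
  open import Data.List.Relation.Unary.Unique.Propositional using (Unique)
  import Data.List.Relation.Unary.Unique.Propositional.Properties as UniqueP
  open import Data.Maybe using (Maybe; just; nothing)
  open import Data.Nat as ℕ using (ℕ; zero; suc; z≤n; s≤s; NonZero)
  open import Data.Nat.Divisibility using (_∣_)
  open import Data.Nat.Induction using (<-rec)
  import Data.Nat.Properties as ℕP
  open import Data.Nat.Tactic.RingSolver using () renaming (solve-∀ to solveℕ)
  open import Data.Product using (_×_; _,_; proj₁; proj₂; Σ; ∃)
  import Data.Product.Properties as ×P
  open import Data.Sum using (_⊎_; inj₁; inj₂; [_,_]′)
  import Data.Sum.Properties as ⊎P
  open import Function using (_∘_; id)
  open import Relation.Binary.Definitions using (DecidableEquality)
  open import Relation.Binary.PropositionalEquality as ≡ using (_≡_; _≢_; refl; sym; trans; cong; cong₂; subst)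
  open import Relation.Nullary using (Dec; yes; no; ¬_)
  open import Relation.Nullary.Decidable using (_×-dec_; _⊎-dec_; ¬?; map′; True; False; toWitness; toWitnessFalse)
  import Defs

  private variable
    Ix Jx : Set

  +congˡ : ∀ a {x y} → x ≡ y → a + x ≡ a + y
  +congˡ a = cong (λ z → a + z)

  -- Power series with integer coefficients and the Cauchy product.

  Ser : Set
  Ser = ℕ → ℤ

  infixl 6 _⊕_
  infixl 7 _⊗_
  infix 8 ⊖_

  opaque
    _⊕_ : Ser → Ser → Ser
    (f ⊕ g) m = f m + g m

    ⊖_ : Ser → Ser
    (⊖ f) m = - f m

    ⊕-at : ∀ f g m → (f ⊕ g) m ≡ f m + g m
    ⊕-at f g m = refl

    ⊖-at : ∀ f m → (⊖ f) m ≡ - f m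
    ⊖-at f m = refl

  -- Peeling the lowest coefficient of the left factor makes the product structurally recursive in
  -- the exponent, so the ring laws follow by plain induction without finite sums.
  _⊗_ : Ser → Ser → Ser
  (f ⊗ g) zero    = f 0 * g 0
  (f ⊗ g) (suc m) = f 0 * g (suc m) + ((f ∘ suc) ⊗ g) m

  con : ℤ → Ser
  con c zero    = c
  con c (suc _) = + 0

  qp : ℕ → Ser
  qp zero    = con (+ 1)
  qp (suc k) zero    = + 0
  qp (suc k) (suc m) = qp k m

  record CongRel : Set₁ where
    field
      R     : ℤ → ℤ → Set
      rrefl : ∀ {x} → R x x
      rsym  : ∀ {x y} → R x y → R y x
      rtrans : ∀ {x y z} → R x y → R y z → R x z
      r+    : ∀ {x y u v} → R x y → R u v → R (x + u) (y + v)
      r*    : ∀ {x y u v} → R x y → R u v → R (x * u) (y * v)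

  module _ (C : CongRel) where
    open CongRel C
    -- The bound k ≤ m lets one induction serve both congruence modulo ℓ and agreement below a power
    -- of q.
    ⊗-rel : ∀ {f f′ g g′} m → (∀ k → k ℕ.≤ m → R (f k) (f′ k)) → (∀ k → k ℕ.≤ m → R (g k) (g′ k)) →
            R ((f ⊗ g) m) ((f′ ⊗ g′) m)
    ⊗-rel zero    p r = r* (p 0 z≤n) (r 0 z≤n)
    ⊗-rel (suc m) p r = r+ (r* (p 0 z≤n) (r (suc m) ℕP.≤-refl))
      (⊗-rel m (λ k le → p (suc k) (s≤s le)) (λ k le → r k (ℕP.m≤n⇒m≤1+n le)))

  ≡-rel : CongRel
  ≡-rel = record { R = _≡_ ; rrefl = refl ; rsym = sym ; rtrans = trans ; r+ = cong₂ _+_ ; r* = cong₂ _*_ }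

  ⊗-ext : ∀ {f f′ g g′} m → (∀ k → k ℕ.≤ m → f k ≡ f′ k) → (∀ k → k ℕ.≤ m → g k ≡ g′ k) →
          (f ⊗ g) m ≡ (f′ ⊗ g′) m
  ⊗-ext = ⊗-rel ≡-rel

  opaque
    unfolding _⊕_
    ⊗-distribʳ : ∀ f g h m → ((f ⊕ g) ⊗ h) m ≡ (f ⊗ h) m + (g ⊗ h) m
    ⊗-distribʳ f g h zero    = ℤP.*-distribʳ-+ (h 0) (f 0) (g 0)
    ⊗-distribʳ f g h (suc m) = trans (+congˡ ((f 0 + g 0) * h (suc m)) (⊗-distribʳ (f ∘ suc) (g ∘ suc) h m))
      (lem (f 0) (g 0) (h (suc m)) _ _)
      where
      lem : ∀ a b c x y → (a + b) * c + (x + y) ≡ (a * c + x) + (b * c + y)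
      lem = solve-∀

  ⊗-scaleˡ : ∀ c f h m → ((λ k → c * f k) ⊗ h) m ≡ c * (f ⊗ h) m
  ⊗-scaleˡ c f h zero    = ℤP.*-assoc c (f 0) (h 0)
  ⊗-scaleˡ c f h (suc m) = trans (+congˡ (c * f 0 * h (suc m)) (⊗-scaleˡ c (f ∘ suc) h m)) (lem c (f 0) (h (suc m)) _)
    where
    lem : ∀ a b d x → a * b * d + a * x ≡ a * (b * d + x)
    lem = solve-∀

  -- Peeling from the other end is what commutativity needs, because the definition treats the two
  -- factors asymmetrically.
  ⊗-last : ∀ f g m → (f ⊗ g) (suc m) ≡ (f ⊗ (g ∘ suc)) m + f (suc m) * g 0
  ⊗-last f g zero    = refl
  ⊗-last f g (suc m) = trans (+congˡ (f 0 * g (suc (suc m))) (⊗-last (f ∘ suc) g m)) (sym (ℤP.+-assoc (f 0 * g (suc (suc m))) _ _))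

  ⊗-comm : ∀ f g m → (f ⊗ g) m ≡ (g ⊗ f) m
  ⊗-comm f g zero    = ℤP.*-comm (f 0) (g 0)
  ⊗-comm f g (suc m) = trans (⊗-last f g m) (trans (cong (_+ f (suc m) * g 0) (⊗-comm f (g ∘ suc) m))
    (trans (ℤP.+-comm ((g ∘ suc ⊗ f) m) _) (cong (_+ (g ∘ suc ⊗ f) m) (ℤP.*-comm (f (suc m)) (g 0)))))

  opaque
    unfolding _⊕_
    ⊗-assoc : ∀ f g h m → ((f ⊗ g) ⊗ h) m ≡ (f ⊗ (g ⊗ h)) m
    ⊗-assoc f g h zero    = ℤP.*-assoc (f 0) (g 0) (h 0)
    ⊗-assoc f g h (suc m) = trans
      (+congˡ ((f 0 * g 0) * h (suc m))
        (trans (⊗-distribʳ (λ k → f 0 * g (suc k)) ((f ∘ suc) ⊗ g) h m)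
               (cong₂ _+_ (⊗-scaleˡ (f 0) (g ∘ suc) h m) (⊗-assoc (f ∘ suc) g h m))))
      (lem (f 0) (g 0) (h (suc m)) _ _)
      where
      lem : ∀ a b c x y → a * b * c + (a * x + y) ≡ a * (b * c + x) + y
      lem = solve-∀

  ⊗-zeroˡ : ∀ g m → ((λ _ → + 0) ⊗ g) m ≡ + 0
  ⊗-zeroˡ g zero    = ℤP.*-zeroˡ (g 0)
  ⊗-zeroˡ g (suc m) = cong₂ _+_ (ℤP.*-zeroˡ (g (suc m))) (⊗-zeroˡ g m)

  ⊗-con : ∀ c g m → (con c ⊗ g) m ≡ c * g m
  ⊗-con c g zero    = refl
  ⊗-con c g (suc m) = trans (+congˡ (c * g (suc m)) (⊗-zeroˡ g m)) (ℤP.+-identityʳ _)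

  ⊗-identityˡ : ∀ g m → (con (+ 1) ⊗ g) m ≡ g m
  ⊗-identityˡ g m = trans (⊗-con (+ 1) g m) (ℤP.*-identityˡ (g m))

  con-* : ∀ a b m → con (a * b) m ≡ (con a ⊗ con b) m
  con-* a b m = trans (lem m) (sym (⊗-con a (con b) m))
    where
    lem : ∀ m → con (a * b) m ≡ a * con b m
    lem zero    = refl
    lem (suc m) = sym (ℤP.*-zeroʳ a)

  -- ℓ = 0 gives equality
  infix 3 _by_

  record Cong (ℓ : ℕ) (x y : ℤ) : Set where
    constructor _by_
    field
      quot : ℤ
      eqn  : x ≡ y + quot * + ℓ

  Cong-rel : ℕ → CongRel
  Cong-rel ℓ = record
    { R = Cong ℓ
    ; rrefl = λ {x} → + 0 by sym (trans (+congˡ (x) (ℤP.*-zeroˡ (+ ℓ))) (ℤP.+-identityʳ x))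
    ; rsym = λ { {x} {y} (k by p) → - k by trans (l₁ y k (+ ℓ)) (cong (_+ - k * + ℓ) (sym p)) }
    ; rtrans = λ { {x} {y} {z} (k by p) (j by q) → k + j by trans p (trans (cong (_+ k * + ℓ) q) (l₂ z k j (+ ℓ))) }
    ; r+ = λ { {x} {y} {u} {v} (k by p) (j by q) → k + j by trans (cong₂ _+_ p q) (l₃ y v k j (+ ℓ)) }
    ; r* = λ { {x} {y} {u} {v} (k by p) (j by q) → (y * j + v * k + k * j * + ℓ) by trans (cong₂ _*_ p q) (l₄ y v k j (+ ℓ)) }
    }
    where
    l₁ : ∀ y k n → y ≡ y + k * n + - k * n
    l₁ = solve-∀
    l₂ : ∀ z k j n → z + j * n + k * n ≡ z + (k + j) * n
    l₂ = solve-∀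
    l₃ : ∀ y v k j n → (y + k * n) + (v + j * n) ≡ (y + v) + (k + j) * n
    l₃ = solve-∀
    l₄ : ∀ y v k j n → (y + k * n) * (v + j * n) ≡ y * v + (y * j + v * k + k * j * n) * n
    l₄ = solve-∀

  Cong-≡ : ∀ {ℓ x y} → x ≡ y → Cong ℓ x y
  Cong-≡ {ℓ} refl = CongRel.rrefl (Cong-rel ℓ)

  Cong-neg : ∀ {ℓ x y} → Cong ℓ x y → Cong ℓ (- x) (- y)
  Cong-neg {ℓ} {x} {y} (k by p) = (- k) by trans (cong -_ p) (lem y k (+ ℓ))
    where
    lem : ∀ y k n → - (y + k * n) ≡ - y + - k * n
    lem = solve-∀

  Cong-0 : ∀ {x y} → Cong 0 x y → x ≡ y
  Cong-0 {x} {y} (k by p) = trans p (trans (+congˡ (y) (ℤP.*-zeroʳ k)) (ℤP.+-identityʳ y))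

  private
    con-0 : ∀ m → con (+ 0) m ≡ + 0
    con-0 zero    = refl
    con-0 (suc m) = refl

  opaque
    unfolding _⊕_ ⊖_
    private
      ⊕-rel : (C : CongRel) → let open CongRel C in ∀ {f f′ g g′} m → R (f m) (f′ m) → R (g m) (g′ m) → R ((f ⊕ g) m) ((f′ ⊕ g′) m)
      ⊕-rel C m = CongRel.r+ C
      ⊖-rel : ∀ ℓ {f g} m → Cong ℓ (f m) (g m) → Cong ℓ ((⊖ f) m) ((⊖ g) m)
      ⊖-rel ℓ m = Cong-neg
      ⊕-assoc : ∀ f g h m → ((f ⊕ g) ⊕ h) m ≡ (f ⊕ (g ⊕ h)) m
      ⊕-assoc f g h m = ℤP.+-assoc (f m) (g m) (h m)
      ⊕-idˡ : ∀ f m → (con (+ 0) ⊕ f) m ≡ f m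
      ⊕-idˡ f m = trans (cong (_+ f m) (con-0 m)) (ℤP.+-identityˡ (f m))
      ⊕-comm : ∀ f g m → (f ⊕ g) m ≡ (g ⊕ f) m
      ⊕-comm f g m = ℤP.+-comm (f m) (g m)
      ⊕-invˡ : ∀ f m → (⊖ f ⊕ f) m ≡ con (+ 0) m
      ⊕-invˡ f m = trans (ℤP.+-inverseˡ (f m)) (sym (con-0 m))
      ⊗-distˡ : ∀ f g h m → (f ⊗ (g ⊕ h)) m ≡ (f ⊗ g ⊕ f ⊗ h) m
      ⊗-distˡ f g h m = trans (⊗-comm f (g ⊕ h) m) (trans (⊗-distribʳ g h f m) (cong₂ _+_ (⊗-comm g f m) (⊗-comm h f m)))
      ⊗-distʳ : ∀ f g h m → ((g ⊕ h) ⊗ f) m ≡ (g ⊗ f ⊕ h ⊗ f) m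
      ⊗-distʳ f g h m = ⊗-distribʳ g h f m
      con-⊕ : ∀ a b m → con (a + b) m ≡ (con a ⊕ con b) m
      con-⊕ a b zero    = refl
      con-⊕ a b (suc m) = refl
      con-⊖ : ∀ a m → con (- a) m ≡ (⊖ con a) m
      con-⊖ a zero    = refl
      con-⊖ a (suc m) = refl

  -- The commutative ring of series modulo ℓ.

  module Modulo (ℓ : ℕ) where
    open CongRel (Cong-rel ℓ) public

    infix 4 _≈_
    record _≈_ (f g : Ser) : Set where
      constructor mk
      field at : ∀ m → Cong ℓ (f m) (g m)
    open _≈_ public

    pw : ∀ {f g} → (∀ m → f m ≡ g m) → f ≈ g
    pw p = mk λ m → Cong-≡ (p m)

    serRing : CommutativeRing 0ℓ 0ℓ
    serRing = record
      { Carrier = Ser ; _≈_ = _≈_ ; _+_ = _⊕_ ; _*_ = _⊗_ ; -_ = ⊖_ ; 0# = con (+ 0) ; 1# = con (+ 1)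
      ; isCommutativeRing = record
        { isRing = record
          { +-isAbelianGroup = record
            { isGroup = record
              { isMonoid = record
                { isSemigroup = record
                  { isMagma = record
                    { isEquivalence = record
                      { refl = mk λ m → rrefl ; sym = λ p → mk λ m → rsym (at p m) ; trans = λ p r → mk λ m → rtrans (at p m) (at r m) }
                    ; ∙-cong = λ p r → mk λ m → ⊕-rel (Cong-rel ℓ) m (at p m) (at r m) }
                  ; assoc = λ f g h → pw (⊕-assoc f g h) }
                ; identity = (λ f → pw (⊕-idˡ f))
                           , (λ f → pw λ m → trans (⊕-comm f (con (+ 0)) m) (⊕-idˡ f m)) }
              ; inverse = (λ f → pw (⊕-invˡ f))
                        , (λ f → pw λ m → trans (⊕-comm f (⊖ f) m) (⊕-invˡ f m))
              ; ⁻¹-cong = λ p → mk λ m → ⊖-rel ℓ m (at p m) }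
            ; comm = λ f g → pw (⊕-comm f g) }
          ; *-cong = λ p r → mk λ m → ⊗-rel (Cong-rel ℓ) m (λ k _ → at p k) (λ k _ → at r k)
          ; *-assoc = λ f g h → pw (⊗-assoc f g h)
          ; *-identity = (λ f → pw (⊗-identityˡ f)) , (λ f → pw λ m → trans (⊗-comm f (con (+ 1)) m) (⊗-identityˡ f m))
          ; distrib = (λ f g h → pw (⊗-distˡ f g h)) , (λ f g h → pw (⊗-distʳ f g h)) }
        ; *-comm = λ f g → pw (⊗-comm f g) } }

    open CommutativeRing serRing public using (setoid)
      renaming (refl to ≈-refl; sym to ≈-sym; trans to ≈-trans; +-cong to ⊕-cong; *-cong to ⊗-cong; -‿cong to ⊖-cong)

    coeffs : CommutativeRing 0ℓ 0ℓ
    coeffs = ℤP.+-*-commutativeRing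

    con-homo : CommutativeRing.rawRing coeffs -Raw-AlmostCommutative⟶ fromCommutativeRing serRing
    con-homo = record
      { ⟦_⟧ = con
      ; +-homo = λ a b → pw (con-⊕ a b)
      ; *-homo = λ a b → pw (con-* a b)
      ; -‿homo = λ a → pw (con-⊖ a)
      ; 0-homo = ≈-refl
      ; 1-homo = ≈-refl }

    -- Coefficients are compared as integers, so the solver proves identities over ℤ only. A
    -- congruence modulo ℓ therefore enters each certificate as an explicit summand ℓ times a
    -- remainder, which `con-congr` then removes.
    con-≟ : ∀ a b → Maybe (con a ≈ con b)
    con-≟ a b with a ℤ.≟ b
    ... | yes refl = just ≈-refl
    ... | no  _    = nothing

    open RingSolver (CommutativeRing.rawRing coeffs) (fromCommutativeRing serRing) con-homo con-≟ public
      using (solve; _:=_; _:+_; _:*_; _:-_; :-_; Polynomial)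
      renaming (con to κ)

    con-congr : ∀ {a b} → Cong ℓ a b → con a ≈ con b
    con-congr p = mk λ { zero → p ; (suc m) → rrefl }

  module Ex = Modulo 0
  open Ex public using () renaming (_≈_ to _≗_; mk to mk≗)

  ex : ∀ {f g} → f ≗ g → ∀ m → f m ≡ g m
  ex p m = Cong-0 (Ex.at p m)

  ≗-pw : ∀ {f g} → (∀ m → f m ≡ g m) → f ≗ g
  ≗-pw = Ex.pw

  lift : ∀ ℓ {f g} → f ≗ g → Modulo._≈_ ℓ f g
  lift ℓ p = Modulo.pw ℓ (ex p)

  -- Agreement below a power of q, and q-adically convergent sums.

  infix 4 _≐[_]_
  record _≐[_]_ (f : Ser) (N : ℕ) (g : Ser) : Set where
    constructor mk≐
    field below : ∀ m → m ℕ.< N → f m ≡ g m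
  open _≐[_]_ public

  𝟘 𝟙 : Ser
  𝟘 = con (+ 0)
  𝟙 = con (+ 1)

  ≐-refl : ∀ {N f} → f ≐[ N ] f
  ≐-refl = mk≐ λ _ _ → refl

  ≐-sym : ∀ {N f g} → f ≐[ N ] g → g ≐[ N ] f
  ≐-sym p = mk≐ λ m l → sym (below p m l)

  ≐-trans : ∀ {N f g h} → f ≐[ N ] g → g ≐[ N ] h → f ≐[ N ] h
  ≐-trans p q = mk≐ λ m l → trans (below p m l) (below q m l)

  ≗⇒≐ : ∀ {N f g} → f ≗ g → f ≐[ N ] g
  ≗⇒≐ p = mk≐ λ m _ → ex p m

  ≐⇒≗ : ∀ {f g} → (∀ N → f ≐[ N ] g) → f ≗ g
  ≐⇒≗ p = ≗-pw λ m → below (p (suc m)) m ℕP.≤-refl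

  ≐-⊕ : ∀ {N f f′ g g′} → f ≐[ N ] f′ → g ≐[ N ] g′ → f ⊕ g ≐[ N ] f′ ⊕ g′
  ≐-⊕ {f = f} {f′} {g} {g′} p q = mk≐ λ m l → trans (⊕-at f g m) (trans (cong₂ _+_ (below p m l) (below q m l)) (sym (⊕-at f′ g′ m)))

  ≐-⊗ : ∀ {N f f′ g g′} → f ≐[ N ] f′ → g ≐[ N ] g′ → f ⊗ g ≐[ N ] f′ ⊗ g′
  ≐-⊗ p q = mk≐ λ m l → ⊗-ext m (λ k le → below p k (ℕP.≤-<-trans le l)) (λ k le → below q k (ℕP.≤-<-trans le l))

  ≐-⊖ : ∀ {N f g} → f ≐[ N ] g → ⊖ f ≐[ N ] ⊖ g
  ≐-⊖ {f = f} {g} p = mk≐ λ m l → trans (⊖-at f m) (trans (cong -_ (below p m l)) (sym (⊖-at g m)))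

  ≐-mono : ∀ {M N f g} → M ℕ.≤ N → f ≐[ N ] g → f ≐[ M ] g
  ≐-mono le p = mk≐ λ m l → below p m (ℕP.<-≤-trans l le)

  record DecEq (Ix : Set) : Set where
    field _≟_ : DecidableEquality Ix
  open DecEq {{...}} public

  instance
    decℕ : DecEq ℕ
    decℕ = record { _≟_ = ℕ._≟_ }
    decℤ : DecEq ℤ
    decℤ = record { _≟_ = ℤ._≟_ }
    dec× : ∀ {Ix Jx} → {{DecEq Ix}} → {{DecEq Jx}} → DecEq (Ix × Jx)
    dec× = record { _≟_ = ×P.≡-dec _≟_ _≟_ }
    dec⊎ : ∀ {Ix Jx} → {{DecEq Ix}} → {{DecEq Jx}} → DecEq (Ix ⊎ Jx)
    dec⊎ = record { _≟_ = ⊎P.≡-dec _≟_ _≟_ }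

  sumL : (Ix → Ser) → List Ix → Ser
  sumL F []       = 𝟘
  sumL F (x ∷ xs) = F x ⊕ sumL F xs

  sumZ : (Ix → ℤ) → List Ix → ℤ
  sumZ φ []       = + 0
  sumZ φ (x ∷ xs) = φ x + sumZ φ xs

  sumL-at : ∀ (F : Ix → Ser) xs m → sumL F xs m ≡ sumZ (λ x → F x m) xs
  sumL-at F [] zero = refl
  sumL-at F [] (suc m) = refl
  sumL-at F (x ∷ xs) m = trans (⊕-at (F x) (sumL F xs) m) (+congˡ (F x m) (sumL-at F xs m))

  sumZ-cong : ∀ {φ ψ : Ix → ℤ} → (∀ x → φ x ≡ ψ x) → ∀ xs → sumZ φ xs ≡ sumZ ψ xs
  sumZ-cong p [] = refl
  sumZ-cong p (x ∷ xs) = cong₂ _+_ (p x) (sumZ-cong p xs)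

  sumZ-0 : ∀ {φ : Ix → ℤ} xs → All (λ x → φ x ≡ + 0) xs → sumZ φ xs ≡ + 0
  sumZ-0 [] [] = refl
  sumZ-0 (x ∷ xs) (p ∷ ps) = cong₂ _+_ p (sumZ-0 xs ps)

  sumZ-+ : ∀ (φ ψ : Ix → ℤ) xs → sumZ (λ x → φ x + ψ x) xs ≡ sumZ φ xs + sumZ ψ xs
  sumZ-+ φ ψ [] = refl
  sumZ-+ φ ψ (x ∷ xs) = trans (+congˡ (φ x + ψ x) (sumZ-+ φ ψ xs)) (lem (φ x) (ψ x) _ _)
    where
    lem : ∀ a b c d → a + b + (c + d) ≡ a + c + (b + d)
    lem = solve-∀

  sumZ-swap : ∀ (D : Ix → Jx → ℤ) xs ys → sumZ (λ x → sumZ (D x) ys) xs ≡ sumZ (λ y → sumZ (λ x → D x y) xs) ys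
  sumZ-swap D [] ys = sym (sumZ-0 ys (All.universal (λ _ → refl) ys))
  sumZ-swap D (x ∷ xs) ys = trans (+congˡ (sumZ (D x) ys) (sumZ-swap D xs ys)) (sym (sumZ-+ (D x) _ ys))

  module _ {{_ : DecEq Ix}} (φ : Ix → ℤ) where
    private
      δ : Ix → Ix → ℤ
      δ x y with x ≟ y
      ... | yes _ = φ y
      ... | no  _ = + 0

      δ-≢ : ∀ {x y} → x ≢ y → δ x y ≡ + 0
      δ-≢ {x} {y} ne with x ≟ y
      ... | yes e = ⊥-elim (ne e)
      ... | no  _ = refl

      δ-refl : ∀ x → δ x x ≡ φ x
      δ-refl x with x ≟ x
      ... | yes _ = refl
      ... | no ne = ⊥-elim (ne refl)

      δ-sym : ∀ x y → δ x y ≡ δ y x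
      δ-sym x y with x ≟ y
      ... | yes refl = sym (δ-refl y)
      ... | no  ne   = sym (δ-≢ (ne ∘ sym))

      δ-0 : ∀ {x} → φ x ≡ + 0 → ∀ y → δ x y ≡ + 0
      δ-0 {x} p y with x ≟ y
      ... | yes refl = p
      ... | no  _    = refl

      row : ∀ {x} ys → Unique ys → x ∈ ys → sumZ (δ x) ys ≡ φ x
      row (y ∷ ys) (ne ∷ u) (here refl) = trans (cong₂ _+_ (δ-refl y) (sumZ-0 ys (All.map δ-≢ ne))) (ℤP.+-identityʳ _)
      row {x} (y ∷ ys) (ne ∷ u) (there x∈) = trans
        (cong₂ _+_ (δ-≢ λ { refl → All.lookup ne x∈ refl }) (row ys u x∈)) (ℤP.+-identityˡ _)

      row′ : ∀ {ys} → Unique ys → (∀ x → x ∈ ys ⊎ φ x ≡ + 0) → ∀ x → sumZ (δ x) ys ≡ φ x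
      row′ {ys} u c x with c x
      ... | inj₁ x∈ = row ys u x∈
      ... | inj₂ p  = trans (sumZ-0 ys (All.universal (δ-0 p) ys)) (sym p)

    -- Double counting: both sides equal the sum of the diagonal matrix `δ` over xs × ys, once by
    -- rows and once by columns. This avoids comparing the two lists as permutations.
    sumZ-support : ∀ {xs ys} → Unique xs → Unique ys → (∀ x → x ∈ xs ⊎ φ x ≡ + 0) → (∀ x → x ∈ ys ⊎ φ x ≡ + 0) →
                   sumZ φ xs ≡ sumZ φ ys
    sumZ-support {xs} {ys} ux uy cx cy = trans (sumZ-cong (λ x → sym (row′ uy cy x)) xs)
      (trans (sumZ-swap δ xs ys)
      (sumZ-cong (λ y → trans (sumZ-cong (λ x → δ-sym x y) xs) (row′ ux cx y)) ys))

  -- xs lists every index whose term is visible below q^N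
  Covers : ℕ → (Ix → Ser) → List Ix → Set
  Covers {Ix} N F xs = Unique xs × (∀ (x : Ix) → x ∈ xs ⊎ F x ≐[ N ] 𝟘)

  con0 : ∀ m → 𝟘 m ≡ + 0
  con0 zero    = refl
  con0 (suc m) = refl

  sumL-covers : {{_ : DecEq Ix}} → ∀ {N} {F : Ix → Ser} {xs ys} → Covers N F xs → Covers N F ys → sumL F xs ≐[ N ] sumL F ys
  sumL-covers {F = F} {xs} {ys} (ux , cx) (uy , cy) = mk≐ λ m l →
    trans (sumL-at F xs m) (trans
      (sumZ-support (λ x → F x m) ux uy (λ x → pt m l (cx x)) (λ x → pt m l (cy x)))
      (sym (sumL-at F ys m)))
    where
    pt : ∀ {x zs} m → m ℕ.< _ → x ∈ zs ⊎ F x ≐[ _ ] 𝟘 → x ∈ zs ⊎ F x m ≡ + 0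
    pt m l (inj₁ p) = inj₁ p
    pt m l (inj₂ p) = inj₂ (trans (below p m l) (con0 m))

  -- convergence of Σ F to s in the q-adic topology
  record SumS (F : Ix → Ser) (s : Ser) : Set where
    constructor mkS
    field part : ∀ N → Σ (List Ix) λ xs → Covers N F xs × sumL F xs ≐[ N ] s
  open SumS public

  Summable : (Ix → Ser) → Set
  Summable {Ix} F = ∀ N → Σ (List Ix) (Covers N F)

  -- The main device for identities: both sides are exhibited as limits of one and the same family.
  sumS-unique : {{_ : DecEq Ix}} → ∀ {F : Ix → Ser} {s t} → SumS F s → SumS F t → s ≗ t
  sumS-unique p q = ≐⇒≗ λ N → let (xs , cx , ex′) = part p N ; (ys , cy , ey) = part q N in
    ≐-trans (≐-sym ex′) (≐-trans (sumL-covers cx cy) ey)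

  total : {F : Ix → Ser} → Summable F → Ser
  total {F = F} S m = sumL F (proj₁ (S (suc m))) m

  covers-mono : ∀ {M N} {F : Ix → Ser} {xs} → M ℕ.≤ N → Covers N F xs → Covers M F xs
  covers-mono le (u , c) = u , λ x → [ inj₁ , inj₂ ∘ ≐-mono le ]′ (c x)

  sumS-total : {{_ : DecEq Ix}} → ∀ {F : Ix → Ser} (S : Summable F) → SumS F (total S)
  sumS-total {F = F} S = mkS λ N → proj₁ (S N) , proj₂ (S N) , mk≐ λ m l →
    below (sumL-covers (covers-mono l (proj₂ (S N))) (proj₂ (S (suc m)))) m ℕP.≤-refl

  sumL-cong : ∀ {F G : Ix → Ser} → (∀ x → F x ≗ G x) → ∀ xs → sumL F xs ≗ sumL G xs
  sumL-cong p [] = Ex.≈-refl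
  sumL-cong p (x ∷ xs) = Ex.⊕-cong (p x) (sumL-cong p xs)

  covers-cong : ∀ {N} {F G : Ix → Ser} {xs} → (∀ x → F x ≗ G x) → Covers N F xs → Covers N G xs
  covers-cong p (u , c) = u , λ x → [ inj₁ , (λ z → inj₂ (≐-trans (≗⇒≐ (Ex.≈-sym (p x))) z)) ]′ (c x)

  sumS-cong : ∀ {F G : Ix → Ser} {s t} → (∀ x → F x ≗ G x) → s ≗ t → SumS F s → SumS G t
  sumS-cong p q S = mkS λ N → let (xs , c , e) = part S N in
    xs , covers-cong p c , ≐-trans (≗⇒≐ (Ex.≈-sym (sumL-cong p xs))) (≐-trans e (≗⇒≐ q))

  sumL-⊕ : ∀ (F G : Ix → Ser) xs → sumL (λ x → F x ⊕ G x) xs ≗ sumL F xs ⊕ sumL G xs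
  sumL-⊕ F G [] = Ex.solve 0 (κ (+ 0) := κ (+ 0) :+ κ (+ 0)) Ex.≈-refl
    where open Ex using (_:+_; _:=_; κ)
  sumL-⊕ F G (x ∷ xs) = Ex.≈-trans (Ex.⊕-cong Ex.≈-refl (sumL-⊕ F G xs))
    (Ex.solve 4 (λ a b c d → a :+ b :+ (c :+ d) := a :+ c :+ (b :+ d)) Ex.≈-refl (F x) (G x) _ _)
    where open Ex using (_:+_; _:=_)

  sumL-⊗ : ∀ g (F : Ix → Ser) xs → sumL (λ x → g ⊗ F x) xs ≗ g ⊗ sumL F xs
  sumL-⊗ g F [] = Ex.solve 1 (λ a → κ (+ 0) := a :* κ (+ 0)) Ex.≈-refl g
    where open Ex using (_:*_; _:=_; κ)
  sumL-⊗ g F (x ∷ xs) = Ex.≈-trans (Ex.⊕-cong Ex.≈-refl (sumL-⊗ g F xs))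
    (Ex.solve 3 (λ a b c → a :* b :+ a :* c := a :* (b :+ c)) Ex.≈-refl g (F x) _)
    where open Ex using (_:+_; _:*_; _:=_)

  ≐0-⊕ : ∀ {N f g} → f ≐[ N ] 𝟘 → g ≐[ N ] 𝟘 → f ⊕ g ≐[ N ] 𝟘
  ≐0-⊕ p q = ≐-trans (≐-⊕ p q) (≗⇒≐ (Ex.solve 0 (κ (+ 0) :+ κ (+ 0) := κ (+ 0)) Ex.≈-refl))
    where open Ex using (_:+_; _:=_; κ)

  ≐0-⊗ : ∀ {N} g {f} → f ≐[ N ] 𝟘 → g ⊗ f ≐[ N ] 𝟘
  ≐0-⊗ g p = ≐-trans (≐-⊗ ≐-refl p) (≗⇒≐ (Ex.solve 1 (λ a → a :* κ (+ 0) := κ (+ 0)) Ex.≈-refl g))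
    where open Ex using (_:*_; _:=_; κ)

  sumS-⊗ : ∀ g {F : Ix → Ser} {s} → SumS F s → SumS (λ x → g ⊗ F x) (g ⊗ s)
  sumS-⊗ g {F} S = mkS λ N → let (xs , (u , c) , e) = part S N in
    xs , (u , λ x → [ inj₁ , inj₂ ∘ ≐0-⊗ g ]′ (c x)) , ≐-trans (≗⇒≐ (sumL-⊗ g F xs)) (≐-⊗ ≐-refl e)

  union : {{_ : DecEq Ix}} → List Ix → List Ix → List Ix
  union xs ys = deduplicate _≟_ (xs ++ ys)

  union-! : {{_ : DecEq Ix}} (xs ys : List Ix) → Unique (union xs ys)
  union-! xs ys = deduplicate-! _≟_ (xs ++ ys)

  covers-⊇ : {{_ : DecEq Ix}} → ∀ {N} {F : Ix → Ser} {xs} zs → Unique zs → (∀ {x} → x ∈ xs → x ∈ zs) → Covers N F xs → Covers N F zs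
  covers-⊇ zs u sub (_ , c) = u , λ x → [ inj₁ ∘ sub , inj₂ ]′ (c x)

  union-l : {{_ : DecEq Ix}} → ∀ (xs ys : List Ix) {x} → x ∈ xs → x ∈ union xs ys
  union-l xs ys p = ∈P.∈-deduplicate⁺ _≟_ (∈P.∈-++⁺ˡ p)

  union-r : {{_ : DecEq Ix}} → ∀ (xs ys : List Ix) {x} → x ∈ ys → x ∈ union xs ys
  union-r xs ys p = ∈P.∈-deduplicate⁺ _≟_ (∈P.∈-++⁺ʳ xs p)

  sumS-⊕ : {{_ : DecEq Ix}} → ∀ {F G : Ix → Ser} {s t} → SumS F s → SumS G t → SumS (λ x → F x ⊕ G x) (s ⊕ t)
  sumS-⊕ {F = F} {G} S T = mkS λ N →
    let (xs , cx , e) = part S N ; (ys , cy , e′) = part T N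
        zs = union xs ys
        cx′ = covers-⊇ zs (union-! xs ys) (union-l xs ys) cx
        cy′ = covers-⊇ zs (union-! xs ys) (union-r xs ys) cy
    in zs
     , (union-! xs ys , λ x → case₂ (proj₂ cx′ x) (proj₂ cy′ x))
     , ≐-trans (≗⇒≐ (sumL-⊕ F G zs))
        (≐-⊕ (≐-trans (sumL-covers cx′ cx) e) (≐-trans (sumL-covers cy′ cy) e′))
    where
    case₂ : ∀ {N x zs} → x ∈ zs ⊎ F x ≐[ N ] 𝟘 → x ∈ zs ⊎ G x ≐[ N ] 𝟘 → x ∈ zs ⊎ F x ⊕ G x ≐[ N ] 𝟘
    case₂ (inj₁ p) _ = inj₁ p
    case₂ (inj₂ _) (inj₁ p) = inj₁ p
    case₂ (inj₂ p) (inj₂ q) = inj₂ (≐0-⊕ p q)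

  ⊖-as-⊗ : ∀ f → con (- + 1) ⊗ f ≗ ⊖ f
  ⊖-as-⊗ f = ≗-pw λ m → trans (⊗-con (- + 1) f m) (trans (ℤP.-1*i≡-i (f m)) (sym (⊖-at f m)))

  sumS-⊖ : ∀ {F : Ix → Ser} {s} → SumS F s → SumS (λ x → ⊖ F x) (⊖ s)
  sumS-⊖ S = sumS-cong (λ x → ⊖-as-⊗ _) (⊖-as-⊗ _) (sumS-⊗ (con (- + 1)) S)

  record _≃_ (Jx Ix : Set) : Set where
    constructor bij
    field
      to   : Jx → Ix
      from : Ix → Jx
      to-from : ∀ x → to (from x) ≡ x
      from-to : ∀ x → from (to x) ≡ x

  sumL-map : ∀ (F : Ix → Ser) (h : Jx → Ix) ks → sumL F (map h ks) ≡ sumL (F ∘ h) ks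
  sumL-map F h [] = refl
  sumL-map F h (k ∷ ks) = cong (F (h k) ⊕_) (sumL-map F h ks)

  sumS-bij : ∀ (σ : Jx ≃ Ix) {F : Ix → Ser} {s} → SumS F s → SumS (F ∘ _≃_.to σ) s
  sumS-bij (bij to from tf ft) {F} {s} S = mkS λ N → let (xs , (u , c) , e) = part S N in
    map from xs
    , (UniqueP.map⁺ (λ {x} {y} p → trans (sym (tf x)) (trans (cong to p) (tf y))) u
      , λ k → [ (λ p → inj₁ (subst (_∈ map from xs) (ft k) (∈P.∈-map⁺ from p))) , inj₂ ]′ (c (to k)))
    , ≐-trans (≗⇒≐ (go xs)) e
    where
    go : ∀ xs → sumL (F ∘ to) (map from xs) ≗ sumL F xs
    go [] = Ex.≈-refl
    go (x ∷ xs) = Ex.⊕-cong (≗-pw λ m → cong (λ z → F z m) (tf x)) (go xs)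

  sumL-++ : ∀ (F : Ix → Ser) xs ys → sumL F (xs ++ ys) ≗ sumL F xs ⊕ sumL F ys
  sumL-++ F [] ys = Ex.solve 1 (λ a → a := κ (+ 0) :+ a) Ex.≈-refl (sumL F ys)
    where open Ex using (_:+_; _:=_; κ)
  sumL-++ F (x ∷ xs) ys = Ex.≈-trans (Ex.⊕-cong Ex.≈-refl (sumL-++ F xs ys))
    (Ex.solve 3 (λ a b c → a :+ (b :+ c) := a :+ b :+ c) Ex.≈-refl (F x) _ _)
    where open Ex using (_:+_; _:=_)

  sumS-⊎ : ∀ {F : Ix → Ser} {G : Jx → Ser} {s t} → SumS F s → SumS G t → SumS [ F , G ]′ (s ⊕ t)
  sumS-⊎ {F = F} {G} S T = mkS λ N →
    let (xs , (u , c) , e) = part S N ; (ys , (v , d) , e′) = part T N in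
    map inj₁ xs ++ map inj₂ ys
    , (UniqueP.++⁺ (UniqueP.map⁺ ⊎P.inj₁-injective u) (UniqueP.map⁺ ⊎P.inj₂-injective v) (disj xs ys)
      , λ { (inj₁ x) → [ inj₁ ∘ ∈P.∈-++⁺ˡ ∘ ∈P.∈-map⁺ inj₁ , inj₂ ]′ (c x)
          ; (inj₂ y) → [ inj₁ ∘ ∈P.∈-++⁺ʳ (map inj₁ xs) ∘ ∈P.∈-map⁺ inj₂ , inj₂ ]′ (d y) })
    , ≐-trans (≗⇒≐ (sumL-++ [ F , G ]′ (map inj₁ xs) (map inj₂ ys)))
        (≐-⊕ (subst (_≐[ N ] _) (sym (sumL-map [ F , G ]′ inj₁ xs)) e)
             (subst (_≐[ N ] _) (sym (sumL-map [ F , G ]′ inj₂ ys)) e′))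
    where
    disj : ∀ xs ys {z} → z ∈ map inj₁ xs × z ∈ map inj₂ ys → ⊥
    disj xs ys (p , q) with ∈P.∈-map⁻ inj₁ p | ∈P.∈-map⁻ inj₂ q
    ... | _ , _ , refl | _ , _ , ()

  sumL-× : ∀ (F : Ix → Ser) (G : Jx → Ser) xs ys →
           sumL (λ z → F (proj₁ z) ⊗ G (proj₂ z)) (cartesianProduct xs ys) ≗ sumL F xs ⊗ sumL G ys
  sumL-× F G [] ys = Ex.solve 1 (λ a → κ (+ 0) := κ (+ 0) :* a) Ex.≈-refl (sumL G ys)
    where open Ex using (_:*_; _:=_; κ)
  sumL-× F G (x ∷ xs) ys = Ex.≈-trans (sumL-++ _ (map (x ,_) ys) (cartesianProduct xs ys))
    (Ex.≈-trans (Ex.⊕-cong (Ex.≈-trans (≗-pw λ m → cong (λ f → f m) (sumL-map _ (x ,_) ys)) (sumL-⊗ (F x) G ys)) (sumL-× F G xs ys))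
    (Ex.solve 3 (λ a b c → a :* c :+ b :* c := (a :+ b) :* c) Ex.≈-refl (F x) _ _))
    where open Ex using (_:+_; _:*_; _:=_)

  sumS-× : ∀ {F : Ix → Ser} {G : Jx → Ser} {s t} → SumS F s → SumS G t → SumS (λ z → F (proj₁ z) ⊗ G (proj₂ z)) (s ⊗ t)
  sumS-× {F = F} {G} S T = mkS λ N →
    let (xs , (u , c) , e) = part S N ; (ys , (v , d) , e′) = part T N in
    cartesianProduct xs ys
    , (UniqueP.cartesianProduct⁺ u v , λ { (x , y) → pt (c x) (d y) })
    , ≐-trans (≗⇒≐ (sumL-× F G xs ys)) (≐-⊗ e e′)
    where
    pt : ∀ {N x y xs ys} → x ∈ xs ⊎ F x ≐[ N ] 𝟘 → y ∈ ys ⊎ G y ≐[ N ] 𝟘 →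
         (x , y) ∈ cartesianProduct xs ys ⊎ F x ⊗ G y ≐[ N ] 𝟘
    pt (inj₁ p) (inj₁ q) = inj₁ (∈P.∈-cartesianProduct⁺ p q)
    pt {x = x} _ (inj₂ q) = inj₂ (≐0-⊗ (F x) q)
    pt {x = x} {y} (inj₂ p) _ = inj₂ (≐-trans (≗⇒≐ (CommutativeRing.*-comm Ex.serRing (F x) (G y))) (≐0-⊗ (G y) p))
      where open import Algebra.Bundles using (CommutativeRing)

  module _ {{_ : DecEq Ix}} {{_ : DecEq Jx}} {F : Ix × Jx → Ser} {g : Ix → Ser}
           (inner : ∀ i → SumS (λ k → F (i , k)) (g i)) where
    private
      rows : ℕ → List Ix → List (Ix × Jx)
      rows N [] = []
      rows N (i ∷ is) = map (i ,_) (proj₁ (part (inner i) N)) ++ rows N is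

      rows-fst : ∀ N is {z} → z ∈ rows N is → proj₁ z ∈ is
      rows-fst N (i ∷ is) p with ∈P.∈-++⁻ (map (i ,_) (proj₁ (part (inner i) N))) p
      ... | inj₁ q with ∈P.∈-map⁻ (i ,_) q
      ...   | _ , _ , refl = here refl
      rows-fst N (i ∷ is) p | inj₂ q = there (rows-fst N is q)

      rows-! : ∀ N {is} → Unique is → Unique (rows N is)
      rows-! N {[]} [] = []
      rows-! N {i ∷ is} (ne ∷ u) = UniqueP.++⁺
        (UniqueP.map⁺ (λ { refl → refl }) (proj₁ (proj₁ (proj₂ (part (inner i) N)))))
        (rows-! N u)
        (λ { (p , q) → dis (∈P.∈-map⁻ (i ,_) p) (rows-fst N is q) })
        where
        dis : ∀ {z} → ∃ (λ k → k ∈ proj₁ (part (inner i) N) × z ≡ (i , k)) → proj₁ z ∈ is → ⊥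
        dis (_ , _ , refl) q = All.lookup ne q refl

      rows-∈ : ∀ N {is i} k → i ∈ is → (i , k) ∈ rows N is ⊎ F (i , k) ≐[ N ] 𝟘
      rows-∈ N {i ∷ is} k (here refl) =
        [ inj₁ ∘ ∈P.∈-++⁺ˡ ∘ ∈P.∈-map⁺ (i ,_) , inj₂ ]′ (proj₂ (proj₁ (proj₂ (part (inner i) N))) k)
      rows-∈ N {i′ ∷ is} k (there p) = [ inj₁ ∘ ∈P.∈-++⁺ʳ _ , inj₂ ]′ (rows-∈ N k p)

      rows-sum : ∀ N is → sumL F (rows N is) ≐[ N ] sumL g is
      rows-sum N [] = ≐-refl
      rows-sum N (i ∷ is) = ≐-trans (≗⇒≐ (sumL-++ F (map (i ,_) (proj₁ (part (inner i) N))) (rows N is)))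
        (≐-⊕ (subst (_≐[ N ] g i) (sym (sumL-map F (i ,_) (proj₁ (part (inner i) N)))) (proj₂ (proj₂ (part (inner i) N)))) (rows-sum N is))

      heads : List (Ix × Jx) → List Ix
      heads zs = deduplicate _≟_ (map proj₁ zs)

      module _ {N zs} (cz : Covers N F zs) where
        absent : ∀ i → i ∉ heads zs → ∀ k → F (i , k) ≐[ N ] 𝟘
        absent i ni k = [ (λ p → ⊥-elim (ni (∈P.∈-deduplicate⁺ _≟_ (∈P.∈-map⁺ proj₁ p)))) , id ]′ (proj₂ cz (i , k))

        covers-rows : Covers N F (rows N (heads zs))
        covers-rows = rows-! N (deduplicate-! _≟_ (map proj₁ zs)) , pt
          where
          pt : ∀ z → z ∈ rows N (heads zs) ⊎ F z ≐[ N ] 𝟘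
          pt (i , k) with DecMem._∈?_ _≟_ i (heads zs)
          ... | yes p = rows-∈ N k p
          ... | no  p = inj₂ (absent i p k)

        covers-heads : Covers N g (heads zs)
        covers-heads = deduplicate-! _≟_ (map proj₁ zs) , pt
          where
          zeros : ∀ i → i ∉ heads zs → ∀ ks → sumL (λ k → F (i , k)) ks ≐[ N ] 𝟘
          zeros i p [] = ≐-refl
          zeros i p (k ∷ ks) = ≐0-⊕ (absent i p k) (zeros i p ks)
          pt : ∀ i → i ∈ heads zs ⊎ g i ≐[ N ] 𝟘
          pt i with DecMem._∈?_ _≟_ i (heads zs)
          ... | yes p = inj₁ p
          ... | no  p = inj₂ (≐-trans (≐-sym (proj₂ (proj₂ (part (inner i) N)))) (zeros i p (proj₁ (part (inner i) N))))

    -- Below q^N a row that meets no listed index has only vanishing terms, so its sum vanishes too;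
    -- hence the first coordinates of a cover of `F` already cover `g`.
    sumS-outer : ∀ {s} → SumS F s → SumS g s
    sumS-outer S = mkS λ N → let (zs , cz , e) = part S N in
      heads zs , covers-heads cz
      , ≐-trans (≐-sym (rows-sum N (heads zs))) (≐-trans (sumL-covers (covers-rows cz) cz) e)

    -- Joint summability is a separate hypothesis because convergence of the row sums does not imply
    -- it: infinitely many rows could cancel internally.
    sumS-joint : Summable F → ∀ {s} → SumS g s → SumS F s
    sumS-joint J S = mkS λ N → let (zs , cz) = J N ; (is , ci , e) = part S N in
      rows N (heads zs) , covers-rows cz
      , ≐-trans (rows-sum N (heads zs)) (≐-trans (sumL-covers (covers-heads cz) ci) e)

  swap≃ : (Jx × Ix) ≃ (Ix × Jx)
  swap≃ = bij (λ { (k , i) → i , k }) (λ { (i , k) → k , i }) (λ _ → refl) (λ _ → refl)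

  -- Triangular exponents, signs, cuts and monomials.

  -- triN n = n (n - 1) / 2
  triN : ℕ → ℕ
  triN zero    = 0
  triN (suc n) = n ℕ.+ triN n

  -- z (z - 1) / 2 is a natural number for negative z as well: at z = -(n + 1) it equals (n + 1)(n +
  -- 2) / 2.
  tri : ℤ → ℕ
  tri (+ n)    = triN n
  tri -[1+ n ] = triN (2 ℕ.+ n)

  -- This removes the division: exponents are compared after doubling, as polynomial identities, and
  -- `double-inj` returns to the original ones.
  tri-double : ∀ z → + 2 * + tri z ≡ z * z - z
  tri-double (+ n) = go n
    where
    step : ∀ a t → + 2 * (a + t) ≡ (+ 1 + a) * (+ 1 + a) - (+ 1 + a) + (+ 2 * t - (a * a - a))
    step = solve-∀
    go : ∀ n → + 2 * + triN n ≡ + n * + n - + n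
    go zero    = refl
    go (suc n) = trans (step (+ n) (+ triN n)) (trans (cong (λ x → (+ 1 + + n) * (+ 1 + + n) - (+ 1 + + n) + (x - (+ n * + n - + n))) (go n)) (l (+ n)))
      where
      l : ∀ a → (+ 1 + a) * (+ 1 + a) - (+ 1 + a) + (a * a - a - (a * a - a)) ≡ (+ 1 + a) * (+ 1 + a) - (+ 1 + a)
      l = solve-∀
  tri-double -[1+ n ] = trans (tri-double (+ suc (suc n))) (l (+ n))
    where
    l : ∀ a → (+ 2 + a) * (+ 2 + a) - (+ 2 + a) ≡ (- (+ 1 + a)) * (- (+ 1 + a)) - - (+ 1 + a)
    l = solve-∀

  double-inj : ∀ {x y} → + 2 * x ≡ + 2 * y → x ≡ y
  double-inj {x} {y} = ℤP.*-cancelˡ-≡ (+ 2) x y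

  sgnN : ℕ → ℤ
  sgnN zero    = + 1
  sgnN (suc n) = - sgnN n

  sgn : ℤ → ℤ
  sgn z = sgnN ∣ z ∣

  sgn-suc : ∀ z → sgn (+ 1 + z) ≡ - sgn z
  sgn-suc (+ n)          = refl
  sgn-suc -[1+ zero ]    = refl
  sgn-suc -[1+ suc n ]   = sym (ℤP.neg-involutive _)

  sgn-+ : ∀ a b → sgn (a + b) ≡ sgn a * sgn b
  sgn-+ (+ n) b = go n
    where
    go : ∀ n → sgn (+ n + b) ≡ sgnN n * sgn b
    go zero    = trans (cong sgn (ℤP.+-identityˡ b)) (sym (ℤP.*-identityˡ _))
    go (suc n) = trans (cong sgn (ℤP.+-assoc (+ 1) (+ n) b)) (trans (sgn-suc (+ n + b))
      (trans (cong -_ (go n)) (ℤP.neg-distribˡ-* (sgnN n) (sgn b))))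
  sgn-+ -[1+ n ] b = go n
    where
    l₁ : ∀ b → b ≡ + 1 + (- + 1 + b)
    l₁ = solve-∀
    l₂ : ∀ x y → - (- x * y) ≡ x * y
    l₂ = solve-∀
    down : ∀ x → sgn (- + 1 + x) ≡ - sgn x
    down x = trans (sym (ℤP.neg-involutive _)) (cong -_ (sym (trans (cong sgn (l₁ x)) (sgn-suc (- + 1 + x)))))
    go : ∀ n → sgn (-[1+ n ] + b) ≡ - sgnN n * sgn b
    go zero    = trans (down b) (sym (ℤP.-1*i≡-i (sgn b)))
    go (suc n) = trans (cong sgn (ℤP.+-assoc (- + 1) -[1+ n ] b)) (trans (down (-[1+ n ] + b))
      (trans (cong -_ (go n)) (l₃ (sgnN n) (sgn b))))
      where
      l₃ : ∀ x y → - (- x * y) ≡ - (- x) * y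
      l₃ = solve-∀

  sgn-neg : ∀ z → sgn (- z) ≡ sgn z
  sgn-neg z = cong sgnN (ℤP.∣-i∣≡∣i∣ z)

  sgn-double : ∀ z → sgn z * sgn z ≡ + 1
  sgn-double z = go ∣ z ∣
    where
    l : ∀ x → - x * - x ≡ x * x
    l = solve-∀
    go : ∀ n → sgnN n * sgnN n ≡ + 1
    go zero    = refl
    go (suc n) = trans (l (sgnN n)) (go n)

  sgn-even : ∀ a b c → a ≡ b + + 2 * c → sgn a ≡ sgn b
  sgn-even a b c refl = trans (sgn-+ b (+ 2 * c)) (trans (cong (sgn b *_) (trans (cong sgn (l c)) (trans (sgn-+ c c) (sgn-double c)))) (ℤP.*-identityʳ _))
    where
    l : ∀ c → + 2 * c ≡ c + c
    l = solve-∀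

  sgn-odd : ∀ a b c → a ≡ + 1 + (b + + 2 * c) → sgn a ≡ - sgn b
  sgn-odd a b c refl = trans (sgn-suc (b + + 2 * c)) (cong -_ (sgn-even _ b c refl))

  pos : ℤ → ℤ
  pos (+ zero)  = + 0
  pos (+ suc _) = + 1
  pos -[1+ _ ]  = + 0

  -- The cut lies between 0 and 1, at the centre of the reflection z ↦ 1 - z, so the two half-lines
  -- are exchanged without boundary terms.
  pos-1- : ∀ z → pos (+ 1 - z) ≡ + 1 - pos z
  pos-1- (+ zero)        = refl
  pos-1- (+ suc zero)    = refl
  pos-1- (+ suc (suc n)) = refl
  pos-1- -[1+ n ]        = refl

  -- The value at negative exponents is only a default: the families summed below have weight 0
  -- wherever the exponent could be negative.
  qz : ℤ → Ser
  qz (+ n)    = qp n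
  qz -[1+ _ ] = 𝟘

  qp-shift : ∀ a f m → (qp (suc a) ⊗ f) (suc m) ≡ (qp a ⊗ f) m
  qp-shift a f m = trans (cong (_+ (qp a ⊗ f) m) (ℤP.*-zeroˡ (f (suc m)))) (ℤP.+-identityˡ _)

  qp-* : ∀ a b → qp a ⊗ qp b ≗ qp (a ℕ.+ b)
  qp-* a b = ≗-pw (go a)
    where
    go : ∀ a m → (qp a ⊗ qp b) m ≡ qp (a ℕ.+ b) m
    go zero    m       = ⊗-identityˡ (qp b) m
    go (suc a) zero    = ℤP.*-zeroˡ (qp b 0)
    go (suc a) (suc m) = trans (qp-shift a (qp b) m) (go a m)

  qp-small : ∀ {N n} → N ℕ.≤ n → qp n ≐[ N ] 𝟘
  qp-small le = mk≐ λ m l → trans (go _ m (ℕP.<-≤-trans l le)) (sym (con0 m))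
    where
    go : ∀ n m → m ℕ.< n → qp n m ≡ + 0
    go (suc n) zero    l = refl
    go (suc n) (suc m) (s≤s l) = go n m l

  term : ℤ → ℤ → Ser
  term w e = con w ⊗ qz e

  term-0 : ∀ {w} e → w ≡ + 0 → term w e ≗ 𝟘
  term-0 e refl = Ex.solve 1 (λ a → κ (+ 0) :* a := κ (+ 0)) Ex.≈-refl (qz e)
    where open Ex using (_:*_; _:=_; κ)

  -- With the default value of `qz` exponents do not add in general: `qz` at -1 times `qz` at 1 is
  -- 0, while `qz` at 0 is 1. This condition is what makes products of terms multiply correctly.
  Ok : ℤ → ℤ → Set
  Ok w e = w ≡ + 0 ⊎ ∃ λ n → e ≡ + n

  term-* : ∀ {w e w′ e′} → Ok w e → Ok w′ e′ → term w e ⊗ term w′ e′ ≗ term (w * w′) (e + e′)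
  term-* {w} {e} {w′} {e′} (inj₁ refl) _ = Ex.≈-trans
    (Ex.solve 2 (λ a b → κ (+ 0) :* a :* b := κ (+ 0)) Ex.≈-refl (qz e) (term w′ e′)) (Ex.≈-sym (term-0 (e + e′) (ℤP.*-zeroˡ w′)))
    where open Ex using (_:*_; _:=_; κ)
  term-* {w} {e} {w′} {e′} (inj₂ _) (inj₁ refl) = Ex.≈-trans
    (Ex.solve 2 (λ a b → b :* (κ (+ 0) :* a) := κ (+ 0)) Ex.≈-refl (qz e′) (term w e)) (Ex.≈-sym (term-0 (e + e′) (ℤP.*-zeroʳ w)))
    where open Ex using (_:*_; _:=_; κ)
  term-* {w} {_} {w′} (inj₂ (m , refl)) (inj₂ (n , refl)) = Ex.≈-trans
    (Ex.solve 4 (λ a b c d → a :* b :* (c :* d) := a :* c :* (b :* d)) Ex.≈-refl (con w) (qp m) (con w′) (qp n))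
    (Ex.⊗-cong (Ex.≈-sym (≗-pw (con-* w w′))) (qp-* m n))
    where open Ex using (_:*_; _:=_; κ)

  term-+ : ∀ w w′ e → term w e ⊕ term w′ e ≗ term (w + w′) e
  term-+ w w′ e = Ex.≈-trans (Ex.solve 3 (λ a b c → a :* c :+ b :* c := (a :+ b) :* c) Ex.≈-refl (con w) (con w′) (qz e))
    (Ex.⊗-cong (≗-pw lem) Ex.≈-refl)
    where
    open Ex using (_:*_; _:+_; _:=_; κ)
    lem : ∀ m → (con w ⊕ con w′) m ≡ con (w + w′) m
    lem zero    = ⊕-at (con w) (con w′) 0
    lem (suc m) = ⊕-at (con w) (con w′) (suc m)

  term-con : ∀ c w e → con c ⊗ term w e ≗ term (c * w) e
  term-con c w e = Ex.≈-trans (Ex.≈-sym (Ex*.*-assoc (con c) (con w) (qz e))) (Ex.⊗-cong (Ex.≈-sym (≗-pw (con-* c w))) Ex.≈-refl)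
    where
    module Ex* = CommutativeRing Ex.serRing

  term-≡ : ∀ {w w′ e e′} → w ≡ w′ → e ≡ e′ → term w e ≗ term w′ e′
  term-≡ refl refl = Ex.≈-refl

  term-small : ∀ {N} w n → N ℕ.≤ n → term w (+ n) ≐[ N ] 𝟘
  term-small w n le = ≐0-⊗ (con w) (qp-small le)

  -- Summability from the growth of exponents.

  record Sized (Ix : Set) : Set where
    field
      size  : Ix → ℕ
      box   : ℕ → List Ix
      box-! : ∀ B → Unique (box B)
      box-∈ : ∀ B x → size x ℕ.≤ B → x ∈ box B
  open Sized {{...}} public

  instance
    sizedℕ : Sized ℕ
    sizedℕ = record { size = id ; box = upTo ∘ suc ; box-! = UniqueP.upTo⁺ ∘ suc ; box-∈ = λ B x l → ∈P.∈-upTo⁺ (s≤s l) }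

    sizedℤ : Sized ℤ
    sizedℤ = record
      { size = ∣_∣
      ; box = λ B → map +_ (upTo (suc B)) ++ map -[1+_] (upTo B)
      ; box-! = λ B → UniqueP.++⁺ (UniqueP.map⁺ ℤP.+-injective (UniqueP.upTo⁺ (suc B))) (UniqueP.map⁺ ℤP.-[1+-injective (UniqueP.upTo⁺ B))
          (λ { (p , q) → dis (∈P.∈-map⁻ +_ p) (∈P.∈-map⁻ -[1+_] q) })
      ; box-∈ = λ { B (+ n) l → ∈P.∈-++⁺ˡ (∈P.∈-map⁺ +_ (∈P.∈-upTo⁺ (s≤s l)))
                  ; B -[1+ n ] l → ∈P.∈-++⁺ʳ (map +_ (upTo (suc B))) (∈P.∈-map⁺ -[1+_] (∈P.∈-upTo⁺ l)) } }
      where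
      dis : ∀ {z A B} → ∃ (λ (x : ℕ) → x ∈ A × z ≡ + x) → ∃ (λ x → x ∈ B × z ≡ -[1+ x ]) → ⊥
      dis (_ , _ , refl) (_ , _ , ())

    sized× : ∀ {Ix Jx} → {{Sized Ix}} → {{Sized Jx}} → Sized (Ix × Jx)
    sized× = record
      { size = λ { (x , y) → size x ℕ.+ size y }
      ; box = λ B → cartesianProduct (box B) (box B)
      ; box-! = λ B → UniqueP.cartesianProduct⁺ (box-! B) (box-! B)
      ; box-∈ = λ { B (x , y) l → ∈P.∈-cartesianProduct⁺ (box-∈ B x (ℕP.≤-trans (ℕP.m≤m+n _ _) l)) (box-∈ B y (ℕP.≤-trans (ℕP.m≤n+m _ _) l)) } }

  size-summable : {{_ : Sized Ix}} {F : Ix → Ser} (c : ℕ) → (∀ N x → N ℕ.+ c ℕ.< size x → F x ≐[ N ] 𝟘) → Summable F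
  size-summable c p N = box (N ℕ.+ c) , box-! (N ℕ.+ c) , λ x → go x (size x ℕ.≤? N ℕ.+ c)
    where
    go : ∀ x → Dec (size x ℕ.≤ N ℕ.+ c) → _
    go x (yes l) = inj₁ (box-∈ (N ℕ.+ c) x l)
    go x (no nl) = inj₂ (p N x (ℕP.≰⇒> nl))

  -- The slack 2 is needed at the corner (1 , 1) of the positive cone: its size is 2, while its
  -- exponent may be 0, as it is for `EK`.
  Tame : {{_ : Sized Ix}} → (Ix → ℤ) → (Ix → ℤ) → Set
  Tame {Ix} w E = ∀ (x : Ix) → w x ≡ + 0 ⊎ ∃ λ n → E x ≡ + n × size x ℕ.≤ n ℕ.+ 2

  tame-ok : {{_ : Sized Ix}} {w E : Ix → ℤ} → Tame w E → ∀ x → Ok (w x) (E x)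
  tame-ok t x = [ inj₁ , (λ { (n , e , _) → inj₂ (n , e) }) ]′ (t x)

  SumM : (Ix → ℤ) → (Ix → ℤ) → Ser → Set
  SumM w E s = SumS (λ x → term (w x) (E x)) s

  tame-summable : {{_ : Sized Ix}} {w E : Ix → ℤ} → Tame w E → Summable (λ x → term (w x) (E x))
  tame-summable {w = w} {E} t = size-summable 2 λ N x l → go N x l (t x)
    where
    go : ∀ N x → N ℕ.+ 2 ℕ.< size x → w x ≡ + 0 ⊎ (∃ λ n → E x ≡ + n × size x ℕ.≤ n ℕ.+ 2) → term (w x) (E x) ≐[ N ] 𝟘
    go N x l (inj₁ p) = ≗⇒≐ (term-0 (E x) p)
    go N x l (inj₂ (n , e , b)) = subst (λ z → term (w x) z ≐[ N ] 𝟘) (sym e)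
      (term-small (w x) n (ℕP.<⇒≤ (ℕP.+-cancelʳ-< 2 N n (ℕP.<-≤-trans l b))))

  sumM-× : {w E : Ix → ℤ} {w′ E′ : Jx → ℤ} {s t : Ser} → (∀ x → Ok (w x) (E x)) → (∀ x → Ok (w′ x) (E′ x)) →
           SumM w E s → SumM w′ E′ t → SumM (λ z → w (proj₁ z) * w′ (proj₂ z)) (λ z → E (proj₁ z) + E′ (proj₂ z)) (s ⊗ t)
  sumM-× o o′ S T = sumS-cong (λ z → term-* (o (proj₁ z)) (o′ (proj₂ z))) Ex.≈-refl (sumS-× S T)

  sumM-+ : {{_ : DecEq Ix}} {w w′ E : Ix → ℤ} {s t : Ser} → SumM w E s → SumM w′ E t → SumM (λ x → w x + w′ x) E (s ⊕ t)
  sumM-+ {w = w} {w′} {E} S T = sumS-cong (λ x → term-+ (w x) (w′ x) (E x)) Ex.≈-refl (sumS-⊕ S T)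

  sumM-cong : {w w′ E E′ : Ix → ℤ} {s : Ser} → (∀ x → w x ≡ w′ x) → (∀ x → E x ≡ E′ x) → SumM w E s → SumM w′ E′ s
  sumM-cong p q = sumS-cong (λ x → term-≡ (p x) (q x)) Ex.≈-refl

  sumM-scale : ∀ c {w E : Ix → ℤ} {s : Ser} → SumM w E s → SumM (λ x → c * w x) E (con c ⊗ s)
  sumM-scale c {w} {E} S = sumS-cong (λ x → term-con c (w x) (E x)) Ex.≈-refl (sumS-⊗ (con c) S)

  sumM-neg : {w E : Ix → ℤ} {s : Ser} → SumM w E s → SumM (λ x → - w x) E (⊖ s)
  sumM-neg {w = w} {E} S = sumS-cong (λ x → Ex.≈-trans (Ex.≈-sym (⊖-as-⊗ (term (w x) (E x)))) (Ex.≈-trans (term-con (- + 1) (w x) (E x)) (term-≡ {e = E x} (ℤP.-1*i≡-i (w x)) refl))) Ex.≈-refl (sumS-⊖ S)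

  private
    sumZ-Cong : ∀ ℓ {φ ψ : Ix → ℤ} → (∀ x → Cong ℓ (φ x) (ψ x)) → ∀ xs → Cong ℓ (sumZ φ xs) (sumZ ψ xs)
    sumZ-Cong ℓ p [] = Cong-≡ refl
    sumZ-Cong ℓ p (x ∷ xs) = CongRel.r+ (Cong-rel ℓ) (p x) (sumZ-Cong ℓ p xs)

  -- Only the weights are reduced modulo ℓ, the exponents stay exact. This is the point where a
  -- triangular weight may be replaced by a function of residues.
  sumM-mod : {{_ : DecEq Ix}} → ∀ ℓ {w w′ E : Ix → ℤ} {s t : Ser} → (∀ x → Cong ℓ (w x) (w′ x)) →
             SumM w E s → SumM w′ E t → Modulo._≈_ ℓ s t
  sumM-mod ℓ {w} {w′} {E} {s} {t} p S T = Modulo.mk λ m →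
    let (xs , cx , e) = part S (suc m) ; (ys , cy , e′) = part T (suc m)
        zs = union xs ys
        cx′ = covers-⊇ zs (union-! xs ys) (union-l xs ys) cx
        cy′ = covers-⊇ zs (union-! xs ys) (union-r xs ys) cy
    in rtrans (Cong-≡ (trans (sym (below (≐-trans (sumL-covers cx′ cx) e) m ℕP.≤-refl)) (sumL-at _ zs m)))
      (rtrans (sumZ-Cong ℓ (λ x → rtrans (Cong-≡ (⊗-con (w x) (qz (E x)) m)) (rtrans (r* (p x) rrefl) (Cong-≡ (sym (⊗-con (w′ x) (qz (E x)) m))))) zs)
      (Cong-≡ (trans (sym (sumL-at _ zs m)) (below (≐-trans (sumL-covers cy′ cy) e′) m ℕP.≤-refl))))
    where open CongRel (Cong-rel ℓ)

  -- Indicators of residue classes.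

  ind : ∀ {P : Set} → Dec P → ℤ
  ind (yes _) = + 1
  ind (no _)  = + 0

  ind-cong : ∀ {P Q : Set} (p : Dec P) (q : Dec Q) → (P → Q) → (Q → P) → ind p ≡ ind q
  ind-cong (yes p) (yes q) f g = refl
  ind-cong (yes p) (no nq) f g = ⊥-elim (nq (f p))
  ind-cong (no np) (yes q) f g = ⊥-elim (np (g q))
  ind-cong (no np) (no nq) f g = refl

  opaque
    cls : ℕ → ℤ → ℤ → ℤ
    cls ℓ r i = ind (+ ℓ ∣? (i - r))

    cls-ind : ∀ ℓ r i → cls ℓ r i ≡ ind (+ ℓ ∣? (i - r))
    cls-ind ℓ r i = refl

    cls-no : ∀ ℓ {r i} → ¬ (+ ℓ ∣ᶻ (i - r)) → cls ℓ r i ≡ + 0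
    cls-no ℓ {r} {i} n with + ℓ ∣? (i - r)
    ... | yes p = ⊥-elim (n p)
    ... | no  _ = refl

    cls-yes : ∀ ℓ {r i} → + ℓ ∣ᶻ (i - r) → cls ℓ r i ≡ + 1
    cls-yes ℓ {r} {i} p with + ℓ ∣? (i - r)
    ... | yes _ = refl
    ... | no n = ⊥-elim (n p)

  ∣-eq : ∀ {a x y} → a ∣ᶻ x → x ≡ y → a ∣ᶻ y
  ∣-eq p refl = p

  ∣-lin : ∀ {a x y} u v → a ∣ᶻ x → a ∣ᶻ y → a ∣ᶻ (u * x + v * y)
  ∣-lin {a} u v (divides p refl) (divides q refl) = divides (u * p + v * q) (l u v p q a)
    where
    l : ∀ u v p q a → u * (p * a) + v * (q * a) ≡ (u * p + v * q) * a
    l = solve-∀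

  record _∋_≡_ (ℓ : ℕ) (i r : ℤ) : Set where
    constructor congruent
    field divs : + ℓ ∣ᶻ (i - r)
  open _∋_≡_ public

  -- Hecke cones and the families of residue pieces.

  data Sign : ℤ → Set where
    up   : ∀ a → Sign (+ suc a)
    down : ∀ a → Sign (- + a)

  sign : ∀ z → Sign z
  sign (+ zero)  = down 0
  sign (+ suc a) = up a
  sign -[1+ a ]  = down (suc a)

  pos-down : ∀ a → pos (- + a) ≡ + 0
  pos-down zero    = refl
  pos-down (suc a) = refl

  tri-down : ∀ a → tri (- + a) ≡ triN (suc a)
  tri-down zero    = refl
  tri-down (suc a) = refl

  -- The sign of a Hecke double sum: 1 if both coordinates are at least 1, -1 if both are at most 0,
  -- and 0 in the mixed quadrants, where the indefinite exponents are unbounded below. Written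
  -- additively so that cuts of different cones can telescope.
  quad : ℤ × ℤ → ℤ
  quad (x , y) = pos x + pos y - + 1

  Tame₂ : (ℤ × ℤ → ℤ) → Set
  Tame₂ E = (∀ a b → ∃ λ n → E (+ suc a , + suc b) ≡ + n × a ℕ.+ b ℕ.≤ n)
          × (∀ a b → ∃ λ n → E (- + a , - + b) ≡ + n × a ℕ.+ b ℕ.≤ n)

  quad-tame : ∀ {E} (w : ℤ × ℤ → ℤ) → Tame₂ E → Tame (λ z → w z * quad z) E
  quad-tame {E} w (p , q) (x , y) with sign x | sign y
  ... | up a | up b = let (n , e , l) = p a b in inj₂ (n , e ,
    ℕP.≤-trans (ℕP.≤-reflexive (trans (cong suc (ℕP.+-suc a b)) (ℕP.+-comm 2 (a ℕ.+ b)))) (ℕP.+-monoˡ-≤ 2 l))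
  ... | up a | down b = inj₁ (trans (cong (λ z → w (+ suc a , - + b) * (+ 1 + z - + 1)) (pos-down b)) (ℤP.*-zeroʳ (w (+ suc a , - + b))))
  ... | down a | up b = inj₁ (trans (cong (λ z → w (- + a , + suc b) * (z + + 1 - + 1)) (pos-down a)) (ℤP.*-zeroʳ (w (- + a , + suc b))))
  ... | down a | down b = let (n , e , l) = q a b in inj₂ (n , e ,
    ℕP.≤-trans (ℕP.≤-reflexive (cong₂ ℕ._+_ (ℤP.∣-i∣≡∣i∣ (+ a)) (ℤP.∣-i∣≡∣i∣ (+ b)))) (ℕP.≤-trans l (ℕP.m≤m+n n 2)))

  cast : ∀ A a b p q r → + A * (+ a * + b) + + p * + a + + q * + b + + r ≡ + (A ℕ.* (a ℕ.* b) ℕ.+ p ℕ.* a ℕ.+ q ℕ.* b ℕ.+ r)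
  cast A a b p q r = cong (_+ + r) (cong₂ _+_ (cong₂ _+_ (trans (cong (+ A *_) (sym (ℤP.pos-* a b))) (sym (ℤP.pos-* A (a ℕ.* b)))) (sym (ℤP.pos-* p a))) (sym (ℤP.pos-* q b)))

  cast-≤ : ∀ A a b p q r → a ℕ.+ b ℕ.≤ A ℕ.* (a ℕ.* b) ℕ.+ suc p ℕ.* a ℕ.+ suc q ℕ.* b ℕ.+ r
  cast-≤ A a b p q r = ℕP.≤-trans (ℕP.+-mono-≤
      (ℕP.≤-trans (ℕP.m≤m+n a (p ℕ.* a)) (ℕP.m≤n+m (suc p ℕ.* a) (A ℕ.* (a ℕ.* b))))
      (ℕP.m≤m+n b (q ℕ.* b)))
    (ℕP.m≤m+n _ r)

  bilinear : ∀ {E} A p q r p′ q′ r′ →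
    (∀ a b → E (+ 1 + a , + 1 + b) ≡ + A * (a * b) + + suc p * a + + suc q * b + + r) →
    (∀ a b → E (- a , - b) ≡ + A * (a * b) + + suc p′ * a + + suc q′ * b + + r′) → Tame₂ E
  bilinear A p q r p′ q′ r′ f g =
      (λ a b → _ , trans (f (+ a) (+ b)) (cast A a b (suc p) (suc q) r) , cast-≤ A a b p q r)
    , (λ a b → _ , trans (g (+ a) (+ b)) (cast A a b (suc p′) (suc q′) r′) , cast-≤ A a b p′ q′ r′)

  -- `EH` is the form of the Hecke sum. `EY` and `EK` are what remains of 3 tri c + `EH` when tri n
  -- is split off along `σ₁` or `σ₂`, and along `σ₃`.
  EH EY EK : ℤ × ℤ → ℤ
  EH (i , k) = + tri i + + tri k + + 2 * (i * k)
  EY (i , s) = + 3 * (i * s) + + 3 * + tri s - i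
  EK (u , v) = + 3 * (u * v) - + 2 * u - + 2 * v + + 1

  EL EJ : ℤ → ℤ
  EL n = + tri n
  EJ c = + 3 * + tri c

  n≤triN+2 : ∀ n → n ℕ.≤ triN n ℕ.+ 2
  n≤triN+2 zero          = z≤n
  n≤triN+2 (suc zero)    = s≤s z≤n
  n≤triN+2 (suc (suc n)) = subst (suc (suc n) ℕ.≤_) (l n (triN n)) (s≤s (s≤s (ℕP.m≤m+n n (suc (n ℕ.+ triN n)))))
    where
    l : ∀ n t → suc (suc (n ℕ.+ suc (n ℕ.+ t))) ≡ suc (n ℕ.+ (n ℕ.+ t)) ℕ.+ 2
    l n t = trans (cong (λ x → suc (suc x)) (ℕP.+-suc n (n ℕ.+ t))) (ℕP.+-comm 2 (suc (n ℕ.+ (n ℕ.+ t))))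

  size-tri : ∀ z → ∣ z ∣ ℕ.≤ tri z ℕ.+ 2
  size-tri (+ n)    = n≤triN+2 n
  size-tri -[1+ n ] = ℕP.≤-trans (ℕP.m≤m+n (suc n) (triN (suc n))) (ℕP.m≤m+n _ 2)

  tameL : ∀ w → Tame w EL
  tameL w z = inj₂ (tri z , refl , size-tri z)

  tameJ : ∀ w → Tame w EJ
  tameJ w z = inj₂ (3 ℕ.* tri z , sym (ℤP.pos-* 3 (tri z)) , ℕP.≤-trans (size-tri z) (ℕP.+-monoˡ-≤ 2 (ℕP.m≤m+n (tri z) _)))

  tameH : Tame₂ EH
  tameH = (λ a b → _ , refl , ℕP.≤-trans (ℕP.+-mono-≤ (ℕP.m≤m+n a (triN a)) (ℕP.m≤m+n b (triN b))) (ℕP.m≤m+n _ _))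
    , (λ a b → triN (suc a) ℕ.+ triN (suc b) ℕ.+ 2 ℕ.* (a ℕ.* b)
      , trans (cong₂ (λ x y → + x + + y + + 2 * (- + a * - + b)) (tri-down a) (tri-down b))
          (+congˡ (+ (triN (suc a) ℕ.+ triN (suc b))) (trans (l (+ a) (+ b)) (trans (cong (+ 2 *_) (sym (ℤP.pos-* a b))) (sym (ℤP.pos-* 2 (a ℕ.* b))))))
      , ℕP.≤-trans (ℕP.+-mono-≤ (ℕP.m≤m+n a (triN a)) (ℕP.m≤m+n b (triN b))) (ℕP.m≤m+n _ _))
    where
    l : ∀ a b → + 2 * (- a * - b) ≡ + 2 * (a * b)
    l = solve-∀

  tameY : Tame₂ EY
  tameY = (λ a b → _ , trans (l (+ a) (+ b) (+ triN (suc b))) (cong₂ _+_ (cast 3 a b 2 3 2) (sym (ℤP.pos-* 3 (triN (suc b))))) ,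
        ℕP.≤-trans (cast-≤ 3 a b 1 2 2) (ℕP.m≤m+n _ _))
    , (λ a b → _ , trans (cong (λ t → + 3 * (- + a * - + b) + + 3 * + t - (- + a)) (tri-down b))
          (trans (l′ (+ a) (+ b) (+ triN b)) (cong₂ _+_ (cast 3 a b 1 3 0) (sym (ℤP.pos-* 3 (triN b))))) ,
        ℕP.≤-trans (cast-≤ 3 a b 0 2 0) (ℕP.m≤m+n _ _))
    where
    l : ∀ a b t → + 3 * ((+ 1 + a) * (+ 1 + b)) + + 3 * t - (+ 1 + a) ≡ + 3 * (a * b) + + 2 * a + + 3 * b + + 2 + + 3 * t
    l = solve-∀
    l′ : ∀ a b t → + 3 * (- a * - b) + + 3 * (b + t) - (- a) ≡ + 3 * (a * b) + + 1 * a + + 3 * b + + 0 + + 3 * t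
    l′ = solve-∀

  tameK : Tame₂ EK
  tameK = bilinear {EK} 3 0 0 0 1 1 1 (λ a b → l a b) (λ a b → l′ a b)
    where
    l : ∀ a b → + 3 * ((+ 1 + a) * (+ 1 + b)) - + 2 * (+ 1 + a) - + 2 * (+ 1 + b) + + 1 ≡ + 3 * (a * b) + + 1 * a + + 1 * b + + 0
    l = solve-∀
    l′ : ∀ a b → + 3 * (- a * - b) - + 2 * (- a) - + 2 * (- b) + + 1 ≡ + 3 * (a * b) + + 2 * a + + 2 * b + + 1
    l′ = solve-∀

  module Families (ℓ : ℕ) where
    wL : ℤ → ℤ → ℤ
    wL ν n = cls ℓ ν n * sgn n
    -- Over all c the sum would vanish, because c ↦ 1 - c keeps tri c and reverses the sign. The
    -- class of 1 contains the exponent 0 exactly once for ℓ > 1, so the restricted series has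
    -- constant term -1.
    wJ : ℤ → ℤ
    wJ c = cls ℓ (+ 1) c * sgn c
    pair : ℤ → ℤ → ℤ × ℤ → ℤ
    pair a b (x , y) = cls ℓ a x * cls ℓ b y
    wH wY wK : ℤ → ℤ → ℤ × ℤ → ℤ
    wH a b z = pair a b z * sgn (proj₁ z + proj₂ z) * quad z
    wY a b z = pair a b z * sgn (proj₂ z) * quad z
    wK a b z = pair a b z * quad z

    tmH : ∀ a b → Tame (wH a b) EH
    tmH a b = quad-tame {EH} (λ z → pair a b z * sgn (proj₁ z + proj₂ z)) tameH
    tmY : ∀ a b → Tame (wY a b) EY
    tmY a b = quad-tame {EY} (λ z → pair a b z * sgn (proj₂ z)) tameY
    tmK : ∀ a b → Tame (wK a b) EK
    tmK a b = quad-tame {EK} (pair a b) tameK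

    abstract
      L : ℤ → Ser
      L ν = total (tame-summable (tameL (wL ν)))
      J : Ser
      J = total (tame-summable (tameJ wJ))
      H Y Kr : ℤ → ℤ → Ser
      H a b = total (tame-summable (tmH a b))
      Y a b = total (tame-summable (tmY a b))
      Kr a b = total (tame-summable (tmK a b))
      sumL′ : ∀ ν → SumM (wL ν) EL (L ν)
      sumL′ ν = sumS-total (tame-summable (tameL (wL ν)))
      sumJ : SumM wJ EJ J
      sumJ = sumS-total (tame-summable (tameJ wJ))
      sumH : ∀ a b → SumM (wH a b) EH (H a b)
      sumH a b = sumS-total (tame-summable (tmH a b))
      sumY : ∀ a b → SumM (wY a b) EY (Y a b)
      sumY a b = sumS-total (tame-summable (tmY a b))
      sumK : ∀ a b → SumM (wK a b) EK (Kr a b)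
      sumK a b = sumS-total (tame-summable (tmK a b))

    okL : ∀ ν x → Ok (wL ν x) (EL x)
    okL ν = tame-ok (tameL (wL ν))

  ind-× : ∀ {P Q : Set} (p : Dec P) (q : Dec Q) → ind p * ind q ≡ ind (p ×-dec q)
  ind-× (yes _) (yes _) = refl
  ind-× (yes _) (no _)  = refl
  ind-× (no _)  (yes _) = refl
  ind-× (no _)  (no _)  = refl

  opaque
    unfolding cls
    cls₁ : ∀ ℓ {a x a′ x′} → (ℓ ∋ x ≡ a → ℓ ∋ x′ ≡ a′) → (ℓ ∋ x′ ≡ a′ → ℓ ∋ x ≡ a) → cls ℓ a x ≡ cls ℓ a′ x′
    cls₁ ℓ {a} {x} {a′} {x′} f g = ind-cong (+ ℓ ∣? (x - a)) (+ ℓ ∣? (x′ - a′)) (divs ∘ f ∘ congruent) (divs ∘ g ∘ congruent)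

    cls₂ : ∀ ℓ {a b c d x y z t} →
      (ℓ ∋ x ≡ a → ℓ ∋ y ≡ b → ℓ ∋ z ≡ c × ℓ ∋ t ≡ d) →
      (ℓ ∋ z ≡ c → ℓ ∋ t ≡ d → ℓ ∋ x ≡ a × ℓ ∋ y ≡ b) →
      cls ℓ a x * cls ℓ b y ≡ cls ℓ c z * cls ℓ d t
    cls₂ ℓ {a} {b} {c} {d} {x} {y} {z} {t} f g = trans (ind-× (+ ℓ ∣? (x - a)) (+ ℓ ∣? (y - b)))
      (trans (ind-cong (+ ℓ ∣? (x - a) ×-dec + ℓ ∣? (y - b)) (+ ℓ ∣? (z - c) ×-dec + ℓ ∣? (t - d))
         (λ { (p , q) → let (r , s) = f (congruent p) (congruent q) in divs r , divs s })
         (λ { (p , q) → let (r , s) = g (congruent p) (congruent q) in divs r , divs s }))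
       (sym (ind-× (+ ℓ ∣? (z - c)) (+ ℓ ∣? (t - d)))))

    cls₃ : ∀ ℓ {a b c x y z a′ b′ c′ x′ y′ z′} →
      (ℓ ∋ x ≡ a → ℓ ∋ y ≡ b → ℓ ∋ z ≡ c → ℓ ∋ x′ ≡ a′ × ℓ ∋ y′ ≡ b′ × ℓ ∋ z′ ≡ c′) →
      (ℓ ∋ x′ ≡ a′ → ℓ ∋ y′ ≡ b′ → ℓ ∋ z′ ≡ c′ → ℓ ∋ x ≡ a × ℓ ∋ y ≡ b × ℓ ∋ z ≡ c) →
      cls ℓ a x * (cls ℓ b y * cls ℓ c z) ≡ cls ℓ a′ x′ * (cls ℓ b′ y′ * cls ℓ c′ z′)
    cls₃ ℓ {a} {b} {c} {x} {y} {z} {a′} {b′} {c′} {x′} {y′} {z′} f g =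
      trans (cong (cls ℓ a x *_) (ind-× (+ ℓ ∣? (y - b)) (+ ℓ ∣? (z - c))))
      (trans (ind-× (+ ℓ ∣? (x - a)) (+ ℓ ∣? (y - b) ×-dec + ℓ ∣? (z - c)))
      (trans (ind-cong (+ ℓ ∣? (x - a) ×-dec (+ ℓ ∣? (y - b) ×-dec + ℓ ∣? (z - c))) (+ ℓ ∣? (x′ - a′) ×-dec (+ ℓ ∣? (y′ - b′) ×-dec + ℓ ∣? (z′ - c′)))
         (λ { (p , q , r) → let (s , t , u) = f (congruent p) (congruent q) (congruent r) in divs s , divs t , divs u })
         (λ { (p , q , r) → let (s , t , u) = g (congruent p) (congruent q) (congruent r) in divs s , divs t , divs u }))
      (trans (sym (ind-× (+ ℓ ∣? (x′ - a′)) (+ ℓ ∣? (y′ - b′) ×-dec + ℓ ∣? (z′ - c′))))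
       (cong (cls ℓ a′ x′ *_) (sym (ind-× (+ ℓ ∣? (y′ - b′)) (+ ℓ ∣? (z′ - c′))))))))

  -- The numbers u and k are the coefficients of an explicit integer combination of the hypothesis
  -- and of ℓ, so each use is a polynomial identity for the ring solver; likewise in the variants
  -- with two or three hypotheses.
  ≡-lin₁ : ∀ {ℓ x a e d} u k → ℓ ∋ x ≡ a → u * (x - a) + k * + ℓ ≡ e - d → ℓ ∋ e ≡ d
  ≡-lin₁ {ℓ} {x} {a} u k (congruent p) q = congruent (∣-eq (∣-lin {x = x - a} {+ ℓ} u k p ℤD.∣-refl) q)

  ≡-lin₂ : ∀ {ℓ x y a b e d} u v k → ℓ ∋ x ≡ a → ℓ ∋ y ≡ b → u * (x - a) + v * (y - b) + k * + ℓ ≡ e - d → ℓ ∋ e ≡ d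
  ≡-lin₂ {ℓ} {x} {y} {a} {b} u v k (congruent p) (congruent q) r = congruent (∣-eq
    (∣-lin {x = u * (x - a) + v * (y - b)} {+ ℓ} (+ 1) k (∣-lin {x = x - a} {y - b} u v p q) ℤD.∣-refl)
    (trans (cong (_+ k * + ℓ) (ℤP.*-identityˡ (u * (x - a) + v * (y - b)))) r))

  ≡-lin₃ : ∀ {ℓ x y z a b c e d} u v w → ℓ ∋ x ≡ a → ℓ ∋ y ≡ b → ℓ ∋ z ≡ c → u * (x - a) + v * (y - b) + w * (z - c) ≡ e - d → ℓ ∋ e ≡ d
  ≡-lin₃ {ℓ} {x} {y} {z} {a} {b} {c} u v w (congruent p) (congruent q) (congruent r) s = congruent (∣-eq
    (∣-lin {x = u * (x - a) + v * (y - b)} {z - c} (+ 1) w (∣-lin {x = x - a} {y - b} u v p q) r)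
    (trans (cong (_+ w * (z - c)) (ℤP.*-identityˡ (u * (x - a) + v * (y - b)))) s))

  -- The three-term relation for `J` times a Hecke piece.

  module ThreeTerm (ℓ : ℕ) where
    open Families ℓ

    private
      I₃ : Set
      I₃ = ℤ × (ℤ × ℤ)

      -- Integral affine changes of variables with integral inverses. The first new coordinate
      -- becomes the index of the theta series split off, the other two the indices of `Y` or `Kr`.
      σ₁ σ₂ σ₃ : I₃ ≃ I₃
      σ₁ = bij (λ { (c , i , k) → k + + 2 * i , i , c - i }) (λ { (n , i , s) → s + i , i , n - + 2 * i })
        (λ { (n , i , s) → cong₂ (λ x y → x , i , y) (l₁ n i) (l₂ s i) })
        (λ { (c , i , k) → cong₂ (λ x y → x , i , y) (l₃ c i) (l₄ k i) })
        where
        l₁ : ∀ n i → n - + 2 * i + + 2 * i ≡ n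
        l₁ = solve-∀
        l₂ : ∀ s i → s + i - i ≡ s
        l₂ = solve-∀
        l₃ : ∀ c i → c - i + i ≡ c
        l₃ = solve-∀
        l₄ : ∀ k i → k + + 2 * i - + 2 * i ≡ k
        l₄ = solve-∀
      σ₂ = bij (λ { (c , i , k) → i + + 2 * k , k , + 1 - (c + k) }) (λ { (n , k , s) → + 1 - (s + k) , n - + 2 * k , k })
        (λ { (n , k , s) → cong₂ (λ x y → x , k , y) (l₁ n k) (l₂ s k) })
        (λ { (c , i , k) → cong₂ (λ x y → x , y , k) (l₂ c k) (l₃ i k) })
        where
        l₁ : ∀ n k → n - + 2 * k + + 2 * k ≡ n
        l₁ = solve-∀
        l₂ : ∀ s k → + 1 - (+ 1 - (s + k) + k) ≡ s
        l₂ = solve-∀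
        l₃ : ∀ i k → i + + 2 * k - + 2 * k ≡ i
        l₃ = solve-∀
      σ₃ = bij (λ { (c , i , k) → k - i + + 3 * c - + 1 , + 1 - (c - i) , c + k })
               (λ { (n , u , v) → n - (v - u) , u + (n - (v - u)) - + 1 , v - (n - (v - u)) })
        (λ { (n , u , v) → cong₂ _,_ (l₁ n u v) (cong₂ _,_ (l₂ n u v) (l₃ n u v)) })
        (λ { (c , i , k) → cong₂ _,_ (l₄ c i k) (cong₂ _,_ (l₅ c i k) (l₆ c i k)) })
        where
        l₁ : ∀ n u v → v - (n - (v - u)) - (u + (n - (v - u)) - + 1) + + 3 * (n - (v - u)) - + 1 ≡ n
        l₁ = solve-∀
        l₂ : ∀ n u v → + 1 - (n - (v - u) - (u + (n - (v - u)) - + 1)) ≡ u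
        l₂ = solve-∀
        l₃ : ∀ n u v → n - (v - u) + (v - (n - (v - u))) ≡ v
        l₃ = solve-∀
        l₄ : ∀ c i k → k - i + + 3 * c - + 1 - (c + k - (+ 1 - (c - i))) ≡ c
        l₄ = solve-∀
        l₅ : ∀ c i k → + 1 - (c - i) + (k - i + + 3 * c - + 1 - (c + k - (+ 1 - (c - i)))) - + 1 ≡ i
        l₅ = solve-∀
        l₆ : ∀ c i k → c + k - (k - i + + 3 * c - + 1 - (c + k - (+ 1 - (c - i)))) ≡ k
        l₆ = solve-∀

      E₀ : I₃ → ℤ
      E₀ (c , z) = EJ c + EH z

      e₀ : ∀ c i k → + 2 * E₀ (c , i , k) ≡ + 3 * (c * c - c) + ((i * i - i) + (k * k - k) + + 4 * (i * k))
      e₀ c i k = trans (l (+ tri c) (+ tri i) (+ tri k) (i * k))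
        (cong₂ (λ x y → + 3 * x + (y + + 4 * (i * k))) (tri-double c) (cong₂ _+_ (tri-double i) (tri-double k)))
        where
        l : ∀ a b d e → + 2 * (+ 3 * a + (b + d + + 2 * e)) ≡ + 3 * (+ 2 * a) + (+ 2 * b + + 2 * d + + 4 * e)
        l = solve-∀

      e₁ : ∀ x → EL (proj₁ (_≃_.to σ₁ x)) + EY (proj₂ (_≃_.to σ₁ x)) ≡ E₀ x
      e₁ (c , i , k) = double-inj (trans (l (+ tri (k + + 2 * i)) (+ tri (c - i)) i (i * (c - i)))
        (trans (cong₂ (λ x y → x + (+ 6 * (i * (c - i)) + + 3 * y - + 2 * i)) (tri-double (k + + 2 * i)) (tri-double (c - i)))
        (trans (m c i k) (sym (e₀ c i k)))))
        where
        l : ∀ a b i p → + 2 * (a + (+ 3 * p + + 3 * b - i)) ≡ + 2 * a + (+ 6 * p + + 3 * (+ 2 * b) - + 2 * i)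
        l = solve-∀
        m : ∀ c i k → (k + + 2 * i) * (k + + 2 * i) - (k + + 2 * i) + (+ 6 * (i * (c - i)) + + 3 * ((c - i) * (c - i) - (c - i)) - + 2 * i)
          ≡ + 3 * (c * c - c) + ((i * i - i) + (k * k - k) + + 4 * (i * k))
        m = solve-∀

      e₂ : ∀ x → EL (proj₁ (_≃_.to σ₂ x)) + EY (proj₂ (_≃_.to σ₂ x)) ≡ E₀ x
      e₂ (c , i , k) = double-inj (trans (l (+ tri (i + + 2 * k)) (+ tri (+ 1 - (c + k))) k (k * (+ 1 - (c + k))))
        (trans (cong₂ (λ x y → x + (+ 6 * (k * (+ 1 - (c + k))) + + 3 * y - + 2 * k)) (tri-double (i + + 2 * k)) (tri-double (+ 1 - (c + k))))
        (trans (m c i k) (sym (e₀ c i k)))))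
        where
        l : ∀ a b i p → + 2 * (a + (+ 3 * p + + 3 * b - i)) ≡ + 2 * a + (+ 6 * p + + 3 * (+ 2 * b) - + 2 * i)
        l = solve-∀
        m : ∀ c i k → (i + + 2 * k) * (i + + 2 * k) - (i + + 2 * k) + (+ 6 * (k * (+ 1 - (c + k))) + + 3 * ((+ 1 - (c + k)) * (+ 1 - (c + k)) - (+ 1 - (c + k))) - + 2 * k)
          ≡ + 3 * (c * c - c) + ((i * i - i) + (k * k - k) + + 4 * (i * k))
        m = solve-∀

      e₃ : ∀ x → EL (proj₁ (_≃_.to σ₃ x)) + EK (proj₂ (_≃_.to σ₃ x)) ≡ E₀ x
      e₃ (c , i , k) = double-inj (trans (l (+ tri (k - i + + 3 * c - + 1)) (EK (+ 1 - (c - i) , c + k)))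
        (trans (cong (_+ + 2 * EK (+ 1 - (c - i) , c + k)) (tri-double (k - i + + 3 * c - + 1)))
        (trans (m c i k) (sym (e₀ c i k)))))
        where
        l : ∀ a b → + 2 * (a + b) ≡ + 2 * a + + 2 * b
        l = solve-∀
        m : ∀ c i k → (k - i + + 3 * c - + 1) * (k - i + + 3 * c - + 1) - (k - i + + 3 * c - + 1)
            + + 2 * (+ 3 * ((+ 1 - (c - i)) * (c + k)) - + 2 * (+ 1 - (c - i)) - + 2 * (c + k) + + 1)
          ≡ + 3 * (c * c - c) + ((i * i - i) + (k * k - k) + + 4 * (i * k))
        m = solve-∀

    -- Write P, Q, R, S for the cuts of i, k, c - i, c + k. The three products carry the weights P +
    -- R - 1, Q - S and S - R, so the auxiliary cuts cancel and P + Q - 1 remains. The minus signs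
    -- arise because `σ₂` and `σ₃` change the parity of the total sign.
    J-H : ∀ a b → J ⊗ H a b ≗ L (b + + 2 * a) ⊗ Y a (+ 1 - a) ⊕ (⊖ (L (a + + 2 * b) ⊗ Y b (- b)) ⊕ ⊖ (L (b - a + + 2) ⊗ Kr a (b + + 1)))
    J-H a b = sumS-unique left right
      where
      ν₁ ν₂ ν₃ : ℤ
      ν₁ = b + + 2 * a
      ν₂ = a + + 2 * b
      ν₃ = b - a + + 2
      w₀ W₁ W₂ W₃ E₁ E₂ E₃ : I₃ → ℤ
      w₀ x = wJ (proj₁ x) * wH a b (proj₂ x)
      W₁ x = wL ν₁ (proj₁ (_≃_.to σ₁ x)) * wY a (+ 1 - a) (proj₂ (_≃_.to σ₁ x))
      W₂ x = wL ν₂ (proj₁ (_≃_.to σ₂ x)) * wY b (- b) (proj₂ (_≃_.to σ₂ x))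
      W₃ x = wL ν₃ (proj₁ (_≃_.to σ₃ x)) * wK a (b + + 1) (proj₂ (_≃_.to σ₃ x))
      E₁ x = EL (proj₁ (_≃_.to σ₁ x)) + EY (proj₂ (_≃_.to σ₁ x))
      E₂ x = EL (proj₁ (_≃_.to σ₂ x)) + EY (proj₂ (_≃_.to σ₂ x))
      E₃ x = EL (proj₁ (_≃_.to σ₃ x)) + EK (proj₂ (_≃_.to σ₃ x))
      weight : ∀ x → W₁ x + (- W₂ x + - W₃ x) ≡ w₀ x
      weight (c , i , k) = begin
        cls ℓ ν₁ (k + + 2 * i) * sgn (k + + 2 * i) * (cls ℓ a i * cls ℓ (+ 1 - a) (c - i) * sgn (c - i) * (P + R - + 1))
          + (- (cls ℓ ν₂ (i + + 2 * k) * sgn (i + + 2 * k) * (cls ℓ b k * cls ℓ (- b) (+ 1 - (c + k)) * sgn (+ 1 - (c + k)) * (Q + pos (+ 1 - (c + k)) - + 1)))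
          + - (cls ℓ ν₃ n * sgn n * (cls ℓ a (+ 1 - (c - i)) * cls ℓ (b + + 1) (c + k) * (pos (+ 1 - (c - i)) + S - + 1))))
          ≡⟨ cong₂ _+_ (g₁ (cls ℓ ν₁ (k + + 2 * i)) (sgn (k + + 2 * i)) (cls ℓ a i) (cls ℓ (+ 1 - a) (c - i)) (sgn (c - i)) (P + R - + 1))
               (cong₂ (λ x y → - x + - y)
                 (g₁ (cls ℓ ν₂ (i + + 2 * k)) (sgn (i + + 2 * k)) (cls ℓ b k) (cls ℓ (- b) (+ 1 - (c + k))) (sgn (+ 1 - (c + k))) (Q + pos (+ 1 - (c + k)) - + 1))
                 (g₂ (cls ℓ ν₃ n) (sgn n) (cls ℓ a (+ 1 - (c - i))) (cls ℓ (b + + 1) (c + k)) (pos (+ 1 - (c - i)) + S - + 1))) ⟩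
        cls ℓ ν₁ (k + + 2 * i) * (cls ℓ a i * cls ℓ (+ 1 - a) (c - i)) * (sgn (k + + 2 * i) * sgn (c - i)) * (P + R - + 1)
          + (- (cls ℓ ν₂ (i + + 2 * k) * (cls ℓ b k * cls ℓ (- b) (+ 1 - (c + k))) * (sgn (i + + 2 * k) * sgn (+ 1 - (c + k))) * (Q + pos (+ 1 - (c + k)) - + 1))
          + - (cls ℓ ν₃ n * (cls ℓ a (+ 1 - (c - i)) * cls ℓ (b + + 1) (c + k)) * sgn n * (pos (+ 1 - (c - i)) + S - + 1)))
          ≡⟨ cong₂ _+_ (cong₂ (λ x y → x * y * (P + R - + 1)) c₁ s₁)
               (cong₂ (λ x y → - x + - y)
                 (cong₂ _*_ (cong₂ _*_ c₂ s₂) (cong (λ p → Q + p - + 1) (pos-1- (c + k))))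
                 (cong₂ _*_ (cong₂ _*_ c₃ s₃) (cong (λ p → p + S - + 1) (pos-1- (c - i))))) ⟩
        X * s * (P + R - + 1) + (- (X * - s * (Q + (+ 1 - S) - + 1)) + - (X * - s * (+ 1 - R + S - + 1)))
          ≡⟨ fin (cls ℓ (+ 1) c) (cls ℓ a i) (cls ℓ b k) (sgn c) (sgn (i + k)) P Q R S ⟩
        wJ c * wH a b (i , k) ∎
        where
        open ≡.≡-Reasoning
        n P Q R S X s : ℤ
        n = k - i + + 3 * c - + 1
        P = pos i
        Q = pos k
        R = pos (c - i)
        S = pos (c + k)
        X = cls ℓ (+ 1) c * (cls ℓ a i * cls ℓ b k)
        s = sgn c * sgn (i + k)
        g₁ : ∀ x y z u v p → x * y * (z * u * v * p) ≡ x * (z * u) * (y * v) * p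
        g₁ = solve-∀
        g₂ : ∀ x y z u p → x * y * (z * u * p) ≡ x * (z * u) * y * p
        g₂ = solve-∀
        fin : ∀ x y z u v P Q R S → x * (y * z) * (u * v) * (P + R - + 1)
            + (- (x * (y * z) * - (u * v) * (Q + (+ 1 - S) - + 1)) + - (x * (y * z) * - (u * v) * (+ 1 - R + S - + 1)))
            ≡ x * u * (y * z * v * (P + Q - + 1))
        fin = solve-∀
        c₁ : cls ℓ ν₁ (k + + 2 * i) * (cls ℓ a i * cls ℓ (+ 1 - a) (c - i)) ≡ X
        c₁ = cls₃ ℓ
          (λ p q r → ≡-lin₃ (+ 0) (+ 1) (+ 1) p q r (t₁ a b c i k) , ≡-lin₃ (+ 0) (+ 1) (+ 0) p q r (t₂ a b c i k) , ≡-lin₃ (+ 1) (- + 2) (+ 0) p q r (t₃ a b c i k))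
          (λ p q r → ≡-lin₃ (+ 0) (+ 2) (+ 1) p q r (t₄ a b c i k) , ≡-lin₃ (+ 0) (+ 1) (+ 0) p q r (t₅ a b c i k) , ≡-lin₃ (+ 1) (- + 1) (+ 0) p q r (t₆ a b c i k))
          where
          t₁ : ∀ a b c i k → + 0 * (k + + 2 * i - (b + + 2 * a)) + + 1 * (i - a) + + 1 * (c - i - (+ 1 - a)) ≡ c - + 1
          t₁ = solve-∀
          t₂ : ∀ a b c i k → + 0 * (k + + 2 * i - (b + + 2 * a)) + + 1 * (i - a) + + 0 * (c - i - (+ 1 - a)) ≡ i - a
          t₂ = solve-∀
          t₃ : ∀ a b c i k → + 1 * (k + + 2 * i - (b + + 2 * a)) + - + 2 * (i - a) + + 0 * (c - i - (+ 1 - a)) ≡ k - b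
          t₃ = solve-∀
          t₄ : ∀ a b c i k → + 0 * (c - + 1) + + 2 * (i - a) + + 1 * (k - b) ≡ k + + 2 * i - (b + + 2 * a)
          t₄ = solve-∀
          t₅ : ∀ a b c i k → + 0 * (c - + 1) + + 1 * (i - a) + + 0 * (k - b) ≡ i - a
          t₅ = solve-∀
          t₆ : ∀ a b c i k → + 1 * (c - + 1) + - + 1 * (i - a) + + 0 * (k - b) ≡ c - i - (+ 1 - a)
          t₆ = solve-∀
        c₂ : cls ℓ ν₂ (i + + 2 * k) * (cls ℓ b k * cls ℓ (- b) (+ 1 - (c + k))) ≡ X
        c₂ = cls₃ ℓ
          (λ p q r → ≡-lin₃ (+ 0) (- + 1) (- + 1) p q r (t₁ a b c i k) , ≡-lin₃ (+ 1) (- + 2) (+ 0) p q r (t₂ a b c i k) , ≡-lin₃ (+ 0) (+ 1) (+ 0) p q r (t₃ a b c i k))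
          (λ p q r → ≡-lin₃ (+ 0) (+ 1) (+ 2) p q r (t₄ a b c i k) , ≡-lin₃ (+ 0) (+ 0) (+ 1) p q r (t₅ a b c i k) , ≡-lin₃ (- + 1) (+ 0) (- + 1) p q r (t₆ a b c i k))
          where
          t₁ : ∀ a b c i k → + 0 * (i + + 2 * k - (a + + 2 * b)) + - + 1 * (k - b) + - + 1 * (+ 1 - (c + k) - - b) ≡ c - + 1
          t₁ = solve-∀
          t₂ : ∀ a b c i k → + 1 * (i + + 2 * k - (a + + 2 * b)) + - + 2 * (k - b) + + 0 * (+ 1 - (c + k) - - b) ≡ i - a
          t₂ = solve-∀
          t₃ : ∀ a b c i k → + 0 * (i + + 2 * k - (a + + 2 * b)) + + 1 * (k - b) + + 0 * (+ 1 - (c + k) - - b) ≡ k - b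
          t₃ = solve-∀
          t₄ : ∀ a b c i k → + 0 * (c - + 1) + + 1 * (i - a) + + 2 * (k - b) ≡ i + + 2 * k - (a + + 2 * b)
          t₄ = solve-∀
          t₅ : ∀ a b c i k → + 0 * (c - + 1) + + 0 * (i - a) + + 1 * (k - b) ≡ k - b
          t₅ = solve-∀
          t₆ : ∀ a b c i k → - + 1 * (c - + 1) + + 0 * (i - a) + - + 1 * (k - b) ≡ + 1 - (c + k) - - b
          t₆ = solve-∀
        c₃ : cls ℓ ν₃ n * (cls ℓ a (+ 1 - (c - i)) * cls ℓ (b + + 1) (c + k)) ≡ X
        c₃ = cls₃ ℓ
          (λ p q r → ≡-lin₃ (+ 1) (+ 1) (- + 1) p q r (t₁ a b c i k) , ≡-lin₃ (+ 1) (+ 2) (- + 1) p q r (t₂ a b c i k) , ≡-lin₃ (- + 1) (- + 1) (+ 2) p q r (t₃ a b c i k))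
          (λ p q r → ≡-lin₃ (+ 3) (- + 1) (+ 1) p q r (t₄ a b c i k) , ≡-lin₃ (- + 1) (+ 1) (+ 0) p q r (t₅ a b c i k) , ≡-lin₃ (+ 1) (+ 0) (+ 1) p q r (t₆ a b c i k))
          where
          t₁ : ∀ a b c i k → + 1 * (k - i + + 3 * c - + 1 - (b - a + + 2)) + + 1 * (+ 1 - (c - i) - a) + - + 1 * (c + k - (b + + 1)) ≡ c - + 1
          t₁ = solve-∀
          t₂ : ∀ a b c i k → + 1 * (k - i + + 3 * c - + 1 - (b - a + + 2)) + + 2 * (+ 1 - (c - i) - a) + - + 1 * (c + k - (b + + 1)) ≡ i - a
          t₂ = solve-∀
          t₃ : ∀ a b c i k → - + 1 * (k - i + + 3 * c - + 1 - (b - a + + 2)) + - + 1 * (+ 1 - (c - i) - a) + + 2 * (c + k - (b + + 1)) ≡ k - b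
          t₃ = solve-∀
          t₄ : ∀ a b c i k → + 3 * (c - + 1) + - + 1 * (i - a) + + 1 * (k - b) ≡ k - i + + 3 * c - + 1 - (b - a + + 2)
          t₄ = solve-∀
          t₅ : ∀ a b c i k → - + 1 * (c - + 1) + + 1 * (i - a) + + 0 * (k - b) ≡ + 1 - (c - i) - a
          t₅ = solve-∀
          t₆ : ∀ a b c i k → + 1 * (c - + 1) + + 0 * (i - a) + + 1 * (k - b) ≡ c + k - (b + + 1)
          t₆ = solve-∀
        s₁ : sgn (k + + 2 * i) * sgn (c - i) ≡ s
        s₁ = trans (sym (sgn-+ (k + + 2 * i) (c - i))) (trans (sgn-even _ (c + (i + k)) (+ 0) (l c i k)) (sgn-+ c (i + k)))
          where
          l : ∀ c i k → k + + 2 * i + (c - i) ≡ c + (i + k) + + 2 * + 0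
          l = solve-∀
        s₂ : sgn (i + + 2 * k) * sgn (+ 1 - (c + k)) ≡ - s
        s₂ = trans (sym (sgn-+ (i + + 2 * k) (+ 1 - (c + k)))) (trans (sgn-odd _ (c + (i + k)) (- c) (l c i k)) (cong -_ (sgn-+ c (i + k))))
          where
          l : ∀ c i k → i + + 2 * k + (+ 1 - (c + k)) ≡ + 1 + (c + (i + k) + + 2 * - c)
          l = solve-∀
        s₃ : sgn n ≡ - s
        s₃ = trans (sgn-odd _ (c + (i + k)) (c - i - + 1) (l c i k)) (cong -_ (sgn-+ c (i + k)))
          where
          l : ∀ c i k → k - i + + 3 * c - + 1 ≡ + 1 + (c + (i + k) + + 2 * (c - i - + 1))
          l = solve-∀
      left : SumM w₀ E₀ (J ⊗ H a b)
      left = sumM-× {w = wJ} {EJ} {wH a b} {EH} (tame-ok (tameJ wJ)) (tame-ok (tmH a b)) sumJ (sumH a b)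
      t₁ : SumM W₁ E₁ (L ν₁ ⊗ Y a (+ 1 - a))
      t₁ = sumS-bij σ₁ (sumM-× {w = wL ν₁} {EL} {wY a (+ 1 - a)} {EY} (okL ν₁) (tame-ok (tmY a (+ 1 - a))) (sumL′ ν₁) (sumY a (+ 1 - a)))
      t₂ : SumM W₂ E₂ (L ν₂ ⊗ Y b (- b))
      t₂ = sumS-bij σ₂ (sumM-× {w = wL ν₂} {EL} {wY b (- b)} {EY} (okL ν₂) (tame-ok (tmY b (- b))) (sumL′ ν₂) (sumY b (- b)))
      t₃ : SumM W₃ E₃ (L ν₃ ⊗ Kr a (b + + 1))
      t₃ = sumS-bij σ₃ (sumM-× {w = wL ν₃} {EL} {wK a (b + + 1)} {EK} (okL ν₃) (tame-ok (tmK a (b + + 1))) (sumL′ ν₃) (sumK a (b + + 1)))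
      right : SumM w₀ E₀ (L ν₁ ⊗ Y a (+ 1 - a) ⊕ (⊖ (L ν₂ ⊗ Y b (- b)) ⊕ ⊖ (L ν₃ ⊗ Kr a (b + + 1))))
      right = sumM-cong {w = λ x → W₁ x + (- W₂ x + - W₃ x)} {w₀} {E₀} {E₀} weight (λ _ → refl)
        (sumM-+ {w = W₁} {λ x → - W₂ x + - W₃ x} {E₀} (sumM-cong {w = W₁} {W₁} {E₁} {E₀} (λ _ → refl) e₁ t₁)
        (sumM-+ {w = λ x → - W₂ x} {λ x → - W₃ x} {E₀}
          (sumM-cong {w = λ x → - W₂ x} {λ x → - W₂ x} {E₂} {E₀} (λ _ → refl) e₂ (sumM-neg {w = W₂} {E₂} t₂))
          (sumM-cong {w = λ x → - W₃ x} {λ x → - W₃ x} {E₃} {E₀} (λ _ → refl) e₃ (sumM-neg {w = W₃} {E₃} t₃))))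

  -- Periodicity and reflection of the residue pieces.

  cls-per : ∀ ℓ {r r′} k i → r′ ≡ r + k * + ℓ → cls ℓ r′ i ≡ cls ℓ r i
  cls-per ℓ {r} k i refl = cls₁ ℓ (λ p → ≡-lin₁ (+ 1) k p (l i r k (+ ℓ))) (λ p → ≡-lin₁ (+ 1) (- k) p (l′ i r k (+ ℓ)))
    where
    l : ∀ i r k n → + 1 * (i - (r + k * n)) + k * n ≡ i - r
    l = solve-∀
    l′ : ∀ i r k n → + 1 * (i - r) + - k * n ≡ i - (r + k * n)
    l′ = solve-∀

  tri-reflect : ∀ z → tri (+ 1 - z) ≡ tri z
  tri-reflect z = ℤP.+-injective (double-inj (trans (tri-double (+ 1 - z)) (trans (l z) (sym (tri-double z)))))
    where
    l : ∀ z → (+ 1 - z) * (+ 1 - z) - (+ 1 - z) ≡ z * z - z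
    l = solve-∀

  reflect : ℤ ≃ ℤ
  reflect = bij (λ z → + 1 - z) (λ z → + 1 - z) l l
    where
    l : ∀ z → + 1 - (+ 1 - z) ≡ z
    l = solve-∀

  sgn-reflect : ∀ z → sgn (+ 1 - z) ≡ - sgn z
  sgn-reflect z = sgn-odd (+ 1 - z) z (- z) (l z)
    where
    l : ∀ z → + 1 - z ≡ + 1 + (z + + 2 * - z)
    l = solve-∀

  -- The standard source of vanishing: a sign-reversing involution of the indices shows that a sum
  -- is its own negative, and ℤ has no 2-torsion.
  double-zero : ∀ {s} → s ≗ ⊖ s → s ≗ 𝟘
  double-zero {s} p = ≗-pw λ m → trans (double-inj (trans (l (s m) (trans (ex p m) (⊖-at s m))) (sym (ℤP.*-zeroʳ (+ 2))))) (sym (con0 m))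
    where
    l : ∀ x → x ≡ - x → + 2 * x ≡ + 0
    l x e = trans (l₁ x) (trans (+congˡ x e) (ℤP.+-inverseʳ x))
      where
      l₁ : ∀ x → + 2 * x ≡ x + x
      l₁ = solve-∀

  module Periodic (ℓ : ℕ) where
    open Families ℓ

    L-per : ∀ {ν ν′} k → ν′ ≡ ν + k * + ℓ → L ν′ ≗ L ν
    L-per {ν} {ν′} k e = sumS-unique
      (sumM-cong {w = wL ν′} {wL ν} {EL} {EL} (λ n → cong (_* sgn n) (cls-per ℓ k n e)) (λ _ → refl) (sumL′ ν′)) (sumL′ ν)

    pair-per : ∀ {a a′ b b′} j k z → a′ ≡ a + j * + ℓ → b′ ≡ b + k * + ℓ → pair a′ b′ z ≡ pair a b z
    pair-per j k (x , y) p q = cong₂ _*_ (cls-per ℓ j x p) (cls-per ℓ k y q)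

    K-per : ∀ {a a′ b b′} j k → a′ ≡ a + j * + ℓ → b′ ≡ b + k * + ℓ → Kr a′ b′ ≗ Kr a b
    K-per {a} {a′} {b} {b′} j k p q = sumS-unique
      (sumM-cong {w = wK a′ b′} {wK a b} {EK} {EK} (λ z → cong (λ c → c * quad z) (pair-per j k z p q)) (λ _ → refl) (sumK a′ b′)) (sumK a b)

    L-reflect : ∀ ν → L (+ 1 - ν) ≗ ⊖ L ν
    L-reflect ν = sumS-unique
      (sumM-cong {w = wL (+ 1 - ν) ∘ (λ z → + 1 - z)} {λ z → - wL ν z} {EL ∘ (λ z → + 1 - z)} {EL}
        (λ n → trans (cong₂ _*_ (cls₁ ℓ (λ p → ≡-lin₁ (- + 1) (+ 0) p (l n ν (+ ℓ))) (λ p → ≡-lin₁ (- + 1) (+ 0) p (l′ n ν (+ ℓ)))) (sgn-reflect n))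
          (sym (ℤP.neg-distribʳ-* (cls ℓ ν n) (sgn n))))
        (λ n → cong ℤ.+_ (tri-reflect n)) (sumS-bij reflect (sumL′ (+ 1 - ν))))
      (sumM-neg {w = wL ν} {EL} (sumL′ ν))
      where
      l : ∀ n ν m → - + 1 * (+ 1 - n - (+ 1 - ν)) + + 0 * m ≡ n - ν
      l = solve-∀
      l′ : ∀ n ν m → - + 1 * (n - ν) + + 0 * m ≡ + 1 - n - (+ 1 - ν)
      l′ = solve-∀

    quad-swap : ∀ x y → quad (x , y) ≡ quad (y , x)
    quad-swap x y = cong (λ z → z - + 1) (ℤP.+-comm (pos x) (pos y))

    H-sym : ∀ a b → H a b ≗ H b a
    H-sym a b = sumS-unique
      (sumM-cong {w = λ z → wH a b (proj₂ z , proj₁ z)} {wH b a} {λ z → EH (proj₂ z , proj₁ z)} {EH}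
        (λ { (x , y) → cong₂ _*_ (cong₂ _*_ (ℤP.*-comm (cls ℓ a y) (cls ℓ b x)) (cong sgn (ℤP.+-comm y x))) (quad-swap y x) })
        (λ { (x , y) → cong₂ _+_ (ℤP.+-comm (+ tri y) (+ tri x)) (cong (+ 2 *_) (ℤP.*-comm y x)) }) (sumS-bij swap≃ (sumH a b)))
      (sumH b a)

    K-sym : ∀ a b → Kr a b ≗ Kr b a
    K-sym a b = sumS-unique
      (sumM-cong {w = λ z → wK a b (proj₂ z , proj₁ z)} {wK b a} {λ z → EK (proj₂ z , proj₁ z)} {EK}
        (λ { (x , y) → cong₂ _*_ (ℤP.*-comm (cls ℓ a y) (cls ℓ b x)) (quad-swap y x) })
        (λ { (x , y) → l x y }) (sumS-bij swap≃ (sumK a b)))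
      (sumK b a)
      where
      l : ∀ x y → + 3 * (y * x) - + 2 * y - + 2 * x + + 1 ≡ + 3 * (x * y) - + 2 * x - + 2 * y + + 1
      l = solve-∀

  -- Splitting by parity, and the relation between `Y` and `Kr`.

  even-odd : ∀ z → ∃ λ h → z ≡ + 2 * h ⊎ z ≡ + 2 * h + + 1
  even-odd (+ n) = go n
    where
    go : ∀ n → ∃ λ h → + n ≡ + 2 * h ⊎ + n ≡ + 2 * h + + 1
    go zero = + 0 , inj₁ refl
    go (suc n) with go n
    ... | h , inj₁ e = h , inj₂ (trans (ℤP.+-comm (+ 1) (+ n)) (cong (_+ + 1) e))
    ... | h , inj₂ e = + 1 + h , inj₁ (trans (+congˡ (+ 1) e) (l h))
      where
      l : ∀ h → + 1 + (+ 2 * h + + 1) ≡ + 2 * (+ 1 + h)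
      l = solve-∀
  even-odd -[1+ n ] with even-odd (+ n)
  ... | h , inj₁ e = - + 1 - h , inj₂ (trans (cong (λ x → - (+ 1 + x)) e) (l h))
    where
    l : ∀ h → - (+ 1 + + 2 * h) ≡ + 2 * (- + 1 - h) + + 1
    l = solve-∀
  ... | h , inj₂ e = - + 1 - h , inj₁ (trans (cong (λ x → - (+ 1 + x)) e) (l h))
    where
    l : ∀ h → - (+ 1 + (+ 2 * h + + 1)) ≡ + 2 * (- + 1 - h)
    l = solve-∀

  -- The sign (-1)^z takes different values on the two sides.
  even≢odd : ∀ x y → + 2 * x ≢ + 2 * y + + 1
  even≢odd x y e = dis (trans (sym (sgn-even (+ 2 * x) (+ 0) x (sym (ℤP.+-identityˡ _))))
    (trans (cong sgn e) (sgn-odd (+ 2 * y + + 1) (+ 0) y (l y))))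
    where
    dis : + 1 ≡ - + 1 → ⊥
    dis ()
    l : ∀ y → + 2 * y + + 1 ≡ + 1 + (+ 0 + + 2 * y)
    l = solve-∀

  halves : (ℤ ⊎ ℤ) ≃ ℤ
  halves = bij to from to-from from-to
    where
    to : ℤ ⊎ ℤ → ℤ
    to = [ (λ h → + 2 * h) , (λ h → + 2 * h + + 1) ]′
    from′ : ∀ {z} → ∃ (λ h → z ≡ + 2 * h ⊎ z ≡ + 2 * h + + 1) → ℤ ⊎ ℤ
    from′ (h , inj₁ _) = inj₁ h
    from′ (h , inj₂ _) = inj₂ h
    from : ℤ → ℤ ⊎ ℤ
    from z = from′ (even-odd z)
    to-from : ∀ z → to (from z) ≡ z
    to-from z with even-odd z
    ... | h , inj₁ e = sym e
    ... | h , inj₂ e = sym e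
    from-to : ∀ x → from (to x) ≡ x
    from-to (inj₁ x) with even-odd (+ 2 * x)
    ... | h , inj₁ e = cong inj₁ (double-inj (sym e))
    ... | h , inj₂ e = ⊥-elim (even≢odd x h e)
    from-to (inj₂ x) with even-odd (+ 2 * x + + 1)
    ... | h , inj₁ e = ⊥-elim (even≢odd h x (sym e))
    ... | h , inj₂ e = cong inj₂ (double-inj (trans (l (+ 2 * h)) (trans (cong (λ z → z - + 1) (sym e)) (sym (l (+ 2 * x))))))

      where
      l : ∀ x → x ≡ x + + 1 - + 1
      l = solve-∀

  pos-even : ∀ x → pos (+ 2 * x) ≡ pos x
  pos-even (+ zero)  = refl
  pos-even (+ suc n) = refl
  pos-even -[1+ n ]  = refl

  pos-odd : ∀ x → pos (+ 2 * x + + 1) ≡ pos (+ 1 + x)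
  pos-odd (+ zero)  = refl
  pos-odd (+ suc n) = refl
  pos-odd -[1+ zero ] = refl
  pos-odd -[1+ suc n ] = cong pos (l (+ n))
    where
    l : ∀ n → + 2 * (- (+ 2 + n)) + + 1 ≡ - (+ 1 + (+ 2 + (n + n)))
    l = solve-∀

  Q : Set
  Q = ℤ × ℤ

  module ParitySplit where
    open _≃_ halves renaming (from to half)
    -- In `splitΔ` the second index is halved and i is replaced by t - s, so that the two cuts, at
    -- the second index and at that index plus 2i, become cuts of s and t separately. The other two
    -- splittings are matched to these coordinates.
    splitΔ split₁ split₂ : (Q ⊎ Q) ≃ Q
    splitΔ = bij to′ (λ { (i , s) → g i (half s) }) (λ { (i , s) → tf i s (half s) (to-from s) }) ft
      where
      to′ : Q ⊎ Q → Q
      to′ (inj₁ (s , t)) = t - s , + 2 * s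
      to′ (inj₂ (s , t)) = t - s , + 2 * s + + 1
      g : ℤ → ℤ ⊎ ℤ → Q ⊎ Q
      g i (inj₁ h) = inj₁ (h , i + h)
      g i (inj₂ h) = inj₂ (h , i + h)
      l : ∀ i h → i + h - h ≡ i
      l = solve-∀
      l′ : ∀ s t → t - s + s ≡ t
      l′ = solve-∀
      tf : ∀ i s h → to h ≡ s → to′ (g i h) ≡ (i , s)
      tf i s (inj₁ h) refl = cong (_, s) (l i h)
      tf i s (inj₂ h) refl = cong (_, s) (l i h)
      ft : ∀ x → g (proj₁ (to′ x)) (half (proj₂ (to′ x))) ≡ x
      ft (inj₁ (s , t)) = trans (cong (g (t - s)) (from-to (inj₁ s))) (cong (λ z → inj₁ (s , z)) (l′ s t))
      ft (inj₂ (s , t)) = trans (cong (g (t - s)) (from-to (inj₂ s))) (cong (λ z → inj₂ (s , z)) (l′ s t))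
    split₁ = bij to′ (λ { (u , v) → g v (half (+ 1 - u)) }) (λ { (u , v) → tf u v (half (+ 1 - u)) (to-from (+ 1 - u)) }) ft
      where
      to′ : Q ⊎ Q → Q
      to′ (inj₁ (s , t)) = + 1 - + 2 * s , + 1 - t
      to′ (inj₂ (x , y)) = + 2 * (+ 1 - x) , + 1 - y
      g : ℤ → ℤ ⊎ ℤ → Q ⊎ Q
      g v (inj₁ h) = inj₁ (h , + 1 - v)
      g v (inj₂ h) = inj₂ (h + + 1 , + 1 - v)
      l : ∀ z → + 1 - (+ 1 - z) ≡ z
      l = solve-∀
      l₂ : ∀ h → + 2 * (+ 1 - (h + + 1)) ≡ + 1 - (+ 2 * h + + 1)
      l₂ = solve-∀
      l₃ : ∀ x → + 1 - + 2 * (+ 1 - x) ≡ + 2 * (x - + 1) + + 1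
      l₃ = solve-∀
      l₄ : ∀ x → x - + 1 + + 1 ≡ x
      l₄ = solve-∀
      tf : ∀ u v h → to h ≡ + 1 - u → to′ (g v h) ≡ (u , v)
      tf u v (inj₁ h) e = cong₂ _,_ (trans (cong (λ z → + 1 - z) e) (l u)) (l v)
      tf u v (inj₂ h) e = cong₂ _,_ (trans (l₂ h) (trans (cong (λ z → + 1 - z) e) (l u))) (l v)
      ft : ∀ x → g (proj₂ (to′ x)) (half (+ 1 - proj₁ (to′ x))) ≡ x
      ft (inj₁ (s , t)) = trans (cong (g (+ 1 - t)) (trans (cong half (l (+ 2 * s))) (from-to (inj₁ s)))) (cong (λ z → inj₁ (s , z)) (l t))
      ft (inj₂ (x , y)) = trans (cong (g (+ 1 - y)) (trans (cong half (l₃ x)) (from-to (inj₂ (x - + 1))))) (cong₂ (λ u v → inj₂ (u , v)) (l₄ x) (l y))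
    split₂ = bij to′ (λ { (u , v) → g u (half v) }) (λ { (u , v) → tf u v (half v) (to-from v) }) ft
      where
      to′ : Q ⊎ Q → Q
      to′ (inj₁ (s , t)) = s + + 1 , + 2 * t + + 1
      to′ (inj₂ (u , w)) = u , + 2 * w
      g : ℤ → ℤ ⊎ ℤ → Q ⊎ Q
      g u (inj₁ h) = inj₂ (u , h)
      g u (inj₂ h) = inj₁ (u - + 1 , h)
      l : ∀ x → x - + 1 + + 1 ≡ x
      l = solve-∀
      l′ : ∀ x → x + + 1 - + 1 ≡ x
      l′ = solve-∀
      tf : ∀ u v h → to h ≡ v → to′ (g u h) ≡ (u , v)
      tf u v (inj₁ h) refl = refl
      tf u v (inj₂ h) refl = cong (_, v) (l u)
      ft : ∀ x → g (proj₁ (to′ x)) (half (proj₂ (to′ x))) ≡ x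
      ft (inj₁ (s , t)) = trans (cong (g (s + + 1)) (from-to (inj₂ t))) (cong (λ z → inj₁ (z , t)) (l′ s))
      ft (inj₂ (u , w)) = cong (g u) (from-to (inj₁ w))

  open ParitySplit

  module _ where
    open Families 5
    open Periodic 5
    private
      T : Set
      T = (Q ⊎ Q) ⊎ ((Q ⊎ Q) ⊎ (Q ⊎ Q))

      -- Even second index in the `Y` part is matched with odd u in `split₁`, odd second index with
      -- odd v in `split₂`; the leftovers of the two `Kr` sums, even u and even v, are matched with
      -- each other.
      τ : T → T
      τ (inj₁ (inj₁ x))        = inj₂ (inj₁ (inj₁ x))
      τ (inj₁ (inj₂ x))        = inj₂ (inj₂ (inj₁ x))
      τ (inj₂ (inj₁ (inj₁ x))) = inj₁ (inj₁ x)
      τ (inj₂ (inj₁ (inj₂ x))) = inj₂ (inj₂ (inj₂ x))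
      τ (inj₂ (inj₂ (inj₁ x))) = inj₁ (inj₂ x)
      τ (inj₂ (inj₂ (inj₂ x))) = inj₂ (inj₁ (inj₂ x))

      ττ : ∀ x → τ (τ x) ≡ x
      ττ (inj₁ (inj₁ x))        = refl
      ττ (inj₁ (inj₂ x))        = refl
      ττ (inj₂ (inj₁ (inj₁ x))) = refl
      ττ (inj₂ (inj₁ (inj₂ x))) = refl
      ττ (inj₂ (inj₂ (inj₁ x))) = refl
      ττ (inj₂ (inj₂ (inj₂ x))) = refl

      wΔ : ℤ → Q → ℤ
      wΔ a (i , s) = pair a (+ 1 - a) (i , s) * sgn s * (pos s + pos (s + + 2 * i) - + 1)

      flip≃ : Q ≃ Q
      flip≃ = bij (λ { (i , s) → i , + 1 - (s + + 2 * i) }) (λ { (i , s) → i , + 1 - (s + + 2 * i) })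
        (λ { (i , s) → cong (i ,_) (l i s) }) (λ { (i , s) → cong (i ,_) (l i s) })
        where
        l : ∀ i s → + 1 - (+ 1 - (s + + 2 * i) + + 2 * i) ≡ s
        l = solve-∀

      -- The flip s ↦ 1 - (s + 2i) preserves `EY`, reverses the sign and exchanges the residues 1 -
      -- a and -a. Adding the flipped sum therefore eliminates the cut at i and leaves cuts at s and
      -- s + 2i.
      sumΔ : ∀ a → SumM (wΔ a) EY (Y a (+ 1 - a) ⊕ Y a (- a))
      sumΔ a = sumM-cong {w = λ z → wY a (+ 1 - a) z + w′ z} {wΔ a} {EY} {EY} weight (λ _ → refl)
        (sumM-+ {w = wY a (+ 1 - a)} {w′} {EY} (sumY a (+ 1 - a))
          (sumM-cong {w = w′} {w′} {EY ∘ _≃_.to flip≃} {EY} (λ _ → refl) expo (sumS-bij flip≃ (sumY a (- a)))))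
        where
        w′ : Q → ℤ
        w′ = wY a (- a) ∘ _≃_.to flip≃
        expo : ∀ z → EY (_≃_.to flip≃ z) ≡ EY z
        expo (i , s) = double-inj (trans (l (+ tri (+ 1 - (s + + 2 * i))) i (+ 1 - (s + + 2 * i)))
          (trans (cong (λ x → + 6 * (i * (+ 1 - (s + + 2 * i))) + + 3 * x - + 2 * i) (tri-double (+ 1 - (s + + 2 * i))))
          (trans (m i s) (sym (trans (l (+ tri s) i s) (cong (λ x → + 6 * (i * s) + + 3 * x - + 2 * i) (tri-double s)))))))
          where
          l : ∀ t i s → + 2 * (+ 3 * (i * s) + + 3 * t - i) ≡ + 6 * (i * s) + + 3 * (+ 2 * t) - + 2 * i
          l = solve-∀
          m : ∀ i s → + 6 * (i * (+ 1 - (s + + 2 * i))) + + 3 * ((+ 1 - (s + + 2 * i)) * (+ 1 - (s + + 2 * i)) - (+ 1 - (s + + 2 * i))) - + 2 * i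
            ≡ + 6 * (i * s) + + 3 * (s * s - s) - + 2 * i
          m = solve-∀
        weight : ∀ z → wY a (+ 1 - a) z + w′ z ≡ wΔ a z
        weight (i , s) = trans (+congˡ (wY a (+ 1 - a) (i , s)) (cong₂ _*_ (cong₂ _*_ c
            (trans (sgn-reflect (s + + 2 * i)) (cong -_ (sgn-even (s + + 2 * i) s i refl))))
            (cong (λ p → pos i + p - + 1) (pos-1- (s + + 2 * i)))))
          (m (pair a (+ 1 - a) (i , s)) (sgn s) (pos i) (pos s) (pos (s + + 2 * i)))
          where
          m : ∀ c g i s t → c * g * (i + s - + 1) + c * - g * (i + (+ 1 - t) - + 1) ≡ c * g * (s + t - + 1)
          m = solve-∀
          c : cls 5 a i * cls 5 (- a) (+ 1 - (s + + 2 * i)) ≡ cls 5 a i * cls 5 (+ 1 - a) s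
          c = cls₂ 5
            (λ p q → p , ≡-lin₂ (- + 2) (- + 1) (+ 0) p q (l₁ i s a))
            (λ p q → p , ≡-lin₂ (- + 2) (- + 1) (+ 0) p q (l₂ i s a))
            where
            l₁ : ∀ i s a → - + 2 * (i - a) + - + 1 * (+ 1 - (s + + 2 * i) - - a) + + 0 * + 5 ≡ s - (+ 1 - a)
            l₁ = solve-∀
            l₂ : ∀ i s a → - + 2 * (i - a) + - + 1 * (s - (+ 1 - a)) + + 0 * + 5 ≡ + 1 - (s + + 2 * i) - - a
            l₂ = solve-∀

    -- Both families of κ and the sum on the left split by parity into two pieces each; the six pieces cancel in pairs.
    Y-κ : ∀ a → Y a (+ 1 - a) ⊕ Y a (- a) ⊕ (Kr a (+ 2 * a + + 3) ⊕ Kr (+ 1 + + 2 * a) (a + + 1)) ≗ 𝟘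
    Y-κ a = double-zero (sumS-unique total′ (sumM-cong {w = λ x → - W (τ x)} {W} {E ∘ τ} {E} (λ x → trans (cong -_ (weight x)) (ℤP.neg-involutive (W x))) expo
        (sumM-neg {w = W ∘ τ} {E ∘ τ} (sumS-bij (bij τ τ ττ ττ) total′))))
      where
      open _≃_
      -- These residues solve the substitutions modulo 5, where halving is multiplication by 3. For
      -- instance t - s ≡ a and 2s ≡ 1 - a give s ≡ 2a + 3, hence 1 - t ≡ 2a + 3.
      b₁ a₂ b₂ : ℤ
      b₁ = + 2 * a + + 3
      a₂ = + 1 + + 2 * a
      b₂ = a + + 1
      W E : T → ℤ
      W (inj₁ x)        = wΔ a (to splitΔ x)
      W (inj₂ (inj₁ x)) = wK a b₁ (to split₁ x)
      W (inj₂ (inj₂ x)) = wK a₂ b₂ (to split₂ x)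
      E (inj₁ x)        = EY (to splitΔ x)
      E (inj₂ (inj₁ x)) = EK (to split₁ x)
      E (inj₂ (inj₂ x)) = EK (to split₂ x)
      total′ : SumM W E (Y a (+ 1 - a) ⊕ Y a (- a) ⊕ (Kr a b₁ ⊕ Kr a₂ b₂))
      total′ = sumS-cong {F = [ (λ x → term (W (inj₁ x)) (E (inj₁ x))) , [ (λ x → term (W (inj₂ (inj₁ x))) (E (inj₂ (inj₁ x)))) , (λ x → term (W (inj₂ (inj₂ x))) (E (inj₂ (inj₂ x)))) ]′ ]′}
        (λ { (inj₁ x) → Ex.≈-refl ; (inj₂ (inj₁ x)) → Ex.≈-refl ; (inj₂ (inj₂ x)) → Ex.≈-refl }) Ex.≈-refl
        (sumS-⊎ (sumS-bij splitΔ (sumΔ a)) (sumS-⊎ (sumS-bij split₁ (sumK a b₁)) (sumS-bij split₂ (sumK a₂ b₂))))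
      EY-double : ∀ i s → + 2 * EY (i , s) ≡ + 6 * (i * s) + + 3 * (s * s - s) - + 2 * i
      EY-double i s = trans (l (+ tri s) i s) (cong (λ x → + 6 * (i * s) + + 3 * x - + 2 * i) (tri-double s))
        where
        l : ∀ t i s → + 2 * (+ 3 * (i * s) + + 3 * t - i) ≡ + 6 * (i * s) + + 3 * (+ 2 * t) - + 2 * i
        l = solve-∀
      expoA : ∀ s t → EY (t - s , + 2 * s) ≡ EK (+ 1 - + 2 * s , + 1 - t)
      expoA s t = double-inj (trans (EY-double (t - s) (+ 2 * s)) (l s t))
        where
        l : ∀ s t → + 6 * ((t - s) * (+ 2 * s)) + + 3 * (+ 2 * s * (+ 2 * s) - + 2 * s) - + 2 * (t - s)
          ≡ + 2 * (+ 3 * ((+ 1 - + 2 * s) * (+ 1 - t)) - + 2 * (+ 1 - + 2 * s) - + 2 * (+ 1 - t) + + 1)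
        l = solve-∀
      expoB : ∀ s t → EY (t - s , + 2 * s + + 1) ≡ EK (s + + 1 , + 2 * t + + 1)
      expoB s t = double-inj (trans (EY-double (t - s) (+ 2 * s + + 1)) (l s t))
        where
        l : ∀ s t → + 6 * ((t - s) * (+ 2 * s + + 1)) + + 3 * ((+ 2 * s + + 1) * (+ 2 * s + + 1) - (+ 2 * s + + 1)) - + 2 * (t - s)
          ≡ + 2 * (+ 3 * ((s + + 1) * (+ 2 * t + + 1)) - + 2 * (s + + 1) - + 2 * (+ 2 * t + + 1) + + 1)
        l = solve-∀
      expoC : ∀ x y → EK (+ 2 * (+ 1 - x) , + 1 - y) ≡ EK (x , + 2 * y)
      expoC x y = l x y
        where
        l : ∀ x y → + 3 * (+ 2 * (+ 1 - x) * (+ 1 - y)) - + 2 * (+ 2 * (+ 1 - x)) - + 2 * (+ 1 - y) + + 1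
          ≡ + 3 * (x * (+ 2 * y)) - + 2 * x - + 2 * (+ 2 * y) + + 1
        l = solve-∀
      expo : ∀ x → E (τ x) ≡ E x
      expo (inj₁ (inj₁ (s , t)))        = sym (expoA s t)
      expo (inj₁ (inj₂ (s , t)))        = sym (expoB s t)
      expo (inj₂ (inj₁ (inj₁ (s , t)))) = expoA s t
      expo (inj₂ (inj₁ (inj₂ (x , y)))) = sym (expoC x y)
      expo (inj₂ (inj₂ (inj₁ (s , t)))) = expoB s t
      expo (inj₂ (inj₂ (inj₂ (x , y)))) = expoC x y
      weightA : ∀ s t → wK a b₁ (+ 1 - + 2 * s , + 1 - t) ≡ - wΔ a (t - s , + 2 * s)
      weightA s t = trans (cong₂ _*_ (sym c) (cong₂ (λ x y → x + y - + 1) (trans (pos-1- (+ 2 * s)) (cong (λ z → + 1 - z) (pos-even s))) (pos-1- t)))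
        (trans (m X (pos s) (pos t)) (cong -_ (sym (cong₂ _*_ (cong (X *_) (sgn-even (+ 2 * s) (+ 0) s (sym (ℤP.+-identityˡ _))))
          (cong₂ (λ x y → x + y - + 1) (pos-even s) (trans (cong pos (l s t)) (pos-even t)))))))
        where
        X : ℤ
        X = cls 5 a (t - s) * cls 5 (+ 1 - a) (+ 2 * s)
        m : ∀ X s t → X * (+ 1 - s + (+ 1 - t) - + 1) ≡ - (X * + 1 * (s + t - + 1))
        m = solve-∀
        l : ∀ s t → + 2 * s + + 2 * (t - s) ≡ + 2 * t
        l = solve-∀
        c : X ≡ cls 5 a (+ 1 - + 2 * s) * cls 5 b₁ (+ 1 - t)
        c = cls₂ 5
          (λ p q → ≡-lin₂ (+ 0) (- + 1) (+ 0) p q (l₁ a s t) , ≡-lin₂ (- + 1) (+ 2) (- s - a) p q (l₂ a s t))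
          (λ p q → ≡-lin₂ (- + 2) (- + 1) (- s - a) p q (l₃ a s t) , ≡-lin₂ (- + 1) (+ 0) (+ 0) p q (l₄ a s t))
          where
          l₁ : ∀ a s t → + 0 * (t - s - a) + - + 1 * (+ 2 * s - (+ 1 - a)) + + 0 * + 5 ≡ + 1 - + 2 * s - a
          l₁ = solve-∀
          l₂ : ∀ a s t → - + 1 * (t - s - a) + + 2 * (+ 2 * s - (+ 1 - a)) + (- s - a) * + 5 ≡ + 1 - t - (+ 2 * a + + 3)
          l₂ = solve-∀
          l₃ : ∀ a s t → - + 2 * (+ 1 - + 2 * s - a) + - + 1 * (+ 1 - t - (+ 2 * a + + 3)) + (- s - a) * + 5 ≡ t - s - a
          l₃ = solve-∀
          l₄ : ∀ a s t → - + 1 * (+ 1 - + 2 * s - a) + + 0 * (+ 1 - t - (+ 2 * a + + 3)) + + 0 * + 5 ≡ + 2 * s - (+ 1 - a)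
          l₄ = solve-∀
      weightB : ∀ s t → wK a₂ b₂ (s + + 1 , + 2 * t + + 1) ≡ - wΔ a (t - s , + 2 * s + + 1)
      weightB s t = trans (cong₂ _*_ (sym c) (cong₂ (λ x y → x + y - + 1) (cong pos (ℤP.+-comm s (+ 1))) (pos-odd t)))
        (trans (m X (pos (+ 1 + s)) (pos (+ 1 + t))) (cong -_ (sym (cong₂ _*_ (cong (X *_) (sgn-odd (+ 2 * s + + 1) (+ 0) s (l′ s)))
          (cong₂ (λ x y → x + y - + 1) (pos-odd s) (trans (cong pos (l s t)) (pos-odd t)))))))
        where
        X : ℤ
        X = cls 5 a (t - s) * cls 5 (+ 1 - a) (+ 2 * s + + 1)
        m : ∀ X s t → X * (s + t - + 1) ≡ - (X * - + 1 * (s + t - + 1))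
        m = solve-∀
        l : ∀ s t → + 2 * s + + 1 + + 2 * (t - s) ≡ + 2 * t + + 1
        l = solve-∀
        l′ : ∀ y → + 2 * y + + 1 ≡ + 1 + (+ 0 + + 2 * y)
        l′ = solve-∀
        c : X ≡ cls 5 a₂ (s + + 1) * cls 5 b₂ (+ 2 * t + + 1)
        c = cls₂ 5
          (λ p q → ≡-lin₂ (+ 0) (+ 3) (- s - a) p q (l₁ a s t) , ≡-lin₂ (+ 2) (+ 1) (+ 0) p q (l₂ a s t))
          (λ p q → ≡-lin₂ (- + 1) (+ 3) (- t) p q (l₃ a s t) , ≡-lin₂ (+ 2) (+ 0) a p q (l₄ a s t))
          where
          l₁ : ∀ a s t → + 0 * (t - s - a) + + 3 * (+ 2 * s + + 1 - (+ 1 - a)) + (- s - a) * + 5 ≡ s + + 1 - (+ 1 + + 2 * a)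
          l₁ = solve-∀
          l₂ : ∀ a s t → + 2 * (t - s - a) + + 1 * (+ 2 * s + + 1 - (+ 1 - a)) + + 0 * + 5 ≡ + 2 * t + + 1 - (a + + 1)
          l₂ = solve-∀
          l₃ : ∀ a s t → - + 1 * (s + + 1 - (+ 1 + + 2 * a)) + + 3 * (+ 2 * t + + 1 - (a + + 1)) + (- t) * + 5 ≡ t - s - a
          l₃ = solve-∀
          l₄ : ∀ a s t → + 2 * (s + + 1 - (+ 1 + + 2 * a)) + + 0 * (+ 2 * t + + 1 - (a + + 1)) + a * + 5 ≡ + 2 * s + + 1 - (+ 1 - a)
          l₄ = solve-∀
      weightC : ∀ x y → wK a₂ b₂ (x , + 2 * y) ≡ - wK a b₁ (+ 2 * (+ 1 - x) , + 1 - y)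
      weightC x y = trans (cong₂ _*_ (sym c) (cong (λ z → pos x + z - + 1) (pos-even y)))
        (trans (m X (pos x) (pos y)) (cong -_ (sym (cong (X *_)
          (cong₂ (λ x y → x + y - + 1) (trans (pos-even (+ 1 - x)) (pos-1- x)) (pos-1- y))))))
        where
        X : ℤ
        X = cls 5 a (+ 2 * (+ 1 - x)) * cls 5 b₁ (+ 1 - y)
        m : ∀ X s t → X * (s + t - + 1) ≡ - (X * (+ 1 - s + (+ 1 - t) - + 1))
        m = solve-∀
        c : X ≡ cls 5 a₂ x * cls 5 b₂ (+ 2 * y)
        c = cls₂ 5
          (λ p q → ≡-lin₂ (+ 2) (+ 0) (x - + 1) p q (l₁ a x y) , ≡-lin₂ (+ 0) (- + 2) (- a - + 1) p q (l₂ a x y))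
          (λ p q → ≡-lin₂ (- + 2) (+ 0) (- a) p q (l₃ a x y) , ≡-lin₂ (+ 0) (+ 2) (- y) p q (l₄ a x y))
          where
          l₁ : ∀ a x y → + 2 * (+ 2 * (+ 1 - x) - a) + + 0 * (+ 1 - y - (+ 2 * a + + 3)) + (x - + 1) * + 5 ≡ x - (+ 1 + + 2 * a)
          l₁ = solve-∀
          l₂ : ∀ a x y → + 0 * (+ 2 * (+ 1 - x) - a) + - + 2 * (+ 1 - y - (+ 2 * a + + 3)) + (- a - + 1) * + 5 ≡ + 2 * y - (a + + 1)
          l₂ = solve-∀
          l₃ : ∀ a x y → - + 2 * (x - (+ 1 + + 2 * a)) + + 0 * (+ 2 * y - (a + + 1)) + - a * + 5 ≡ + 2 * (+ 1 - x) - a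
          l₃ = solve-∀
          l₄ : ∀ a x y → + 0 * (x - (+ 1 + + 2 * a)) + + 2 * (+ 2 * y - (a + + 1)) + - y * + 5 ≡ + 1 - y - (+ 2 * a + + 3)
          l₄ = solve-∀
      weight : ∀ x → W (τ x) ≡ - W x
      weight (inj₁ (inj₁ (s , t)))        = weightA s t
      weight (inj₁ (inj₂ (s , t)))        = weightB s t
      weight (inj₂ (inj₁ (inj₁ (s , t)))) = trans (sym (ℤP.neg-involutive _)) (cong -_ (sym (weightA s t)))
      weight (inj₂ (inj₁ (inj₂ (x , y)))) = weightC x y
      weight (inj₂ (inj₂ (inj₁ (s , t)))) = trans (sym (ℤP.neg-involutive _)) (cong -_ (sym (weightB s t)))
      weight (inj₂ (inj₂ (inj₂ (x , y)))) = trans (sym (ℤP.neg-involutive _)) (cong -_ (sym (weightC x y)))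

  -- Cancelling series whose lowest coefficient is a unit.

  module Cancel (ℓ : ℕ) where
    open Modulo ℓ

    infixr 5 _⊕₀_
    infix 6 _⊗₀_

    _⊗₀_ : ∀ p {a} → a ≈ 𝟘 → p ⊗ a ≈ 𝟘
    p ⊗₀ h = ≈-trans (⊗-cong ≈-refl h) (solve 1 (λ p → p :* κ (+ 0) := κ (+ 0)) ≈-refl p)

    _⊕₀_ : ∀ {a b} → a ≈ 𝟘 → b ≈ 𝟘 → a ⊕ b ≈ 𝟘
    h ⊕₀ k = ≈-trans (⊕-cong h k) (solve 0 (κ (+ 0) :+ κ (+ 0) := κ (+ 0)) ≈-refl)

    -- Once the lower coefficients of g vanish, coefficient m of the product is u 0 times g m.
    -- Asking for u 0 squared to be 1 covers both signs and is independent of the modulus.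
    unit-cancel : ∀ u {g} → u 0 * u 0 ≡ + 1 → u ⊗ g ≈ 𝟘 → g ≈ 𝟘
    unit-cancel u {g} u² h = mk λ m → rtrans (<-rec (λ m → Cong ℓ (g m) (+ 0)) step m) (Cong-≡ (sym (con0 m)))
      where
      top : ∀ m → (∀ {k} → k ℕ.< m → Cong ℓ (g k) (+ 0)) → Cong ℓ ((u ⊗ g) m) (u 0 * g m)
      top zero    ih = rrefl
      top (suc m) ih = rtrans (r+ (rrefl {u 0 * g (suc m)}) (rtrans (⊗-rel (Cong-rel ℓ) {u ∘ suc} {u ∘ suc} {g} {λ _ → + 0} m (λ _ _ → rrefl) (λ k l → ih (s≤s l)))
        (Cong-≡ (trans (⊗-comm (u ∘ suc) (λ _ → + 0) m) (⊗-zeroˡ (u ∘ suc) m))))) (Cong-≡ (ℤP.+-identityʳ _))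
      l : ∀ u g → u * (u * g) ≡ u * u * g
      l = solve-∀
      step : ∀ m → (∀ {k} → k ℕ.< m → Cong ℓ (g k) (+ 0)) → Cong ℓ (g m) (+ 0)
      step m ih = rtrans (Cong-≡ (sym (trans (l (u 0) (g m)) (trans (cong (_* g m) u²) (ℤP.*-identityˡ (g m))))))
        (rtrans (r* (rrefl {u 0}) (rtrans (rsym (top m ih)) (rtrans (at h m) (Cong-≡ (con0 m))))) (Cong-≡ (ℤP.*-zeroʳ (u 0))))

    qp-at : ∀ e f m → (qp e ⊗ f) (e ℕ.+ m) ≡ f m
    qp-at zero    f m = ⊗-identityˡ f m
    qp-at (suc e) f m = trans (qp-shift e f (e ℕ.+ m)) (qp-at e f m)

    -- Factoring out q^e leaves a series with constant term c, so the case of a unit constant term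
    -- applies.
    lead-cancel : ∀ e c f {g} → c * c ≡ + 1 → f ≐[ suc e ] term c (+ e) → f ⊗ g ≈ 𝟘 → g ≈ 𝟘
    lead-cancel e c f {g} c² h p = unit-cancel u {g} (trans (cong₂ _*_ u0 u0) c²)
        (mk λ m → rtrans (Cong-≡ (sym (qp-at e (u ⊗ g) m)))
          (rtrans (at (≈-trans (≈-trans (solve 3 (λ a b c → a :* (b :* c) := a :* b :* c) ≈-refl (qp e) u g) (⊗-cong (pw fu) ≈-refl)) p) (e ℕ.+ m))
            (Cong-≡ (trans (con0 (e ℕ.+ m)) (sym (con0 m))))))
      where
      u : Ser
      u m = f (e ℕ.+ m)
      qp-diag : ∀ e → qp e e ≡ + 1
      qp-diag zero    = refl
      qp-diag (suc e) = qp-diag e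
      u0 : u 0 ≡ c
      u0 = trans (cong f (ℕP.+-identityʳ e)) (trans (below h e ℕP.≤-refl) (trans (⊗-con c (qp e) e) (trans (cong (c *_) (qp-diag e)) (ℤP.*-identityʳ c))))
      low : ∀ m → m ℕ.< e → f m ≡ (qp e ⊗ u) m
      low m l = trans (below h m (ℕP.m≤n⇒m≤1+n l)) (trans (below (≐0-⊗ (con c) (qp-small ℕP.≤-refl)) m l)
        (sym (below (≐-trans (≗⇒≐ (Ex.solve 2 (λ a b → a Ex.:* b Ex.:= b Ex.:* a) Ex.≈-refl (qp e) u)) (≐0-⊗ u (qp-small ℕP.≤-refl))) m l)))
      fu : ∀ m → (qp e ⊗ u) m ≡ f m
      fu m with e ℕ.≤? m
      ... | yes l = subst (λ k → (qp e ⊗ u) k ≡ f k) (ℕP.m+[n∸m]≡n l) (qp-at e u (m ℕ.∸ e))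
      ... | no nl = sym (low m (ℕP.≰⇒> nl))

  leading : ∀ {I : Set} {{_ : DecEq I}} {w E : I → ℤ} {s} x₀ e → SumM w E s → E x₀ ≡ + e →
    (∀ x → x ≡ x₀ ⊎ w x ≡ + 0 ⊎ ∃ λ n → E x ≡ + n × e ℕ.< n) → s ≐[ suc e ] term (w x₀) (+ e)
  leading {w = w} {E} {s} x₀ e S p h = let (xs , cx , eq) = part S (suc e) in
    ≐-trans (≐-sym eq) (≐-trans (sumL-covers cx ([] ∷ [] , pt)) (≗⇒≐ (Ex.≈-trans
      (Ex.solve 1 (λ a → a Ex.:+ Ex.κ (+ 0) Ex.:= a) Ex.≈-refl (term (w x₀) (E x₀))) (term-≡ {w x₀} refl p))))
    where
    pt : ∀ x → _
    pt x with h x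
    ... | inj₁ q = inj₁ (here q)
    ... | inj₂ (inj₁ z) = inj₂ (≗⇒≐ (term-0 (E x) z))
    ... | inj₂ (inj₂ (n , q , l)) = inj₂ (subst (λ z → term (w x) z ≐[ suc e ] 𝟘) (sym q) (term-small (w x) n l))

  cls-not : ∀ ℓ {r i} → False (+ ℓ ∣? (i - r)) → cls ℓ r i ≡ + 0
  cls-not ℓ f = cls-no ℓ (toWitnessFalse f)

  cls-is : ∀ ℓ {r i} → True (+ ℓ ∣? (i - r)) → cls ℓ r i ≡ + 1
  cls-is ℓ f = cls-yes ℓ (toWitness f)

  -- Exact relations between the pieces modulo 5.

  module Five where
    open Families 5
    open Periodic 5
    open ThreeTerm 5
    open Ex using (≈-refl; ≈-sym; ≈-trans; ⊕-cong; ⊗-cong; ⊖-cong; solve; _:=_; _:+_; _:*_; _:-_; :-_; κ)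
    open Cancel 0

    -- The reflection ν ↦ 1 - ν exchanges the classes 0 and 1 and the classes 2 and 4, up to sign,
    -- and fixes the class 3, whose piece must vanish. Hence every `L` is 0, ± `α` or ± `β`.
    α β : Ser
    α = L (+ 0)
    β = L (+ 2)

    L1 : L (+ 1) ≗ ⊖ α
    L1 = L-reflect (+ 0)
    L4 : L (+ 4) ≗ ⊖ β
    L4 = ≈-trans (L-per { - + 1} {+ 4} (+ 1) refl) (L-reflect (+ 2))
    L3 : L (+ 3) ≗ 𝟘
    L3 = double-zero (≈-trans (≈-sym (L-per {+ 3} { - + 2} (- + 1) refl)) (L-reflect (+ 3)))
    L5 : L (+ 5) ≗ α
    L5 = L-per {+ 0} {+ 5} (+ 1) refl
    L6 : L (+ 6) ≗ ⊖ α
    L6 = ≈-trans (L-per {+ 1} {+ 6} (+ 1) refl) L1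
    L7 : L (+ 7) ≗ β
    L7 = L-per {+ 2} {+ 7} (+ 1) refl
    L8 : L (+ 8) ≗ 𝟘
    L8 = ≈-trans (L-per {+ 3} {+ 8} (+ 1) refl) L3
    L9 : L (+ 9) ≗ ⊖ β
    L9 = ≈-trans (L-per {+ 4} {+ 9} (+ 1) refl) L4
    L10 : L (+ 10) ≗ α
    L10 = L-per {+ 0} {+ 10} (+ 2) refl
    L11 : L (+ 11) ≗ ⊖ α
    L11 = ≈-trans (L-per {+ 1} {+ 11} (+ 2) refl) L1
    L₋₁ : L (- + 1) ≗ ⊖ β
    L₋₁ = L-reflect (+ 2)
    L₋₂ : L (- + 2) ≗ 𝟘
    L₋₂ = ≈-trans (L-per {+ 3} { - + 2} (- + 1) refl) L3

    Yp Ym : ℤ → Ser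
    Yp a = Y a (+ 1 - a)
    Ym a = Y a (- a)

    -- `J-H` with every ingredient replaced by a chosen representative and moved to one side, ready
    -- for linear combination. `H a b` is symmetric but the right-hand side of `J-H` is not, so an
    -- unordered pair of residues supplies two relations.
    three : ∀ a b {h l₁ l₂ l₃ k} → H a b ≗ h → L (b + + 2 * a) ≗ l₁ → L (a + + 2 * b) ≗ l₂ → L (b - a + + 2) ≗ l₃ → Kr a (b + + 1) ≗ k →
      J ⊗ h ⊕ ⊖ (l₁ ⊗ Yp a ⊕ (⊖ (l₂ ⊗ Ym b) ⊕ ⊖ (l₃ ⊗ k))) ≗ 𝟘
    three a b {h} {l₁} {l₂} {l₃} {k} p q r s t = ≈-trans
      (⊕-cong (≈-trans (⊗-cong ≈-refl (≈-sym p)) (≈-trans (J-H a b) (⊕-cong (⊗-cong q ≈-refl) (⊕-cong (⊖-cong (⊗-cong r ≈-refl)) (⊖-cong (⊗-cong s t)))))) ≈-refl)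
      (solve 1 (λ x → x :- x := κ (+ 0)) ≈-refl (l₁ ⊗ Yp a ⊕ (⊖ (l₂ ⊗ Ym b) ⊕ ⊖ (l₃ ⊗ k))))

    d : ∀ a {k k′} → Kr a (+ 2 * a + + 3) ≗ k → Kr (+ 1 + + 2 * a) (a + + 1) ≗ k′ → Yp a ⊕ Ym a ⊕ (k ⊕ k′) ≗ 𝟘
    d a p q = ≈-trans (⊕-cong ≈-refl (⊕-cong (≈-sym p) (≈-sym q))) (Y-κ a)

    h01 = three (+ 0) (+ 1) ≈-refl L1 ≈-refl L3 ≈-refl
    h10 = three (+ 1) (+ 0) (H-sym (+ 1) (+ 0)) ≈-refl L1 L1 ≈-refl
    h02 = three (+ 0) (+ 2) ≈-refl ≈-refl L4 L4 ≈-refl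
    h12 = three (+ 1) (+ 2) ≈-refl L4 L5 L3 ≈-refl
    h31 = three (+ 3) (+ 1) (H-sym (+ 3) (+ 1)) L7 L5 ≈-refl (K-sym (+ 3) (+ 2))
    h13 = three (+ 1) (+ 3) ≈-refl L5 L7 L4 ≈-refl
    h14 = three (+ 1) (+ 4) ≈-refl L6 L9 L5 (≈-trans (K-per (+ 0) (+ 1) refl refl) (K-sym (+ 1) (+ 0)))
    h41 = three (+ 4) (+ 1) (H-sym (+ 4) (+ 1)) L9 L6 L₋₁ (K-sym (+ 4) (+ 2))
    h34 = three (+ 3) (+ 4) ≈-refl L10 L11 L3 ≈-refl
    h40 = three (+ 4) (+ 0) (H-sym (+ 4) (+ 0)) L8 L4 L₋₂ ≈-refl
    h00 = three (+ 0) (+ 0) ≈-refl ≈-refl ≈-refl ≈-refl ≈-refl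
    h33 = three (+ 3) (+ 3) ≈-refl L9 L9 ≈-refl ≈-refl
    h03 = three (+ 0) (+ 3) ≈-refl L3 L6 L5 ≈-refl
    d0 = d (+ 0) ≈-refl ≈-refl
    d1 = d (+ 1) (≈-trans (K-per (+ 0) (+ 1) refl refl) (K-sym (+ 1) (+ 0))) (K-sym (+ 3) (+ 2))
    d3 = d (+ 3) (≈-trans (K-per {+ 3} {+ 3} {+ 4} {+ 9} (+ 0) (+ 1) refl refl) ≈-refl) (K-per {+ 2} {+ 7} {+ 4} {+ 4} (+ 1) (+ 0) refl refl)
    d4 = d (+ 4) (≈-trans (K-per (+ 0) (+ 2) refl refl) (K-sym (+ 4) (+ 1))) (≈-trans (K-per (+ 1) (+ 1) refl refl) (K-sym (+ 4) (+ 0)))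

    -- Evaluating `J` times `H 0 1` in both orders eliminates `H`; the relations `d0` and `d1` then
    -- eliminate the `Y` terms.
    κ-relation : α ⊗ Kr (+ 0) (+ 3) ⊕ β ⊗ (Kr (+ 2) (+ 3) ⊕ Kr (+ 0) (+ 1)) ≗ 𝟘
    κ-relation = ≈-trans (solve 13 (λ j h a b y0 m0 y1 m1 k02 k11 k03 k23 k01 →
        a :* k03 :+ b :* (k23 :+ k01) :=
          κ (+ 1) :* (j :* h :- (b :* y1 :+ ((:- ((:- a) :* m0)) :+ (:- ((:- a) :* k11)))))
          :+ (κ (- + 1) :* (j :* h :- ((:- a) :* y0 :+ ((:- (b :* m1)) :+ (:- (κ (+ 0) :* k02)))))
          :+ (a :* (y0 :+ m0 :+ (k03 :+ k11)) :+ b :* (y1 :+ m1 :+ (k01 :+ k23))))) ≈-refl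
        J (H (+ 0) (+ 1)) α β (Yp (+ 0)) (Ym (+ 0)) (Yp (+ 1)) (Ym (+ 1)) (Kr (+ 0) (+ 2)) (Kr (+ 1) (+ 1)) (Kr (+ 0) (+ 3)) (Kr (+ 2) (+ 3)) (Kr (+ 0) (+ 1)))
      (con (+ 1) ⊗₀ h10 ⊕₀ con (- + 1) ⊗₀ h01 ⊕₀ α ⊗₀ d0 ⊕₀ β ⊗₀ d1)

    -- In the class of 1 modulo 5 the exponent 0 occurs only at c = 1, since c = 0 is excluded; the
    -- constant term is therefore -1.
    J-cancel : ∀ {g} → J ⊗ g ≗ 𝟘 → g ≗ 𝟘
    J-cancel = lead-cancel 0 (- + 1) J refl (≐-trans (leading {w = wJ} {EJ} (+ 1) 0 sumJ refl pt) (≗⇒≐ (term-≡ {e = + 0} (cong (_* - + 1) (cls-is 5 _)) refl)))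
      where
      pt : ∀ c → c ≡ + 1 ⊎ wJ c ≡ + 0 ⊎ ∃ λ n → EJ c ≡ + n × 0 ℕ.< n
      pt (+ zero)        = inj₂ (inj₁ (cong (_* + 1) (cls-not 5 _)))
      pt (+ suc zero)    = inj₁ refl
      pt (+ suc (suc n)) = inj₂ (inj₂ (_ , sym (ℤP.pos-* 3 (triN (2 ℕ.+ n))) , s≤s z≤n))
      pt -[1+ n ]        = inj₂ (inj₂ (_ , sym (ℤP.pos-* 3 (triN (2 ℕ.+ n))) , s≤s z≤n))

    -- After multiplication by `J` the contributions of `Yp 0` and `Ym 2` cancel and β (α K03 - β
    -- (Yp 1 + Ym 1)) is left, with K03 = `Kr` at 0, 3; `d1` turns this into a multiple of
    -- `κ-relation`.
    R2 : α ⊗ H (+ 0) (+ 2) ⊕ β ⊗ (H (+ 1) (+ 2) ⊕ H (+ 0) (+ 1)) ≗ 𝟘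
    R2 = J-cancel (≈-trans (solve 15 (λ j h02 h12 h01 a b y0 m1 m2 y1 k03 k23 k01 k02 k13 →
        j :* (a :* h02 :+ b :* (h12 :+ h01)) :=
          a :* (j :* h02 :- (b :* y0 :+ ((:- ((:- b) :* m2)) :+ (:- ((:- b) :* k03)))))
          :+ (b :* (j :* h12 :- ((:- b) :* y1 :+ ((:- (a :* m2)) :+ (:- (κ (+ 0) :* k13)))))
          :+ (b :* (j :* h01 :- ((:- a) :* y0 :+ ((:- (b :* m1)) :+ (:- (κ (+ 0) :* k02)))))
          :+ (b :* (a :* k03 :+ b :* (k23 :+ k01)) :+ :- (b :* b) :* (y1 :+ m1 :+ (k01 :+ k23)))))) ≈-refl
        J (H (+ 0) (+ 2)) (H (+ 1) (+ 2)) (H (+ 0) (+ 1)) α β (Yp (+ 0)) (Ym (+ 1)) (Ym (+ 2)) (Yp (+ 1))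
        (Kr (+ 0) (+ 3)) (Kr (+ 2) (+ 3)) (Kr (+ 0) (+ 1)) (Kr (+ 0) (+ 2)) (Kr (+ 1) (+ 3)))
      (α ⊗₀ h02 ⊕₀ β ⊗₀ h12 ⊕₀ β ⊗₀ h01 ⊕₀ β ⊗₀ κ-relation ⊕₀ ⊖ (β ⊗ β) ⊗₀ d1))

    -- After multiplication by `J` everything cancels except -α² times the left-hand side of `d1`.
    R4 : α ⊗ (H (+ 1) (+ 3) ⊕ H (+ 1) (+ 4)) ⊕ ⊖ (β ⊗ H (+ 3) (+ 4)) ≗ 𝟘
    R4 = J-cancel (≈-trans (solve 13 (λ j h13 h14 h34 a b y1 m1 y3 m4 k23 k01 k30 →
        j :* (a :* (h13 :+ h14) :- b :* h34) :=
          a :* (j :* h13 :- (b :* y3 :+ ((:- (a :* m1)) :+ (:- (a :* k23)))))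
          :+ (a :* (j :* h14 :- ((:- a) :* y1 :+ ((:- ((:- b) :* m4)) :+ (:- (a :* k01)))))
          :+ ((:- b) :* (j :* h34 :- (a :* y3 :+ ((:- ((:- a) :* m4)) :+ (:- (κ (+ 0) :* k30)))))
          :+ :- (a :* a) :* (y1 :+ m1 :+ (k01 :+ k23))))) ≈-refl
        J (H (+ 1) (+ 3)) (H (+ 1) (+ 4)) (H (+ 3) (+ 4)) α β (Yp (+ 1)) (Ym (+ 1)) (Yp (+ 3)) (Ym (+ 4))
        (Kr (+ 2) (+ 3)) (Kr (+ 0) (+ 1)) (Kr (+ 3) (+ 5)))
      (α ⊗₀ h31 ⊕₀ α ⊗₀ h14 ⊕₀ ⊖ β ⊗₀ h34 ⊕₀ ⊖ (α ⊗ α) ⊗₀ d1))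

    -- The same comparison of both orders, now for `H 1 4`. Here only the `Y` terms of `Yp 4` and
    -- `Ym 4` are eliminated, by `d4`.
    κ-relation′ : α ⊗ (Yp (+ 1) ⊕ Ym (+ 1) ⊕ Kr (+ 0) (+ 1)) ⊕ β ⊗ (Kr (+ 2) (+ 4) ⊕ Kr (+ 1) (+ 4) ⊕ Kr (+ 0) (+ 4)) ≗ 𝟘
    κ-relation′ = ≈-trans (solve 12 (λ j h a b y1 m1 y4 m4 k01 k24 k14 k04 →
        a :* (y1 :+ m1 :+ k01) :+ b :* (k24 :+ k14 :+ k04) :=
          κ (+ 1) :* (j :* h :- ((:- a) :* y1 :+ ((:- ((:- b) :* m4)) :+ (:- (a :* k01)))))
          :+ (κ (- + 1) :* (j :* h :- ((:- b) :* y4 :+ ((:- ((:- a) :* m1)) :+ (:- ((:- b) :* k24)))))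
          :+ b :* (y4 :+ m4 :+ (k14 :+ k04)))) ≈-refl
        J (H (+ 1) (+ 4)) α β (Yp (+ 1)) (Ym (+ 1)) (Yp (+ 4)) (Ym (+ 4)) (Kr (+ 0) (+ 1)) (Kr (+ 2) (+ 4)) (Kr (+ 1) (+ 4)) (Kr (+ 0) (+ 4)))
      (con (+ 1) ⊗₀ h14 ⊕₀ con (- + 1) ⊗₀ h41 ⊕₀ β ⊗₀ d4)

    -- Times `J`, the first bracket becomes -β² (Ym 1 + K01) and the second -α² (Ym 1 + K01), where
    -- K01 = `Kr` at 0, 1; the second evaluation uses `d3` and `κ-relation′`. The multipliers α² and
    -- β² make the two agree.
    R5 : α ⊗ α ⊗ (α ⊗ H (+ 0) (+ 4) ⊕ β ⊗ (H (+ 0) (+ 1) ⊕ H (+ 0) (+ 0)))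
         ⊕ ⊖ (β ⊗ β ⊗ (α ⊗ (H (+ 1) (+ 3) ⊕ H (+ 3) (+ 3)) ⊕ ⊖ (β ⊗ H (+ 0) (+ 3)))) ≗ 𝟘
    R5 = J-cancel (≈-trans (solve 23 (λ j h04 h01 h00 h13 h33 h03 a b y0 m0 m1 y1 y3 m3 y4 k01 k02 k14 k34 k04 k24 k41 →
        j :* (a :* a :* (a :* h04 :+ b :* (h01 :+ h00)) :- b :* b :* (a :* (h13 :+ h33) :- b :* h03)) :=
          a :* a :* a :* (j :* h04 :- (κ (+ 0) :* y4 :+ ((:- ((:- b) :* m0)) :+ (:- (κ (+ 0) :* k41)))))
          :+ (a :* a :* b :* (j :* h01 :- ((:- a) :* y0 :+ ((:- (b :* m1)) :+ (:- (κ (+ 0) :* k02)))))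
          :+ (a :* a :* b :* (j :* h00 :- (a :* y0 :+ ((:- (a :* m0)) :+ (:- (b :* k01)))))
          :+ ((:- (b :* b :* a)) :* (j :* h13 :- (a :* y1 :+ ((:- (b :* m3)) :+ (:- ((:- b) :* k14)))))
          :+ ((:- (b :* b :* a)) :* (j :* h33 :- ((:- b) :* y3 :+ ((:- ((:- b) :* m3)) :+ (:- (b :* k34)))))
          :+ (b :* b :* b :* (j :* h03 :- (κ (+ 0) :* y0 :+ ((:- ((:- a) :* m3)) :+ (:- (a :* k04)))))
          :+ ((:- (a :* b :* b)) :* (a :* (y1 :+ m1 :+ k01) :+ b :* (k24 :+ k14 :+ k04))
          :+ a :* b :* b :* b :* (y3 :+ m3 :+ (k34 :+ k24))))))))) ≈-refl
        J (H (+ 0) (+ 4)) (H (+ 0) (+ 1)) (H (+ 0) (+ 0)) (H (+ 1) (+ 3)) (H (+ 3) (+ 3)) (H (+ 0) (+ 3)) α β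
        (Yp (+ 0)) (Ym (+ 0)) (Ym (+ 1)) (Yp (+ 1)) (Yp (+ 3)) (Ym (+ 3)) (Yp (+ 4))
        (Kr (+ 0) (+ 1)) (Kr (+ 0) (+ 2)) (Kr (+ 1) (+ 4)) (Kr (+ 3) (+ 4)) (Kr (+ 0) (+ 4)) (Kr (+ 2) (+ 4)) (Kr (+ 4) (+ 1)))
      (α ⊗ α ⊗ α ⊗₀ h40 ⊕₀ α ⊗ α ⊗ β ⊗₀ h01 ⊕₀ α ⊗ α ⊗ β ⊗₀ h00 ⊕₀ ⊖ (β ⊗ β ⊗ α) ⊗₀ h13 ⊕₀ ⊖ (β ⊗ β ⊗ α) ⊗₀ h33 ⊕₀ β ⊗ β ⊗ β ⊗₀ h03
        ⊕₀ ⊖ (α ⊗ β ⊗ β) ⊗₀ κ-relation′ ⊕₀ α ⊗ β ⊗ β ⊗ β ⊗₀ d3))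

  -- From the generating functions to theta series and Hecke sums.

  module Bailey where
    open Ex using (≈-refl; ≈-sym; ≈-trans; ⊕-cong; ⊗-cong; ⊖-cong; solve; _:=_; _:+_; _:*_; _:-_; :-_; κ)
    open Cancel 0

    ≡⇒≗ : ∀ {f g : Ser} → f ≡ g → f ≗ g
    ≡⇒≗ refl = ≈-refl

    sumS-head : ∀ {F : ℕ → Ser} {s} → SumS (F ∘ suc) s → SumS F (F 0 ⊕ s)
    sumS-head {F} S = mkS λ N → let (xs , (u , c) , e) = part S N in
      0 ∷ map suc xs
      , (All.tabulate (λ p q → zero∉ xs (subst (_ ∈_) refl p) q) ∷ UniqueP.map⁺ ℕP.suc-injective u
        , λ { zero → inj₁ (here refl) ; (suc n) → [ inj₁ ∘ there ∘ ∈P.∈-map⁺ suc , inj₂ ]′ (c n) })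
      , ≐-⊕ ≐-refl (subst (_≐[ N ] _) (sym (sumL-map F suc xs)) e)
      where
      zero∉ : ∀ xs {y} → y ∈ map suc xs → 0 ≡ y → ⊥
      zero∉ xs p refl with ∈P.∈-map⁻ suc p
      ... | _ , _ , ()

    sumS-shift : ∀ k {F : ℕ → Ser} {s} → (∀ n → n ℕ.< k → F n ≗ 𝟘) → SumS (λ m → F (m ℕ.+ k)) s → SumS F s
    sumS-shift zero    {F} z S = sumS-cong (λ m → ≡⇒≗ (cong F (ℕP.+-identityʳ m))) ≈-refl S
    sumS-shift (suc k) {F} {s} z S = sumS-cong (λ _ → ≈-refl)
      (≈-trans (⊕-cong (z 0 (s≤s z≤n)) ≈-refl) (solve 1 (λ s → κ (+ 0) :+ s := s) ≈-refl s))
      (sumS-head (sumS-shift k (λ n l → z (suc n) (s≤s l)) (sumS-cong (λ m → ≡⇒≗ (cong F (ℕP.+-suc m k))) ≈-refl S)))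

    sumS-partial : ∀ {F : ℕ → Ser} {s} → (∀ m → F m ≐[ m ] 𝟘) → (∀ N → sumL F (downFrom N) ≐[ N ] s) → SumS F s
    sumS-partial z p = mkS λ N → downFrom N , (UniqueP.downFrom⁺ N , λ m → pt N m (m ℕ.<? N)) , p N
      where
      pt : ∀ N m → Dec (m ℕ.< N) → _
      pt N m (yes l) = inj₁ (∈P.∈-downFrom⁺ l)
      pt N m (no nl) = inj₂ (≐-mono (ℕP.≮⇒≥ nl) (z m))

    telescope : ∀ {t : ℕ → Ser} {s} → (∀ m → t m ≐[ m ] s) → ∀ {F : ℕ → Ser} → F 0 ≗ t 0 → (∀ m → F (suc m) ≗ t (suc m) ⊕ ⊖ t m) →
      (∀ m → F m ≐[ m ] 𝟘) → SumS F s
    telescope {t} {s} h {F} p r z = sumS-partial z λ { zero → mk≐ λ _ () ; (suc N) → go N }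
      where
      sum-t : ∀ N → sumL F (downFrom (suc N)) ≗ t N
      sum-t zero    = ≈-trans (solve 1 (λ a → a :+ κ (+ 0) := a) ≈-refl (F 0)) p
      sum-t (suc N) = ≈-trans (⊕-cong (r N) (sum-t N)) (solve 2 (λ a b → a :- b :+ b := a) ≈-refl (t (suc N)) (t N))
      go : ∀ N → sumL F (downFrom (suc N)) ≐[ suc N ] s
      go N = ≐-trans (≗⇒≐ (≈-trans (sum-t N) (≈-trans (solve 2 (λ a b → a := b :- (b :- a)) ≈-refl (t N) (t (suc N))) (⊕-cong ≈-refl (⊖-cong (≈-sym (r N)))))))
        (≐-trans (≐-⊕ (h (suc N)) (≐-⊖ (z (suc N)))) (≗⇒≐ (solve 1 (λ a → a :- κ (+ 0) := a) ≈-refl s)))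

    -- Finite and infinite q-factorials and their inverses.

    1-q : ℕ → Ser
    1-q k = 𝟙 ⊕ ⊖ qp k

    -- 1 / (1 - q^k), for k ≥ 1
    geo : ℕ → Ser
    geo k m = + geom k m
      where open import Defs using (geom)

    1-q-geo : ∀ k → 1-q (suc k) ⊗ geo (suc k) ≗ 𝟙
    1-q-geo k = ≈-trans (solve 2 (λ a g → (κ (+ 1) :- a) :* g := g :- a :* g) ≈-refl (qp (suc k)) (geo (suc k))) (≗-pw pt)
      where
      open import Data.Nat.Divisibility using (∣m∣n⇒∣m+n; ∣m+n∣m⇒∣n; ∣-refl; m%n≡0⇒n∣m; ∣⇒≤) renaming (_∣?_ to _∣ℕ?_)
      open import Defs using (geom)
      per : ∀ m → geom (suc k) (suc k ℕ.+ m) ≡ geom (suc k) m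
      per m with suc k ∣ℕ? suc k ℕ.+ m | suc k ∣ℕ? m
      ... | yes _ | yes _ = refl
      ... | no  _ | no  _ = refl
      ... | yes p | no  n = ⊥-elim (n (∣m+n∣m⇒∣n p ∣-refl))
      ... | no  n | yes p = ⊥-elim (n (∣m∣n⇒∣m+n ∣-refl p))
      low : ∀ m → m ℕ.< suc k → + geom (suc k) m ≡ 𝟙 m
      low zero l with suc k ∣ℕ? 0
      ... | yes _ = refl
      ... | no  n = ⊥-elim (n (m%n≡0⇒n∣m 0 (suc k) refl))
      low (suc m) l with suc k ∣ℕ? suc m
      ... | yes p = ⊥-elim (ℕP.<⇒≱ l (∣⇒≤ p))
      ... | no  _ = refl
      pt : ∀ m → (geo (suc k) ⊕ ⊖ (qp (suc k) ⊗ geo (suc k))) m ≡ 𝟙 m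
      pt m = trans (⊕-at (geo (suc k)) (⊖ (qp (suc k) ⊗ geo (suc k))) m) (trans (+congˡ (geo (suc k) m) (⊖-at (qp (suc k) ⊗ geo (suc k)) m)) (go (m ℕ.<? suc k)))
        where
        go : Dec (m ℕ.< suc k) → geo (suc k) m + - (qp (suc k) ⊗ geo (suc k)) m ≡ 𝟙 m
        go (yes l) = trans (cong₂ (λ x y → x + - y) (low m l) (trans (ex (≈-sym (solve 2 (λ a b → a :* b := b :* a) ≈-refl (geo (suc k)) (qp (suc k)))) m)
          (trans (below (≐0-⊗ (geo (suc k)) (qp-small ℕP.≤-refl)) m l) (con0 m)))) (ℤP.+-identityʳ (𝟙 m))
        go (no nl) = subst (λ m → geo (suc k) m + - (qp (suc k) ⊗ geo (suc k)) m ≡ 𝟙 m) (ℕP.m+[n∸m]≡n (ℕP.≮⇒≥ nl))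
          (trans (cong₂ (λ x y → x + - y) (cong ℤ.+_ (per (m ℕ.∸ suc k))) (qp-at (suc k) (geo (suc k)) (m ℕ.∸ suc k))) (ℤP.+-inverseʳ (geo (suc k) (m ℕ.∸ suc k))))

    -- 1 / (q^a; q)_n
    Inv : ℕ → ℕ → Ser
    Inv a zero    = 𝟙
    Inv a (suc n) = Inv a n ⊗ geo (a ℕ.+ n)

    I P : ℕ → Ser
    I = Inv 1
    P zero    = 𝟙
    P (suc n) = P n ⊗ 1-q (suc n)

    I-suc : ∀ n → 1-q (suc n) ⊗ I (suc n) ≗ I n
    I-suc n = ≈-trans (solve 3 (λ a b c → a :* (b :* c) := b :* (a :* c)) ≈-refl (1-q (suc n)) (I n) (geo (suc n)))
      (≈-trans (⊗-cong ≈-refl (1-q-geo n)) (solve 1 (λ a → a :* κ (+ 1) := a) ≈-refl (I n)))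

    P-I : ∀ n → P n ⊗ I n ≗ 𝟙
    P-I zero    = solve 0 (κ (+ 1) :* κ (+ 1) := κ (+ 1)) ≈-refl
    P-I (suc n) = ≈-trans (solve 3 (λ a b c → a :* b :* c := a :* (b :* c)) ≈-refl (P n) (1-q (suc n)) (I (suc n)))
      (≈-trans (⊗-cong ≈-refl (I-suc n)) (P-I n))

    1-q-small : ∀ k → 1-q k ≐[ k ] 𝟙
    1-q-small k = ≐-trans (≐-⊕ ≐-refl (≐-⊖ (qp-small ℕP.≤-refl))) (≗⇒≐ (solve 0 (κ (+ 1) :- κ (+ 0) := κ (+ 1)) ≈-refl))

    -- (q;q)_∞ and its inverse, read off diagonally from the stabilising finite products
    E E⁻¹ : Ser
    E m = P m m
    E⁻¹ m = I m m

    private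
      stable : ∀ (A : ℕ → Ser) → (∀ n → A (suc n) ≐[ suc n ] A n) → ∀ n → A n ≐[ suc n ] (λ m → A m m)
      stable A h n = mk≐ λ m l → go m (ℕP.≤-pred l)
        where
        ext : ∀ m k → A (m ℕ.+ k) ≐[ suc m ] A m
        ext m zero    = subst (λ n → A n ≐[ suc m ] A m) (sym (ℕP.+-identityʳ m)) ≐-refl
        ext m (suc k) = ≐-trans (subst (λ n → A n ≐[ suc m ] A (m ℕ.+ k)) (sym (ℕP.+-suc m k)) (≐-mono (s≤s (ℕP.m≤m+n m k)) (h (m ℕ.+ k)))) (ext m k)
        go : ∀ m → m ℕ.≤ n → A n m ≡ A m m
        go m le = trans (cong (λ k → A k m) (sym (ℕP.m+[n∸m]≡n le))) (below (ext m (n ℕ.∸ m)) m ℕP.≤-refl)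

    P-lim : ∀ n → P n ≐[ suc n ] E
    P-lim = stable P λ n → ≐-trans (≐-⊗ ≐-refl (1-q-small (suc n))) (≗⇒≐ (solve 1 (λ a → a :* κ (+ 1) := a) ≈-refl (P n)))

    I-lim : ∀ n → I n ≐[ suc n ] E⁻¹
    I-lim = stable I λ n → ≐-sym (≐-trans (≗⇒≐ (≈-sym (I-suc n))) (≐-trans (≐-⊗ (1-q-small (suc n)) ≐-refl) (≗⇒≐ (solve 1 (λ a → κ (+ 1) :* a := a) ≈-refl (I (suc n))))))

    E-E⁻¹ : E ⊗ E⁻¹ ≗ 𝟙
    E-E⁻¹ = ≐⇒≗ λ N → ≐-trans (≐-⊗ (≐-mono (ℕP.n≤1+n N) (≐-sym (P-lim N))) (≐-mono (ℕP.n≤1+n N) (≐-sym (I-lim N)))) (≗⇒≐ (P-I N))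

    -- Each use of the recursion gains at least one factor q, so every `d k` vanishes to all orders.
    -- No initial value is required.
    descent : ∀ (d : ℕ → Ser) → (∀ k → d k ≗ ⊖ (qp (suc k) ⊗ d (suc k))) → ∀ k → d k ≗ 𝟘
    descent d h k = ≐⇒≗ λ N → go N k
      where
      qp-raise : ∀ {N} k {f} → f ≐[ N ] 𝟘 → qp (suc k) ⊗ f ≐[ suc N ] 𝟘
      qp-raise {N} k {f} p = ≐-trans (≗⇒≐ (≈-trans (⊗-cong (≈-sym (qp-* 1 k)) ≈-refl) (solve 3 (λ a b c → a :* b :* c := a :* (b :* c)) ≈-refl (qp 1) (qp k) f)))
        (mk≐ λ { zero l → trans (ℤP.*-zeroˡ ((qp k ⊗ f) 0)) (sym (con0 0))
               ; (suc m) (s≤s l) → trans (qp-shift 0 (qp k ⊗ f) m) (trans (⊗-identityˡ (qp k ⊗ f) m) (trans (below (≐0-⊗ (qp k) p) m l) (con0 m))) })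
      go : ∀ N k → d k ≐[ N ] 𝟘
      go zero    k = mk≐ λ _ ()
      go (suc N) k = ≐-trans (≗⇒≐ (h k)) (≐-trans (≐-⊖ (qp-raise k (go N (suc k)))) (≗⇒≐ (solve 0 (:- κ (+ 0) := κ (+ 0)) ≈-refl)))

    qp-⊗ : ∀ {a b c} → a ℕ.+ b ≡ c → qp c ≗ qp a ⊗ qp b
    qp-⊗ {a} {b} refl = ≈-sym (qp-* a b)

    ≐0-⊗ˡ : ∀ {N f} g → f ≐[ N ] 𝟘 → f ⊗ g ≐[ N ] 𝟘
    ≐0-⊗ˡ {f = f} g p = ≐-trans (≗⇒≐ (solve 2 (λ a b → a :* b := b :* a) ≈-refl f g)) (≐0-⊗ g p)

    qp-summable : ∀ {e : ℕ → ℕ} (X : ℕ → Ser) → (∀ m → m ℕ.≤ e m) → Summable (λ m → qp (e m) ⊗ X m)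
    qp-summable X h = size-summable 0 λ N m l → ≐0-⊗ˡ (X m)
      (qp-small (ℕP.≤-trans (ℕP.≤-trans (ℕP.≤-reflexive (sym (ℕP.+-identityʳ N))) (ℕP.<⇒≤ l)) (h m)))

    I-+suc : ∀ m k → I (m ℕ.+ k) ≗ 1-q (suc (m ℕ.+ k)) ⊗ I (m ℕ.+ suc k)
    I-+suc m k = ≈-sym (≈-trans (⊗-cong ≈-refl (≡⇒≗ (cong I (ℕP.+-suc m k)))) (I-suc (m ℕ.+ k)))

    -- The inner sums of the Bailey transform.

    -- Σ q^{m² + km} / ((q)_m (q)_{m+k})
    module G where
      ex-g : ℕ → ℕ → ℕ
      ex-g k m = m ℕ.* m ℕ.+ k ℕ.* m

      F : ℕ → ℕ → Ser
      F k m = qp (ex-g k m) ⊗ (I m ⊗ I (m ℕ.+ k))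

      ex-≥ : ∀ k m → m ℕ.≤ ex-g k m
      ex-≥ k zero    = z≤n
      ex-≥ k (suc m) = ℕP.≤-trans (ℕP.m≤m+n (suc m) (m ℕ.* suc m)) (ℕP.m≤m+n _ _)

      abstract
        g : ℕ → Ser
        g k = total (qp-summable (λ m → I m ⊗ I (m ℕ.+ k)) (ex-≥ k))
        sum-g : ∀ k → SumS (F k) (g k)
        sum-g k = sumS-total (qp-summable (λ m → I m ⊗ I (m ℕ.+ k)) (ex-≥ k))

      private
        A : ℕ → ℕ → Ser
        A k zero    = 𝟘
        A k (suc m) = qp (suc k) ⊗ F (suc (suc k)) m

        pointwise : ∀ k m → F k m ⊕ ⊖ F (suc k) m ≗ A k m ⊕ ⊖ (qp (suc k) ⊗ F (suc k) m)
        pointwise k zero = ≈-trans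
          (⊕-cong (⊗-cong (≡⇒≗ (cong qp (ℕP.*-zeroʳ k))) (⊗-cong ≈-refl (≈-sym (I-suc k)))) (⊖-cong (⊗-cong (≡⇒≗ (cong qp (ℕP.*-zeroʳ k))) ≈-refl)))
          (≈-trans (solve 2 (λ q z → κ (+ 1) :* (κ (+ 1) :* ((κ (+ 1) :- q) :* z)) :- κ (+ 1) :* (κ (+ 1) :* z) := κ (+ 0) :- q :* (κ (+ 1) :* (κ (+ 1) :* z))) ≈-refl (qp (suc k)) (I (suc k)))
            (⊕-cong ≈-refl (⊖-cong (⊗-cong ≈-refl (⊗-cong (≡⇒≗ (cong qp (sym (ℕP.*-zeroʳ k)))) ≈-refl)))))
        pointwise k (suc m) = ≈-trans
          (⊕-cong (⊗-cong ≈-refl (⊗-cong ≈-refl (≈-trans (I-+suc (suc m) k) (⊗-cong (⊕-cong ≈-refl (⊖-cong (qp-⊗ {suc m} {suc k} (ℕP.+-suc (suc m) k)))) ≈-refl))))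
            (⊖-cong (⊗-cong (qp-⊗ {ex-g k (suc m)} {suc m} (l₁ k m)) ≈-refl)))
          (≈-trans (solve 5 (λ x y z i Z → x :* (i :* ((κ (+ 1) :- y :* z) :* Z)) :- x :* y :* (i :* Z)
                := x :* (((κ (+ 1) :- y) :* i) :* Z) :- z :* (x :* y :* (i :* Z))) ≈-refl (qp (ex-g k (suc m))) (qp (suc m)) (qp (suc k)) (I (suc m)) (I (suc m ℕ.+ suc k)))
            (⊕-cong (≈-trans (⊗-cong (qp-⊗ {suc k} {ex-g (suc (suc k)) m} (l₂ k m)) (⊗-cong (I-suc m) (≡⇒≗ (cong I (sym (ℕP.+-suc m (suc k)))))))
                (solve 3 (λ a b c → a :* b :* c := a :* (b :* c)) ≈-refl (qp (suc k)) (qp (ex-g (suc (suc k)) m)) (I m ⊗ I (m ℕ.+ suc (suc k)))))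
              (⊖-cong (⊗-cong ≈-refl (⊗-cong (≈-sym (qp-⊗ {ex-g k (suc m)} {suc m} (l₁ k m))) ≈-refl)))))
          where
          l₁ : ∀ k m → suc m ℕ.* suc m ℕ.+ k ℕ.* suc m ℕ.+ suc m ≡ suc m ℕ.* suc m ℕ.+ suc k ℕ.* suc m
          l₁ = solveℕ
          l₂ : ∀ k m → suc k ℕ.+ (m ℕ.* m ℕ.+ suc (suc k) ℕ.* m) ≡ suc m ℕ.* suc m ℕ.+ k ℕ.* suc m
          l₂ = solveℕ

        -- Termwise the difference at k splits so that g_k - g_{k+1} = q^{k+1} (g_{k+2} - g_{k+1}),
        -- which is the recursion of `descent` for consecutive differences.
        diff : ∀ k → g k ⊕ ⊖ g (suc k) ≗ 𝟘
        diff = descent (λ k → g k ⊕ ⊖ g (suc k)) λ k → ≈-trans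
          (sumS-unique (sumS-cong (pointwise k) ≈-refl (sumS-⊕ (sum-g k) (sumS-⊖ (sum-g (suc k)))))
            (sumS-⊕ (sumS-head {A k} (sumS-⊗ (qp (suc k)) (sum-g (suc (suc k))))) (sumS-⊖ (sumS-⊗ (qp (suc k)) (sum-g (suc k))))))
          (solve 3 (λ q a b → κ (+ 0) :+ q :* b :- q :* a := :- (q :* (a :- b))) ≈-refl (qp (suc k)) (g (suc k)) (g (suc (suc k))))

        g-step : ∀ k → g k ≗ g 0
        g-step zero    = ≈-refl
        g-step (suc k) = ≈-trans (≈-trans (solve 2 (λ a b → b := a :- (a :- b)) ≈-refl (g k) (g (suc k)))
          (≈-trans (⊕-cong (g-step k) (⊖-cong (diff k))) (solve 1 (λ a → a :- κ (+ 0) := a) ≈-refl (g 0)))) ≈-refl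

      -- The Durfee rectangle identity. The value does not depend on k, so it may be read off for
      -- large k, where only the summand m = 0 is visible.
      g≗ : ∀ k → g k ≗ E⁻¹
      g≗ k = ≈-trans (g-step k) (≐⇒≗ λ N → ≐-trans (≗⇒≐ (≈-sym (g-step N))) (big N))
        where
        big : ∀ N → g N ≐[ N ] E⁻¹
        big N = let (xs , cx , e) = part (sum-g N) N in
          ≐-trans (≐-sym e) (≐-trans (sumL-covers cx ([] ∷ [] , pt))
          (≐-trans (≗⇒≐ (≈-trans (⊕-cong (⊗-cong (≡⇒≗ (cong qp (ℕP.*-zeroʳ N))) ≈-refl) ≈-refl) (solve 1 (λ a → κ (+ 1) :* (κ (+ 1) :* a) :+ κ (+ 0) := a) ≈-refl (I N))))
            (≐-mono (ℕP.n≤1+n N) (I-lim N))))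
          where
          pt : ∀ m → m ∈ (0 ∷ []) ⊎ F N m ≐[ N ] 𝟘
          pt zero    = inj₁ (here refl)
          pt (suc m) = inj₂ (≐0-⊗ˡ _ (qp-small (ℕP.≤-trans (ℕP.m≤m*n N (suc m)) (ℕP.m≤n+m (N ℕ.* suc m) (suc m ℕ.* suc m)))))

    -- Σ q^m / ((q)_m (q)_{m+k})
    module Hk where
      F : ℕ → ℕ → Ser
      F k m = qp m ⊗ (I m ⊗ I (m ℕ.+ k))

      abstract
        h : ℕ → Ser
        h k = total (qp-summable (λ m → I m ⊗ I (m ℕ.+ k)) (λ _ → ℕP.≤-refl))
        sum-h : ∀ k → SumS (F k) (h k)
        sum-h k = sumS-total (qp-summable (λ m → I m ⊗ I (m ℕ.+ k)) (λ _ → ℕP.≤-refl))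

      -- The combined summand is the increment of 1 / ((q)_m (q)_{m+k+1}), which tends to 1 / E².
      h-rec : ∀ k → h k ⊕ qp (suc k) ⊗ h (suc k) ≗ E⁻¹ ⊗ E⁻¹
      h-rec k = sumS-unique (sumS-⊕ (sum-h k) (sumS-⊗ (qp (suc k)) (sum-h (suc k))))
        (telescope {λ m → I m ⊗ I (m ℕ.+ suc k)}
          (λ m → ≐-⊗ (≐-mono (ℕP.n≤1+n m) (I-lim m)) (≐-mono (ℕP.≤-trans (ℕP.m≤m+n m (suc k)) (ℕP.n≤1+n _)) (I-lim (m ℕ.+ suc k))))
          (≈-trans (⊕-cong (⊗-cong ≈-refl (⊗-cong ≈-refl (≈-sym (I-suc k)))) ≈-refl)
            (solve 2 (λ q z → κ (+ 1) :* (κ (+ 1) :* ((κ (+ 1) :- q) :* z)) :+ q :* (κ (+ 1) :* (κ (+ 1) :* z)) := κ (+ 1) :* z) ≈-refl (qp (suc k)) (I (suc k))))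
          step
          (λ m → ≐0-⊕ (≐0-⊗ˡ _ (qp-small ℕP.≤-refl)) (≐0-⊗ (qp (suc k)) (≐0-⊗ˡ _ (qp-small ℕP.≤-refl)))))
        where
        step : ∀ m → F k (suc m) ⊕ qp (suc k) ⊗ F (suc k) (suc m) ≗ I (suc m) ⊗ I (suc m ℕ.+ suc k) ⊕ ⊖ (I m ⊗ I (m ℕ.+ suc k))
        step m = ≈-trans (⊕-cong (⊗-cong ≈-refl (⊗-cong ≈-refl up₁)) ≈-refl)
          (≈-trans (solve 4 (λ y z i Z → y :* (i :* ((κ (+ 1) :- y :* z) :* Z)) :+ z :* (y :* (i :* Z))
              := i :* Z :- ((κ (+ 1) :- y) :* i) :* ((κ (+ 1) :- y :* z) :* Z)) ≈-refl (qp (suc m)) (qp (suc k)) (I (suc m)) (I (suc m ℕ.+ suc k)))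
            (⊕-cong ≈-refl (⊖-cong (⊗-cong (I-suc m) (≈-trans (≈-sym up₁) (≡⇒≗ (cong I (sym (ℕP.+-suc m k)))))))))
          where
          up₁ : I (suc m ℕ.+ k) ≗ (𝟙 ⊕ ⊖ (qp (suc m) ⊗ qp (suc k))) ⊗ I (suc m ℕ.+ suc k)
          up₁ = ≈-trans (I-+suc (suc m) k) (⊗-cong (⊕-cong ≈-refl (⊖-cong (qp-⊗ {suc m} {suc k} (ℕP.+-suc (suc m) k)))) ≈-refl)

      -- Write q^{2m} = q^m - q^m (1 - q^m). The factor 1 - q^m lowers (q)_m to (q)_{m-1}, and
      -- shifting m turns the second part into q times the sum at k + 1.
      sum-h₂ : ∀ k → SumS (λ m → qp (2 ℕ.* m) ⊗ (I m ⊗ I (m ℕ.+ k))) (h k ⊕ ⊖ (qp 1 ⊗ h (suc k)))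
      sum-h₂ k = sumS-cong pointwise (solve 2 (λ a b → a :- (κ (+ 0) :+ b) := a :- b) ≈-refl (h k) (qp 1 ⊗ h (suc k)))
          (sumS-⊕ (sum-h k) (sumS-⊖ (sumS-head {A} (sumS-⊗ (qp 1) (sum-h (suc k))))))
        where
        A : ℕ → Ser
        A zero    = 𝟘
        A (suc m) = qp 1 ⊗ F (suc k) m
        pointwise : ∀ m → F k m ⊕ ⊖ A m ≗ qp (2 ℕ.* m) ⊗ (I m ⊗ I (m ℕ.+ k))
        pointwise zero    = solve 1 (λ a → a :- κ (+ 0) := a) ≈-refl (qp 0 ⊗ (I 0 ⊗ I (0 ℕ.+ k)))
        pointwise (suc m) = ≈-trans (⊕-cong ≈-refl (⊖-cong (≈-trans (≈-trans (solve 3 (λ a b c → a :* (b :* c) := a :* b :* c) ≈-refl (qp 1) (qp m) (I m ⊗ I (m ℕ.+ suc k)))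
              (⊗-cong (qp-* 1 m) (⊗-cong (≈-sym (I-suc m)) (≡⇒≗ (cong I (ℕP.+-suc m k)))))) ≈-refl)))
          (≈-trans (solve 3 (λ y i Z → y :* (i :* Z) :- y :* ((κ (+ 1) :- y) :* i :* Z) := y :* y :* (i :* Z)) ≈-refl (qp (suc m)) (I (suc m)) (I (suc m ℕ.+ k)))
            (⊗-cong (≈-sym (qp-⊗ {suc m} {suc m} (l (suc m)))) ≈-refl))
          where
          l : ∀ m → m ℕ.+ m ≡ 2 ℕ.* m
          l = solveℕ

    -- the partial theta function Σ (-1)^r q^{r(r+1)/2 + kr}
    module Rk where
      ex-r : ℕ → ℕ → ℕ
      ex-r k r = triN (suc r) ℕ.+ k ℕ.* r

      F : ℕ → ℕ → Ser
      F k r = term (sgnN r) (+ ex-r k r)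

      private
        tame : ∀ k → Tame sgnN (λ r → + ex-r k r)
        tame k r = inj₂ (_ , refl , ℕP.≤-trans (ℕP.m≤m+n r (triN r)) (ℕP.≤-trans (ℕP.m≤m+n _ (k ℕ.* r)) (ℕP.m≤m+n _ 2)))

      abstract
        R : ℕ → Ser
        R k = total (tame-summable (tame k))
        sum-R : ∀ k → SumS (F k) (R k)
        sum-R k = sumS-total (tame-summable (tame k))

      R-rec : ∀ k → R k ≗ 𝟙 ⊕ ⊖ (qp (suc k) ⊗ R (suc k))
      R-rec k = ≈-trans (sumS-unique (sum-R k) (sumS-head {F k} (sumS-cong pointwise ≈-refl (sumS-⊖ (sumS-⊗ (qp (suc k)) (sum-R (suc k)))))))
        (⊕-cong (≈-trans (⊗-cong ≈-refl (≡⇒≗ (cong qp (ℕP.*-zeroʳ k)))) (solve 0 (κ (+ 1) :* κ (+ 1) := κ (+ 1)) ≈-refl)) ≈-refl)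
        where
        pointwise : ∀ r → ⊖ (qp (suc k) ⊗ F (suc k) r) ≗ F k (suc r)
        pointwise r = ≈-trans (solve 3 (λ a b c → :- (a :* (b :* c)) := (κ (- + 1) :* b) :* (a :* c)) ≈-refl (qp (suc k)) (con (sgnN r)) (qp (ex-r (suc k) r)))
          (⊗-cong (≈-trans (≈-sym (≗-pw (con-* (- + 1) (sgnN r)))) (≡⇒≗ (cong con (ℤP.-1*i≡-i (sgnN r))))) (≈-sym (qp-⊗ {suc k} {ex-r (suc k) r} (l k r (triN r)))))
          where
          l : ∀ k r t → suc k ℕ.+ (r ℕ.+ t ℕ.+ suc k ℕ.* r) ≡ suc r ℕ.+ (r ℕ.+ t) ℕ.+ k ℕ.* suc r
          l = solveℕ

      -- Both sides satisfy the same first-order recursion in k, so their difference falls under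
      -- `descent`.
      h≗ : ∀ k → Hk.h k ≗ E⁻¹ ⊗ E⁻¹ ⊗ R k
      h≗ k = ≈-trans (solve 2 (λ a b → a := a :- b :+ b) ≈-refl (Hk.h k) (E⁻¹ ⊗ E⁻¹ ⊗ R k))
        (≈-trans (⊕-cong (descent (λ k → Hk.h k ⊕ ⊖ (E⁻¹ ⊗ E⁻¹ ⊗ R k)) step k) ≈-refl) (solve 1 (λ a → κ (+ 0) :+ a := a) ≈-refl (E⁻¹ ⊗ E⁻¹ ⊗ R k)))
        where
        step : ∀ k → Hk.h k ⊕ ⊖ (E⁻¹ ⊗ E⁻¹ ⊗ R k) ≗ ⊖ (qp (suc k) ⊗ (Hk.h (suc k) ⊕ ⊖ (E⁻¹ ⊗ E⁻¹ ⊗ R (suc k))))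
        step k = ≈-trans (⊕-cong (≈-trans (solve 2 (λ a b → a := a :+ b :- b) ≈-refl (Hk.h k) (qp (suc k) ⊗ Hk.h (suc k))) (⊕-cong (Hk.h-rec k) ≈-refl)) (⊖-cong (⊗-cong ≈-refl (R-rec k))))
          (solve 4 (λ e q h r → e :- q :* h :- e :* (κ (+ 1) :- q :* r) := :- (q :* (h :- e :* r))) ≈-refl (E⁻¹ ⊗ E⁻¹) (qp (suc k)) (Hk.h (suc k)) (R (suc k)))

    -- Moments of the unit Bailey pair.

    -- The convention 1 / (q)_n = 0 for negative n encodes the range -n ≤ j ≤ n, so moments are sums
    -- over all of ℤ and can be reindexed freely.
    Iz : ℤ → Ser
    Iz (+ n)    = I n
    Iz -[1+ _ ] = 𝟘

    Iz-pred : ∀ z → (𝟙 ⊕ ⊖ qz z) ⊗ Iz z ≗ Iz (z - + 1)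
    Iz-pred (+ zero)  = solve 0 ((κ (+ 1) :- κ (+ 1)) :* κ (+ 1) := κ (+ 0)) ≈-refl
    Iz-pred (+ suc n) = I-suc n
    Iz-pred -[1+ n ]  = solve 0 ((κ (+ 1) :- κ (+ 0)) :* κ (+ 0) := κ (+ 0)) ≈-refl

    -- Adding exponents fails for negative z, but there the factor `Iz z` is zero.
    Iz-absorb : ∀ t z X → qp t ⊗ (qz z ⊗ (Iz z ⊗ X)) ≗ qz (+ t + z) ⊗ (Iz z ⊗ X)
    Iz-absorb t (+ n) X = ≈-trans (solve 3 (λ a b c → a :* (b :* c) := a :* b :* c) ≈-refl (qp t) (qp n) (I n ⊗ X)) (⊗-cong (qp-* t n) ≈-refl)
    Iz-absorb t -[1+ n ] X = solve 3 (λ a b c → a :* (κ (+ 0) :* (κ (+ 0) :* c)) := b :* (κ (+ 0) :* c)) ≈-refl (qp t) (qz (+ t + -[1+ n ])) X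

    qz-+ : ∀ a b → qz (a + b) ⊗ (Iz a ⊗ Iz b) ≗ qz a ⊗ qz b ⊗ (Iz a ⊗ Iz b)
    qz-+ (+ m) (+ n) = ⊗-cong (≈-sym (qp-* m n)) ≈-refl
    qz-+ (+ m) -[1+ n ] = solve 3 (λ a b c → a :* (b :* κ (+ 0)) := c :* κ (+ 0) :* (b :* κ (+ 0))) ≈-refl (qz (+ m + -[1+ n ])) (I m) (qp m)
    qz-+ -[1+ m ] b = solve 3 (λ a b c → a :* (κ (+ 0) :* b) := κ (+ 0) :* c :* (κ (+ 0) :* b)) ≈-refl (qz (-[1+ m ] + b)) (Iz b) (qz b)

    -- The q-Pascal rule for reciprocals, from 1 - q^{a+b} = (1 - q^b) + q^b (1 - q^a).
    pascal : ∀ a b → (𝟙 ⊕ ⊖ qz (a + b)) ⊗ (Iz a ⊗ Iz b) ≗ Iz a ⊗ Iz (b - + 1) ⊕ qz b ⊗ (Iz b ⊗ Iz (a - + 1))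
    pascal a b = ≈-trans (solve 3 (λ q x y → (κ (+ 1) :- q) :* (x :* y) := x :* y :- q :* (x :* y)) ≈-refl (qz (a + b)) (Iz a) (Iz b))
      (≈-trans (⊕-cong ≈-refl (⊖-cong (qz-+ a b)))
      (≈-trans (solve 4 (λ p q x y → x :* y :- p :* q :* (x :* y) := x :* ((κ (+ 1) :- q) :* y) :+ q :* (y :* ((κ (+ 1) :- p) :* x))) ≈-refl (qz a) (qz b) (Iz a) (Iz b))
      (⊕-cong (⊗-cong ≈-refl (Iz-pred b)) (⊗-cong ≈-refl (⊗-cong ≈-refl (Iz-pred a))))))

    1-q-cancel : ∀ k {x y} → 1-q (suc k) ⊗ x ≗ 1-q (suc k) ⊗ y → x ≗ y
    1-q-cancel k {x} {y} p = ≈-trans (solve 2 (λ x y → x := x :- y :+ y) ≈-refl x y)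
      (≈-trans (⊕-cong (unit-cancel (1-q (suc k)) one² (≈-trans (solve 3 (λ a x y → a :* (x :- y) := a :* x :- a :* y) ≈-refl (1-q (suc k)) x y)
          (≈-trans (⊕-cong p ≈-refl) (solve 1 (λ a → a :- a := κ (+ 0)) ≈-refl (1-q (suc k) ⊗ y))))) ≈-refl)
        (solve 1 (λ a → κ (+ 0) :+ a := a) ≈-refl y))
      where
      one² : 1-q (suc k) 0 * 1-q (suc k) 0 ≡ + 1
      one² = cong (λ z → z * z) (trans (⊕-at 𝟙 (⊖ qp (suc k)) 0) (+congˡ (+ 1) (⊖-at (qp (suc k)) 0)))

    tri-eq : ∀ a b k → a * a - a ≡ b * b - b + + 2 * k → + tri a ≡ + tri b + k
    tri-eq a b k e = double-inj (trans (tri-double a) (trans e (trans (cong (_+ + 2 * k) (sym (tri-double b))) (l (+ tri b) k))))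
      where
      l : ∀ t k → + 2 * t + + 2 * k ≡ + 2 * (t + k)
      l = solve-∀

    summable-⊗ : ∀ {I : Set} {F : I → Ser} (X : I → Ser) → Summable F → Summable (λ x → F x ⊗ X x)
    summable-⊗ X S N = let (xs , u , c) = S N in xs , u , λ x → [ inj₁ , inj₂ ∘ ≐0-⊗ˡ (X x) ]′ (c x)

    momF : (ℤ → ℤ) → (ℤ → Ser) → ℤ → Ser
    momF w X j = term (w j * sgn j) (EL j) ⊗ X j

    abstract
      Mom : (ℤ → ℤ) → (ℤ → Ser) → Ser
      Mom w X = total (summable-⊗ X (tame-summable (tameL (λ j → w j * sgn j))))
      mom : ∀ w X → SumS (momF w X) (Mom w X)
      mom w X = sumS-total (summable-⊗ X (tame-summable (tameL (λ j → w j * sgn j))))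

    mom-⊕ : ∀ w v X → Mom (λ j → w j + v j) X ≗ Mom w X ⊕ Mom v X
    mom-⊕ w v X = sumS-unique (mom (λ j → w j + v j) X) (sumS-cong pointwise ≈-refl (sumS-⊕ (mom w X) (mom v X)))
      where
      pointwise : ∀ j → momF w X j ⊕ momF v X j ≗ momF (λ j → w j + v j) X j
      pointwise j = ≈-trans (solve 3 (λ a b x → a :* x :+ b :* x := (a :+ b) :* x) ≈-refl (term (w j * sgn j) (EL j)) (term (v j * sgn j) (EL j)) (X j))
        (⊗-cong (≈-trans (term-+ (w j * sgn j) (v j * sgn j) (EL j)) (term-≡ {e = EL j} (sym (ℤP.*-distribʳ-+ (sgn j) (w j) (v j))) refl)) ≈-refl)

    mom-⊖ : ∀ w X → Mom (λ j → - w j) X ≗ ⊖ Mom w X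
    mom-⊖ w X = sumS-unique (mom (λ j → - w j) X) (sumS-cong pointwise ≈-refl (sumS-⊖ (mom w X)))
      where
      pointwise : ∀ j → ⊖ momF w X j ≗ momF (λ j → - w j) X j
      pointwise j = ≈-trans (solve 3 (λ a b c → :- (a :* b :* c) := κ (- + 1) :* a :* b :* c) ≈-refl (con (w j * sgn j)) (qz (EL j)) (X j))
        (⊗-cong (⊗-cong (≈-trans (≈-sym (≗-pw (con-* (- + 1) (w j * sgn j)))) (≡⇒≗ (cong con (l (w j) (sgn j))))) ≈-refl) ≈-refl)
        where
        l : ∀ w s → - + 1 * (w * s) ≡ - w * s
        l = solve-∀

    mom-cong : ∀ {w v X Y} → (∀ j → w j ≡ v j) → (∀ j → X j ≗ Y j) → Mom w X ≗ Mom v Y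
    mom-cong {w} {v} {X} {Y} p q = sumS-unique (mom w X) (sumS-cong (λ j → ⊗-cong (term-≡ {e = EL j} (cong (_* sgn j) (sym (p j))) refl) (≈-sym (q j))) ≈-refl (mom v Y))

    -- the sums over j of w(j) (-1)^j q^{j(j-1)/2} / ((q)_{n-j} (q)_{n+j}) and its two neighbours
    XM XN XA : ℕ → ℤ → Ser
    XM n j = Iz (+ n - j) ⊗ Iz (+ n + j)
    XN n j = Iz (+ n - j) ⊗ Iz (+ n + j - + 1)
    XA n j = Iz (+ n - j) ⊗ Iz (+ n + j + + 1)

    shift-term : ∀ c t z Y e → + t + z ≡ + e → con c ⊗ qp t ⊗ (qz z ⊗ (Iz z ⊗ Y)) ≗ con c ⊗ qp e ⊗ (Iz z ⊗ Y)
    shift-term c t z Y e p = ≈-trans (solve 3 (λ a b c → a :* b :* c := a :* (b :* c)) ≈-refl (con c) (qp t) (qz z ⊗ (Iz z ⊗ Y)))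
      (≈-trans (⊗-cong ≈-refl (≈-trans (Iz-absorb t z Y) (⊗-cong (≡⇒≗ (cong qz p)) ≈-refl)))
      (solve 3 (λ a b c → a :* (b :* c) := a :* b :* c) ≈-refl (con c) (qp e) (Iz z ⊗ Y)))

    private
      split : ∀ e c t a b → a + b ≡ + e → 1-q e ⊗ (con c ⊗ qp t ⊗ (Iz a ⊗ Iz b)) ≗ con c ⊗ qp t ⊗ (Iz a ⊗ Iz (b - + 1)) ⊕ con c ⊗ qp t ⊗ (qz b ⊗ (Iz b ⊗ Iz (a - + 1)))
      split e c t a b p = ≈-trans (solve 3 (λ x y z → x :* (y :* z) := y :* (x :* z)) ≈-refl (1-q e) (con c ⊗ qp t) (Iz a ⊗ Iz b))
        (≈-trans (⊗-cong ≈-refl (≈-trans (⊗-cong (⊕-cong ≈-refl (⊖-cong (≡⇒≗ (cong qz (sym p))))) ≈-refl) (pascal a b)))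
          (solve 3 (λ x y z → x :* (y :+ z) := x :* y :+ x :* z) ≈-refl (con c ⊗ qp t) (Iz a ⊗ Iz (b - + 1)) (qz b ⊗ (Iz b ⊗ Iz (a - + 1)))))

      con-neg : ∀ c e n X → con (- c) ⊗ qp (n ℕ.+ e) ⊗ X ≗ ⊖ (qp n ⊗ (con c ⊗ qp e ⊗ X))
      con-neg c e n X = ≈-trans (⊗-cong (⊗-cong (≈-trans (≡⇒≗ (cong con (sym (ℤP.-1*i≡-i c)))) (≗-pw (con-* (- + 1) c))) (qp-⊗ {n} {e} refl)) ≈-refl)
        (solve 4 (λ c n e x → κ (- + 1) :* c :* (n :* e) :* x := :- (n :* (c :* e :* x))) ≈-refl (con c) (qp n) (qp e) X)

      down≃ up≃ flip≃ : ℤ ≃ ℤ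
      down≃ = bij (λ j → j - + 1) (λ j → j + + 1) l₁ l₂
        where
        l₁ : ∀ j → j + + 1 - + 1 ≡ j
        l₁ = solve-∀
        l₂ : ∀ j → j - + 1 + + 1 ≡ j
        l₂ = solve-∀
      up≃ = bij (λ j → j + + 1) (λ j → j - + 1) l₂ l₁
        where
        l₁ : ∀ j → j + + 1 - + 1 ≡ j
        l₁ = solve-∀
        l₂ : ∀ j → j - + 1 + + 1 ≡ j
        l₂ = solve-∀
      flip≃ = bij (λ j → - + 1 - j) (λ j → - + 1 - j) l l
        where
        l : ∀ j → - + 1 - (- + 1 - j) ≡ j
        l = solve-∀

    -- Apply `pascal` to n - j and n + j. In the second half the shift j ↦ j - 1 turns the exponent
    -- tri (j - 1) + n + j - 1 into n + tri j and changes the sign, so the same kernel `XN`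
    -- reappears with a shifted weight.
    M-rec : ∀ n w → 1-q (n ℕ.+ n) ⊗ Mom w (XM n) ≗ Mom w (XN n) ⊕ ⊖ (qp n ⊗ Mom (λ j → w (j - + 1)) (XN n))
    M-rec n w = ≈-trans (sumS-unique (sumS-⊗ (1-q (n ℕ.+ n)) (mom w (XM n))) (sumS-cong (λ j → ≈-sym (split (n ℕ.+ n) (w j * sgn j) (tri j) (+ n - j) (+ n + j) (l (+ n) j))) ≈-refl
        (sumS-⊕ (mom w (XN n)) (mom w S)))) (⊕-cong ≈-refl shifted)
      where
      S : ℤ → Ser
      S j = qz (+ n + j) ⊗ (Iz (+ n + j) ⊗ Iz (+ n - j - + 1))
      l : ∀ n j → n - j + (n + j) ≡ n + n
      l = solve-∀
      shifted : Mom w S ≗ ⊖ (qp n ⊗ Mom (λ j → w (j - + 1)) (XN n))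
      shifted = sumS-unique (sumS-bij down≃ (mom w S)) (sumS-cong (λ j → ≈-sym (pointwise j)) ≈-refl (sumS-⊖ (sumS-⊗ (qp n) (mom (λ j → w (j - + 1)) (XN n)))))
        where
        pointwise : ∀ j → momF w S (j - + 1) ≗ ⊖ (qp n ⊗ momF (λ j → w (j - + 1)) (XN n) j)
        pointwise j = ≈-trans (shift-term (w (j - + 1) * sgn (j - + 1)) (tri (j - + 1)) (+ n + (j - + 1)) (Iz (+ n - (j - + 1) - + 1)) (n ℕ.+ tri j) e)
          (≈-trans (⊗-cong (⊗-cong (≡⇒≗ (cong con sg)) ≈-refl) (≈-trans (⊗-cong (≡⇒≗ (cong Iz (l₁ (+ n) j))) (≡⇒≗ (cong Iz (l₂ (+ n) j))))
              (solve 2 (λ a b → a :* b := b :* a) ≈-refl (Iz (+ n + j - + 1)) (Iz (+ n - j)))))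
            (con-neg (w (j - + 1) * sgn j) (tri j) n (XN n j)))
          where
          l₁ : ∀ n j → n + (j - + 1) ≡ n + j - + 1
          l₁ = solve-∀
          l₂ : ∀ n j → n - (j - + 1) - + 1 ≡ n - j
          l₂ = solve-∀
          l₃ : ∀ w s → w * - s ≡ - (w * s)
          l₃ = solve-∀
          l₄ : ∀ j → j - + 1 ≡ + 1 + (j + + 2 * - + 1)
          l₄ = solve-∀
          l₅ : ∀ j → (j - + 1) * (j - + 1) - (j - + 1) ≡ j * j - j + + 2 * (+ 1 - j)
          l₅ = solve-∀
          l₆ : ∀ n j t → t + (+ 1 - j) + (n + (j - + 1)) ≡ n + t
          l₆ = solve-∀
          sg : w (j - + 1) * sgn (j - + 1) ≡ - (w (j - + 1) * sgn j)
          sg = trans (cong (w (j - + 1) *_) (sgn-odd (j - + 1) j (- + 1) (l₄ j))) (l₃ (w (j - + 1)) (sgn j))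
          e : + tri (j - + 1) + (+ n + (j - + 1)) ≡ + (n ℕ.+ tri j)
          e = trans (cong (_+ (+ n + (j - + 1))) (tri-eq (j - + 1) j (+ 1 - j) (l₅ j))) (l₆ (+ n) j (+ tri j))

    -- As for `M-rec`, with the two factors in the other order: the shift is now j ↦ j + 1, and tri
    -- (j + 1) + n - j equals n + tri j.
    N-rec : ∀ n w → 1-q (suc (n ℕ.+ n)) ⊗ Mom w (XN (suc n)) ≗ Mom w (XM n) ⊕ ⊖ (qp n ⊗ Mom (λ j → w (j + + 1)) (XM n))
    N-rec n w = ≈-trans (sumS-unique (sumS-⊗ (1-q (suc (n ℕ.+ n))) (mom w (XN (suc n)))) (sumS-cong (λ j → ≈-sym (pointwise₀ j)) ≈-refl
        (sumS-⊕ (mom w (XM n)) (mom w S)))) (⊕-cong ≈-refl shifted)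
      where
      S : ℤ → Ser
      S j = qz (+ suc n - j) ⊗ (Iz (+ suc n - j) ⊗ Iz (+ n + j - + 1))
      l₀ : ∀ n j → + 1 + n - j - + 1 ≡ n - j
      l₀ = solve-∀
      l₁ : ∀ n j → + 1 + n + j - + 1 ≡ n + j
      l₁ = solve-∀
      l : ∀ n j → n + j + (+ 1 + n - j) ≡ + 1 + (n + n)
      l = solve-∀
      pointwise₀ : ∀ j → 1-q (suc (n ℕ.+ n)) ⊗ momF w (XN (suc n)) j ≗ momF w (XM n) j ⊕ momF w S j
      pointwise₀ j = ≈-trans (⊗-cong ≈-refl (⊗-cong ≈-refl (≈-trans (⊗-cong ≈-refl (≡⇒≗ (cong Iz (l₁ (+ n) j)))) (solve 2 (λ a b → a :* b := b :* a) ≈-refl (Iz (+ suc n - j)) (Iz (+ n + j))))))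
        (≈-trans (split (suc (n ℕ.+ n)) (w j * sgn j) (tri j) (+ n + j) (+ suc n - j) (l (+ n) j))
          (⊕-cong (⊗-cong ≈-refl (≈-trans (⊗-cong ≈-refl (≡⇒≗ (cong Iz (l₀ (+ n) j)))) (solve 2 (λ a b → a :* b := b :* a) ≈-refl (Iz (+ n + j)) (Iz (+ n - j))))) ≈-refl))
      shifted : Mom w S ≗ ⊖ (qp n ⊗ Mom (λ j → w (j + + 1)) (XM n))
      shifted = sumS-unique (sumS-bij up≃ (mom w S)) (sumS-cong (λ j → ≈-sym (pointwise j)) ≈-refl (sumS-⊖ (sumS-⊗ (qp n) (mom (λ j → w (j + + 1)) (XM n)))))
        where
        pointwise : ∀ j → momF w S (j + + 1) ≗ ⊖ (qp n ⊗ momF (λ j → w (j + + 1)) (XM n) j)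
        pointwise j = ≈-trans (shift-term (w (j + + 1) * sgn (j + + 1)) (tri (j + + 1)) (+ suc n - (j + + 1)) (Iz (+ n + (j + + 1) - + 1)) (n ℕ.+ tri j) e)
          (≈-trans (⊗-cong (⊗-cong (≡⇒≗ (cong con sg)) ≈-refl) (⊗-cong (≡⇒≗ (cong Iz (m₁ (+ n) j))) (≡⇒≗ (cong Iz (m₂ (+ n) j)))))
            (con-neg (w (j + + 1) * sgn j) (tri j) n (XM n j)))
          where
          m₁ : ∀ n j → + 1 + n - (j + + 1) ≡ n - j
          m₁ = solve-∀
          m₂ : ∀ n j → n + (j + + 1) - + 1 ≡ n + j
          m₂ = solve-∀
          m₃ : ∀ w s → w * - s ≡ - (w * s)
          m₃ = solve-∀
          m₄ : ∀ j → j + + 1 ≡ + 1 + (j + + 2 * + 0)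
          m₄ = solve-∀
          m₅ : ∀ j → (j + + 1) * (j + + 1) - (j + + 1) ≡ j * j - j + + 2 * j
          m₅ = solve-∀
          m₆ : ∀ n j t → t + j + (+ 1 + n - (j + + 1)) ≡ n + t
          m₆ = solve-∀
          sg : w (j + + 1) * sgn (j + + 1) ≡ - (w (j + + 1) * sgn j)
          sg = trans (cong (w (j + + 1) *_) (sgn-odd (j + + 1) j (+ 0) (m₄ j))) (m₃ (w (j + + 1)) (sgn j))
          e : + tri (j + + 1) + (+ suc n - (j + + 1)) ≡ + (n ℕ.+ tri j)
          e = trans (cong (_+ (+ suc n - (j + + 1))) (tri-eq (j + + 1) j j (m₅ j))) (m₆ (+ n) j (+ tri j))

    -- The reflection j ↦ 1 - j exchanges n - j with n + j - 1 and fixes tri j, while the sign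
    -- changes. Weights invariant under it therefore have moment zero.
    N-reflect : ∀ n w → Mom w (XN n) ≗ ⊖ Mom (λ j → w (+ 1 - j)) (XN n)
    N-reflect n w = sumS-unique (sumS-bij reflect (mom w (XN n))) (sumS-cong (λ j → ≈-sym (pointwise j)) ≈-refl (sumS-⊖ (mom (λ j → w (+ 1 - j)) (XN n))))
      where
      l₁ : ∀ n j → n - (+ 1 - j) ≡ n + j - + 1
      l₁ = solve-∀
      l₂ : ∀ n j → n + (+ 1 - j) - + 1 ≡ n - j
      l₂ = solve-∀
      l₃ : ∀ w s → w * - s ≡ - (w * s)
      l₃ = solve-∀
      pointwise : ∀ j → momF w (XN n) (+ 1 - j) ≗ ⊖ momF (λ j → w (+ 1 - j)) (XN n) j
      pointwise j = ≈-trans (⊗-cong (term-≡ {e = EL (+ 1 - j)} (trans (cong (w (+ 1 - j) *_) (sgn-reflect j)) (l₃ (w (+ 1 - j)) (sgn j))) (cong ℤ.+_ (tri-reflect j)))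
          (≈-trans (⊗-cong (≡⇒≗ (cong Iz (l₁ (+ n) j))) (≡⇒≗ (cong Iz (l₂ (+ n) j)))) (solve 2 (λ a b → a :* b := b :* a) ≈-refl (Iz (+ n + j - + 1)) (Iz (+ n - j)))))
        (≈-trans (con-neg (w (+ 1 - j) * sgn j) (tri j) 0 (XN n j)) (⊖-cong (solve 1 (λ x → κ (+ 1) :* x := x) ≈-refl (momF (λ j → w (+ 1 - j)) (XN n) j))))

    one-w id-w tri-w T-w : ℤ → ℤ
    one-w _ = + 1
    id-w j  = j
    tri-w j = + tri j
    T-w j   = + tri (j + + 1)

    N-one : ∀ n → Mom one-w (XN n) ≗ 𝟘
    N-one n = double-zero (N-reflect n one-w)

    N-tri : ∀ n → Mom tri-w (XN n) ≗ 𝟘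
    N-tri n = double-zero (≈-trans (N-reflect n tri-w) (⊖-cong (mom-cong (λ j → cong ℤ.+_ (tri-reflect j)) (λ _ → ≈-refl))))

    M-0 : ∀ w → Mom w (XM 0) ≗ con (w (+ 0))
    M-0 w = sumS-unique (mom w (XM 0)) (mkS λ N → (+ 0 ∷ []) , ([] ∷ [] , pt N) , ≗⇒≐ (≈-trans
        (⊕-cong (⊗-cong (⊗-cong (≡⇒≗ (cong con (ℤP.*-identityʳ (w (+ 0))))) ≈-refl) ≈-refl) ≈-refl)
        (solve 1 (λ a → a :* κ (+ 1) :* (κ (+ 1) :* κ (+ 1)) :+ κ (+ 0) := a) ≈-refl (con (w (+ 0))))))
      where
      pt : ∀ N j → j ∈ (+ 0 ∷ []) ⊎ momF w (XM 0) j ≐[ N ] 𝟘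
      pt N (+ zero)  = inj₁ (here refl)
      pt N (+ suc n) = inj₂ (≗⇒≐ (solve 2 (λ a b → a :* (κ (+ 0) :* b) := κ (+ 0)) ≈-refl (term (w (+ suc n) * sgn (+ suc n)) (EL (+ suc n))) (I (suc n))))
      pt N -[1+ n ]  = inj₂ (≗⇒≐ (solve 2 (λ a b → a :* (b :* κ (+ 0)) := κ (+ 0)) ≈-refl (term (w -[1+ n ] * sgn -[1+ n ]) (EL -[1+ n ])) (Iz (+ 0 - -[1+ n ]))))

    private
      sum-⊖ : ∀ {a b} q → a ≗ 𝟘 → b ≗ 𝟘 → a ⊕ ⊖ (q ⊗ b) ≗ 𝟘
      sum-⊖ q p r = ≈-trans (⊕-cong p (⊖-cong (⊗-cong ≈-refl r))) (solve 1 (λ q → κ (+ 0) :- q :* κ (+ 0) := κ (+ 0)) ≈-refl q)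

    -- The unit Bailey pair: both moments on the right of `M-rec` have constant weight and vanish,
    -- and 1 - q^{2n} is cancellable for n ≥ 1.
    M-one : ∀ n → Mom one-w (XM (suc n)) ≗ 𝟘
    M-one n = unit-cancel (1-q (suc n ℕ.+ suc n)) one² (≈-trans (M-rec (suc n) one-w) (sum-⊖ (qp (suc n)) (N-one (suc n)) (N-one (suc n))))
      where
      one² : 1-q (suc n ℕ.+ suc n) 0 * 1-q (suc n ℕ.+ suc n) 0 ≡ + 1
      one² = cong (λ z → z * z) (trans (⊕-at 𝟙 (⊖ qp (suc n ℕ.+ suc n)) 0) (+congˡ (+ 1) (⊖-at (qp (suc n ℕ.+ suc n)) 0)))

    O : ℕ → Ser
    O n = Mom id-w (XN n)

    T≡tri+ : ∀ j → T-w j ≡ tri-w j + j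
    T≡tri+ j = tri-eq (j + + 1) j j (l j)
      where
      l : ∀ j → (j + + 1) * (j + + 1) - (j + + 1) ≡ j * j - j + + 2 * j
      l = solve-∀

    N-T : ∀ n → Mom T-w (XN n) ≗ O n
    N-T n = ≈-trans (mom-cong T≡tri+ (λ _ → ≈-refl)) (≈-trans (mom-⊕ tri-w id-w (XN n)) (≈-trans (⊕-cong (N-tri n) ≈-refl) (solve 1 (λ a → κ (+ 0) :+ a := a) ≈-refl (O n))))

    -- The weight T shifted by one is tri, whose moment over `XN` vanishes by reflection; and T
    -- differs from tri by j, so only the first moment `O` is left.
    M-T-rec : ∀ n → 1-q (n ℕ.+ n) ⊗ Mom T-w (XM n) ≗ O n
    M-T-rec n = ≈-trans (M-rec n T-w) (≈-trans (⊕-cong (N-T n) (⊖-cong (⊗-cong ≈-refl (≈-trans (mom-cong (λ j → cong (λ z → + tri z) (l j)) (λ _ → ≈-refl)) (N-tri n)))))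
      (solve 2 (λ a q → a :- q :* κ (+ 0) := a) ≈-refl (O n) (qp n)))
      where
      l : ∀ j → j - + 1 + + 1 ≡ j
      l = solve-∀

    M-id-rec : ∀ n → 1-q (n ℕ.+ n) ⊗ Mom id-w (XM n) ≗ 1-q n ⊗ O n
    M-id-rec n = ≈-trans (M-rec n id-w) (≈-trans (⊕-cong ≈-refl (⊖-cong (⊗-cong ≈-refl
        (≈-trans (mom-⊕ id-w (λ _ → - + 1) (XN n)) (⊕-cong ≈-refl (≈-trans (mom-⊖ one-w (XN n)) (⊖-cong (N-one n))))))))
      (solve 2 (λ a q → a :- q :* (a :+ :- κ (+ 0)) := (κ (+ 1) :- q) :* a) ≈-refl (O n) (qp n)))

    O-rec : ∀ n → 1-q (suc (n ℕ.+ n)) ⊗ O (suc n) ≗ 1-q n ⊗ Mom id-w (XM n) ⊕ ⊖ (qp n ⊗ Mom one-w (XM n))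
    O-rec n = ≈-trans (N-rec n id-w) (≈-trans (⊕-cong ≈-refl (⊖-cong (⊗-cong ≈-refl (mom-⊕ id-w one-w (XM n)))))
      (solve 3 (λ a b q → a :- q :* (a :+ b) := (κ (+ 1) :- q) :* a :- q :* b) ≈-refl (Mom id-w (XM n)) (Mom one-w (XM n)) (qp n)))

    -- Going from n to n + 1 alternates between the two kernels: `M-id-rec` and `O-rec` each
    -- contribute one factor 1 - q^n, as the constant weight drops out for n ≥ 1. The base case is
    -- different: there 1 - q^0 kills the first moment and the value comes from the constant weight
    -- at n = 0.
    O-closed : ∀ n → O (suc n) ≗ ⊖ (P n ⊗ P n ⊗ I (suc (n ℕ.+ n)))
    O-closed zero = 1-q-cancel 0 (≈-trans (O-rec 0) (≈-trans (⊕-cong ≈-refl (⊖-cong (⊗-cong ≈-refl (M-0 one-w))))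
      (≈-trans (solve 1 (λ a → (κ (+ 1) :- κ (+ 1)) :* a :- κ (+ 1) :* κ (+ 1) := :- κ (+ 1)) ≈-refl (Mom id-w (XM 0)))
      (≈-trans (⊖-cong (≈-sym (I-suc 0))) (solve 2 (λ a b → :- (a :* b) := a :* :- (κ (+ 1) :* κ (+ 1) :* b)) ≈-refl (1-q 1) (I 1))))))
    O-closed (suc n) = ≈-trans (1-q-cancel (suc (suc (n ℕ.+ n))) (1-q-cancel (suc (n ℕ.+ n)) (≈-trans (⊗-cong ≈-refl s₁)
        (≈-trans (solve 3 (λ x a m → x :* (a :* m) := a :* (x :* m)) ≈-refl x a m) (≈-trans (⊗-cong ≈-refl (≈-trans s₂ (⊗-cong ≈-refl s₃)))
        (solve 5 (λ a p x y z → a :* (a :* :- (p :* p :* (x :* (y :* z)))) := x :* (y :* :- (p :* a :* (p :* a) :* z))) ≈-refl a (P n) x y z))))))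
      (⊖-cong (⊗-cong ≈-refl (≡⇒≗ (cong I (sym (cong (λ z → suc (suc z)) (ℕP.+-suc n n)))))))
      where
      a x y z m : Ser
      a = 1-q (suc n)
      x = 1-q (2 ℕ.+ (n ℕ.+ n))
      y = 1-q (3 ℕ.+ (n ℕ.+ n))
      z = I (3 ℕ.+ (n ℕ.+ n))
      m = Mom id-w (XM (suc n))
      s₁ : y ⊗ O (suc (suc n)) ≗ a ⊗ m
      s₁ = ≈-trans (⊗-cong (≡⇒≗ (cong 1-q (sym (cong (λ z → suc (suc z)) (ℕP.+-suc n n))))) ≈-refl) (≈-trans (O-rec (suc n))
        (≈-trans (⊕-cong ≈-refl (⊖-cong (⊗-cong ≈-refl (M-one n)))) (solve 2 (λ a q → a :- q :* κ (+ 0) := a) ≈-refl (a ⊗ m) (qp (suc n)))))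
      s₂ : x ⊗ m ≗ a ⊗ O (suc n)
      s₂ = ≈-trans (⊗-cong (≡⇒≗ (cong 1-q (sym (cong suc (ℕP.+-suc n n))))) ≈-refl) (M-id-rec (suc n))
      s₃ : O (suc n) ≗ ⊖ (P n ⊗ P n ⊗ (x ⊗ (y ⊗ z)))
      s₃ = ≈-trans (O-closed n) (⊖-cong (⊗-cong ≈-refl (≈-trans (≈-sym (I-suc (suc (n ℕ.+ n)))) (⊗-cong ≈-refl (≈-sym (I-suc (suc (suc (n ℕ.+ n)))))))))

    -- (q)_{n-1}² / (q)_{2n}, indexed from n = 1
    b₊ : ℕ → Ser
    b₊ n = P n ⊗ P n ⊗ I (suc (suc (n ℕ.+ n)))

    private
      1-q-even : ∀ n → 1-q (suc n ℕ.+ suc n) ≗ 1-q (suc (suc (n ℕ.+ n)))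
      1-q-even n = ≡⇒≗ (cong 1-q (cong suc (ℕP.+-suc n n)))

    M-T : ∀ n → Mom T-w (XM (suc n)) ≗ ⊖ b₊ n
    M-T n = 1-q-cancel (suc (n ℕ.+ n)) (≈-trans (⊗-cong (≈-sym (1-q-even n)) ≈-refl) (≈-trans (M-T-rec (suc n)) (≈-trans (O-closed n) (≈-trans (⊖-cong (⊗-cong ≈-refl (≈-sym (I-suc (suc (n ℕ.+ n))))))
      (solve 3 (λ p x z → :- (p :* p :* (x :* z)) := x :* :- (p :* p :* z)) ≈-refl (P n) (1-q (2 ℕ.+ (n ℕ.+ n))) (I (2 ℕ.+ (n ℕ.+ n))))))))

    M-id : ∀ n → Mom id-w (XM (suc n)) ≗ ⊖ (P n ⊗ P (suc n) ⊗ I (suc (suc (n ℕ.+ n))))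
    M-id n = 1-q-cancel (suc (n ℕ.+ n)) (≈-trans (⊗-cong (≈-sym (1-q-even n)) ≈-refl) (≈-trans (M-id-rec (suc n)) (≈-trans (⊗-cong ≈-refl (≈-trans (O-closed n) (⊖-cong (⊗-cong ≈-refl (≈-sym (I-suc (suc (n ℕ.+ n))))))))
      (solve 4 (λ p a x z → a :* :- (p :* p :* (x :* z)) := x :* :- (p :* (p :* a) :* z)) ≈-refl (P n) (1-q (suc n)) (1-q (2 ℕ.+ (n ℕ.+ n))) (I (2 ℕ.+ (n ℕ.+ n)))))))

    -- the part with q^{n+j+1} is antisymmetric under j ↦ -1 - j
    M-A : ∀ n → Mom T-w (XM n) ≗ Mom T-w (XA n)
    M-A n = ≈-trans (sumS-unique (mom T-w (XM n)) (sumS-cong (λ j → ≈-sym (pointwise j)) ≈-refl (sumS-⊕ (mom T-w (XA n)) (sumS-⊖ (mom T-w B)))))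
        (≈-trans (⊕-cong ≈-refl (⊖-cong (double-zero anti))) (solve 1 (λ a → a :- κ (+ 0) := a) ≈-refl (Mom T-w (XA n))))
      where
      B : ℤ → Ser
      B j = qz (+ n + j + + 1) ⊗ (Iz (+ n + j + + 1) ⊗ Iz (+ n - j))
      l₀ : ∀ x → x + + 1 - + 1 ≡ x
      l₀ = solve-∀
      pointwise : ∀ j → momF T-w (XM n) j ≗ momF T-w (XA n) j ⊕ ⊖ momF T-w B j
      pointwise j = ≈-trans (⊗-cong ≈-refl (⊗-cong ≈-refl (≈-trans (≡⇒≗ (cong Iz (sym (l₀ (+ n + j))))) (≈-sym (Iz-pred (+ n + j + + 1))))))
        (solve 4 (λ t a q b → t :* (a :* ((κ (+ 1) :- q) :* b)) := t :* (a :* b) :- t :* (q :* (b :* a))) ≈-refl (term (T-w j * sgn j) (EL j)) (Iz (+ n - j)) (qz (+ n + j + + 1)) (Iz (+ n + j + + 1)))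
      absorbed : ∀ c t z Y → con c ⊗ qp t ⊗ (qz z ⊗ (Iz z ⊗ Y)) ≗ con c ⊗ (qz (+ t + z) ⊗ (Iz z ⊗ Y))
      absorbed c t z Y = ≈-trans (solve 3 (λ a b c → a :* b :* c := a :* (b :* c)) ≈-refl (con c) (qp t) (qz z ⊗ (Iz z ⊗ Y))) (⊗-cong ≈-refl (Iz-absorb t z Y))
      anti : Mom T-w B ≗ ⊖ Mom T-w B
      anti = sumS-unique (sumS-bij flip≃ (mom T-w B)) (sumS-cong (λ j → ≈-sym (p j)) ≈-refl (sumS-⊖ (mom T-w B)))
        where
        p : ∀ j → momF T-w B (- + 1 - j) ≗ ⊖ momF T-w B j
        p j = ≈-trans (absorbed (T-w (- + 1 - j) * sgn (- + 1 - j)) (tri (- + 1 - j)) (+ n + (- + 1 - j) + + 1) (Iz (+ n - (- + 1 - j))))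
          (≈-trans (⊗-cong (≈-trans (≡⇒≗ (cong con sg)) (≗-pw (con-* (- + 1) (T-w j * sgn j)))) (≈-trans (⊗-cong (≡⇒≗ (cong qz e)) (⊗-cong (≡⇒≗ (cong Iz (l₁ (+ n) j))) (≡⇒≗ (cong Iz (l₂ (+ n) j))))) ≈-refl))
          (≈-trans (solve 4 (λ c q a b → κ (- + 1) :* c :* (q :* (a :* b)) := :- (c :* (q :* (b :* a)))) ≈-refl (con (T-w j * sgn j)) (qz (+ tri j + (+ n + j + + 1))) (Iz (+ n - j)) (Iz (+ n + j + + 1)))
            (⊖-cong (≈-sym (absorbed (T-w j * sgn j) (tri j) (+ n + j + + 1) (Iz (+ n - j)))))))
          where
          l₁ : ∀ n j → n + (- + 1 - j) + + 1 ≡ n - j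
          l₁ = solve-∀
          l₂ : ∀ n j → n - (- + 1 - j) ≡ n + j + + 1
          l₂ = solve-∀
          l₃ : ∀ j → - + 1 - j ≡ + 1 + (j + + 2 * (- + 1 - j))
          l₃ = solve-∀
          l₄ : ∀ j → - + 1 - j + + 1 ≡ + 1 - (j + + 1)
          l₄ = solve-∀
          l₅ : ∀ t s → t * - s ≡ - + 1 * (t * s)
          l₅ = solve-∀
          l₆ : ∀ j → (- + 1 - j) * (- + 1 - j) - (- + 1 - j) ≡ j * j - j + + 2 * (+ 2 * j + + 1)
          l₆ = solve-∀
          l₇ : ∀ t n j → t + (+ 2 * j + + 1) + (n + (- + 1 - j) + + 1) ≡ t + (n + j + + 1)
          l₇ = solve-∀
          sg : T-w (- + 1 - j) * sgn (- + 1 - j) ≡ - + 1 * (T-w j * sgn j)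
          sg = trans (cong₂ _*_ (trans (cong (λ z → + tri z) (l₄ j)) (cong ℤ.+_ (tri-reflect (j + + 1)))) (sgn-odd (- + 1 - j) j (- + 1 - j) (l₃ j))) (l₅ (T-w j) (sgn j))
          e : + tri (- + 1 - j) + (+ n + (- + 1 - j) + + 1) ≡ + tri j + (+ n + j + + 1)
          e = trans (cong (_+ (+ n + (- + 1 - j) + + 1)) (tri-eq (- + 1 - j) j (+ 2 * j + + 1) (l₆ j))) (l₇ (+ tri j) (+ n) j)

    -- Interchanging the summations.

    -- The double family is jointly summable because its exponent is at least δ n + tri j, with δ n
    -- ≥ n and tri j ≥ |j| - 2; the two iterated sums then agree.
    exchange : ∀ (δ : ℕ → ℕ) → (∀ n → n ℕ.≤ δ n) → ∀ w (X : ℕ → ℤ → Ser) {s} {g : ℤ → Ser} →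
      SumS (λ n → qp (δ n) ⊗ Mom w (X n)) s → (∀ j → SumS (λ n → qp (δ n) ⊗ X n j) (g j)) →
      SumS (λ j → term (w j * sgn j) (EL j) ⊗ g j) s
    exchange δ δ≥ w X {s} {g} outer inner = sumS-outer (λ j → sumS-cong (λ n → swapped n j) ≈-refl (sumS-⊗ (term (w j * sgn j) (EL j)) (inner j)))
        (sumS-bij swap≃ (sumS-joint {F = F} (λ n → sumS-⊗ (qp (δ n)) (mom w (X n))) summable outer))
      where
      F : ℕ × ℤ → Ser
      F (n , j) = qp (δ n) ⊗ momF w (X n) j
      swapped : ∀ n j → term (w j * sgn j) (EL j) ⊗ (qp (δ n) ⊗ X n j) ≗ F (n , j)
      swapped n j = solve 3 (λ a b c → a :* (b :* c) := b :* (a :* c)) ≈-refl (term (w j * sgn j) (EL j)) (qp (δ n)) (X n j)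
      summable : Summable F
      summable = size-summable 2 λ { N (n , j) l → ≐-trans
        (≗⇒≐ (≈-trans (solve 4 (λ a b c d → a :* (b :* c :* d) := a :* c :* (b :* d)) ≈-refl (qp (δ n)) (con (w j * sgn j)) (qp (tri j)) (X n j)) (⊗-cong (qp-* (δ n) (tri j)) ≈-refl)))
        (≐0-⊗ˡ (con (w j * sgn j) ⊗ X n j) (qp-small (ℕP.<⇒≤ (ℕP.+-cancelʳ-< 2 N (δ n ℕ.+ tri j) (ℕP.<-≤-trans l
          (ℕP.≤-trans (ℕP.+-mono-≤ (δ≥ n) (size-tri j)) (ℕP.≤-reflexive (sym (ℕP.+-assoc (δ n) (tri j) 2)))))))) ) }

    Iz-neg : ∀ {n k} → n ℕ.< k → Iz (+ n - + k) ≗ 𝟘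
    Iz-neg {n} {k} l = subst (λ k → Iz (+ n - + k) ≗ 𝟘) (ℕP.m+[n∸m]≡n l) (≡⇒≗ (cong Iz (m (+ n) (+ (k ℕ.∸ suc n)))))
      where
      m : ∀ n d → n - (+ 1 + n + d) ≡ - (+ 1 + d)
      m = solve-∀

    inner : ∀ (c : ℕ → Ser) k l {s} → SumS (λ m → c (m ℕ.+ k) ⊗ (I m ⊗ I (m ℕ.+ l))) s →
      SumS (λ n → c n ⊗ (Iz (+ n - + k) ⊗ Iz (+ n + (+ l - + k)))) s
    inner c k l S = sumS-shift k
        (λ n lt → ≈-trans (⊗-cong ≈-refl (⊗-cong (Iz-neg lt) ≈-refl)) (solve 2 (λ a b → a :* (κ (+ 0) :* b) := κ (+ 0)) ≈-refl (c n) (Iz (+ n + (+ l - + k)))))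
        (sumS-cong (λ m → ⊗-cong ≈-refl (⊗-cong (≡⇒≗ (cong Iz (sym (l₁ (+ m) (+ k))))) (≡⇒≗ (cong Iz (sym (l₂ (+ m) (+ k) (+ l))))))) ≈-refl S)
      where
      l₁ : ∀ m k → m + k - k ≡ m
      l₁ = solve-∀
      l₂ : ∀ m k l → m + k + (l - k) ≡ m + l
      l₂ = solve-∀

    -- The sign of j affects `XM n j` only through the order of its two factors, so the kernel is
    -- required for k = |j| alone.
    inner-M : ∀ (c s : ℕ → Ser) → (∀ k → SumS (λ m → c (m ℕ.+ k) ⊗ (I m ⊗ I (m ℕ.+ (k ℕ.+ k)))) (s k)) →
      ∀ j → SumS (λ n → c n ⊗ XM n j) (s ∣ j ∣)
    inner-M c s S j = go j
      where
      l : ∀ n k → n + (k + k - k) ≡ n + k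
      l = solve-∀
      l′ : ∀ n k → n + (k + k - k) ≡ n - - k
      l′ = solve-∀
      go : ∀ j → SumS (λ n → c n ⊗ XM n j) (s ∣ j ∣)
      go (+ k) = sumS-cong (λ n → ⊗-cong ≈-refl (⊗-cong ≈-refl (≡⇒≗ (cong Iz (l (+ n) (+ k)))))) ≈-refl (inner c k (k ℕ.+ k) (S k))
      go -[1+ k ] = sumS-cong (λ n → ⊗-cong ≈-refl (≈-trans (⊗-cong ≈-refl (≡⇒≗ (cong Iz (l′ (+ n) (+ suc k)))))
        (solve 2 (λ a b → a :* b := b :* a) ≈-refl (Iz (+ n - + suc k)) (Iz (+ n - -[1+ k ]))))) ≈-refl (inner c (suc k) (suc k ℕ.+ suc k) (S (suc k)))

    -- `XA` is symmetric under j ↦ -1 - j; this selects the nonnegative member of each orbit.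
    fold : ℤ → ℕ
    fold (+ k)    = k
    fold -[1+ k ] = k

    inner-A : ∀ (c s : ℕ → Ser) → (∀ k → SumS (λ m → c (m ℕ.+ k) ⊗ (I m ⊗ I (m ℕ.+ suc (k ℕ.+ k)))) (s k)) →
      ∀ j → SumS (λ n → c n ⊗ XA n j) (s (fold j))
    inner-A c s S (+ k) = sumS-cong (λ n → ⊗-cong ≈-refl (⊗-cong ≈-refl (≡⇒≗ (cong Iz (l (+ n) (+ k)))))) ≈-refl (inner c k (suc (k ℕ.+ k)) (S k))
      where
      l : ∀ n k → n + (+ 1 + (k + k) - k) ≡ n + k + + 1
      l = solve-∀
    inner-A c s S -[1+ k ] = sumS-cong (λ n → ⊗-cong ≈-refl (≈-trans (⊗-cong (≡⇒≗ (cong Iz (l₁ (+ n) (+ k)))) (≡⇒≗ (cong Iz (l₂ (+ n) (+ k)))))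
        (solve 2 (λ a b → a :* b := b :* a) ≈-refl (Iz (+ n + -[1+ k ] + + 1)) (Iz (+ n - -[1+ k ]))))) ≈-refl (inner c k (suc (k ℕ.+ k)) (S k))
      where
      l₁ : ∀ n k → n - k ≡ n + - (+ 1 + k) + + 1
      l₁ = solve-∀
      l₂ : ∀ n k → n + (+ 1 + (k + k) - k) ≡ n - - (+ 1 + k)
      l₂ = solve-∀

    cancel-E : ∀ a b → E ⊗ (a ⊗ (b ⊗ E⁻¹)) ≗ a ⊗ b
    cancel-E a b = ≈-trans (solve 4 (λ e a b i → e :* (a :* (b :* i)) := a :* b :* (e :* i)) ≈-refl E a b E⁻¹)
      (≈-trans (⊗-cong ≈-refl E-E⁻¹) (solve 2 (λ a b → a :* b :* κ (+ 1) := a :* b) ≈-refl a b))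

    cancel-E² : ∀ a b r → E ⊗ E ⊗ (a ⊗ (b ⊗ (E⁻¹ ⊗ E⁻¹ ⊗ r))) ≗ a ⊗ (b ⊗ r)
    cancel-E² a b r = ≈-trans (solve 5 (λ e i a b r → e :* e :* (a :* (b :* (i :* i :* r))) := e :* i :* (e :* i) :* (a :* (b :* r))) ≈-refl E E⁻¹ a b r)
      (≈-trans (⊗-cong (⊗-cong E-E⁻¹ E-E⁻¹) ≈-refl) (solve 1 (λ a → κ (+ 1) :* κ (+ 1) :* a := a) ≈-refl (a ⊗ (b ⊗ r))))

    term-qp : ∀ w t e z → + t + + e ≡ z → term w (+ t) ⊗ qp e ≗ term w z
    term-qp w t e z refl = ≈-trans (solve 3 (λ a b c → a :* b :* c := a :* (b :* c)) ≈-refl (con w) (qp t) (qp e)) (⊗-cong ≈-refl (qp-* t e))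

    -- With n = m + k, n² = k² + (m² + 2km): the inner sum is `G.g` at 2k, equal to 1 / E whatever k
    -- is, and a single theta series remains.
    square-M : ∀ w {s} → SumS (λ n → qp (n ℕ.* n) ⊗ Mom w (XM n)) s → SumM (λ j → w j * sgn j) (λ j → + tri j + j * j) (E ⊗ s)
    square-M w S = sumS-cong (λ j → ≈-trans (cancel-E (term (w j * sgn j) (EL j)) (qp (∣ j ∣ ℕ.* ∣ j ∣))) (term-qp (w j * sgn j) (tri j) (∣ j ∣ ℕ.* ∣ j ∣) (+ tri j + j * j) (+congˡ (+ tri j) (sq j)))) ≈-refl
      (sumS-⊗ E (exchange (λ n → n ℕ.* n) n≤n² w XM S (inner-M (λ n → qp (n ℕ.* n)) (λ k → qp (k ℕ.* k) ⊗ E⁻¹) kernel)))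
      where
      n≤n² : ∀ n → n ℕ.≤ n ℕ.* n
      n≤n² zero    = z≤n
      n≤n² (suc n) = ℕP.m≤m+n (suc n) (n ℕ.* suc n)
      sq : ∀ j → + (∣ j ∣ ℕ.* ∣ j ∣) ≡ j * j
      sq (+ n)    = ℤP.pos-* n n
      sq -[1+ n ] = refl
      l : ∀ m k → k ℕ.* k ℕ.+ (m ℕ.* m ℕ.+ (k ℕ.+ k) ℕ.* m) ≡ (m ℕ.+ k) ℕ.* (m ℕ.+ k)
      l = solveℕ
      kernel : ∀ k → SumS (λ m → qp ((m ℕ.+ k) ℕ.* (m ℕ.+ k)) ⊗ (I m ⊗ I (m ℕ.+ (k ℕ.+ k)))) (qp (k ℕ.* k) ⊗ E⁻¹)
      kernel k = sumS-cong (λ m → ≈-trans (solve 3 (λ a b c → a :* (b :* c) := a :* b :* c) ≈-refl (qp (k ℕ.* k)) (qp (G.ex-g (k ℕ.+ k) m)) (I m ⊗ I (m ℕ.+ (k ℕ.+ k))))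
        (⊗-cong (≈-sym (qp-⊗ {k ℕ.* k} {G.ex-g (k ℕ.+ k) m} (l m k))) ≈-refl)) (⊗-cong ≈-refl (G.g≗ (k ℕ.+ k))) (sumS-⊗ (qp (k ℕ.* k)) (G.sum-g (k ℕ.+ k)))

    -- Here n² + n = k² + k + (m² + (2k + 1) m), so `G.g` is needed at the odd index 2k + 1, which
    -- is the index that `XA` provides.
    oblong-A : ∀ w {s} → SumS (λ n → qp (n ℕ.* n ℕ.+ n) ⊗ Mom w (XA n)) s → SumM (λ j → w j * sgn j) (λ j → + tri j + (j * j + j)) (E ⊗ s)
    oblong-A w S = sumS-cong (λ j → ≈-trans (cancel-E (term (w j * sgn j) (EL j)) (qp (δ (fold j)))) (term-qp (w j * sgn j) (tri j) (δ (fold j)) (+ tri j + (j * j + j)) (+congˡ (+ tri j) (sq j)))) ≈-refl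
      (sumS-⊗ E (exchange δ (λ n → ℕP.m≤n+m n (n ℕ.* n)) w XA S (inner-A (qp ∘ δ) (λ k → qp (δ k) ⊗ E⁻¹) kernel)))
      where
      δ : ℕ → ℕ
      δ n = n ℕ.* n ℕ.+ n
      sq : ∀ j → + δ (fold j) ≡ j * j + j
      sq (+ n)    = cong (_+ + n) (ℤP.pos-* n n)
      sq -[1+ n ] = trans (cong (_+ + n) (ℤP.pos-* n n)) (l (+ n))
        where
        l : ∀ n → n * n + n ≡ - (+ 1 + n) * - (+ 1 + n) + - (+ 1 + n)
        l = solve-∀
      l : ∀ m k → k ℕ.* k ℕ.+ k ℕ.+ (m ℕ.* m ℕ.+ suc (k ℕ.+ k) ℕ.* m) ≡ (m ℕ.+ k) ℕ.* (m ℕ.+ k) ℕ.+ (m ℕ.+ k)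
      l = solveℕ
      kernel : ∀ k → SumS (λ m → qp (δ (m ℕ.+ k)) ⊗ (I m ⊗ I (m ℕ.+ suc (k ℕ.+ k)))) (qp (δ k) ⊗ E⁻¹)
      kernel k = sumS-cong (λ m → ≈-trans (solve 3 (λ a b c → a :* (b :* c) := a :* b :* c) ≈-refl (qp (δ k)) (qp (G.ex-g (suc (k ℕ.+ k)) m)) (I m ⊗ I (m ℕ.+ suc (k ℕ.+ k))))
        (⊗-cong (≈-sym (qp-⊗ {δ k} {G.ex-g (suc (k ℕ.+ k)) m} (l m k))) ≈-refl)) (⊗-cong ≈-refl (G.g≗ (suc (k ℕ.+ k)))) (sumS-⊗ (qp (δ k)) (G.sum-g (suc (k ℕ.+ k))))

    open Rk using (R; R-rec)

    -- For linear exponents the inner sum is a partial theta series divided by E². Its summation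
    -- index becomes the second index of the Hecke sum.
    linear-M : ∀ w {s} → SumS (λ n → qp n ⊗ Mom w (XM n)) s →
      SumS (λ j → term (w j * sgn j) (EL j) ⊗ (qp ∣ j ∣ ⊗ R (∣ j ∣ ℕ.+ ∣ j ∣))) (E ⊗ E ⊗ s)
    linear-M w S = sumS-cong (λ j → cancel-E² (term (w j * sgn j) (EL j)) (qp ∣ j ∣) (R (∣ j ∣ ℕ.+ ∣ j ∣))) ≈-refl
      (sumS-⊗ (E ⊗ E) (exchange id (λ _ → ℕP.≤-refl) w XM S (inner-M qp (λ k → qp k ⊗ (E⁻¹ ⊗ E⁻¹ ⊗ R (k ℕ.+ k))) kernel)))
      where
      kernel : ∀ k → SumS (λ m → qp (m ℕ.+ k) ⊗ (I m ⊗ I (m ℕ.+ (k ℕ.+ k)))) (qp k ⊗ (E⁻¹ ⊗ E⁻¹ ⊗ R (k ℕ.+ k)))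
      kernel k = sumS-cong (λ m → ≈-trans (solve 3 (λ a b c → a :* (b :* c) := a :* b :* c) ≈-refl (qp k) (qp m) (I m ⊗ I (m ℕ.+ (k ℕ.+ k))))
        (⊗-cong (≈-sym (qp-⊗ {k} {m} (ℕP.+-comm k m))) ≈-refl)) (⊗-cong ≈-refl (Rk.h≗ (k ℕ.+ k))) (sumS-⊗ (qp k) (Hk.sum-h (k ℕ.+ k)))

    double-M : ∀ w {s} → SumS (λ n → qp (2 ℕ.* n) ⊗ Mom w (XM n)) s →
      SumS (λ j → term (w j * sgn j) (EL j) ⊗ (qp (2 ℕ.* ∣ j ∣) ⊗ (R (∣ j ∣ ℕ.+ ∣ j ∣) ⊕ ⊖ (qp 1 ⊗ R (suc (∣ j ∣ ℕ.+ ∣ j ∣)))))) (E ⊗ E ⊗ s)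
    double-M w S = sumS-cong (λ j → cancel-E² (term (w j * sgn j) (EL j)) (qp (2 ℕ.* ∣ j ∣)) (r ∣ j ∣)) ≈-refl
      (sumS-⊗ (E ⊗ E) (exchange (λ n → 2 ℕ.* n) (λ n → ℕP.m≤m+n n _) w XM S (inner-M (λ n → qp (2 ℕ.* n)) (λ k → qp (2 ℕ.* k) ⊗ (E⁻¹ ⊗ E⁻¹ ⊗ r k)) kernel)))
      where
      r : ℕ → Ser
      r k = R (k ℕ.+ k) ⊕ ⊖ (qp 1 ⊗ R (suc (k ℕ.+ k)))
      l : ∀ m k → 2 ℕ.* k ℕ.+ 2 ℕ.* m ≡ 2 ℕ.* (m ℕ.+ k)
      l = solveℕ
      kernel : ∀ k → SumS (λ m → qp (2 ℕ.* (m ℕ.+ k)) ⊗ (I m ⊗ I (m ℕ.+ (k ℕ.+ k)))) (qp (2 ℕ.* k) ⊗ (E⁻¹ ⊗ E⁻¹ ⊗ r k))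
      kernel k = sumS-cong (λ m → ≈-trans (solve 3 (λ a b c → a :* (b :* c) := a :* b :* c) ≈-refl (qp (2 ℕ.* k)) (qp (2 ℕ.* m)) (I m ⊗ I (m ℕ.+ (k ℕ.+ k))))
          (⊗-cong (≈-sym (qp-⊗ {2 ℕ.* k} {2 ℕ.* m} (l m k))) ≈-refl))
        (⊗-cong ≈-refl (≈-trans (⊕-cong (Rk.h≗ (k ℕ.+ k)) (⊖-cong (⊗-cong ≈-refl (Rk.h≗ (suc (k ℕ.+ k))))))
          (solve 4 (λ e a b q → e :* a :- q :* (e :* b) := e :* (a :- q :* b)) ≈-refl (E⁻¹ ⊗ E⁻¹) (R (k ℕ.+ k)) (R (suc (k ℕ.+ k))) (qp 1))))
        (sumS-⊗ (qp (2 ℕ.* k)) (Hk.sum-h₂ (k ℕ.+ k)))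

    sumS-zero : ∀ {A : Set} {F : A → Ser} → (∀ x → F x ≗ 𝟘) → SumS F 𝟘
    sumS-zero z = mkS λ N → [] , ([] , λ x → inj₂ (≗⇒≐ (z x))) , ≐-refl

    signs : ℤ ≃ (ℕ ⊎ ℕ)
    signs = bij (λ { (+ zero) → inj₂ 0 ; (+ suc r) → inj₁ r ; -[1+ r ] → inj₂ (suc r) })
      (λ { (inj₁ r) → + suc r ; (inj₂ zero) → + 0 ; (inj₂ (suc r)) → -[1+ r ] })
      (λ { (inj₁ r) → refl ; (inj₂ zero) → refl ; (inj₂ (suc r)) → refl })
      (λ { (+ zero) → refl ; (+ suc r) → refl ; -[1+ r ] → refl })

    hecke-w : (ℤ → ℤ) → ℤ × ℤ → ℤ
    hecke-w v (i , k) = v i * sgn (i + k) * quad (i , k)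

    abstract
      Hecke : (ℤ → ℤ) → Ser
      Hecke v = total (tame-summable (quad-tame {EH} (λ { (i , k) → v i * sgn (i + k) }) tameH))
      sum-Hecke : ∀ v → SumM (hecke-w v) EH (Hecke v)
      sum-Hecke v = sumS-total (tame-summable (quad-tame {EH} (λ { (i , k) → v i * sgn (i + k) }) tameH))

    ρ : ℤ → Ser
    ρ (+ n)    = qp (n ℕ.+ n) ⊗ R (n ℕ.+ n)
    ρ -[1+ n ] = R (suc n ℕ.+ suc n)

    private
      ⊖-term : ∀ w t u e {x z} → - (w * u) ≡ x → + t + + e ≡ z → ⊖ (term w (+ t) ⊗ term u (+ e)) ≗ term x z
      ⊖-term w t u e {x} {z} p q = ≈-trans (⊖-cong (term-* {w} {+ t} {u} {+ e} (inj₂ (t , refl)) (inj₂ (e , refl))))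
        (≈-trans (≈-sym (⊖-as-⊗ (term (w * u) (+ t + + e)))) (≈-trans (term-con (- + 1) (w * u) (+ t + + e)) (term-≡ (trans (ℤP.-1*i≡-i (w * u)) p) q)))

    -- For i ≤ 0 the row runs over k ≤ 0 and is the partial theta series at 2|i|. For i ≥ 1 it runs
    -- over k ≥ 1, and starting one step later costs the factor q^{2i} in `ρ`.
    hecke-rows : ∀ v → SumS (λ i → ⊖ (term (v i * sgn i) (EL i) ⊗ ρ i)) (Hecke v)
    hecke-rows v = sumS-outer row (sum-Hecke v)
      where
      lower : ∀ i r → pos i ≡ + 0 → ∀ a → i ≡ - + a →
        ⊖ (term (v i * sgn i) (EL i) ⊗ Rk.F (a ℕ.+ a) r) ≗ term (hecke-w v (i , - + r)) (EH (i , - + r))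
      lower i r p a q = ⊖-term (v i * sgn i) (tri i) (sgnN r) (Rk.ex-r (a ℕ.+ a) r)
        (sym (trans (cong₂ (λ x y → v i * x * (y - + 1)) (trans (sgn-+ i (- + r)) (cong (sgn i *_) (sgn-neg (+ r)))) (cong₂ _+_ p (pos-down r))) (l (v i) (sgn i) (sgnN r))))
        (trans (cong (λ x → + tri i + (+ triN (suc r) + x)) (trans (ℤP.pos-* (a ℕ.+ a) r) (l₂ (+ a) (+ r)))) (trans (sym (ℤP.+-assoc (+ tri i) (+ triN (suc r)) (+ 2 * (- + a * - + r))))
          (cong₂ (λ x y → + tri i + + x + + 2 * (y * - + r)) (sym (tri-down r)) (sym q))))
        where
        l : ∀ v s t → v * (s * t) * (+ 0 + + 0 - + 1) ≡ - (v * s * t)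
        l = solve-∀
        l₂ : ∀ a r → (a + a) * r ≡ + 2 * (- a * - r)
        l₂ = solve-∀
      upper : ∀ a r → let i = + suc a in
        ⊖ (term (v i * sgn i) (EL i) ⊗ (qp (suc a ℕ.+ suc a) ⊗ Rk.F (suc a ℕ.+ suc a) r)) ≗ term (hecke-w v (i , + suc r)) (EH (i , + suc r))
      upper a r = ≈-trans (⊖-cong (⊗-cong ≈-refl (≈-trans (solve 3 (λ x y z → x :* (y :* z) := y :* (x :* z)) ≈-refl (qp k) (con (sgnN r)) (qp (Rk.ex-r k r))) (⊗-cong ≈-refl (qp-* k (Rk.ex-r k r))))))
        (⊖-term (v i * sgn i) (tri i) (sgnN r) (k ℕ.+ Rk.ex-r k r)
          (sym (trans (cong (λ x → v i * x * + 1) (sgn-+ i (+ suc r))) (l (v i) (sgn i) (sgnN r))))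
          (trans (cong (λ x → + tri i + (+ k + (+ triN (suc r) + x))) (ℤP.pos-* k r)) (l₂ (+ tri i) (+ triN (suc r)) (+ suc a) (+ r))))
        where
        k : ℕ
        k = suc a ℕ.+ suc a
        i : ℤ
        i = + suc a
        l : ∀ v s t → v * (s * - t) * + 1 ≡ - (v * s * t)
        l = solve-∀
        l₂ : ∀ t u a r → t + ((a + a) + (u + (a + a) * r)) ≡ t + u + + 2 * (a * (+ 1 + r))
        l₂ = solve-∀
      vanish : ∀ i k → quad (i , k) ≡ + 0 → 𝟘 ≗ term (hecke-w v (i , k)) (EH (i , k))
      vanish i k p = ≈-sym (term-0 (EH (i , k)) (trans (cong (v i * sgn (i + k) *_) p) (ℤP.*-zeroʳ (v i * sgn (i + k)))))
      down-row : ∀ i a → pos i ≡ + 0 → i ≡ - + a → SumS (λ k → term (hecke-w v (i , k)) (EH (i , k))) (⊖ (term (v i * sgn i) (EL i) ⊗ R (a ℕ.+ a)))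
      down-row i a p q = sumS-cong pt (solve 1 (λ a → κ (+ 0) :+ a := a) ≈-refl (⊖ (term (v i * sgn i) (EL i) ⊗ R (a ℕ.+ a))))
        (sumS-bij signs (sumS-⊎ (sumS-zero {F = λ _ → 𝟘} (λ _ → ≈-refl)) (sumS-⊖ (sumS-⊗ (term (v i * sgn i) (EL i)) (Rk.sum-R (a ℕ.+ a))))))
        where
        pt : ∀ k → _ ≗ term (hecke-w v (i , k)) (EH (i , k))
        pt (+ zero)  = lower i 0 p a q
        pt (+ suc r) = vanish i (+ suc r) (cong (λ x → x + + 1 - + 1) p)
        pt -[1+ r ]  = lower i (suc r) p a q
      row : ∀ i → SumS (λ k → term (hecke-w v (i , k)) (EH (i , k))) (⊖ (term (v i * sgn i) (EL i) ⊗ ρ i))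
      row (+ zero)  = sumS-cong (λ _ → ≈-refl) (⊖-cong (⊗-cong ≈-refl (solve 1 (λ a → a := κ (+ 1) :* a) ≈-refl (R 0)))) (down-row (+ 0) 0 refl refl)
      row -[1+ n ]  = down-row -[1+ n ] (suc n) refl refl
      row (+ suc a) = sumS-cong pt (solve 1 (λ a → a :+ κ (+ 0) := a) ≈-refl (⊖ (term (v (+ suc a) * sgn (+ suc a)) (EL (+ suc a)) ⊗ ρ (+ suc a))))
        (sumS-bij signs (sumS-⊎ (sumS-⊖ (sumS-⊗ (term (v (+ suc a) * sgn (+ suc a)) (EL (+ suc a))) (sumS-⊗ (qp (suc a ℕ.+ suc a)) (Rk.sum-R (suc a ℕ.+ suc a))))) (sumS-zero {F = λ _ → 𝟘} (λ _ → ≈-refl))))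
        where
        pt : ∀ k → _ ≗ term (hecke-w v (+ suc a , k)) (EH (+ suc a , k))
        pt (+ zero)  = vanish (+ suc a) (+ 0) refl
        pt (+ suc r) = upper a r
        pt -[1+ r ]  = vanish (+ suc a) -[1+ r ] refl

    -- With j = -i the rows agree one by one, because tri (-i) + |i| equals tri i + 2i for i > 0 and
    -- tri i for i ≤ 0. This is why the weight is reflected.
    linear-Hecke : ∀ w {s} → SumS (λ n → qp n ⊗ Mom w (XM n)) s → E ⊗ E ⊗ s ≗ ⊖ Hecke (λ i → w (- i))
    linear-Hecke w S = sumS-unique (sumS-bij negate (linear-M w S)) (sumS-cong pt ≈-refl (sumS-⊖ (hecke-rows (λ i → w (- i)))))
      where
      negate : ℤ ≃ ℤ
      negate = bij -_ -_ ℤP.neg-involutive ℤP.neg-involutive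
      t : ∀ c a b d e f X → a ℕ.+ b ≡ d ℕ.+ e → X ≗ f → con c ⊗ qp d ⊗ (qp e ⊗ X) ≗ con c ⊗ qp a ⊗ (qp b ⊗ f)
      t c a b d e f X p q = ≈-trans (solve 4 (λ c d e x → c :* d :* (e :* x) := c :* (d :* e) :* x) ≈-refl (con c) (qp d) (qp e) X)
        (≈-trans (⊗-cong (⊗-cong ≈-refl (≈-trans (qp-* d e) (qp-⊗ {a} {b} p))) q) (solve 4 (λ c d e x → c :* (d :* e) :* x := c :* d :* (e :* x)) ≈-refl (con c) (qp a) (qp b) f))
      pt : ∀ i → ⊖ (⊖ (term (w (- i) * sgn i) (EL i) ⊗ ρ i)) ≗ term (w (- i) * sgn (- i)) (EL (- i)) ⊗ (qp ∣ - i ∣ ⊗ R (∣ - i ∣ ℕ.+ ∣ - i ∣))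
      pt (+ zero) = solve 2 (λ t r → :- (:- (t :* (κ (+ 1) :* r))) := t :* (κ (+ 1) :* r)) ≈-refl (term (w (+ 0) * sgn (+ 0)) (EL (+ 0))) (R 0)
      pt (+ suc n) = ≈-trans (solve 1 (λ a → :- (:- a) := a) ≈-refl (term (w -[1+ n ] * sgn (+ suc n)) (EL (+ suc n)) ⊗ ρ (+ suc n)))
        (t (w -[1+ n ] * sgn (+ suc n)) (triN (suc (suc n))) (suc n) (triN (suc n)) (suc n ℕ.+ suc n) (R (suc n ℕ.+ suc n)) (R (suc n ℕ.+ suc n)) (l (suc n) (triN (suc n))) ≈-refl)
        where
        l : ∀ n t → n ℕ.+ t ℕ.+ n ≡ t ℕ.+ (n ℕ.+ n)
        l = solveℕ
      pt -[1+ n ] = ≈-trans (solve 2 (λ a b → :- (:- (a :* b)) := a :* (κ (+ 1) :* b)) ≈-refl (term (w (+ suc n) * sgn -[1+ n ]) (EL -[1+ n ])) (R (suc n ℕ.+ suc n)))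
        (t (w (+ suc n) * sgn (+ suc n)) (triN (suc n)) (suc n) (triN (suc (suc n))) 0 (R (suc n ℕ.+ suc n)) (R (suc n ℕ.+ suc n)) (l (suc n) (triN (suc n))) ≈-refl)
        where
        l : ∀ n t → t ℕ.+ n ≡ n ℕ.+ t ℕ.+ 0
        l = solveℕ

    -- the two sides differ, row by row, by terms antisymmetric under j ↦ -1 - j
    double-Hecke : ∀ {s} → SumS (λ n → qp (2 ℕ.* n) ⊗ Mom T-w (XM n)) s → E ⊗ E ⊗ s ≗ ⊖ Hecke T-w
    double-Hecke {s} S = ≈-trans (solve 2 (λ a b → a := a :- :- b :+ :- b) ≈-refl (E ⊗ E ⊗ s) (Hecke T-w))
        (≈-trans (⊕-cong (double-zero anti) ≈-refl) (solve 1 (λ a → κ (+ 0) :+ a := a) ≈-refl (⊖ Hecke T-w)))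
      where
      C D : ℤ → Ser
      C j = qp (2 ℕ.* ∣ j ∣) ⊗ (R (∣ j ∣ ℕ.+ ∣ j ∣) ⊕ ⊖ (qp 1 ⊗ R (suc (∣ j ∣ ℕ.+ ∣ j ∣))))
      D j = C j ⊕ ⊖ ρ j
      tm : ℤ → Ser
      tm j = term (T-w j * sgn j) (EL j)
      total′ : SumS (λ j → tm j ⊗ D j) (E ⊗ E ⊗ s ⊕ ⊖ (⊖ Hecke T-w))
      total′ = sumS-cong (λ j → solve 3 (λ t c r → t :* c :- :- (:- (t :* r)) := t :* (c :- r)) ≈-refl (tm j) (C j) (ρ j)) ≈-refl
        (sumS-⊕ (double-M T-w S) (sumS-⊖ (sumS-⊖ (hecke-rows T-w))))
      D-up : ∀ k → D (+ k) ≗ ⊖ (qp (suc (k ℕ.+ k)) ⊗ R (suc (k ℕ.+ k)))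
      D-up k = ≈-trans (⊕-cong (⊗-cong (≡⇒≗ (cong qp (l k))) ≈-refl) ≈-refl)
        (≈-trans (solve 4 (λ a b x y → a :* (x :- b :* y) :- a :* x := :- (b :* a :* y)) ≈-refl (qp (k ℕ.+ k)) (qp 1) (R (k ℕ.+ k)) (R (suc (k ℕ.+ k)))) (⊖-cong (⊗-cong (qp-* 1 (k ℕ.+ k)) ≈-refl)))
        where
        l : ∀ k → 2 ℕ.* k ≡ k ℕ.+ k
        l = solveℕ
      D-down : ∀ k → D -[1+ k ] ≗ ⊖ R (suc (k ℕ.+ k))
      D-down k = ≈-trans (⊕-cong (⊗-cong (≡⇒≗ (cong qp (l (suc k)))) (⊕-cong step ≈-refl)) (⊖-cong step))
          (≈-trans (solve 3 (λ a b y → a :* (κ (+ 1) :- b :* a :* y :- b :* y) :- (κ (+ 1) :- b :* a :* y) := :- (κ (+ 1) :- a :* (κ (+ 1) :- b :* a :* y))) ≈-refl (qp m) (qp 1) (R (suc m)))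
          (⊖-cong (≈-trans (⊕-cong ≈-refl (⊖-cong (⊗-cong (≡⇒≗ (cong qp (cong suc (ℕP.+-suc k k)))) (≈-trans (≈-sym step) (≡⇒≗ (cong R (cong suc (ℕP.+-suc k k)))))))) (≈-sym (R-rec (suc (k ℕ.+ k)))))))
        where
        m : ℕ
        m = suc k ℕ.+ suc k
        step : R m ≗ 𝟙 ⊕ ⊖ (qp 1 ⊗ qp m ⊗ R (suc m))
        step = ≈-trans (R-rec m) (⊕-cong ≈-refl (⊖-cong (⊗-cong (≈-sym (qp-* 1 m)) ≈-refl)))
        l : ∀ k → 2 ℕ.* k ≡ k ℕ.+ k
        l = solveℕ
      pair-sym : ∀ k → tm -[1+ k ] ⊗ D -[1+ k ] ≗ ⊖ (tm (+ k) ⊗ D (+ k))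
      pair-sym k = ≈-trans (⊗-cong (⊗-cong (≈-trans (≡⇒≗ (cong con w)) (≗-pw (con-* (- + 1) (T-w (+ k) * sgn (+ k))))) (≈-trans (≡⇒≗ (cong qp (l k (triN k)))) (≈-sym (qp-* (tri (+ k)) (suc (k ℕ.+ k)))))) (D-down k))
          (≈-trans (solve 4 (λ c t u r → κ (- + 1) :* c :* (t :* u) :* :- r := :- (c :* t :* :- (u :* r))) ≈-refl (con (T-w (+ k) * sgn (+ k))) (qp (tri (+ k))) (qp (suc (k ℕ.+ k))) (R (suc (k ℕ.+ k))))
            (⊖-cong (⊗-cong ≈-refl (≈-sym (D-up k)))))
        where
        l : ∀ k t → suc k ℕ.+ (k ℕ.+ t) ≡ t ℕ.+ suc (k ℕ.+ k)
        l = solveℕ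
        m₁ : ∀ k → - (+ 1 + k) + + 1 ≡ + 1 - (k + + 1)
        m₁ = solve-∀
        m₂ : ∀ t s → t * - s ≡ - + 1 * (t * s)
        m₂ = solve-∀
        w : T-w -[1+ k ] * sgn -[1+ k ] ≡ - + 1 * (T-w (+ k) * sgn (+ k))
        w = trans (cong (_* sgn -[1+ k ]) (cong ℤ.+_ (trans (cong tri (m₁ (+ k))) (tri-reflect (+ k + + 1))))) (m₂ (T-w (+ k)) (sgn (+ k)))
      anti : E ⊗ E ⊗ s ⊕ ⊖ (⊖ Hecke T-w) ≗ ⊖ (E ⊗ E ⊗ s ⊕ ⊖ (⊖ Hecke T-w))
      anti = sumS-unique (sumS-bij flip≃ total′) (sumS-cong pt ≈-refl (sumS-⊖ total′))
        where
        pt : ∀ j → ⊖ (tm j ⊗ D j) ≗ tm (- + 1 - j) ⊗ D (- + 1 - j)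
        pt (+ zero)  = ≈-sym (pair-sym 0)
        pt (+ suc k) = ≈-sym (pair-sym (suc k))
        pt -[1+ k ]  = ≈-trans (⊖-cong (pair-sym k)) (≈-trans (solve 1 (λ a → :- (:- a) := a) ≈-refl (tm (+ k) ⊗ D (+ k))) (≡⇒≗ (cong (λ z → tm z ⊗ D z) (m (+ k)))))
          where
          m : ∀ k → k ≡ - + 1 - - (+ 1 + k)
          m = solve-∀

    -- Comparison with the given definition of `pp`.

    open Defs using (Series; sumTo; _⊛_; one; geom; invPoch; invPochInf; shift; expo; pp)

    ι : Series → Ser
    ι f m = + f m

    sumTo-head : ∀ K f → sumTo (suc K) f ≡ f 0 ℕ.+ sumTo K (f ∘ suc)
    sumTo-head zero    f = sym (ℕP.+-identityʳ (f 0))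
    sumTo-head (suc K) f = trans (cong (ℕ._+ f (suc K)) (sumTo-head K f)) (ℕP.+-assoc (f 0) (sumTo K (f ∘ suc)) (f (suc K)))

    ι-⊛ : ∀ f g → ι (f ⊛ g) ≗ ι f ⊗ ι g
    ι-⊛ f g = ≗-pw (go f)
      where
      go : ∀ f m → + (f ⊛ g) m ≡ (ι f ⊗ ι g) m
      go f zero    = ℤP.pos-* (f 0) (g 0)
      go f (suc m) = trans (cong ℤ.+_ (sumTo-head (suc m) (λ k → f k ℕ.* g (suc m ℕ.∸ k))))
        (cong₂ _+_ (ℤP.pos-* (f 0) (g (suc m))) (go (f ∘ suc) m))

    ι-one : ι one ≗ 𝟙
    ι-one = ≗-pw λ { zero → refl ; (suc m) → refl }

    ι-invPoch : ∀ a n → ι (invPoch a n) ≗ Inv a n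
    ι-invPoch a zero    = ι-one
    ι-invPoch a (suc n) = ≈-trans (ι-⊛ (invPoch a n) (geom (a ℕ.+ n))) (⊗-cong (ι-invPoch a n) ≈-refl)

    ι-shift : ∀ e f → ι (shift e f) ≗ qp e ⊗ ι f
    ι-shift e f = ≗-pw pt
      where
      pt : ∀ m → + shift e f m ≡ (qp e ⊗ ι f) m
      pt m with e ℕ.≤? m
      ... | yes l = trans (sym (qp-at e (ι f) (m ℕ.∸ e))) (cong (qp e ⊗ ι f) (ℕP.m+[n∸m]≡n l))
      ... | no nl = sym (trans (below (≐0-⊗ˡ (ι f) (qp-small ℕP.≤-refl)) m (ℕP.≰⇒> nl)) (con0 m))

    -- 1 / (q^a; q)_∞
    Inv∞ : ℕ → Ser
    Inv∞ a m = Inv a (suc m) m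

    geo-small : ∀ k → geo (suc k) ≐[ suc k ] 𝟙
    geo-small k = ≐-sym (≐-trans (≗⇒≐ (≈-sym (1-q-geo k))) (≐-trans (≐-⊗ (1-q-small (suc k)) ≐-refl) (≗⇒≐ (solve 1 (λ a → κ (+ 1) :* a := a) ≈-refl (geo (suc k))))))

    Inv-lim : ∀ k n → Inv (suc k) n ≐[ n ] Inv∞ (suc k)
    Inv-lim k n = mk≐ λ m l → trans (cong (λ n → Inv (suc k) n m) (sym (ℕP.m+[n∸m]≡n l))) (below (ext (suc m) (n ℕ.∸ suc m)) m ℕP.≤-refl)
      where
      ext : ∀ m d → Inv (suc k) (m ℕ.+ d) ≐[ m ] Inv (suc k) m
      ext m zero    = subst (λ n → Inv (suc k) n ≐[ m ] Inv (suc k) m) (sym (ℕP.+-identityʳ m)) ≐-refl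
      ext m (suc d) = subst (λ n → Inv (suc k) n ≐[ m ] Inv (suc k) m) (sym (ℕP.+-suc m d))
        (≐-trans (≐-⊗ ≐-refl (≐-mono (ℕP.≤-trans (ℕP.m≤m+n m d) (ℕP.≤-trans (ℕP.m≤n+m (m ℕ.+ d) k) (ℕP.n≤1+n _))) (geo-small (k ℕ.+ (m ℕ.+ d)))))
          (≐-trans (≗⇒≐ (solve 1 (λ a → a :* κ (+ 1) := a) ≈-refl (Inv (suc k) (m ℕ.+ d)))) (ext m d)))

    I-split : ∀ k n → I (k ℕ.+ n) ≗ I k ⊗ Inv (suc k) n
    I-split k zero    = ≈-trans (≡⇒≗ (cong I (ℕP.+-identityʳ k))) (solve 1 (λ a → a := a :* κ (+ 1)) ≈-refl (I k))
    I-split k (suc n) = ≈-trans (≡⇒≗ (cong I (ℕP.+-suc k n))) (≈-trans (⊗-cong (I-split k n) ≈-refl)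
      (solve 3 (λ a b c → a :* b :* c := a :* (b :* c)) ≈-refl (I k) (Inv (suc k) n) (geo (suc k ℕ.+ n))))

    Inv-P : ∀ k n → Inv (suc k) n ≗ P k ⊗ I (k ℕ.+ n)
    Inv-P k n = ≈-trans (solve 1 (λ a → a := κ (+ 1) :* a) ≈-refl (Inv (suc k) n)) (≈-trans (⊗-cong (≈-sym (P-I k)) ≈-refl)
      (≈-trans (solve 3 (λ a b c → a :* b :* c := a :* (b :* c)) ≈-refl (P k) (I k) (Inv (suc k) n)) (⊗-cong ≈-refl (≈-sym (I-split k n)))))

    E-Inv∞ : ∀ k → E ⊗ Inv∞ (suc k) ≗ P k
    E-Inv∞ k = ≈-trans (⊗-cong ≈-refl (≐⇒≗ λ N → ≐-trans (≐-sym (Inv-lim k N)) (≐-trans (≗⇒≐ (Inv-P k N))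
        (≐-⊗ ≐-refl (≐-mono (ℕP.≤-trans (ℕP.m≤n+m N k) (ℕP.n≤1+n _)) (I-lim (k ℕ.+ N)))))))
      (≈-trans (solve 3 (λ e p i → e :* (p :* i) := p :* (e :* i)) ≈-refl E (P k) E⁻¹) (≈-trans (⊗-cong ≈-refl E-E⁻¹) (solve 1 (λ a → a :* κ (+ 1) := a) ≈-refl (P k))))

    gf : ℕ → Ser
    gf i m = + pp i m

    -- The hypothesis says that the summand of index n = k + 1 starts no earlier than q^n, so
    -- cutting the outer sum at m is exact for coefficient m. Multiplication by E turns 1 / (q^n)_∞
    -- into (q)_{n-1}.
    sum-gf : ∀ i → (∀ k → k ℕ.< expo i (suc k)) → SumS (λ k → qp (expo i (suc k)) ⊗ b₊ k) (E ⊗ gf i)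
    sum-gf i h = sumS-cong pointwise ≈-refl (sumS-⊗ E (sumS-partial small partial))
      where
      F : ℕ → Series
      F k = Defs.term (expo i (suc k)) (suc k)
      F≗ : ∀ k → ι (F k) ≗ qp (expo i (suc k)) ⊗ (Inv∞ (suc k) ⊗ Inv (suc k) (suc (suc k)))
      F≗ k = ≈-trans (ι-shift (expo i (suc k)) (invPochInf (suc k) ⊛ invPoch (suc k) (suc (suc k)))) (⊗-cong ≈-refl
        (≈-trans (ι-⊛ (invPochInf (suc k)) (invPoch (suc k) (suc (suc k)))) (⊗-cong (≗-pw λ m → ex (ι-invPoch (suc k) (suc m)) m) (ι-invPoch (suc k) (suc (suc k))))))
      small : ∀ m → ι (F m) ≐[ m ] 𝟘
      small m = ≐-trans (≗⇒≐ (F≗ m)) (≐0-⊗ˡ (Inv∞ (suc m) ⊗ Inv (suc m) (suc (suc m))) (qp-small (ℕP.<⇒≤ (h m))))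
      total-at : ∀ N m → sumL (λ k → ι (F k)) (downFrom N) m ≡ + sumTo N (λ k → F k m)
      total-at zero    m = con0 m
      total-at (suc N) m = trans (⊕-at (ι (F N)) (sumL (λ k → ι (F k)) (downFrom N)) m)
        (trans (+congˡ (+ F N m) (total-at N m)) (cong ℤ.+_ (ℕP.+-comm (F N m) (sumTo N (λ k → F k m)))))
      tail : ∀ m d → sumTo (m ℕ.+ suc d) (λ k → F k m) ≡ sumTo (suc m) (λ k → F k m)
      tail m zero    = cong (λ n → sumTo n (λ k → F k m)) (ℕP.+-comm m 1)
      tail m (suc d) = trans (cong (λ n → sumTo n (λ k → F k m)) (ℕP.+-suc m (suc d))) (trans (cong₂ ℕ._+_ (tail m d)
        (ℤP.+-injective (trans (below (small (m ℕ.+ suc d)) m (ℕP.m<m+n m (s≤s z≤n))) (con0 m)))) (ℕP.+-identityʳ _))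
      top : ∀ m → sumTo (suc m) (λ k → F k m) ≡ pp i m
      top m = trans (cong (sumTo m (λ k → F k m) ℕ.+_) (ℤP.+-injective (trans (ex (F≗ m) m) (trans
          (below (≐0-⊗ˡ (Inv∞ (suc m) ⊗ Inv (suc m) (suc (suc m))) (qp-small ℕP.≤-refl)) m (h m)) (con0 m))))) (ℕP.+-identityʳ _)
      partial : ∀ N → sumL (λ k → ι (F k)) (downFrom N) ≐[ N ] gf i
      partial N = mk≐ λ m l → trans (total-at N m) (cong ℤ.+_ (trans (cong (λ n → sumTo n (λ k → F k m)) (sym (trans (ℕP.+-suc m (N ℕ.∸ suc m)) (ℕP.m+[n∸m]≡n l)))) (trans (tail m (N ℕ.∸ suc m)) (top m))))
      pointwise : ∀ k → E ⊗ ι (F k) ≗ qp (expo i (suc k)) ⊗ b₊ k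
      pointwise k = ≈-trans (⊗-cong ≈-refl (F≗ k)) (≈-trans (solve 4 (λ e q a b → e :* (q :* (a :* b)) := q :* (e :* a :* b)) ≈-refl E (qp (expo i (suc k))) (Inv∞ (suc k)) (Inv (suc k) (suc (suc k))))
        (⊗-cong ≈-refl (≈-trans (⊗-cong (E-Inv∞ k) (≈-trans (Inv-P k (suc (suc k))) (⊗-cong ≈-refl (≡⇒≗ (cong I (trans (ℕP.+-suc k (suc k)) (cong suc (ℕP.+-suc k k))))))))
          (solve 2 (λ p z → p :* (p :* z) := p :* p :* z) ≈-refl (P k) (I (suc (suc (k ℕ.+ k))))))))

    -- The identities of Jacobi, Euler and Rogers, and the four generating functions.

    module _ {A : Set} {{_ : DecEq A}} where
      sumS-≐ : ∀ {N} {F G : A → Ser} {s t} → (∀ x → F x ≐[ N ] G x) → SumS F s → SumS G t → s ≐[ N ] t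
      sumS-≐ {N} {F} {G} h S T =
        let (xs , cx , e) = part S N ; (ys , cy , e′) = part T N
            zs = union xs ys
        in ≐-trans (≐-sym (≐-trans (sumL-covers (covers-⊇ zs (union-! xs ys) (union-l xs ys) cx) cx) e))
          (≐-trans (go zs) (≐-trans (sumL-covers (covers-⊇ zs (union-! xs ys) (union-r xs ys) cy) cy) e′))
        where
        go : ∀ zs → sumL F zs ≐[ N ] sumL G zs
        go [] = ≐-refl
        go (z ∷ zs) = ≐-⊕ (h z) (go zs)

    -- the limit n → ∞ of the first moment
    jacobi : SumM (λ j → j * sgn j) EL (⊖ (E ⊗ E ⊗ E))
    jacobi = sumS-cong (λ _ → ≈-refl) Θ≗ ΘS
      where
      Θ : Ser
      Θ = total (tame-summable (tameL (λ j → j * sgn j)))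
      ΘS : SumM (λ j → j * sgn j) EL Θ
      ΘS = sumS-total (tame-summable (tameL (λ j → j * sgn j)))
      Iz-big : ∀ {N} d {z} → z ≡ + (N ℕ.+ d) → Iz z ≐[ N ] E⁻¹
      Iz-big {N} d refl = ≐-mono (ℕP.≤-trans (ℕP.m≤m+n N d) (ℕP.n≤1+n _)) (I-lim (N ℕ.+ d))
      -- The choice n = 2N + 2 exceeds every |j| ≤ N + 2 by at least N. All other j have tri j ≥ N
      -- and are invisible below q^N.
      near : ∀ N k → k ℕ.≤ suc (suc N) → let n = suc (suc N) ℕ.+ N in
        Iz (+ n - + k) ≐[ N ] E⁻¹ × Iz (+ n + + k) ≐[ N ] E⁻¹
      near N k l = Iz-big (suc (suc N) ℕ.∸ k) (trans (cong (λ x → + (x ℕ.+ N) - + k) (sym (ℕP.m+[n∸m]≡n l))) (l₁ (+ k) (+ (suc (suc N) ℕ.∸ k)) (+ N)))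
        , Iz-big (suc (suc N) ℕ.+ k) (l₂ (+ k) (+ N))
        where
        l₁ : ∀ k d n → k + d + n - k ≡ n + d
        l₁ = solve-∀
        l₂ : ∀ k n → + 2 + n + n + k ≡ n + (+ 2 + n + k)
        l₂ = solve-∀
      limit : ∀ N → Mom id-w (XM (suc (suc N) ℕ.+ N)) ≐[ N ] E⁻¹ ⊗ E⁻¹ ⊗ Θ
      limit N = sumS-≐ pt (mom id-w (XM (suc (suc N) ℕ.+ N))) (sumS-⊗ (E⁻¹ ⊗ E⁻¹) ΘS)
        where
        pt : ∀ j → momF id-w (XM (suc (suc N) ℕ.+ N)) j ≐[ N ] E⁻¹ ⊗ E⁻¹ ⊗ term (j * sgn j) (EL j)
        pt j with N ℕ.≤? tri j
        ... | yes l = ≐-trans (≐0-⊗ˡ (XM (suc (suc N) ℕ.+ N) j) (term-small (j * sgn j) (tri j) l)) (≐-sym (≐0-⊗ (E⁻¹ ⊗ E⁻¹) (term-small (j * sgn j) (tri j) l)))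
        ... | no nl = ≐-trans (≐-⊗ ≐-refl (go j (ℕP.≤-trans (size-tri j) (ℕP.≤-trans (ℕP.+-monoˡ-≤ 2 (ℕP.<⇒≤ (ℕP.≰⇒> nl))) (ℕP.≤-reflexive (ℕP.+-comm N 2))))))
            (≗⇒≐ (solve 2 (λ t e → t :* (e :* e) := e :* e :* t) ≈-refl (term (j * sgn j) (EL j)) E⁻¹))
          where
          go : ∀ j → ∣ j ∣ ℕ.≤ suc (suc N) → XM (suc (suc N) ℕ.+ N) j ≐[ N ] E⁻¹ ⊗ E⁻¹
          go (+ k) l = let (p , q) = near N k l in ≐-⊗ p q
          go -[1+ k ] l = let (p , q) = near N (suc k) l in ≐-⊗ q p
      limit′ : ∀ N → Mom id-w (XM (suc (suc N) ℕ.+ N)) ≐[ N ] ⊖ (E ⊗ E ⊗ E⁻¹)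
      limit′ N = ≐-trans (≗⇒≐ (M-id (suc N ℕ.+ N))) (≐-⊖ (≐-⊗ (≐-⊗ (≐-mono (ℕP.≤-trans (ℕP.m≤n+m N (suc N)) (ℕP.n≤1+n _)) (P-lim (suc N ℕ.+ N)))
        (≐-mono (ℕP.≤-trans (ℕP.m≤n+m N (suc (suc N))) (ℕP.n≤1+n _)) (P-lim (suc (suc N) ℕ.+ N))))
        (≐-mono (ℕP.≤-trans (ℕP.≤-trans (ℕP.m≤n+m N (suc N)) (ℕP.m≤n+m _ (suc N ℕ.+ N))) (ℕP.≤-trans (ℕP.n≤1+n _) (ℕP.≤-trans (ℕP.n≤1+n _) (ℕP.n≤1+n _)))) (I-lim (suc (suc ((suc N ℕ.+ N) ℕ.+ (suc N ℕ.+ N))))))))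
      Θ≗ : Θ ≗ ⊖ (E ⊗ E ⊗ E)
      Θ≗ = ≈-trans (solve 1 (λ t → t := κ (+ 1) :* κ (+ 1) :* t) ≈-refl Θ) (≈-trans (⊗-cong (⊗-cong (≈-sym E-E⁻¹) (≈-sym E-E⁻¹)) ≈-refl)
        (≈-trans (solve 3 (λ e i t → e :* i :* (e :* i) :* t := e :* e :* (i :* i :* t)) ≈-refl E E⁻¹ Θ)
        (≈-trans (⊗-cong ≈-refl (≐⇒≗ λ N → ≐-trans (≐-sym (limit N)) (limit′ N)))
        (≈-trans (solve 2 (λ e i → e :* e :* :- (e :* e :* i) := :- (e :* e :* e :* (e :* i))) ≈-refl E E⁻¹)
        (≈-trans (⊖-cong (⊗-cong ≈-refl E-E⁻¹)) (solve 1 (λ e → :- (e :* e :* e :* κ (+ 1)) := :- (e :* e :* e)) ≈-refl E))))))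

    -- By `M-one` only n = 0 survives. Feeding this into the same transforms as the weight T gives
    -- Euler's and Rogers' identities without extra work.
    sum-one : ∀ (δ : ℕ → ℕ) → δ 0 ≡ 0 → SumS (λ n → qp (δ n) ⊗ Mom one-w (XM n)) 𝟙
    sum-one δ p = sumS-cong (λ _ → ≈-refl) (≈-trans (⊕-cong (⊗-cong (≡⇒≗ (cong qp p)) (M-0 one-w)) ≈-refl) (solve 0 (κ (+ 1) :* κ (+ 1) :+ κ (+ 0) := κ (+ 1)) ≈-refl))
      (sumS-head (sumS-zero (λ n → ≈-trans (⊗-cong ≈-refl (M-one n)) (solve 1 (λ a → a :* κ (+ 0) := κ (+ 0)) ≈-refl (qp (δ (suc n)))))))

    -- The added term n = 0 has weight T_0 = 0, and for n ≥ 1 the moments are -b_n.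
    sum-T : ∀ (δ : ℕ → ℕ) {s : Ser} → SumS (λ k → qp (δ (suc k)) ⊗ b₊ k) s → SumS (λ n → qp (δ n) ⊗ Mom T-w (XM n)) (⊖ s)
    sum-T δ {s} S = sumS-cong (λ _ → ≈-refl) (≈-trans (⊕-cong (⊗-cong ≈-refl (M-0 T-w)) ≈-refl) (solve 2 (λ q s → q :* κ (+ 0) :+ s := s) ≈-refl (qp (δ 0)) (⊖ s)))
      (sumS-head (sumS-cong (λ n → ≈-trans (solve 2 (λ q b → :- (q :* b) := q :* :- b) ≈-refl (qp (δ (suc n))) (b₊ n)) (⊗-cong ≈-refl (≈-sym (M-T n)))) ≈-refl (sumS-⊖ S)))

    -- Euler's pentagonal number theorem: the exponent is j (3j - 1) / 2.
    pentagonal : SumM sgn (λ j → + tri j + j * j) E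
    pentagonal = sumS-cong (λ j → term-≡ {e = + tri j + j * j} (ℤP.*-identityˡ (sgn j)) refl) (solve 1 (λ e → e :* κ (+ 1) := e) ≈-refl E) (square-M one-w (sum-one (λ n → n ℕ.* n) refl))

    rogers : E ⊗ E ≗ ⊖ Hecke one-w
    rogers = ≈-trans (solve 1 (λ e → e :* e := e :* e :* κ (+ 1)) ≈-refl E) (linear-Hecke one-w (sum-one id refl))

    private
      E³ : ∀ p h → E ⊗ E ⊗ ⊖ (E ⊗ p) ≗ ⊖ h → E ⊗ E ⊗ E ⊗ p ≗ h
      E³ p h q = ≈-trans (solve 2 (λ e p → e :* e :* e :* p := :- (e :* e :* :- (e :* p))) ≈-refl E p) (≈-trans (⊖-cong q) (solve 1 (λ h → :- (:- h) := h) ≈-refl h))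

    -- The reflected weight T at -i equals tri i.
    gf₁ : E ⊗ E ⊗ E ⊗ gf 1 ≗ Hecke tri-w
    gf₁ = E³ (gf 1) (Hecke tri-w) (≈-trans (linear-Hecke T-w (sum-T id (sum-gf 1 λ _ → ℕP.≤-refl)))
        (⊖-cong (sumS-unique (sum-Hecke (λ i → T-w (- i))) (sumM-cong {w = hecke-w tri-w} {hecke-w (λ i → T-w (- i))} {EH} {EH}
          (λ { (i , k) → cong (λ x → x * sgn (i + k) * quad (i , k)) (cong ℤ.+_ (sym (trans (cong tri (ℤP.+-comm (- i) (+ 1))) (tri-reflect i)))) }) (λ _ → refl) (sum-Hecke tri-w)))))

    gf₂ : E ⊗ E ⊗ E ⊗ gf 2 ≗ Hecke T-w
    gf₂ = E³ (gf 2) (Hecke T-w) (double-Hecke (sum-T (λ n → 2 ℕ.* n) (sum-gf 2 λ k → ℕP.m≤m+n (suc k) _)))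

    -- `M-A` first replaces the kernel by `XA`, so that the exponent n² + n meets the odd shift
    -- required by `oblong-A`.
    gf₃ : SumM (λ j → T-w j * sgn j) (λ j → + tri j + (j * j + j)) (⊖ (E ⊗ E ⊗ gf 3))
    gf₃ = sumS-cong (λ _ → ≈-refl) (solve 2 (λ e p → e :* :- (e :* p) := :- (e :* e :* p)) ≈-refl E (gf 3))
      (oblong-A T-w (sumS-cong (λ n → ⊗-cong ≈-refl (M-A n)) ≈-refl (sum-T (λ n → n ℕ.* n ℕ.+ n) (sum-gf 3 λ k → ℕP.m≤n+m (suc k) (suc k ℕ.* suc k)))))

    gf₄ : SumM (λ j → T-w j * sgn j) (λ j → + tri j + j * j) (⊖ (E ⊗ E ⊗ gf 4))
    gf₄ = sumS-cong (λ _ → ≈-refl) (solve 2 (λ e p → e :* :- (e :* p) := :- (e :* e :* p)) ≈-refl E (gf 4))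
      (square-M T-w (sum-T (λ n → n ℕ.* n) (sum-gf 4 λ k → ℕP.m≤m+n (suc k) _)))

  open Bailey

  -- Support and vanishing on residue classes of exponents.

  cong? : ∀ ℓ x y → Dec (Cong ℓ x y)
  cong? ℓ x y = map′ (λ { (divides k e) → k by trans (l x y) (+congˡ y e) }) (λ { (k by e) → divides k (trans (cong (_- y) e) (l′ y (k * + ℓ))) }) (+ ℓ ∣? (x - y))
    where
    l : ∀ x y → x ≡ y + (x - y)
    l = solve-∀
    l′ : ∀ y k → y + k - y ≡ k
    l′ = solve-∀

  residue : ∀ ℓ .{{_ : NonZero ℓ}} z → ∃ λ (r : Fin ℓ) → Cong ℓ z (+ toℕ r)
  residue ℓ z = fromℕ< (n%ℕd<d z ℓ) , ((z /ℕ ℓ) by trans (a≡a%ℕn+[a/ℕn]*n z ℓ) (cong (λ r → + r + (z /ℕ ℓ) * + ℓ) (sym (toℕ-fromℕ< (n%ℕd<d z ℓ)))))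

  Cong⇒cls : ∀ ℓ {r i} → Cong ℓ i r → cls ℓ r i ≡ + 1
  Cong⇒cls ℓ {r} {i} (k by e) = cls-yes ℓ (divides k (trans (cong (_- r) e) (l r (k * + ℓ))))
    where
    l : ∀ y k → y + k - y ≡ k
    l = solve-∀

  ¬Cong⇒cls : ∀ ℓ {r i} → ¬ Cong ℓ i r → cls ℓ r i ≡ + 0
  ¬Cong⇒cls ℓ {r} {i} n = cls-no ℓ λ { (divides k e) → n (k by trans (l i r) (+congˡ r e)) }
    where
    l : ∀ x y → x ≡ y + (x - y)
    l = solve-∀

  -- ℓ is the odd number 2h + 1, so that halving is possible modulo ℓ
  module Odd (h : ℕ) where
    ℓ : ℕ
    ℓ = suc (h ℕ.+ h)

    open CongRel (Cong-rel ℓ)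

    -- Let x be the difference of the two triangular values. Since 2x = yℓ and ℓ = 2h + 1, x = xℓ -
    -- h (2x) = (x - hy) ℓ; this is the quotient supplied.
    tri-cong : ∀ {z r} → Cong ℓ z r → Cong ℓ (+ tri z) (+ tri r)
    tri-cong {z} {r} (k by e) = (x - + h * y) by trans (trans (l₁ (+ tri z) (+ tri r)) (+congˡ (+ tri r) (l₂ x (+ h)))) (+congˡ (+ tri r) (trans (cong (λ t → x * + ℓ - + h * t) two) (l₃ x (+ h) y (+ ℓ))))
      where
      x y : ℤ
      x = + tri z - + tri r
      y = k * (z + r - + 1)
      l₁ : ∀ a b → a ≡ b + (a - b)
      l₁ = solve-∀
      l₂ : ∀ x h → x ≡ x * (+ 1 + (h + h)) - h * (+ 2 * x)
      l₂ = solve-∀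
      l₃ : ∀ x h y n → x * n - h * (y * n) ≡ (x - h * y) * n
      l₃ = solve-∀
      l₄ : ∀ a b → + 2 * (a - b) ≡ + 2 * a - + 2 * b
      l₄ = solve-∀
      l₅ : ∀ z r → z * z - z - (r * r - r) ≡ (z - r) * (z + r - + 1)
      l₅ = solve-∀
      l₆ : ∀ r kn s → (r + kn - r) * s ≡ kn * s
      l₆ = solve-∀
      l₇ : ∀ k n s → k * n * s ≡ k * s * n
      l₇ = solve-∀
      two : + 2 * x ≡ y * + ℓ
      two = trans (l₄ (+ tri z) (+ tri r)) (trans (cong₂ _-_ (tri-double z) (tri-double r)) (trans (l₅ z r)
        (trans (cong (λ w → (w - r) * (z + r - + 1)) e) (trans (l₆ r (k * + ℓ) (z + r - + 1)) (l₇ k (+ ℓ) (z + r - + 1))))))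

    EH-cong : ∀ {i k r s} → Cong ℓ i r → Cong ℓ k s → Cong ℓ (EH (i , k)) (EH (r , s))
    EH-cong p q = r+ (r+ (tri-cong p) (tri-cong q)) (r* (rrefl {+ 2}) (r* p q))

  module Classes (ℓ : ℕ) where
    open Modulo ℓ public
    open Cancel ℓ public

    -- Modulo ℓ: `Van c` means no exponent in the class c, `Off c` means no exponent off the class
    -- c. The second grades products by ℤ/ℓ.
    Van Off : ℤ → Ser → Set
    Van c f = ∀ m → Cong ℓ (+ m) c → Cong ℓ (f m) (+ 0)
    Off c f = ∀ m → ¬ Cong ℓ (+ m) c → Cong ℓ (f m) (+ 0)

    Off⇒Van : ∀ {c d f} → ¬ Cong ℓ d c → Off c f → Van d f
    Off⇒Van n o m p = o m (λ q → n (rtrans (rsym p) q))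

    Van-≈ : ∀ {c f g} → f ≈ g → Van c f → Van c g
    Van-≈ p v m q = rtrans (rsym (at p m)) (v m q)

    Off-≈ : ∀ {c f g} → f ≈ g → Off c f → Off c g
    Off-≈ p o m q = rtrans (rsym (at p m)) (o m q)

    zero-+ : ∀ {x y} → Cong ℓ x (+ 0) → Cong ℓ y (+ 0) → Cong ℓ (x + y) (+ 0)
    zero-+ p q = r+ p q

    zero-* : ∀ {x} y → Cong ℓ x (+ 0) → Cong ℓ (y * x) (+ 0)
    zero-* y p = rtrans (r* (rrefl {y}) p) (Cong-≡ (ℤP.*-zeroʳ y))

    zero-*ʳ : ∀ {x} y → Cong ℓ x (+ 0) → Cong ℓ (x * y) (+ 0)
    zero-*ʳ y p = rtrans (r* p (rrefl {y})) (Cong-≡ (ℤP.*-zeroˡ y))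

    Van-⊕ : ∀ {c f g} → Van c f → Van c g → Van c (f ⊕ g)
    Van-⊕ {f = f} {g} p q m e = rtrans (Cong-≡ (⊕-at f g m)) (zero-+ (p m e) (q m e))

    Off-⊕ : ∀ {c f g} → Off c f → Off c g → Off c (f ⊕ g)
    Off-⊕ {f = f} {g} p q m e = rtrans (Cong-≡ (⊕-at f g m)) (zero-+ (p m e) (q m e))

    Off-⊖ : ∀ {c f} → Off c f → Off c (⊖ f)
    Off-⊖ {f = f} p m e = rtrans (Cong-≡ (⊖-at f m)) (Cong-neg (p m e))

    Van-⊖ : ∀ {c f} → Van c f → Van c (⊖ f)
    Van-⊖ {f = f} p m e = rtrans (Cong-≡ (⊖-at f m)) (Cong-neg (p m e))

    ⊗-zero : ∀ f g m → (∀ i j → i ℕ.+ j ≡ m → Cong ℓ (f i * g j) (+ 0)) → Cong ℓ ((f ⊗ g) m) (+ 0)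
    ⊗-zero f g zero    h = h 0 0 refl
    ⊗-zero f g (suc m) h = zero-+ (h 0 (suc m) refl) (⊗-zero (f ∘ suc) g m (λ i j e → h (suc i) j (cong suc e)))

    Off-⊗ : ∀ {c d f g} → Off c f → Off d g → Off (c + d) (f ⊗ g)
    Off-⊗ {c} {d} {f} {g} p q m n = ⊗-zero f g m λ i j e → go i j e (cong? ℓ (+ i) c) (cong? ℓ (+ j) d)
      where
      go : ∀ i j → i ℕ.+ j ≡ m → Dec (Cong ℓ (+ i) c) → Dec (Cong ℓ (+ j) d) → Cong ℓ (f i * g j) (+ 0)
      go i j e (yes a) (yes b) = ⊥-elim (n (rtrans (Cong-≡ (cong ℤ.+_ (sym e))) (r+ a b)))
      go i j e (no a)  _       = zero-*ʳ (g j) (p i a)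
      go i j e _       (no b)  = zero-* (f i) (q j b)

    Off-Van-⊗ : ∀ {c d f g} → Off c f → Van d g → Van (c + d) (f ⊗ g)
    Off-Van-⊗ {c} {d} {f} {g} p q m n = ⊗-zero f g m λ i j e → go i j e (cong? ℓ (+ i) c)
      where
      go : ∀ i j → i ℕ.+ j ≡ m → Dec (Cong ℓ (+ i) c) → Cong ℓ (f i * g j) (+ 0)
      go i j e (no a)  = zero-*ʳ (g j) (p i a)
      go i j e (yes a) = zero-* (f i) (q j (rtrans (Cong-≡ (l (+ i) (+ j))) (rtrans (r+ (rtrans (Cong-≡ (cong ℤ.+_ e)) n) (Cong-neg a)) (Cong-≡ (l′ c d)))))
        where
        l : ∀ i j → j ≡ i + j + - i
        l = solve-∀
        l′ : ∀ c d → c + d + - c ≡ d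
        l′ = solve-∀

    Off-con : ∀ c → Off (+ 0) (con c)
    Off-con c zero    n = ⊥-elim (n rrefl)
    Off-con c (suc m) n = rrefl

    Off-c⊗ : ∀ {c f} k → Off c f → Off c (con k ⊗ f)
    Off-c⊗ {f = f} k o m n = rtrans (Cong-≡ (⊗-con k f m)) (zero-* k (o m n))

    -- As u lives on exponents divisible by ℓ, coefficient m of the product involves only
    -- coefficients of g in the class of m. Strong induction inside that class isolates g m.
    Van-unit : ∀ u {g c} → u 0 ≡ + 1 → Off (+ 0) u → Van c (u ⊗ g) → Van c g
    Van-unit u {g} {c} u0 o v = <-rec (λ m → Cong ℓ (+ m) c → Cong ℓ (g m) (+ 0)) step
      where
      step : ∀ m → (∀ {k} → k ℕ.< m → Cong ℓ (+ k) c → Cong ℓ (g k) (+ 0)) → Cong ℓ (+ m) c → Cong ℓ (g m) (+ 0)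
      step m ih p = rtrans (rsym (top m p ih)) (v m p)
        where
        lead : ∀ m → u 0 * g m ≡ g m
        lead m = trans (cong (_* g m) u0) (ℤP.*-identityˡ (g m))
        top : ∀ m → Cong ℓ (+ m) c → (∀ {k} → k ℕ.< m → Cong ℓ (+ k) c → Cong ℓ (g k) (+ 0)) → Cong ℓ ((u ⊗ g) m) (g m)
        top zero    p ih = Cong-≡ (lead 0)
        top (suc m) p ih = rtrans (r+ (Cong-≡ (lead (suc m))) (⊗-zero (u ∘ suc) g m λ i j e → go i j e (cong? ℓ (+ suc i) (+ 0)))) (Cong-≡ (ℤP.+-identityʳ (g (suc m))))
          where
          l : ∀ i j → j ≡ + 1 + (i + j) + - (+ 1 + i)
          l = solve-∀
          go : ∀ i j → i ℕ.+ j ≡ m → Dec (Cong ℓ (+ suc i) (+ 0)) → Cong ℓ (u (suc i) * g j) (+ 0)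
          go i j e (no n)  = zero-*ʳ (g j) (o (suc i) n)
          go i j e (yes q) = zero-* (u (suc i)) (ih (s≤s (subst (j ℕ.≤_) e (ℕP.m≤n+m j i)))
            (rtrans (Cong-≡ (l (+ i) (+ j))) (rtrans (r+ (rtrans (Cong-≡ (cong (λ x → + 1 + + x) e)) p) (Cong-neg q)) (Cong-≡ (ℤP.+-identityʳ c)))))

    sum-at : ∀ {A : Set} {w E′ : A → ℤ} {s} m → SumM w E′ s → (∀ x → Cong ℓ (w x) (+ 0) ⊎ E′ x ≢ + m) → Cong ℓ (s m) (+ 0)
    sum-at {w = w} {E′} {s} m S h = let (xs , _ , e) = part S (suc m) in
      rtrans (Cong-≡ (sym (below e m ℕP.≤-refl))) (go xs)
      where
      qp-off : ∀ k m → k ≢ m → qp k m ≡ + 0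
      qp-off zero zero ne = ⊥-elim (ne refl)
      qp-off zero (suc m) ne = refl
      qp-off (suc k) zero ne = refl
      qp-off (suc k) (suc m) ne = qp-off k m (ne ∘ cong suc)
      qz-off : ∀ e → e ≢ + m → qz e m ≡ + 0
      qz-off (+ k) ne = qp-off k m (λ q → ne (cong ℤ.+_ q))
      qz-off -[1+ k ] ne = con0 m
      pt : ∀ x → Cong ℓ (term (w x) (E′ x) m) (+ 0)
      pt x with h x
      ... | inj₁ p = rtrans (Cong-≡ (⊗-con (w x) (qz (E′ x)) m)) (zero-*ʳ (qz (E′ x) m) p)
      ... | inj₂ ne = Cong-≡ (trans (⊗-con (w x) (qz (E′ x)) m) (trans (cong (w x *_) (qz-off (E′ x) ne)) (ℤP.*-zeroʳ (w x))))
      go : ∀ xs → Cong ℓ (sumL (λ x → term (w x) (E′ x)) xs m) (+ 0)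
      go [] = Cong-≡ (con0 m)
      go (x ∷ xs) = rtrans (Cong-≡ (⊕-at (term (w x) (E′ x)) (sumL (λ x → term (w x) (E′ x)) xs) m)) (zero-+ (pt x) (go xs))

    sum-Van : ∀ {A : Set} {w E′ : A → ℤ} {s c} → SumM w E′ s → (∀ x → Cong ℓ (w x) (+ 0) ⊎ ¬ Cong ℓ (E′ x) c) → Van c s
    sum-Van S h m p = sum-at m S λ x → [ inj₁ , (λ n → inj₂ λ e → n (rtrans (Cong-≡ e) p)) ]′ (h x)

    sum-Off : ∀ {A : Set} {w E′ : A → ℤ} {s c} → SumM w E′ s → (∀ x → w x ≡ + 0 ⊎ Cong ℓ (E′ x) c) → Off c s
    sum-Off S h m n = sum-at m S λ x → [ (λ e → inj₁ (Cong-≡ e)) , (λ q → inj₂ λ e → n (rtrans (Cong-≡ (sym e)) q)) ]′ (h x)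

    infixr 8 _^ˢ_
    _^ˢ_ : Ser → ℕ → Ser
    f ^ˢ zero  = 𝟙
    f ^ˢ suc n = f ⊗ f ^ˢ n

    ^ˢ-⊗ : ∀ f g n → (f ⊗ g) ^ˢ n ≈ f ^ˢ n ⊗ g ^ˢ n
    ^ˢ-⊗ f g zero    = solve 0 (κ (+ 1) := κ (+ 1) :* κ (+ 1)) ≈-refl
    ^ˢ-⊗ f g (suc n) = ≈-trans (⊗-cong ≈-refl (^ˢ-⊗ f g n)) (solve 4 (λ a b c d → a :* b :* (c :* d) := a :* c :* (b :* d)) ≈-refl f g (f ^ˢ n) (g ^ˢ n))

    ^ˢ-≐ : ∀ {N f g} n → f ≐[ N ] g → f ^ˢ n ≐[ N ] g ^ˢ n
    ^ˢ-≐ zero    p = ≐-refl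
    ^ˢ-≐ (suc n) p = ≐-⊗ p (^ˢ-≐ n p)

    qp-Off : ∀ n → Cong ℓ (+ n) (+ 0) → Off (+ 0) (qp n)
    qp-Off n p m q = go n m (λ e → q (rtrans (Cong-≡ (cong ℤ.+_ (sym e))) p))
      where
      go : ∀ k m → k ≢ m → Cong ℓ (qp k m) (+ 0)
      go zero zero ne = ⊥-elim (ne refl)
      go zero (suc m) ne = rrefl
      go (suc k) zero ne = rrefl
      go (suc k) (suc m) ne = go k m (ne ∘ cong suc)

    -- Each finite product of (1 - q^k)^ℓ is a series in q^ℓ modulo ℓ, and coefficientwise these
    -- products stabilise. The binomial congruence is a hypothesis, to be supplied by an explicit
    -- expansion for each prime.
    frobenius : (∀ x → (𝟙 ⊕ ⊖ x) ^ˢ ℓ ≈ 𝟙 ⊕ ⊖ (x ^ˢ ℓ)) → Off (+ 0) (E ^ˢ ℓ)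
    frobenius h m n = rtrans (Cong-≡ (sym (below (^ˢ-≐ ℓ (P-lim m)) m ℕP.≤-refl))) (P-Off m m n)
      where
      power : ∀ k n → qp k ^ˢ n ≗ qp (n ℕ.* k)
      power k zero    = Ex.≈-refl
      power k (suc n) = Ex.≈-trans (Ex.⊗-cong Ex.≈-refl (power k n)) (qp-* k (n ℕ.* k))
      factor : ∀ k → Off (+ 0) (1-q k ^ˢ ℓ)
      factor k = Off-≈ (≈-sym (≈-trans (h (qp k)) (⊕-cong ≈-refl (⊖-cong (lift ℓ (power k ℓ))))))
        (Off-⊕ (Off-con (+ 1)) (Off-⊖ (qp-Off (ℓ ℕ.* k) (+ k by trans (ℤP.pos-* ℓ k) (trans (ℤP.*-comm (+ ℓ) (+ k)) (sym (ℤP.+-identityˡ (+ k * + ℓ))))))))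
      P-Off : ∀ n → Off (+ 0) (P n ^ˢ ℓ)
      P-Off zero    = one ℓ
        where
        one : ∀ n → Off (+ 0) (𝟙 ^ˢ n)
        one zero    = Off-con (+ 1)
        one (suc n) = Off-⊗ {+ 0} {+ 0} (Off-con (+ 1)) (one n)
      P-Off (suc n) = Off-≈ (≈-sym (^ˢ-⊗ (P n) (1-q (suc n)) ℓ)) (Off-⊗ {+ 0} {+ 0} (P-Off n) (factor (suc n)))

    Van⇒∣ : ∀ {i c} → Van c (gf i) → ∀ m → Cong ℓ (+ m) c → ℓ ∣ Defs.pp i m
    Van⇒∣ v m p with v m p
    ... | k by e = ∣⇒∣ᵤ (divides k (trans e (ℤP.+-identityˡ (k * + ℓ))))

  -- The congruences modulo 3.

  module Three where
    open Classes 3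
    open Odd 1 using (tri-cong; EH-cong)

    E³-Off : Off (+ 0) (E ^ˢ 3)
    E³-Off = frobenius λ x → ≈-trans
      (solve 1 (λ x → (κ (+ 1) :- x) :* ((κ (+ 1) :- x) :* ((κ (+ 1) :- x) :* κ (+ 1))) := (κ (+ 1) :- x :* (x :* (x :* κ (+ 1)))) :+ κ (+ 3) :* (x :* x :- x)) ≈-refl x)
      (≈-trans (⊕-cong ≈-refl (⊗-cong (con-congr (+ 1 by refl)) ≈-refl)) (solve 2 (λ a b → a :+ κ (+ 0) :* b := a) ≈-refl (𝟙 ⊕ ⊖ (x ^ˢ 3)) (x ⊗ x ⊕ ⊖ x)))

    hecke-Van : ∀ v c → (∀ {z r} → Cong 3 z r → Cong 3 (v z) (v r)) →
      (∀ (r s : Fin 3) → Cong 3 (v (+ toℕ r)) (+ 0) ⊎ ¬ Cong 3 (EH (+ toℕ r , + toℕ s)) c) → Van c (Hecke v)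
    hecke-Van v c vc chk = sum-Van (sum-Hecke v) λ { (i , k) → let (r , p) = residue 3 i ; (s , q) = residue 3 k in
      [ (λ z → inj₁ (zero-*ʳ (quad (i , k)) (zero-*ʳ (sgn (i + k)) (rtrans (vc p) z)))) , (λ n → inj₂ λ e → n (rtrans (rsym (EH-cong p q)) e)) ]′ (chk r s) }

    van : ∀ i c v → E ⊗ E ⊗ E ⊗ gf i ≗ Hecke v → Van c (Hecke v) → Van c (gf i)
    van i c v p h = Van-unit (E ^ˢ 3) refl E³-Off (Van-≈ (≈-trans (≈-sym (lift 3 p)) (solve 2 (λ e p → e :* e :* e :* p := e :* (e :* (e :* κ (+ 1))) :* p) ≈-refl E (gf i))) h)

    -- Only i ≡ 2 has weight nonzero modulo 3, and there the exponents for k ≡ 0, 1, 2 are 1, 2, 1.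
    gf₁-Van : Van (+ 0) (gf 1)
    gf₁-Van = van 1 (+ 0) tri-w gf₁ (hecke-Van tri-w (+ 0) tri-cong
      (toWitness {a? = all? λ r → all? λ s → cong? 3 (tri-w (+ toℕ r)) (+ 0) ⊎-dec ¬? (cong? 3 (EH (+ toℕ r , + toℕ s)) (+ 0))} _))

    -- Only i ≡ 1 has weight nonzero modulo 3, and there the exponents for k ≡ 0, 1, 2 are 0, 2, 2.
    gf₂-Van : Van (+ 1) (gf 2)
    gf₂-Van = van 2 (+ 1) T-w gf₂ (hecke-Van T-w (+ 1) (λ p → tri-cong (r+ p rrefl))
      (toWitness {a? = all? λ r → all? λ s → cong? 3 (T-w (+ toℕ r)) (+ 0) ⊎-dec ¬? (cong? 3 (EH (+ toℕ r , + toℕ s)) (+ 1))} _))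

  -- Decomposition of weighted sums into residue pieces.

  sumZ-scale : ∀ {A : Set} (φ : A → ℤ) c xs → sumZ (λ x → φ x * c) xs ≡ sumZ φ xs * c
  sumZ-scale φ c []       = sym (ℤP.*-zeroˡ c)
  sumZ-scale φ c (x ∷ xs) = trans (+congˡ (φ x * c) (sumZ-scale φ c xs)) (sym (ℤP.*-distribʳ-+ c (φ x) (sumZ φ xs)))

  sumM-list : ∀ {A K : Set} {{_ : DecEq K}} {E′ : K → ℤ} (c : A → ℤ) {w : A → K → ℤ} {S : A → Ser} → (∀ r → SumM (w r) E′ (S r)) →
    ∀ rs → SumM (λ x → sumZ (λ r → c r * w r x) rs) E′ (sumL (λ r → con (c r) ⊗ S r) rs)
  sumM-list {E′ = E′} c h [] = sumS-zero (λ x → term-0 (E′ x) refl)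
  sumM-list {E′ = E′} c {w} h (r ∷ rs) = sumM-+ {w = λ x → c r * w r x} {λ x → sumZ (λ r → c r * w r x) rs} {E′} (sumM-scale (c r) {w r} {E′} (h r)) (sumM-list {E′ = E′} c {w} h rs)

  range : ℕ → List ℤ
  range ℓ = map ℤ.+_ (upTo ℓ)

  -- the indicator cls, but reducing on numerals
  δ : ℕ → ℤ → ℤ → ℤ
  δ ℓ r i = ind (+ ℓ ∣? (i - r))

  cls-cong : ∀ ℓ {r i j} → Cong ℓ i j → cls ℓ r i ≡ δ ℓ r j
  cls-cong ℓ {r} {i} {j} p with cong? ℓ i r
  ... | yes q = trans (Cong⇒cls ℓ q) (trans (sym (Cong⇒cls ℓ (rtrans (rsym p) q))) (cls-ind ℓ r j))
    where open CongRel (Cong-rel ℓ)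
  ... | no  n = trans (¬Cong⇒cls ℓ n) (trans (sym (¬Cong⇒cls ℓ (λ q → n (rtrans p q)))) (cls-ind ℓ r j))
    where open CongRel (Cong-rel ℓ)

  module Decompose (ℓ : ℕ) .{{_ : NonZero ℓ}} where
    open Modulo ℓ
    open Families ℓ

    -- Modulo ℓ the weight is a combination of class indicators. The second hypothesis is the finite
    -- check on representatives, phrased with `δ` so that it can be decided by computation.
    single : ∀ {f g : ℤ → ℤ} {E′ s} {S : ℤ → Ser} → (∀ {i r} → Cong ℓ i r → Cong ℓ (f i) (f r)) →
      (∀ (r : Fin ℓ) → sumZ (λ ν → f ν * δ ℓ ν (+ toℕ r)) (range ℓ) ≡ f (+ toℕ r)) →
      SumM (λ i → f i * g i) E′ s → (∀ ν → SumM (λ i → cls ℓ ν i * g i) E′ (S ν)) →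
      s ≈ sumL (λ ν → con (f ν) ⊗ S ν) (range ℓ)
    single {f} {g} {E′} fc chk S T = sumM-mod ℓ {λ i → f i * g i} {λ i → sumZ (λ ν → f ν * (cls ℓ ν i * g i)) (range ℓ)} {E′} pt S (sumM-list {E′ = E′} f {λ ν i → cls ℓ ν i * g i} T (range ℓ))
      where
      pt : ∀ i → Cong ℓ (f i * g i) (sumZ (λ ν → f ν * (cls ℓ ν i * g i)) (range ℓ))
      pt i = let (r , p) = residue ℓ i in rtrans (r* (rtrans (fc p) (Cong-≡ (sym (trans (sumZ-cong (λ ν → cong (f ν *_) (cls-cong ℓ p)) (range ℓ)) (chk r))))) (rrefl {g i}))
        (Cong-≡ (trans (sym (sumZ-scale (λ ν → f ν * cls ℓ ν i) (g i) (range ℓ))) (sumZ-cong (λ ν → ℤP.*-assoc (f ν) (cls ℓ ν i) (g i)) (range ℓ))))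

    hecke : ∀ {v : ℤ → ℤ} → (∀ {i r} → Cong ℓ i r → Cong ℓ (v i) (v r)) →
      (∀ (r s : Fin ℓ) → sumZ (λ z → v (proj₁ z) * (δ ℓ (proj₁ z) (+ toℕ r) * δ ℓ (proj₂ z) (+ toℕ s))) (cartesianProduct (range ℓ) (range ℓ)) ≡ v (+ toℕ r)) →
      Hecke v ≈ sumL (λ z → con (v (proj₁ z)) ⊗ H (proj₁ z) (proj₂ z)) (cartesianProduct (range ℓ) (range ℓ))
    hecke {v} vc chk = sumM-mod ℓ {hecke-w v} {λ x → sumZ (λ z → v (proj₁ z) * wH (proj₁ z) (proj₂ z) x) rs} {EH} pt (sum-Hecke v) (sumM-list {E′ = EH} (v ∘ proj₁) {λ z → wH (proj₁ z) (proj₂ z)} {λ z → H (proj₁ z) (proj₂ z)} (λ z → sumH (proj₁ z) (proj₂ z)) rs)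
      where
      rs : List (ℤ × ℤ)
      rs = cartesianProduct (range ℓ) (range ℓ)
      l : ∀ v a b s q → v * (a * b * s * q) ≡ v * (a * b) * (s * q)
      l = solve-∀
      pt : ∀ x → Cong ℓ (hecke-w v x) (sumZ (λ z → v (proj₁ z) * wH (proj₁ z) (proj₂ z) x) rs)
      pt (i , k) = let (r , p) = residue ℓ i ; (s , q) = residue ℓ k in
        rtrans (Cong-≡ (ℤP.*-assoc (v i) (sgn (i + k)) (quad (i , k))))
        (rtrans (r* (rtrans (vc p) (Cong-≡ (sym (trans (sumZ-cong (λ z → cong (v (proj₁ z) *_) (cong₂ _*_ (cls-cong ℓ p) (cls-cong ℓ q))) rs) (chk r s))))) (rrefl {sgn (i + k) * quad (i , k)}))
        (Cong-≡ (trans (sym (sumZ-scale (λ z → v (proj₁ z) * (cls ℓ (proj₁ z) i * cls ℓ (proj₂ z) k)) (sgn (i + k) * quad (i , k)) rs))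
          (sumZ-cong (λ z → sym (l (v (proj₁ z)) (cls ℓ (proj₁ z) i) (cls ℓ (proj₂ z) k) (sgn (i + k)) (quad (i , k)))) rs))))

  -- The congruences modulo 5.

  module FiveClasses where
    open Classes 5
    open Families 5
    open Periodic 5
    open Five using (α; β; L1; L3; L4; R2; R4; R5)
    open Odd 2 using (tri-cong; EH-cong)

    -- The ring solver knows no symmetry of `H`; sorting the indices reduces the 25 pieces to 15
    -- independent symbols.
    H-sort : ∀ a b → H a b ≗ H (a ℤ.⊓ b) (a ℤ.⊔ b)
    H-sort a b with ℤP.≤-total a b
    ... | inj₁ l = ≡⇒≗ (cong₂ H (sym (ℤP.i≤j⇒i⊓j≡i l)) (sym (ℤP.i≤j⇒i⊔j≡j l)))
    ... | inj₂ l = Ex.≈-trans (H-sym a b) (≡⇒≗ (cong₂ H (sym (ℤP.i≥j⇒i⊓j≡j l)) (sym (ℤP.i≥j⇒i⊔j≡i l))))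

    sorted : ∀ (v : ℤ → ℤ) (rs : List (ℤ × ℤ)) → sumL (λ z → con (v (proj₁ z)) ⊗ H (proj₁ z) (proj₂ z)) rs ≗ sumL (λ z → con (v (proj₁ z)) ⊗ H (proj₁ z ℤ.⊓ proj₂ z) (proj₁ z ℤ.⊔ proj₂ z)) rs
    sorted v rs = sumL-cong (λ z → Ex.⊗-cong Ex.≈-refl (H-sort (proj₁ z) (proj₂ z))) rs

    E⁵-Off : Off (+ 0) (E ^ˢ 5)
    E⁵-Off = frobenius λ x → ≈-trans
      (solve 1 (λ x → (κ (+ 1) :- x) :* ((κ (+ 1) :- x) :* ((κ (+ 1) :- x) :* ((κ (+ 1) :- x) :* ((κ (+ 1) :- x) :* κ (+ 1)))))
        := (κ (+ 1) :- x :* (x :* (x :* (x :* (x :* κ (+ 1)))))) :+ κ (+ 5) :* (x :* x :* x :* x :- κ (+ 2) :* x :* x :* x :+ κ (+ 2) :* x :* x :- x)) ≈-refl x)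
      (≈-trans (⊕-cong ≈-refl (⊗-cong (con-congr (+ 1 by refl)) ≈-refl)) (solve 2 (λ a b → a :+ κ (+ 0) :* b := a) ≈-refl (𝟙 ⊕ ⊖ (x ^ˢ 5)) (x ⊗ x ⊗ x ⊗ x ⊕ ⊖ (con (+ 2) ⊗ x ⊗ x ⊗ x) ⊕ con (+ 2) ⊗ x ⊗ x ⊕ ⊖ x)))

    -- Jacobi's series with weight j reduced modulo 5: the classes 0 and 1 give `α`, the classes 2
    -- and 4 give (-2 + 4) `β`, and the class 3 vanishes.
    E³≈ : E ⊗ E ⊗ E ≈ α ⊕ con (+ 2) ⊗ β
    E³≈ = ≈-trans (solve 1 (λ e → e := :- (:- e)) ≈-refl (E ⊗ E ⊗ E)) (≈-trans (⊖-cong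
        (≈-trans (Decompose.single 5 {f = id} {sgn} {EL} {S = L} id (toWitness {a? = all? λ r → _ ℤ.≟ _} _) jacobi sumL′)
        (⊕-cong ≈-refl (⊕-cong (⊗-cong ≈-refl (lift 5 L1)) (⊕-cong ≈-refl (⊕-cong (⊗-cong ≈-refl (lift 5 L3)) (⊕-cong (⊗-cong ≈-refl (lift 5 L4)) ≈-refl)))))))
      (≈-trans (solve 2 (λ a b → :- (κ (+ 0) :* a :+ (κ (+ 1) :* :- a :+ (κ (+ 2) :* b :+ (κ (+ 3) :* κ (+ 0) :+ (κ (+ 4) :* :- b :+ κ (+ 0))))))
        := a :+ κ (+ 2) :* b) ≈-refl α β) ≈-refl))

    α-Off : Off (+ 0) α
    α-Off = sum-Off (sumL′ (+ 0)) λ n → [ (λ p → inj₂ (tri-cong p)) , (λ q → inj₁ (cong (_* sgn n) q)) ]′ (case n)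
      where
      case : ∀ n → Cong 5 n (+ 0) ⊎ cls 5 (+ 0) n ≡ + 0
      case n with cong? 5 n (+ 0)
      ... | yes p = inj₁ p
      ... | no  q = inj₂ (¬Cong⇒cls 5 q)

    β-Off : Off (+ 1) β
    β-Off = sum-Off (sumL′ (+ 2)) λ n → [ (λ p → inj₂ (tri-cong p)) , (λ q → inj₁ (cong (_* sgn n) q)) ]′ (case n)
      where
      case : ∀ n → Cong 5 n (+ 2) ⊎ cls 5 (+ 2) n ≡ + 0
      case n with cong? 5 n (+ 2)
      ... | yes p = inj₁ p
      ... | no  q = inj₂ (¬Cong⇒cls 5 q)

    H-Off : ∀ a b {c} → True (cong? 5 (EH (a , b)) c) → Off c (H a b)
    H-Off a b {c} t = sum-Off (sumH a b) λ { (i , k) → go i k (cong? 5 i a) (cong? 5 k b) }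
      where
      go : ∀ i k → Dec (Cong 5 i a) → Dec (Cong 5 k b) → wH a b (i , k) ≡ + 0 ⊎ Cong 5 (EH (i , k)) c
      go i k (yes p) (yes q) = inj₂ (rtrans (EH-cong p q) (toWitness t))
      go i k (no n)  _       = inj₁ (trans (cong (λ x → x * cls 5 b k * sgn (i + k) * quad (i , k)) (¬Cong⇒cls 5 n)) refl)
      go i k _       (no n)  = inj₁ (cong (λ x → x * sgn (i + k) * quad (i , k)) (trans (cong (cls 5 a i *_) (¬Cong⇒cls 5 n)) (ℤP.*-zeroʳ (cls 5 a i))))

    apart : ∀ {c d f} → False (cong? 5 d c) → Off c f → Van d f
    apart n = Off⇒Van (toWitnessFalse n)

    Off-Van⇒0 : ∀ {c f} → Off c f → Van c f → f ≈ 𝟘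
    Off-Van⇒0 {c} o v = mk λ m → rtrans (go m (cong? 5 (+ m) c)) (Cong-≡ (sym (con0 m)))
      where
      go : ∀ m → Dec (Cong 5 (+ m) c) → _
      go m (yes p) = v m p
      go m (no n)  = o m n

    -- The pieces of -E² grouped by the class of `EH a b` modulo 5; the coefficient 2 counts the two
    -- orders of unequal indices. The series `G0` to `G4` are the same grouping for E³ P_2.
    S0 S1 S2 S3 S4 : Ser
    S0 = con (+ 1) ⊗ H (+ 0) (+ 0) ⊕ con (+ 2) ⊗ H (+ 0) (+ 1) ⊕ con (+ 2) ⊗ H (+ 1) (+ 2) ⊕ con (+ 1) ⊗ H (+ 2) (+ 2)
    S1 = con (+ 2) ⊗ H (+ 0) (+ 2) ⊕ con (+ 2) ⊗ H (+ 0) (+ 4) ⊕ con (+ 2) ⊗ H (+ 2) (+ 3)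
    S2 = con (+ 1) ⊗ H (+ 1) (+ 1)
    S3 = con (+ 2) ⊗ H (+ 0) (+ 3) ⊕ con (+ 2) ⊗ H (+ 2) (+ 4) ⊕ con (+ 2) ⊗ H (+ 3) (+ 4)
    S4 = con (+ 2) ⊗ H (+ 1) (+ 3) ⊕ con (+ 2) ⊗ H (+ 1) (+ 4) ⊕ con (+ 1) ⊗ H (+ 3) (+ 3) ⊕ con (+ 1) ⊗ H (+ 4) (+ 4)
    S0-Off : Off (+ 0) S0
    S0-Off = Off-⊕ (Off-⊕ (Off-⊕ (Off-c⊗ (+ 1) (H-Off (+ 0) (+ 0) _)) (Off-c⊗ (+ 2) (H-Off (+ 0) (+ 1) _))) (Off-c⊗ (+ 2) (H-Off (+ 1) (+ 2) _))) (Off-c⊗ (+ 1) (H-Off (+ 2) (+ 2) _))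
    S1-Off : Off (+ 1) S1
    S1-Off = Off-⊕ (Off-⊕ (Off-c⊗ (+ 2) (H-Off (+ 0) (+ 2) _)) (Off-c⊗ (+ 2) (H-Off (+ 0) (+ 4) _))) (Off-c⊗ (+ 2) (H-Off (+ 2) (+ 3) _))
    S2-Off : Off (+ 2) S2
    S2-Off = Off-c⊗ (+ 1) (H-Off (+ 1) (+ 1) _)
    S3-Off : Off (+ 3) S3
    S3-Off = Off-⊕ (Off-⊕ (Off-c⊗ (+ 2) (H-Off (+ 0) (+ 3) _)) (Off-c⊗ (+ 2) (H-Off (+ 2) (+ 4) _))) (Off-c⊗ (+ 2) (H-Off (+ 3) (+ 4) _))
    S4-Off : Off (+ 4) S4
    S4-Off = Off-⊕ (Off-⊕ (Off-⊕ (Off-c⊗ (+ 2) (H-Off (+ 1) (+ 3) _)) (Off-c⊗ (+ 2) (H-Off (+ 1) (+ 4) _))) (Off-c⊗ (+ 1) (H-Off (+ 3) (+ 3) _))) (Off-c⊗ (+ 1) (H-Off (+ 4) (+ 4) _))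

    S≈ : Hecke one-w ≈ S0 ⊕ S1 ⊕ S2 ⊕ S3 ⊕ S4
    S≈ = ≈-trans (Decompose.hecke 5 {one-w} (λ _ → rrefl) (toWitness {a? = all? λ r → all? λ s → _ ℤ.≟ _} _)) (≈-trans (lift 5 (sorted one-w (cartesianProduct (range 5) (range 5))))
      (solve 15 (λ h00 h01 h02 h03 h04 h11 h12 h13 h14 h22 h23 h24 h33 h34 h44 → κ (+ 1) :* h00 :+ (κ (+ 1) :* h01 :+ (κ (+ 1) :* h02 :+ (κ (+ 1) :* h03 :+ (κ (+ 1) :* h04 :+ (κ (+ 1) :* h01 :+ (κ (+ 1) :* h11 :+ (κ (+ 1) :* h12 :+ (κ (+ 1) :* h13 :+ (κ (+ 1) :* h14 :+ (κ (+ 1) :* h02 :+ (κ (+ 1) :* h12 :+ (κ (+ 1) :* h22 :+ (κ (+ 1) :* h23 :+ (κ (+ 1) :* h24 :+ (κ (+ 1) :* h03 :+ (κ (+ 1) :* h13 :+ (κ (+ 1) :* h23 :+ (κ (+ 1) :* h33 :+ (κ (+ 1) :* h34 :+ (κ (+ 1) :* h04 :+ (κ (+ 1) :* h14 :+ (κ (+ 1) :* h24 :+ (κ (+ 1) :* h34 :+ (κ (+ 1) :* h44 :+ (κ (+ 0))))))))))))))))))))))))))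
          := (κ (+ 1) :* h00 :+ κ (+ 2) :* h01 :+ κ (+ 2) :* h12 :+ κ (+ 1) :* h22) :+ (κ (+ 2) :* h02 :+ κ (+ 2) :* h04 :+ κ (+ 2) :* h23) :+ (κ (+ 1) :* h11) :+ (κ (+ 2) :* h03 :+ κ (+ 2) :* h24 :+ κ (+ 2) :* h34) :+ (κ (+ 2) :* h13 :+ κ (+ 2) :* h14 :+ κ (+ 1) :* h33 :+ κ (+ 1) :* h44)) ≈-refl (H (+ 0) (+ 0)) (H (+ 0) (+ 1)) (H (+ 0) (+ 2)) (H (+ 0) (+ 3)) (H (+ 0) (+ 4)) (H (+ 1) (+ 1)) (H (+ 1) (+ 2)) (H (+ 1) (+ 3)) (H (+ 1) (+ 4)) (H (+ 2) (+ 2)) (H (+ 2) (+ 3)) (H (+ 2) (+ 4)) (H (+ 3) (+ 3)) (H (+ 3) (+ 4)) (H (+ 4) (+ 4))))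

    G0 G1 G2 G3 G4 : Ser
    G0 = con (+ 1) ⊗ H (+ 0) (+ 1) ⊕ con (+ 4) ⊗ H (+ 1) (+ 2) ⊕ con (+ 3) ⊗ H (+ 2) (+ 2)
    G1 = con (+ 3) ⊗ H (+ 0) (+ 2) ⊕ con (+ 10) ⊗ H (+ 0) (+ 4) ⊕ con (+ 9) ⊗ H (+ 2) (+ 3)
    G2 = con (+ 1) ⊗ H (+ 1) (+ 1)
    G3 = con (+ 6) ⊗ H (+ 0) (+ 3) ⊕ con (+ 13) ⊗ H (+ 2) (+ 4) ⊕ con (+ 16) ⊗ H (+ 3) (+ 4)
    G4 = con (+ 7) ⊗ H (+ 1) (+ 3) ⊕ con (+ 11) ⊗ H (+ 1) (+ 4) ⊕ con (+ 6) ⊗ H (+ 3) (+ 3) ⊕ con (+ 10) ⊗ H (+ 4) (+ 4)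
    G0-Off : Off (+ 0) G0
    G0-Off = Off-⊕ (Off-⊕ (Off-c⊗ (+ 1) (H-Off (+ 0) (+ 1) _)) (Off-c⊗ (+ 4) (H-Off (+ 1) (+ 2) _))) (Off-c⊗ (+ 3) (H-Off (+ 2) (+ 2) _))
    G1-Off : Off (+ 1) G1
    G1-Off = Off-⊕ (Off-⊕ (Off-c⊗ (+ 3) (H-Off (+ 0) (+ 2) _)) (Off-c⊗ (+ 10) (H-Off (+ 0) (+ 4) _))) (Off-c⊗ (+ 9) (H-Off (+ 2) (+ 3) _))
    G2-Off : Off (+ 2) G2
    G2-Off = Off-c⊗ (+ 1) (H-Off (+ 1) (+ 1) _)
    G3-Off : Off (+ 3) G3
    G3-Off = Off-⊕ (Off-⊕ (Off-c⊗ (+ 6) (H-Off (+ 0) (+ 3) _)) (Off-c⊗ (+ 13) (H-Off (+ 2) (+ 4) _))) (Off-c⊗ (+ 16) (H-Off (+ 3) (+ 4) _))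
    G4-Off : Off (+ 4) G4
    G4-Off = Off-⊕ (Off-⊕ (Off-⊕ (Off-c⊗ (+ 7) (H-Off (+ 1) (+ 3) _)) (Off-c⊗ (+ 11) (H-Off (+ 1) (+ 4) _))) (Off-c⊗ (+ 6) (H-Off (+ 3) (+ 3) _))) (Off-c⊗ (+ 10) (H-Off (+ 4) (+ 4) _))

    G≈ : Hecke T-w ≈ G0 ⊕ G1 ⊕ G2 ⊕ G3 ⊕ G4
    G≈ = ≈-trans (Decompose.hecke 5 {T-w} (λ p → tri-cong (r+ p rrefl)) (toWitness {a? = all? λ r → all? λ s → _ ℤ.≟ _} _)) (≈-trans (lift 5 (sorted T-w (cartesianProduct (range 5) (range 5))))
      (solve 15 (λ h00 h01 h02 h03 h04 h11 h12 h13 h14 h22 h23 h24 h33 h34 h44 → κ (+ 0) :* h00 :+ (κ (+ 0) :* h01 :+ (κ (+ 0) :* h02 :+ (κ (+ 0) :* h03 :+ (κ (+ 0) :* h04 :+ (κ (+ 1) :* h01 :+ (κ (+ 1) :* h11 :+ (κ (+ 1) :* h12 :+ (κ (+ 1) :* h13 :+ (κ (+ 1) :* h14 :+ (κ (+ 3) :* h02 :+ (κ (+ 3) :* h12 :+ (κ (+ 3) :* h22 :+ (κ (+ 3) :* h23 :+ (κ (+ 3) :* h24 :+ (κ (+ 6) :* h03 :+ (κ (+ 6) :* h13 :+ (κ (+ 6) :* h23 :+ (κ (+ 6) :* h33 :+ (κ (+ 6) :* h34 :+ (κ (+ 10) :* h04 :+ (κ (+ 10) :* h14 :+ (κ (+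 10) :* h24 :+ (κ (+ 10) :* h34 :+ (κ (+ 10) :* h44 :+ (κ (+ 0))))))))))))))))))))))))))
          := (κ (+ 1) :* h01 :+ κ (+ 4) :* h12 :+ κ (+ 3) :* h22) :+ (κ (+ 3) :* h02 :+ κ (+ 10) :* h04 :+ κ (+ 9) :* h23) :+ (κ (+ 1) :* h11) :+ (κ (+ 6) :* h03 :+ κ (+ 13) :* h24 :+ κ (+ 16) :* h34) :+ (κ (+ 7) :* h13 :+ κ (+ 11) :* h14 :+ κ (+ 6) :* h33 :+ κ (+ 10) :* h44)) ≈-refl (H (+ 0) (+ 0)) (H (+ 0) (+ 1)) (H (+ 0) (+ 2)) (H (+ 0) (+ 3)) (H (+ 0) (+ 4)) (H (+ 1) (+ 1)) (H (+ 1) (+ 2)) (H (+ 1) (+ 3)) (H (+ 1) (+ 4)) (H (+ 2) (+ 2)) (H (+ 2) (+ 3)) (H (+ 2) (+ 4)) (H (+ 3) (+ 3)) (H (+ 3) (+ 4)) (H (+ 4) (+ 4))))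

    product : E ^ˢ 5 ≈ ⊖ ((S0 ⊕ S1 ⊕ S2 ⊕ S3 ⊕ S4) ⊗ (α ⊕ con (+ 2) ⊗ β))
    product = ≈-trans (solve 1 (λ e → e :* (e :* (e :* (e :* (e :* κ (+ 1))))) := e :* e :* (e :* e :* e)) ≈-refl E)
      (≈-trans (⊗-cong (≈-trans (lift 5 rogers) (⊖-cong S≈)) E³≈) (solve 2 (λ a b → :- a :* b := :- (a :* b)) ≈-refl (S0 ⊕ S1 ⊕ S2 ⊕ S3 ⊕ S4) (α ⊕ con (+ 2) ⊗ β)))

    2β-Off : Off (+ 1) (con (+ 2) ⊗ β)
    2β-Off = Off-c⊗ (+ 2) β-Off

    -- E^5 = E² E³ has exponents in class 0 only, so the class 1 part of the product of the two
    -- dissections must vanish. `F3` is its class 3 part.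
    F1 : S1 ⊗ α ⊕ con (+ 2) ⊗ (S0 ⊗ β) ≈ 𝟘
    F1 = Off-Van⇒0 {+ 1} (Off-⊕ (Off-⊗ {+ 1} {+ 0} S1-Off α-Off) (Off-c⊗ (+ 2) (Off-⊗ {+ 0} {+ 1} S0-Off β-Off)))
      (Van-≈ (≈-trans (⊕-cong (⊖-cong product) ≈-refl) (solve 7 (λ s0 s1 s2 s3 s4 a b →
          :- (:- ((s0 :+ s1 :+ s2 :+ s3 :+ s4) :* (a :+ κ (+ 2) :* b))) :+ :- (a :* (s0 :+ s2 :+ s3 :+ s4) :+ κ (+ 2) :* b :* (s1 :+ s2 :+ s3 :+ s4))
          := s1 :* a :+ κ (+ 2) :* (s0 :* b)) ≈-refl S0 S1 S2 S3 S4 α β))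
        (Van-⊕ (Van-⊖ (apart _ E⁵-Off)) (Van-⊖ (Van-⊕
          (Off-Van-⊗ {+ 0} {+ 1} α-Off (Van-⊕ (Van-⊕ (Van-⊕ (apart _ S0-Off) (apart _ S2-Off)) (apart _ S3-Off)) (apart _ S4-Off)))
          (Off-Van-⊗ {+ 1} {+ 0} 2β-Off (Van-⊕ (Van-⊕ (Van-⊕ (apart _ S1-Off) (apart _ S2-Off)) (apart _ S3-Off)) (apart _ S4-Off)))))))

    F3 : S3 ⊗ α ⊕ con (+ 2) ⊗ (S2 ⊗ β) ≈ 𝟘
    F3 = Off-Van⇒0 {+ 3} (Off-⊕ (Off-⊗ {+ 3} {+ 0} S3-Off α-Off) (Off-c⊗ (+ 2) (Off-⊗ {+ 2} {+ 1} S2-Off β-Off)))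
      (Van-≈ (≈-trans (⊕-cong (⊖-cong product) ≈-refl) (solve 7 (λ s0 s1 s2 s3 s4 a b →
          :- (:- ((s0 :+ s1 :+ s2 :+ s3 :+ s4) :* (a :+ κ (+ 2) :* b))) :+ :- (a :* (s0 :+ s1 :+ s2 :+ s4) :+ κ (+ 2) :* b :* (s0 :+ s1 :+ s3 :+ s4))
          := s3 :* a :+ κ (+ 2) :* (s2 :* b)) ≈-refl S0 S1 S2 S3 S4 α β))
        (Van-⊕ (Van-⊖ (apart _ E⁵-Off)) (Van-⊖ (Van-⊕
          (Off-Van-⊗ {+ 0} {+ 3} α-Off (Van-⊕ (Van-⊕ (Van-⊕ (apart _ S0-Off) (apart _ S1-Off)) (apart _ S2-Off)) (apart _ S4-Off)))
          (Off-Van-⊗ {+ 1} {+ 2} 2β-Off (Van-⊕ (Van-⊕ (Van-⊕ (apart _ S0-Off) (apart _ S1-Off)) (apart _ S3-Off)) (apart _ S4-Off)))))))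

    -- The binomial terms of (α + 2β)^4, which represents E^12; the index is the class of the
    -- exponents, as `α` lies in class 0 and `β` in class 1.
    m1 m2 m3 m4 m0 : Ser
    m0 = α ⊗ (α ⊗ (α ⊗ α))
    m1 = con (+ 8) ⊗ (α ⊗ (α ⊗ (α ⊗ β)))
    m2 = con (+ 24) ⊗ (α ⊗ (α ⊗ (β ⊗ β)))
    m3 = con (+ 32) ⊗ (α ⊗ (β ⊗ (β ⊗ β)))
    m4 = con (+ 16) ⊗ (β ⊗ (β ⊗ (β ⊗ β)))

    m0-Off : Off (+ 0) m0
    m0-Off = Off-⊗ {+ 0} {+ 0} α-Off (Off-⊗ {+ 0} {+ 0} α-Off (Off-⊗ {+ 0} {+ 0} α-Off α-Off))
    m1-Off : Off (+ 1) m1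
    m1-Off = Off-c⊗ (+ 8) (Off-⊗ {+ 0} {+ 1} α-Off (Off-⊗ {+ 0} {+ 1} α-Off (Off-⊗ {+ 0} {+ 1} α-Off β-Off)))
    m2-Off : Off (+ 2) m2
    m2-Off = Off-c⊗ (+ 24) (Off-⊗ {+ 0} {+ 2} α-Off (Off-⊗ {+ 0} {+ 2} α-Off (Off-⊗ {+ 1} {+ 1} β-Off β-Off)))
    m3-Off : Off (+ 3) m3
    m3-Off = Off-c⊗ (+ 32) (Off-⊗ {+ 0} {+ 3} α-Off (Off-⊗ {+ 1} {+ 2} β-Off (Off-⊗ {+ 1} {+ 1} β-Off β-Off)))
    m4-Off : Off (+ 4) m4
    m4-Off = Off-c⊗ (+ 16) (Off-⊗ {+ 1} {+ 3} β-Off (Off-⊗ {+ 1} {+ 2} β-Off (Off-⊗ {+ 1} {+ 1} β-Off β-Off)))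

    -- The left-hand side collects all products of class 1 in E^12 times E³ P_2. It is an explicit
    -- combination of `F1`, `R2`, `R5`, `R4`, `F3` and a multiple of 5.
    X≈0 : m0 ⊗ G1 ⊕ m1 ⊗ G0 ⊕ m2 ⊗ G4 ⊕ m3 ⊗ G3 ⊕ m4 ⊗ G2 ≈ 𝟘
    X≈0 = ≈-trans (solve 17 (λ a b h00 h01 h02 h03 h04 h11 h12 h13 h14 h22 h23 h24 h33 h34 h44 →
        a :* (a :* (a :* a)) :* (κ (+ 3) :* h02 :+ κ (+ 10) :* h04 :+ κ (+ 9) :* h23) :+ κ (+ 8) :* (a :* (a :* (a :* b))) :* (κ (+ 1) :* h01 :+ κ (+ 4) :* h12 :+ κ (+ 3) :* h22) :+ κ (+ 24) :* (a :* (a :* (b :* b))) :* (κ (+ 7) :* h13 :+ κ (+ 11) :* h14 :+ κ (+ 6) :* h33 :+ κ (+ 10) :* h44)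
          :+ κ (+ 32) :* (a :* (b :* (b :* b))) :* (κ (+ 6) :* h03 :+ κ (+ 13) :* h24 :+ κ (+ 16) :* h34) :+ κ (+ 16) :* (b :* (b :* (b :* b))) :* (κ (+ 1) :* h11) :=
        κ (+ 2) :* a :* a :* a :* ((κ (+ 2) :* h02 :+ κ (+ 2) :* h04 :+ κ (+ 2) :* h23) :* a :+ κ (+ 2) :* ((κ (+ 1) :* h00 :+ κ (+ 2) :* h01 :+ κ (+ 2) :* h12 :+ κ (+ 1) :* h22) :* b))
          :+ (:- (a :* a :* a) :* (a :* h02 :+ b :* (h12 :+ h01))
          :+ (a :* (a :* a :* (a :* h04 :+ b :* (h01 :+ h00)) :+ :- (b :* b :* (a :* (h13 :+ h33) :+ :- (b :* h03))))
          :+ (:- (a :* b :* b) :* (a :* (h13 :+ h14) :+ :- (b :* h34))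
          :+ (κ (+ 3) :* b :* b :* b :* ((κ (+ 2) :* h03 :+ κ (+ 2) :* h24 :+ κ (+ 2) :* h34) :* a :+ κ (+ 2) :* ((κ (+ 1) :* h11) :* b))
          :+ κ (+ 5) :* (a :* a :* a :* a :* (κ (+ 1) :* h04 :+ κ (+ 1) :* h23) :+ a :* a :* a :* b :* (κ (- + 1) :* h00 :+ κ (+ 5) :* h12 :+ κ (+ 4) :* h22) :+ a :* a :* b :* b :* (κ (+ 34) :* h13 :+ κ (+ 53) :* h14 :+ κ (+ 29) :* h33 :+ κ (+ 48) :* h44) :+ a :* b :* b :* b :* (κ (+ 37) :* h03 :+ κ (+ 82) :* h24 :+ κ (+ 101) :* h34) :+ b :* b :* b :* b :* (κ (+ 2) :* h11))))))) ≈-refl α β (H (+ 0) (+ 0)) (H (+ 0) (+ 1)) (H (+ 0) (+ 2)) (H (+ 0) (+ 3)) (H (+ 0) (+ 4)) (H (+ 1) (+ 1)) (H (+ 1) (+ 2)) (H (+ 1) (+ 3)) (H (+ 1) (+ 4)) (H (+ 2) (+ 2)) (H (+ 2) (+ 3)) (H (+ 2) (+ 4)) (H (+ 3) (+ 3)) (H (+ 3) (+ 4)) (H (+ 4) (+ 4)))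
      (con (+ 2) ⊗ α ⊗ α ⊗ α ⊗₀ F1 ⊕₀ ⊖ (α ⊗ α ⊗ α) ⊗₀ lift 5 R2 ⊕₀ α ⊗₀ lift 5 R5 ⊕₀ ⊖ (α ⊗ β ⊗ β) ⊗₀ lift 5 R4
        ⊕₀ con (+ 3) ⊗ β ⊗ β ⊗ β ⊗₀ F3 ⊕₀ five)
      where
      rest : Ser
      rest = α ⊗ α ⊗ α ⊗ α ⊗ (con (+ 1) ⊗ H (+ 0) (+ 4) ⊕ con (+ 1) ⊗ H (+ 2) (+ 3)) ⊕ α ⊗ α ⊗ α ⊗ β ⊗ (con (- + 1) ⊗ H (+ 0) (+ 0) ⊕ con (+ 5) ⊗ H (+ 1) (+ 2) ⊕ con (+ 4) ⊗ H (+ 2) (+ 2)) ⊕ α ⊗ α ⊗ β ⊗ β ⊗ (con (+ 34) ⊗ H (+ 1) (+ 3) ⊕ con (+ 53) ⊗ H (+ 1) (+ 4) ⊕ con (+ 29) ⊗ H (+ 3) (+ 3) ⊕ con (+ 48) ⊗ H (+ 4) (+ 4)) ⊕ α ⊗ β ⊗ β ⊗ β ⊗ (con (+ 37) ⊗ H (+ 0) (+ 3) ⊕ con (+ 82) ⊗ H (+ 2) (+ 4) ⊕ con (+ 101) ⊗ H (+ 3) (+ 4)) ⊕ β ⊗ β ⊗ β ⊗ β ⊗ (con (+ 2) ⊗ H (+ 1) (+ 1))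
      five : con (+ 5) ⊗ rest ≈ 𝟘
      five = ≈-trans (⊗-cong (con-congr (+ 1 by refl)) ≈-refl) (solve 1 (λ a → κ (+ 0) :* a := κ (+ 0)) ≈-refl rest)

    -- The multiplier is E^15 = (E³)^4 E³, a power of E^5, so it can be cancelled inside a class;
    -- every product outside `X≈0` misses class 1 by grading.
    gf₂-Van : Van (+ 1) (gf 2)
    gf₂-Van = Van-unit ((E ^ˢ 5) ^ˢ 3) refl (Off-⊗ {+ 0} {+ 0} E⁵-Off (Off-⊗ {+ 0} {+ 0} E⁵-Off (Off-⊗ {+ 0} {+ 0} E⁵-Off (Off-con (+ 1)))))
      (Van-≈ (≈-sym expand) (Van-⊕ (Van-⊕ (Van-⊕ (Van-⊕ (Van-⊕ (λ m _ → rtrans (at X≈0 m) (Cong-≡ (con0 m)))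
          (Off-Van-⊗ {+ 0} {+ 1} m0-Off (Van-⊕ (Van-⊕ (Van-⊕ (apart _ G0-Off) (apart _ G2-Off)) (apart _ G3-Off)) (apart _ G4-Off))))
          (Off-Van-⊗ {+ 1} {+ 0} m1-Off (Van-⊕ (Van-⊕ (Van-⊕ (apart _ G1-Off) (apart _ G2-Off)) (apart _ G3-Off)) (apart _ G4-Off))))
          (Off-Van-⊗ {+ 2} { - + 1} m2-Off (Van-⊕ (Van-⊕ (Van-⊕ (apart _ G0-Off) (apart _ G1-Off)) (apart _ G2-Off)) (apart _ G3-Off))))
          (Off-Van-⊗ {+ 3} { - + 2} m3-Off (Van-⊕ (Van-⊕ (Van-⊕ (apart _ G0-Off) (apart _ G1-Off)) (apart _ G2-Off)) (apart _ G4-Off))))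
          (Off-Van-⊗ {+ 4} { - + 3} m4-Off (Van-⊕ (Van-⊕ (Van-⊕ (apart _ G0-Off) (apart _ G1-Off)) (apart _ G3-Off)) (apart _ G4-Off)))))
      where
      expand : (E ^ˢ 5) ^ˢ 3 ⊗ gf 2 ≈ (m0 ⊗ G1 ⊕ m1 ⊗ G0 ⊕ m2 ⊗ G4 ⊕ m3 ⊗ G3 ⊕ m4 ⊗ G2) ⊕ m0 ⊗ (G0 ⊕ G2 ⊕ G3 ⊕ G4) ⊕ m1 ⊗ (G1 ⊕ G2 ⊕ G3 ⊕ G4)
        ⊕ m2 ⊗ (G0 ⊕ G1 ⊕ G2 ⊕ G3) ⊕ m3 ⊗ (G0 ⊕ G1 ⊕ G2 ⊕ G4) ⊕ m4 ⊗ (G0 ⊕ G1 ⊕ G3 ⊕ G4)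
      expand = ≈-trans (solve 2 (λ e p → let f = e :* (e :* (e :* (e :* (e :* κ (+ 1))))) ; c = e :* e :* e in
          f :* (f :* (f :* κ (+ 1))) :* p := c :* c :* (c :* c) :* (c :* p)) ≈-refl E (gf 2))
        (≈-trans (⊗-cong (⊗-cong (⊗-cong E³≈ E³≈) (⊗-cong E³≈ E³≈)) (≈-trans (lift 5 gf₂) G≈))
        (solve 7 (λ a b g0 g1 g2 g3 g4 → let t = a :+ κ (+ 2) :* b
                                             m0 = a :* (a :* (a :* a)) ; m1 = κ (+ 8) :* (a :* (a :* (a :* b))) ; m2 = κ (+ 24) :* (a :* (a :* (b :* b)))
                                             m3 = κ (+ 32) :* (a :* (b :* (b :* b))) ; m4 = κ (+ 16) :* (b :* (b :* (b :* b))) in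
          t :* t :* (t :* t) :* (g0 :+ g1 :+ g2 :+ g3 :+ g4) :=
            (m0 :* g1 :+ m1 :* g0 :+ m2 :* g4 :+ m3 :* g3 :+ m4 :* g2) :+ m0 :* (g0 :+ g2 :+ g3 :+ g4) :+ m1 :* (g1 :+ g2 :+ g3 :+ g4)
              :+ m2 :* (g0 :+ g1 :+ g2 :+ g3) :+ m3 :* (g0 :+ g1 :+ g2 :+ g4) :+ m4 :* (g0 :+ g1 :+ g3 :+ g4)) ≈-refl α β G0 G1 G2 G3 G4))

    theta-Van : ∀ {w ex : ℤ → ℤ} {s : Ser} c → (∀ {j r} → Cong 5 j r → Cong 5 (w j) (w r)) → (∀ {j r} → Cong 5 j r → Cong 5 (ex j) (ex r)) →
      (∀ (r : Fin 5) → Cong 5 (w (+ toℕ r)) (+ 0) ⊎ ¬ Cong 5 (ex (+ toℕ r)) c) → SumM (λ j → w j * sgn j) ex s → Van c s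
    theta-Van {w} {ex} c wc ec chk S = sum-Van S λ j → let (r , p) = residue 5 j in
      [ (λ z → inj₁ (zero-*ʳ (sgn j) (rtrans (wc p) z))) , (λ n → inj₂ λ e → n (rtrans (rsym (ec p)) e)) ]′ (chk r)

    -- E³ has no exponents in the classes 2, 3, 4, because L 3 vanishes
    from-theta : ∀ {i} → Van (+ 4) (⊖ (E ⊗ E ⊗ gf i)) → Van (+ 3) (⊖ (E ⊗ E ⊗ gf i)) → Van (+ 4) (gf i)
    from-theta {i} p q = Van-unit (E ^ˢ 5) refl E⁵-Off (Van-≈ (≈-trans (⊖-cong (≈-trans (solve 3 (λ a b c → a :* c :+ b :* c := (a :+ b) :* c) ≈-refl α (con (+ 2) ⊗ β) (⊖ (E ⊗ E ⊗ gf i))) (⊗-cong (≈-sym E³≈) ≈-refl)))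
        (solve 2 (λ e p → :- (e :* e :* e :* :- (e :* e :* p)) := e :* (e :* (e :* (e :* (e :* κ (+ 1))))) :* p) ≈-refl E (gf i)))
      (Van-⊖ (Van-⊕ (Off-Van-⊗ {+ 0} {+ 4} α-Off p) (Off-Van-⊗ {+ 1} {+ 3} 2β-Off q))))

    -- The weight T_j is nonzero modulo 5 only for j ≡ 1, 2, 3, where the exponents are 2, 2, 0; the
    -- classes 3 and 4 are never hit.
    gf₃-Van : Van (+ 4) (gf 3)
    gf₃-Van = from-theta {3} (van (+ 4) (toWitness {a? = all? λ r → cong? 5 (T-w (+ toℕ r)) (+ 0) ⊎-dec ¬? (cong? 5 (ex′ (+ toℕ r)) (+ 4))} _))
        (van (+ 3) (toWitness {a? = all? λ r → cong? 5 (T-w (+ toℕ r)) (+ 0) ⊎-dec ¬? (cong? 5 (ex′ (+ toℕ r)) (+ 3))} _))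
      where
      ex′ : ℤ → ℤ
      ex′ j = + tri j + (j * j + j)
      van : ∀ c → (∀ (r : Fin 5) → Cong 5 (T-w (+ toℕ r)) (+ 0) ⊎ ¬ Cong 5 (ex′ (+ toℕ r)) c) → Van c (⊖ (E ⊗ E ⊗ gf 3))
      van c chk = theta-Van {T-w} {ex′} c (λ p → tri-cong (r+ p (rrefl {+ 1}))) (λ p → r+ (tri-cong p) (r+ (r* p p) p)) chk gf₃

    -- For j ≡ 1, 2, 3 the exponents are now 1, 0, 2, again missing the classes 3 and 4.
    gf₄-Van : Van (+ 4) (gf 4)
    gf₄-Van = from-theta {4} (van (+ 4) (toWitness {a? = all? λ r → cong? 5 (T-w (+ toℕ r)) (+ 0) ⊎-dec ¬? (cong? 5 (ex′ (+ toℕ r)) (+ 4))} _))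
        (van (+ 3) (toWitness {a? = all? λ r → cong? 5 (T-w (+ toℕ r)) (+ 0) ⊎-dec ¬? (cong? 5 (ex′ (+ toℕ r)) (+ 3))} _))
      where
      ex′ : ℤ → ℤ
      ex′ j = + tri j + j * j
      van : ∀ c → (∀ (r : Fin 5) → Cong 5 (T-w (+ toℕ r)) (+ 0) ⊎ ¬ Cong 5 (ex′ (+ toℕ r)) c) → Van c (⊖ (E ⊗ E ⊗ gf 4))
      van c chk = theta-Van {T-w} {ex′} c (λ p → tri-cong (r+ p (rrefl {+ 1}))) (λ p → r+ (tri-cong p) (r* p p)) chk gf₄

  -- Product relations between theta pieces modulo 7.

  module SevenClasses where
    open Classes 7
    open Families 7
    open Periodic 7
    open Odd 3 using (tri-cong)

    EU : ℤ → ℤ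
    EU x = + tri x + x * x

    EP : ℤ × ℤ → ℤ
    EP (s , x) = + 2 * (s * s) - + 2 * (s * x) + + 2 * (x * x) - s

    private
      sq : ∀ j → + (∣ j ∣ ℕ.* ∣ j ∣) ≡ j * j
      sq (+ n)    = ℤP.pos-* n n
      sq -[1+ n ] = refl

      n≤n² : ∀ n → n ℕ.≤ n ℕ.* n
      n≤n² zero    = z≤n
      n≤n² (suc n) = ℕP.m≤m+n (suc n) (n ℕ.* suc n)

      tameU : ∀ w → Tame w EU
      tameU w x = inj₂ (tri x ℕ.+ ∣ x ∣ ℕ.* ∣ x ∣ , +congˡ (+ tri x) (sym (sq x)) , ℕP.≤-trans (size-tri x) (ℕP.+-monoˡ-≤ 2 (ℕP.m≤m+n (tri x) _)))

      -- The form is a sum of nonnegative parts, 2 tri s + x² + (s - x)².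
      tameP : ∀ w → Tame w EP
      tameP w (s , x) = inj₂ (tri s ℕ.+ ∣ x ∣ ℕ.* ∣ x ∣ ℕ.+ (tri s ℕ.+ ∣ s - x ∣ ℕ.* ∣ s - x ∣)
        , trans (l₁ s x) (trans (cong (λ t → t + x * x + (s - x) * (s - x)) (sym (tri-double s))) (trans (l₂ (+ tri s) (x * x) ((s - x) * (s - x)))
            (cong₂ (λ y z → + tri s + y + (+ tri s + z)) (sym (sq x)) (sym (sq (s - x))))))
        , ℕP.≤-trans (ℕP.+-mono-≤ (size-tri s) (n≤n² ∣ x ∣)) (ℕP.≤-trans (ℕP.≤-reflexive (l₃ (tri s) (∣ x ∣ ℕ.* ∣ x ∣))) (ℕP.+-monoˡ-≤ 2 (ℕP.m≤m+n (tri s ℕ.+ ∣ x ∣ ℕ.* ∣ x ∣) _))))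
        where
        l₁ : ∀ s x → + 2 * (s * s) - + 2 * (s * x) + + 2 * (x * x) - s ≡ s * s - s + x * x + (s - x) * (s - x)
        l₁ = solve-∀
        l₂ : ∀ t y z → + 2 * t + y + z ≡ t + y + (t + z)
        l₂ = solve-∀
        l₃ : ∀ t y → t ℕ.+ 2 ℕ.+ y ≡ t ℕ.+ y ℕ.+ 2
        l₃ = solveℕ

    abstract
      U : ℤ → Ser
      U j = total (tame-summable (tameU (λ x → cls 7 j x * sgn x)))
      sumU : ∀ j → SumM (λ x → cls 7 j x * sgn x) EU (U j)
      sumU j = sumS-total (tame-summable (tameU (λ x → cls 7 j x * sgn x)))
      Pt : ℤ → ℤ → Ser
      Pt s j = total (tame-summable (tameP (pair s j)))
      sumP : ∀ s j → SumM (pair s j) EP (Pt s j)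
      sumP s j = sumS-total (tame-summable (tameP (pair s j)))

    Pt-flip : ∀ s j {s′ j′} k l → s′ ≡ s + k * + 7 → j′ ≡ s - j + l * + 7 → Pt s′ j′ ≗ Pt s j
    Pt-flip s j {s′} {j′} k l p q = sumS-unique (sumM-cong {w = pair s′ j′} {pair s (s - j)} {EP} {EP} (λ z → pair-per k l z p q) (λ _ → refl) (sumP s′ j′))
      (sumM-cong {w = pair s j ∘ _≃_.to σ} {pair s (s - j)} {EP ∘ _≃_.to σ} {EP}
        (λ { (t , x) → cls₂ 7 (λ p q → p , ≡-lin₂ (+ 1) (- + 1) (+ 0) p q (l₁ s j t x)) (λ p q → p , ≡-lin₂ (+ 1) (- + 1) (+ 0) p q (l₂ s j t x)) })
        (λ { (t , x) → l₃ t x }) (sumS-bij σ (sumP s j)))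
      where
      σ : Q ≃ Q
      σ = bij (λ { (t , x) → t , t - x }) (λ { (t , x) → t , t - x }) (λ { (t , x) → cong (t ,_) (l₀ t x) }) (λ { (t , x) → cong (t ,_) (l₀ t x) })
        where
        l₀ : ∀ t x → t - (t - x) ≡ x
        l₀ = solve-∀
      l₁ : ∀ s j t x → + 1 * (t - s) + - + 1 * (t - x - j) + + 0 * + 7 ≡ x - (s - j)
      l₁ = solve-∀
      l₂ : ∀ s j t x → + 1 * (t - s) + - + 1 * (x - (s - j)) + + 0 * + 7 ≡ t - x - j
      l₂ = solve-∀
      l₃ : ∀ t x → + 2 * (t * t) - + 2 * (t * (t - x)) + + 2 * ((t - x) * (t - x)) - t ≡ + 2 * (t * t) - + 2 * (t * x) + + 2 * (x * x) - t
      l₃ = solve-∀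

    Pt-per : ∀ s j {s′} k → s′ ≡ s + k * + 7 → Pt s′ j ≗ Pt s j
    Pt-per s j {s′} k p = sumS-unique (sumM-cong {w = pair s′ j} {pair s j} {EP} {EP} (λ z → pair-per k (+ 0) z p (sym (ℤP.+-identityʳ j))) (λ _ → refl) (sumP s′ j)) (sumP s j)

    -- If n + x is even, put n = 2s - x. If it is odd, the reflection n ↦ 1 - n, which keeps tri n,
    -- leads back to the even case. Both halves thus carry the same binary form.
    parity-split : (Q ⊎ Q) ≃ Q
    parity-split = bij to′ (λ { (n , x) → g x (half (n + x)) }) (λ { (n , x) → tf n x (half (n + x)) (to-from (n + x)) }) ft
      where
      open _≃_ halves renaming (from to half)
      to′ : Q ⊎ Q → Q
      to′ (inj₁ (s , x)) = + 2 * s - x , x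
      to′ (inj₂ (s , x)) = + 1 + x - + 2 * s , x
      g : ℤ → ℤ ⊎ ℤ → Q ⊎ Q
      g x (inj₁ h) = inj₁ (h , x)
      g x (inj₂ h) = inj₂ (x - h , x)
      l₁ : ∀ n x → n + x - x ≡ n
      l₁ = solve-∀
      l₂ : ∀ h x → + 1 + x - + 2 * (x - h) ≡ + 2 * h + + 1 - x
      l₂ = solve-∀
      l₃ : ∀ s x → + 2 * s - x + x ≡ + 2 * s
      l₃ = solve-∀
      l₄ : ∀ s x → + 1 + x - + 2 * s + x ≡ + 2 * (x - s) + + 1
      l₄ = solve-∀
      l₅ : ∀ s x → x - (x - s) ≡ s
      l₅ = solve-∀
      tf : ∀ n x h → to h ≡ n + x → to′ (g x h) ≡ (n , x)
      tf n x (inj₁ h) e = cong (_, x) (trans (cong (λ z → z - x) e) (l₁ n x))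
      tf n x (inj₂ h) e = cong (_, x) (trans (l₂ h x) (trans (cong (λ z → z - x) e) (l₁ n x)))
      ft : ∀ z → g (proj₂ (to′ z)) (half (proj₁ (to′ z) + proj₂ (to′ z))) ≡ z
      ft (inj₁ (s , x)) = cong (g x) (trans (cong half (l₃ s x)) (from-to (inj₁ s)))
      ft (inj₂ (s , x)) = trans (cong (g x) (trans (cong half (l₄ s x)) (from-to (inj₂ (x - s))))) (cong (λ z → inj₂ (z , x)) (l₅ s x))

    -- The two parities have opposite signs, so a product is a difference of two pieces of one
    -- binary theta series. The factor 4 is the inverse of 2 modulo 7.
    LU : ∀ ν j {A B} → Pt (+ 4 * (ν + j)) j ≗ A → Pt (+ 4 * (+ 1 - ν + j)) j ≗ B → L ν ⊗ U j ≗ A ⊕ ⊖ B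
    LU ν j p q = Ex.≈-trans (sumS-unique (sumS-bij parity-split (sumM-× {w = wL ν} {EL} {λ x → cls 7 j x * sgn x} {EU} (okL ν) (tame-ok (tameU (λ x → cls 7 j x * sgn x))) (sumL′ ν) (sumU j)))
        (sumS-cong {F = [ (λ z → term (pair s₁ j z) (EP z)) , (λ z → term (- pair s₂ j z) (EP z)) ]′}
          (λ { (inj₁ (s , x)) → term-≡ (w₁ s x) (e₁ s x) ; (inj₂ (s , x)) → term-≡ (w₂ s x) (e₂ s x) }) Ex.≈-refl
          (sumS-⊎ (sumP s₁ j) (sumM-neg {w = pair s₂ j} {EP} (sumP s₂ j)))))
      (Ex.⊕-cong p (Ex.⊖-cong q))
      where
      s₁ s₂ : ℤ
      s₁ = + 4 * (ν + j)
      s₂ = + 4 * (+ 1 - ν + j)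
      ex₂ : ∀ n x s → n * n - n + (x * x - x) + + 2 * (x * x) ≡ + 2 * (+ 2 * (s * s) - + 2 * (s * x) + + 2 * (x * x) - s) → EP (s , x) ≡ EL n + EU x
      ex₂ n x s e = double-inj (trans (sym e) (trans (cong₂ (λ y z → y + z + + 2 * (x * x)) (sym (tri-double n)) (sym (tri-double x))) (l (+ tri n) (+ tri x) (x * x))))
        where
        l : ∀ a b c → + 2 * a + + 2 * b + + 2 * c ≡ + 2 * (a + (b + c))
        l = solve-∀
      e₁ : ∀ s x → EP (s , x) ≡ EL (+ 2 * s - x) + EU x
      e₁ s x = ex₂ (+ 2 * s - x) x s (l s x)
        where
        l : ∀ s x → (+ 2 * s - x) * (+ 2 * s - x) - (+ 2 * s - x) + (x * x - x) + + 2 * (x * x) ≡ + 2 * (+ 2 * (s * s) - + 2 * (s * x) + + 2 * (x * x) - s)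
        l = solve-∀
      e₂ : ∀ s x → EP (s , x) ≡ EL (+ 1 + x - + 2 * s) + EU x
      e₂ s x = ex₂ (+ 1 + x - + 2 * s) x s (l s x)
        where
        l : ∀ s x → (+ 1 + x - + 2 * s) * (+ 1 + x - + 2 * s) - (+ 1 + x - + 2 * s) + (x * x - x) + + 2 * (x * x) ≡ + 2 * (+ 2 * (s * s) - + 2 * (s * x) + + 2 * (x * x) - s)
        l = solve-∀
      w₁ : ∀ s x → pair s₁ j (s , x) ≡ wL ν (+ 2 * s - x) * (cls 7 j x * sgn x)
      w₁ s x = sym (trans (cong (λ g → cls 7 ν (+ 2 * s - x) * g * (cls 7 j x * sgn x)) (sgn-even (+ 2 * s - x) x (s - x) (l₁ s x)))
        (trans (l₂ (cls 7 ν (+ 2 * s - x)) (cls 7 j x) (sgn x)) (trans (cong (cls 7 ν (+ 2 * s - x) * cls 7 j x *_) (sgn-double x)) (trans (ℤP.*-identityʳ _) c))))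
        where
        l₁ : ∀ s x → + 2 * s - x ≡ x + + 2 * (s - x)
        l₁ = solve-∀
        l₂ : ∀ a b g → a * g * (b * g) ≡ a * b * (g * g)
        l₂ = solve-∀
        c : cls 7 ν (+ 2 * s - x) * cls 7 j x ≡ cls 7 s₁ s * cls 7 j x
        c = cls₂ 7 (λ p q → ≡-lin₂ (+ 4) (+ 4) (- s) p q (l₃ ν j s x) , q) (λ p q → ≡-lin₂ (+ 2) (- + 1) (ν + j) p q (l₄ ν j s x) , q)
          where
          l₃ : ∀ ν j s x → + 4 * (+ 2 * s - x - ν) + + 4 * (x - j) + - s * + 7 ≡ s - + 4 * (ν + j)
          l₃ = solve-∀
          l₄ : ∀ ν j s x → + 2 * (s - + 4 * (ν + j)) + - + 1 * (x - j) + (ν + j) * + 7 ≡ + 2 * s - x - ν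
          l₄ = solve-∀
      w₂ : ∀ s x → - pair s₂ j (s , x) ≡ wL ν (+ 1 + x - + 2 * s) * (cls 7 j x * sgn x)
      w₂ s x = sym (trans (cong (λ g → cls 7 ν (+ 1 + x - + 2 * s) * g * (cls 7 j x * sgn x)) (sgn-odd (+ 1 + x - + 2 * s) x (- s) (l₁ s x)))
        (trans (l₂ (cls 7 ν (+ 1 + x - + 2 * s)) (cls 7 j x) (sgn x)) (cong -_ (trans (cong (cls 7 ν (+ 1 + x - + 2 * s) * cls 7 j x *_) (sgn-double x)) (trans (ℤP.*-identityʳ _) c)))))
        where
        l₁ : ∀ s x → + 1 + x - + 2 * s ≡ + 1 + (x + + 2 * - s)
        l₁ = solve-∀
        l₂ : ∀ a b g → a * - g * (b * g) ≡ - (a * b * (g * g))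
        l₂ = solve-∀
        c : cls 7 ν (+ 1 + x - + 2 * s) * cls 7 j x ≡ cls 7 s₂ s * cls 7 j x
        c = cls₂ 7 (λ p q → ≡-lin₂ (- + 4) (+ 4) (- s) p q (l₃ ν j s x) , q) (λ p q → ≡-lin₂ (- + 2) (+ 1) (- (+ 1 - ν + j)) p q (l₄ ν j s x) , q)
          where
          l₃ : ∀ ν j s x → - + 4 * (+ 1 + x - + 2 * s - ν) + + 4 * (x - j) + - s * + 7 ≡ s - + 4 * (+ 1 - ν + j)
          l₃ = solve-∀
          l₄ : ∀ ν j s x → - + 2 * (s - + 4 * (+ 1 - ν + j)) + + 1 * (x - j) + - (+ 1 - ν + j) * + 7 ≡ + 1 + x - + 2 * s - ν
          l₄ = solve-∀

    α β γ w u0 u1 u2 u3 u4 u5 : Ser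
    α = L (+ 0)
    β = L (+ 2)
    γ = L (+ 5)
    u0 = U (+ 0)
    u1 = U (+ 1)
    u2 = U (+ 2)
    u3 = U (+ 3)
    u4 = U (+ 4)
    u5 = U (+ 5)
    w = U (+ 6)

    -- In this and the next four relations each product is a difference of two pieces `Pt`. After
    -- the symmetry x ↦ s - x only three distinct pieces occur, and the differences cancel
    -- cyclically.
    r₁ : (L (+ 5) ⊗ U (+ 2)) ⊕ ⊖ (L (+ 0) ⊗ U (+ 4)) ⊕ ⊖ (L (+ 2) ⊗ U (+ 5)) ≈ 𝟘
    r₁ = ≈-trans (lift 7 (Ex.⊕-cong (Ex.⊕-cong (LU (+ 5) (+ 2) (Pt-per (+ 0) (+ 2) (+ 4) refl) (Pt-per (+ 6) (+ 2) (- + 2) refl)) (Ex.⊖-cong (LU (+ 0) (+ 4) (Pt-per (+ 2) (+ 4) (+ 2) refl) (Pt-flip (+ 6) (+ 2) (+ 2) (+ 0) refl refl)))) (Ex.⊖-cong (LU (+ 2) (+ 5) (Pt-flip (+ 0) (+ 2) (+ 4) (+ 1) refl refl) (Pt-flip (+ 2) (+ 4) (+ 2) (+ 1) refl refl)))))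
      (solve 3 (λ x02 x62 x24 → (x02 :- x62) :+ :- (x24 :- x62) :+ :- (x02 :- x24) := κ (+ 0)) ≈-refl (Pt (+ 0) (+ 2)) (Pt (+ 6) (+ 2)) (Pt (+ 2) (+ 4)))

    r₂ : (L (+ 5) ⊗ U (+ 3)) ⊕ ⊖ (L (+ 0) ⊗ U (+ 1)) ⊕ ⊖ (L (+ 2) ⊗ U (+ 0)) ≈ 𝟘
    r₂ = ≈-trans (lift 7 (Ex.⊕-cong (Ex.⊕-cong (LU (+ 5) (+ 3) (Pt-flip (+ 4) (+ 1) (+ 4) (+ 0) refl refl) (Pt-flip (+ 3) (+ 0) (- + 1) (+ 0) refl refl)) (Ex.⊖-cong (LU (+ 0) (+ 1) (Pt-per (+ 4) (+ 1) (+ 0) refl) (Pt-flip (+ 1) (+ 0) (+ 1) (+ 0) refl refl)))) (Ex.⊖-cong (LU (+ 2) (+ 0) (Pt-per (+ 1) (+ 0) (+ 1) refl) (Pt-per (+ 3) (+ 0) (- + 1) refl)))))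
      (solve 3 (λ x41 x30 x10 → (x41 :- x30) :+ :- (x41 :- x10) :+ :- (x10 :- x30) := κ (+ 0)) ≈-refl (Pt (+ 4) (+ 1)) (Pt (+ 3) (+ 0)) (Pt (+ 1) (+ 0)))

    r₃ : (L (+ 2) ⊗ U (+ 1)) ⊕ (L (+ 2) ⊗ U (+ 4)) ⊕ ⊖ (L (+ 0) ⊗ U (+ 6)) ≈ 𝟘
    r₃ = ≈-trans (lift 7 (Ex.⊕-cong (Ex.⊕-cong (LU (+ 2) (+ 1) (Pt-per (+ 5) (+ 1) (+ 1) refl) (Pt-per (+ 0) (+ 1) (+ 0) refl)) (LU (+ 2) (+ 4) (Pt-per (+ 3) (+ 4) (+ 3) refl) (Pt-flip (+ 5) (+ 1) (+ 1) (+ 0) refl refl))) (Ex.⊖-cong (LU (+ 0) (+ 6) (Pt-flip (+ 3) (+ 4) (+ 3) (+ 1) refl refl) (Pt-flip (+ 0) (+ 1) (+ 4) (+ 1) refl refl)))))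
      (solve 3 (λ x51 x01 x34 → (x51 :- x01) :+ (x34 :- x51) :+ :- (x34 :- x01) := κ (+ 0)) ≈-refl (Pt (+ 5) (+ 1)) (Pt (+ 0) (+ 1)) (Pt (+ 3) (+ 4)))

    r₄ : (L (+ 5) ⊗ U (+ 0)) ⊕ (L (+ 5) ⊗ U (+ 5)) ⊕ (L (+ 2) ⊗ U (+ 6)) ≈ 𝟘
    r₄ = ≈-trans (lift 7 (Ex.⊕-cong (Ex.⊕-cong (LU (+ 5) (+ 0) (Pt-per (+ 6) (+ 0) (+ 2) refl) (Pt-per (+ 5) (+ 0) (- + 3) refl)) (LU (+ 5) (+ 5) (Pt-flip (+ 5) (+ 0) (+ 5) (+ 0) refl refl) (Pt-per (+ 4) (+ 5) (+ 0) refl))) (LU (+ 2) (+ 6) (Pt-flip (+ 4) (+ 5) (+ 4) (+ 1) refl refl) (Pt-flip (+ 6) (+ 0) (+ 2) (+ 0) refl refl))))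
      (solve 3 (λ x60 x50 x45 → (x60 :- x50) :+ (x50 :- x45) :+ (x45 :- x60) := κ (+ 0)) ≈-refl (Pt (+ 6) (+ 0)) (Pt (+ 5) (+ 0)) (Pt (+ 4) (+ 5)))

    r₅ : (L (+ 0) ⊗ U (+ 2)) ⊕ (L (+ 0) ⊗ U (+ 3)) ⊕ (L (+ 5) ⊗ U (+ 6)) ≈ 𝟘
    r₅ = ≈-trans (lift 7 (Ex.⊕-cong (Ex.⊕-cong (LU (+ 0) (+ 2) (Pt-per (+ 1) (+ 2) (+ 1) refl) (Pt-per (+ 5) (+ 2) (+ 1) refl)) (LU (+ 0) (+ 3) (Pt-flip (+ 5) (+ 2) (+ 1) (+ 0) refl refl) (Pt-per (+ 2) (+ 3) (+ 2) refl))) (LU (+ 5) (+ 6) (Pt-flip (+ 2) (+ 3) (+ 6) (+ 1) refl refl) (Pt-flip (+ 1) (+ 2) (+ 1) (+ 1) refl refl))))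
      (solve 3 (λ x12 x52 x23 → (x12 :- x52) :+ (x52 :- x23) :+ (x23 :- x12) := κ (+ 0)) ≈-refl (Pt (+ 1) (+ 2)) (Pt (+ 5) (+ 2)) (Pt (+ 2) (+ 3)))

    -- `e i` is the part of E with exponents ≡ i modulo 7. The ratios to `w` are e0/w = -β/γ, e1/w =
    -- α/β, e5/w = -γ/α; `m i` is the same ratio cleared by the common denominator αβγ.
    e m : ℕ → Ser
    e 0 = u0 ⊕ u5
    e 1 = u1 ⊕ u4
    e 2 = w
    e 5 = u2 ⊕ u3
    e _ = 𝟘
    m 0 = ⊖ (α ⊗ (β ⊗ β))
    m 1 = α ⊗ (α ⊗ γ)
    m 2 = α ⊗ (β ⊗ γ)
    m 5 = ⊖ (β ⊗ (γ ⊗ γ))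
    m _ = 𝟘

    M : Ser
    M = α ⊗ (β ⊗ γ)

    private
      move : ∀ {p q x} → x ≈ 𝟘 → p ≈ q ⊕ x → p ≈ q
      move {p} {q} h k = ≈-trans k (≈-trans (⊕-cong ≈-refl h) (solve 1 (λ q → q :+ κ (+ 0) := q) ≈-refl q))

    M-e : ∀ i → M ⊗ e i ≈ w ⊗ m i
    M-e 0 = move ((α ⊗ β) ⊗₀ r₄) (solve 6 (λ a b c w x y → a :* (b :* c) :* (x :+ y) := w :* :- (a :* (b :* b)) :+ a :* b :* (c :* x :+ c :* y :+ b :* w)) ≈-refl α β γ w u0 u5)
    M-e 1 = move ((α ⊗ γ) ⊗₀ r₃) (solve 6 (λ a b c w x y → a :* (b :* c) :* (x :+ y) := w :* (a :* (a :* c)) :+ a :* c :* (b :* x :+ b :* y :+ :- (a :* w))) ≈-refl α β γ w u1 u4)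
    M-e 2 = solve 2 (λ a b → a :* b := b :* a) ≈-refl M w
    M-e 5 = move ((β ⊗ γ) ⊗₀ r₅) (solve 6 (λ a b c w x y → a :* (b :* c) :* (x :+ y) := w :* :- (b :* (c :* c)) :+ b :* c :* (a :* x :+ a :* y :+ c :* w)) ≈-refl α β γ w u2 u3)
    M-e 3 = solve 2 (λ a b → a :* κ (+ 0) := b :* κ (+ 0)) ≈-refl M w
    M-e 4 = solve 2 (λ a b → a :* κ (+ 0) := b :* κ (+ 0)) ≈-refl M w
    M-e (suc (suc (suc (suc (suc (suc _)))))) = solve 2 (λ a b → a :* κ (+ 0) := b :* κ (+ 0)) ≈-refl M w

    -- Klein's relation α³γ - αβ³ + βγ³ = 0, multiplied by w
    klein : w ⊗ (con (+ 1) ⊗ (α ⊗ α ⊗ α ⊗ γ) ⊕ ⊖ (α ⊗ β ⊗ β ⊗ β) ⊕ β ⊗ γ ⊗ γ ⊗ γ) ≈ 𝟘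
    klein = ≈-trans (solve 4 (λ a b c w → w :* (κ (+ 1) :* (a :* a :* a :* c) :- a :* b :* b :* b :+ b :* c :* c :* c)
        := a :* (w :* (a :* (a :* c))) :+ b :* (w :* :- (a :* (b :* b))) :- c :* (w :* :- (b :* (c :* c)))) ≈-refl α β γ w)
      (≈-trans (⊕-cong (⊕-cong (⊗-cong ≈-refl (≈-sym (M-e 1))) (⊗-cong ≈-refl (≈-sym (M-e 0)))) (⊖-cong (⊗-cong ≈-refl (≈-sym (M-e 5)))))
      -- The sum of `r₁` and `r₂` reads γ e5 = α e1 + β e0.
      (≈-trans (solve 10 (λ a b c w u0 u1 u2 u3 u4 u5 → let M = a :* (b :* c) in
          a :* (M :* (u1 :+ u4)) :+ b :* (M :* (u0 :+ u5)) :- c :* (M :* (u2 :+ u3)) := :- M :* (c :* u2 :+ :- (a :* u4) :+ :- (b :* u5)) :+ :- M :* (c :* u3 :+ :- (a :* u1) :+ :- (b :* u0)))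
          ≈-refl α β γ w u0 u1 u2 u3 u4 u5)
        (⊖ M ⊗₀ r₁ ⊕₀ ⊖ M ⊗₀ r₂)))

    Monomial : Set
    Monomial = Ser × ℕ × ℕ

    quadratic : List Monomial → (ℕ → Ser) → Ser
    quadratic []               x = 𝟘
    quadratic ((c , i , j) ∷ ts) x = c ⊗ (x i ⊗ x j) ⊕ quadratic ts x

    quadratic-M : ∀ ts → M ⊗ M ⊗ quadratic ts e ≈ w ⊗ w ⊗ quadratic ts m
    quadratic-M [] = solve 2 (λ a b → a :* a :* κ (+ 0) := b :* b :* κ (+ 0)) ≈-refl M w
    quadratic-M ((c , i , j) ∷ ts) = ≈-trans (solve 5 (λ M c x y q → M :* M :* (c :* (x :* y) :+ q) := c :* ((M :* x) :* (M :* y)) :+ M :* M :* q) ≈-refl M c (e i) (e j) (quadratic ts e))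
      (≈-trans (⊕-cong (⊗-cong ≈-refl (⊗-cong (M-e i) (M-e j))) (quadratic-M ts))
        (solve 5 (λ w c x y q → c :* ((w :* x) :* (w :* y)) :+ w :* w :* q := w :* w :* (c :* (x :* y) :+ q)) ≈-refl w c (m i) (m j) (quadratic ts m)))

    -- `t s` lists the terms of class s in E² E³, with E = e0 + e1 + e2 + e5 and E³ ≡ α + 4β - 2γ;
    -- `α`, `β`, `γ` lie in the classes 0, 1, 3.
    t0 t1 t2 t3 t4 t5 t6 : List Monomial
    t0 = (con (+ 1) ⊗ α , 0 , 0) ∷ (con (+ 2) ⊗ α , 5 , 2) ∷ (con (+ 8) ⊗ β , 1 , 5) ∷ (con (- + 2) ⊗ γ , 2 , 2) ∷ []
    t1 = (con (+ 2) ⊗ α , 0 , 1) ∷ (con (+ 4) ⊗ β , 0 , 0) ∷ (con (+ 8) ⊗ β , 5 , 2) ∷ (con (- + 4) ⊗ γ , 0 , 5) ∷ []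
    t2 = (con (+ 2) ⊗ α , 0 , 2) ∷ (con (+ 1) ⊗ α , 1 , 1) ∷ (con (+ 8) ⊗ β , 0 , 1) ∷ (con (- + 4) ⊗ γ , 1 , 5) ∷ []
    t3 = (con (+ 2) ⊗ α , 1 , 2) ∷ (con (+ 1) ⊗ α , 5 , 5) ∷ (con (+ 8) ⊗ β , 0 , 2) ∷ (con (+ 4) ⊗ β , 1 , 1) ∷ (con (- + 2) ⊗ γ , 0 , 0) ∷ (con (- + 4) ⊗ γ , 5 , 2) ∷ []
    t4 = (con (+ 1) ⊗ α , 2 , 2) ∷ (con (+ 8) ⊗ β , 1 , 2) ∷ (con (+ 4) ⊗ β , 5 , 5) ∷ (con (- + 4) ⊗ γ , 0 , 1) ∷ []
    t5 = (con (+ 2) ⊗ α , 0 , 5) ∷ (con (+ 4) ⊗ β , 2 , 2) ∷ (con (- + 4) ⊗ γ , 0 , 2) ∷ (con (- + 2) ⊗ γ , 1 , 1) ∷ []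
    t6 = (con (+ 2) ⊗ α , 1 , 5) ∷ (con (+ 8) ⊗ β , 0 , 5) ∷ (con (- + 4) ⊗ γ , 1 , 2) ∷ (con (- + 2) ⊗ γ , 5 , 5) ∷ []

    -- The class parts of -E² P_3, whose coefficients are tri j for the residue j of each `U`;
    -- residues 0 and 1 have weight 0. `X` collects the products of class 1 with the parts of E^5,
    -- from 0 + 1, 1 + 0, 5 + 3 and 2 + 6.
    d0 d1 d2 d5 X : Ser
    d0 = con (+ 10) ⊗ u5
    d1 = con (+ 6) ⊗ u4
    d2 = con (+ 15) ⊗ w
    d5 = con (+ 1) ⊗ u2 ⊕ con (+ 3) ⊗ u3
    X = d0 ⊗ quadratic t1 e ⊕ d1 ⊗ quadratic t0 e ⊕ d5 ⊗ quadratic t3 e ⊕ d2 ⊗ quadratic t6 e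

    -- Unlike u2 + u3, the combination u2 + 3 u3 is not determined by `w`. Write it as 3 (u2 + u3) -
    -- 2 u2 and trade γ u2 for α u4 + β u5 by `r₁`.
    M-d5 : M ⊗ d5 ≈ con (+ 3) ⊗ (w ⊗ m 5) ⊕ ⊖ (con (+ 2) ⊗ (α ⊗ β ⊗ (α ⊗ u4 ⊕ β ⊗ u5)))
    M-d5 = ≈-trans (solve 5 (λ a b c x y → a :* (b :* c) :* (κ (+ 1) :* x :+ κ (+ 3) :* y) := κ (+ 3) :* (a :* (b :* c) :* (x :+ y)) :- κ (+ 2) :* (a :* b :* (c :* x))) ≈-refl α β γ u2 u3)
      (⊕-cong (⊗-cong ≈-refl (M-e 5)) (⊖-cong (⊗-cong ≈-refl (⊗-cong ≈-refl (move r₁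
        (solve 3 (λ x y z → x := (y :+ z) :+ (x :+ :- y :+ :- z)) ≈-refl (γ ⊗ u2) (α ⊗ u4) (β ⊗ u5)))))))

    -- One factor `M` clears the `d`, two clear the quadratic parts. What remains is a polynomial in
    -- α, β, γ, w, u4, u5, equal to a multiple of `klein` plus a multiple of 7.
    M³X≈0 : M ⊗ (M ⊗ (M ⊗ X)) ≈ 𝟘
    M³X≈0 = ≈-trans (solve 9 (λ M d0 d1 d5 d2 q1 q0 q3 q6 → M :* (M :* (M :* (d0 :* q1 :+ d1 :* q0 :+ d5 :* q3 :+ d2 :* q6)))
        := M :* d0 :* (M :* M :* q1) :+ M :* d1 :* (M :* M :* q0) :+ (M :* d5) :* (M :* M :* q3) :+ M :* d2 :* (M :* M :* q6)) ≈-refl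
        M d0 d1 d5 d2 (quadratic t1 e) (quadratic t0 e) (quadratic t3 e) (quadratic t6 e))
      (≈-trans (⊕-cong (⊕-cong (⊕-cong (⊗-cong ≈-refl (quadratic-M t1)) (⊗-cong ≈-refl (quadratic-M t0))) (⊗-cong M-d5 (quadratic-M t3))) (⊗-cong ≈-refl (quadratic-M t6)))
      (≈-trans certificate (⊗-cong ≈-refl klein ⊹ seven)))
      where
      rest : Ser
      rest = w ⊗ w ⊗ (u5 ⊗ (con (- + 5) ⊗ α ⊗ α ⊗ α ⊗ α ⊗ α ⊗ β ⊗ β ⊗ β ⊗ γ ⊗ γ ⊕ con (+ 9) ⊗ α ⊗ α ⊗ α ⊗ β ⊗ β ⊗ β ⊗ β ⊗ β ⊗ β ⊗ γ ⊕ con (- + 19) ⊗ α ⊗ α ⊗ β ⊗ β ⊗ β ⊗ β ⊗ γ ⊗ γ ⊗ γ ⊗ γ) ⊕ u4 ⊗ (con (- + 2) ⊗ α ⊗ α ⊗ α ⊗ α ⊗ α ⊗ α ⊗ β ⊗ β ⊗ γ ⊗ γ ⊕ con (+ 4) ⊗ α ⊗ α ⊗ α ⊗ α ⊗ β ⊗ β ⊗ β ⊗ β ⊗ β ⊗ γ ⊕ con (- + 12) ⊗ α ⊗ α ⊗ α ⊗ β ⊗ β ⊗ β ⊗ γ ⊗ γ ⊗ γ ⊗ γ) ⊕ w ⊗ (con (- + 15) ⊗ α ⊗ α ⊗ α ⊗ α ⊗ β ⊗ β ⊗ γ ⊗ γ ⊗ γ ⊗ γ ⊕ con (+ 21) ⊗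 α ⊗ α ⊗ β ⊗ β ⊗ β ⊗ β ⊗ β ⊗ γ ⊗ γ ⊗ γ ⊕ con (- + 6) ⊗ α ⊗ β ⊗ β ⊗ β ⊗ γ ⊗ γ ⊗ γ ⊗ γ ⊗ γ ⊗ γ))
      factor : Ser
      factor = w ⊗ (u5 ⊗ (con (+ 3) ⊗ α ⊗ α ⊗ β ⊗ β ⊗ β ⊗ γ) ⊕ u4 ⊗ (con (+ 2) ⊗ α ⊗ α ⊗ α ⊗ β ⊗ β ⊗ γ) ⊕ w ⊗ (con (- + 3) ⊗ α ⊗ β ⊗ β ⊗ γ ⊗ γ ⊗ γ))
      seven : con (+ 7) ⊗ rest ≈ 𝟘
      seven = ≈-trans (⊗-cong (con-congr (+ 1 by refl)) ≈-refl) (solve 1 (λ a → κ (+ 0) :* a := κ (+ 0)) ≈-refl rest)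
      _⊹_ : ∀ {x y} → factor ⊗ x ≈ factor ⊗ 𝟘 → y ≈ 𝟘 → factor ⊗ x ⊕ y ≈ 𝟘
      p ⊹ q = ≈-trans (⊕-cong p q) (solve 1 (λ f → f :* κ (+ 0) :+ κ (+ 0) := κ (+ 0)) ≈-refl factor)
      certificate : M ⊗ d0 ⊗ (w ⊗ w ⊗ quadratic t1 m) ⊕ M ⊗ d1 ⊗ (w ⊗ w ⊗ quadratic t0 m)
          ⊕ (con (+ 3) ⊗ (w ⊗ m 5) ⊕ ⊖ (con (+ 2) ⊗ (α ⊗ β ⊗ (α ⊗ u4 ⊕ β ⊗ u5)))) ⊗ (w ⊗ w ⊗ quadratic t3 m) ⊕ M ⊗ d2 ⊗ (w ⊗ w ⊗ quadratic t6 m)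
        ≈ factor ⊗ (w ⊗ (con (+ 1) ⊗ (α ⊗ α ⊗ α ⊗ γ) ⊕ ⊖ (α ⊗ β ⊗ β ⊗ β) ⊕ β ⊗ γ ⊗ γ ⊗ γ)) ⊕ con (+ 7) ⊗ rest
      certificate = solve 6 (λ a b c w x4 x5 → let M = a :* (b :* c) in
          M :* (κ (+ 10) :* x5) :* (w :* w :* (κ (+ 2) :* a :* ((:- (a :* (b :* b))) :* (a :* (a :* c))) :+ (κ (+ 4) :* b :* ((:- (a :* (b :* b))) :* (:- (a :* (b :* b)))) :+ (κ (+ 8) :* b :* ((:- (b :* (c :* c))) :* (a :* (b :* c))) :+ (κ (- + 4) :* c :* ((:- (a :* (b :* b))) :* (:- (b :* (c :* c)))) :+ (κ (+ 0))))))) :+ M :* (κ (+ 6) :* x4) :* (w :* w :* (κ (+ 1) :* a :* ((:- (a :* (b :* b))) :* (:- (a :* (b :* b)))) :+ (κ (+ 2) :* a :* ((:- (b :* (c :* c))) :* (a :* (b :* c))) :+ (κ (+ 8) :* b :* ((a :* (a :* c)) :* (:- (b :* (c :* c)))) :+ (κ (- + 2) :* c :* ((a :* (b :* c)) :* (a :* (b :* c))) :+ (κ (+ 0)))))))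
            :+ (κ (+ 3) :* (w :* :- (b :* (c :* c))) :- κ (+ 2) :* (a :* b :* (a :* x4 :+ b :* x5))) :* (w :* w :* (κ (+ 2) :* a :* ((a :* (a :* c)) :* (a :* (b :* c))) :+ (κ (+ 1) :* a :* ((:- (b :* (c :* c))) :* (:- (b :* (c :* c)))) :+ (κ (+ 8) :* b :* ((:- (a :* (b :* b))) :* (a :* (b :* c))) :+ (κ (+ 4) :* b :* ((a :* (a :* c)) :* (a :* (a :* c))) :+ (κ (- + 2) :* c :* ((:- (a :* (b :* b))) :* (:- (a :* (b :* b)))) :+ (κ (- + 4) :* c :* ((:- (b :* (c :* c))) :* (a :* (b :* c))) :+ (κ (+ 0))))))))) :+ M :* (κ (+ 15) :* w) :* (w :* w :* (κ (+ 2) :* a :* ((a :* (a :* c)) :* (:- (b :* (c :* c)))) :+ (κ (+ 8) :* b :* ((:- (a :* (b :* b))) :* (:- (b :* (c :* c)))) :+ (κ (- + 4) :* c :* ((a :* (a :* c)) :* (a :* (b :* c))) :+ (κ (- + 2) :* c :* ((:- (b :* (c :* c))) :* (:- (b :* (c :* c)))) :+ (κ (+ 0)))))))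
          := (w :* (x5 :* (κ (+ 3) :* a :* a :* b :* b :* b :* c) :+ x4 :* (κ (+ 2) :* a :* a :* a :* b :* b :* c) :+ w :* (κ (- + 3) :* a :* b :* b :* c :* c :* c))) :* (w :* (κ (+ 1) :* (a :* a :* a :* c) :- a :* b :* b :* b :+ b :* c :* c :* c)) :+ κ (+ 7) :* (w :* w :* (x5 :* (κ (- + 5) :* a :* a :* a :* a :* a :* b :* b :* b :* c :* c :+ κ (+ 9) :* a :* a :* a :* b :* b :* b :* b :* b :* b :* c :+ κ (- + 19) :* a :* a :* b :* b :* b :* b :* c :* c :* c :* c) :+ x4 :* (κ (- + 2) :* a :* a :* a :* a :* a :* a :* b :* b :* c :* c :+ κ (+ 4) :* a :* a :* a :* a :* b :* b :* b :* b :* b :* c :+ κ (- + 12) :* a :* a :* a :* b :* b :* b :* c :* c :* c :* c) :+ w :* (κ (- + 15) :* a :* a :* a :* a :* b :* b :* c :* c :* c :* c :+ κ (+ 21) :* a :* a :* b :* b :* b :* b :* b :* c :* c :* c :+ κ (- + 6) :* a :* b :* b :* b :* c :* c :* c :* c :* c :* c)))) ≈-refl α β γ w u4 u5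

    lead : ∀ {ν g} n k → tri n ≡ k → wL ν n ≡ + 1 → (∀ x → x ≡ n ⊎ wL ν x ≡ + 0 ⊎ k ℕ.< tri x) → L ν ⊗ g ≈ 𝟘 → g ≈ 𝟘
    lead {ν} n k p q h = lead-cancel k (+ 1) (L ν) refl (≐-trans (leading {w = wL ν} {EL} n k (sumL′ ν) (cong ℤ.+_ p)
        (λ x → [ inj₁ , inj₂ ∘ [ inj₁ , (λ l → inj₂ (tri x , refl , l)) ]′ ]′ (h x))) (≗⇒≐ (term-≡ {e = + k} q refl)))

    private
      off : ∀ {ν x} → False (+ 7 ∣? (x - ν)) → wL ν x ≡ + 0
      off {ν} {x} f = cong (_* sgn x) (cls-not 7 f)
      on : ∀ {ν x} → True (+ 7 ∣? (x - ν)) → sgn x ≡ + 1 → wL ν x ≡ + 1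
      on t s = cong₂ _*_ (cls-is 7 t) s
      big : ∀ n → 3 ℕ.< triN (4 ℕ.+ n)
      big n = ℕP.+-mono-≤ {3} {3 ℕ.+ n} {1} (s≤s (s≤s (s≤s z≤n))) (s≤s z≤n)

    α-cancel : ∀ {g} → α ⊗ g ≈ 𝟘 → g ≈ 𝟘
    α-cancel = lead (+ 0) 0 refl (on _ refl) λ
      { (+ zero) → inj₁ refl ; (+ suc zero) → inj₂ (inj₁ (off _)) ; (+ suc (suc n)) → inj₂ (inj₂ (s≤s z≤n)) ; -[1+ n ] → inj₂ (inj₂ (s≤s z≤n)) }

    β-cancel : ∀ {g} → β ⊗ g ≈ 𝟘 → g ≈ 𝟘
    β-cancel = lead (+ 2) 1 refl (on _ refl) λ
      { (+ zero) → inj₂ (inj₁ (off _)) ; (+ suc zero) → inj₂ (inj₁ (off _)) ; (+ suc (suc zero)) → inj₁ refl ; (+ suc (suc (suc n))) → inj₂ (inj₂ (s≤s (s≤s z≤n)))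
      ; -[1+ zero ] → inj₂ (inj₁ (off _)) ; -[1+ suc n ] → inj₂ (inj₂ (s≤s (s≤s z≤n))) }

    γ-cancel : ∀ {g} → γ ⊗ g ≈ 𝟘 → g ≈ 𝟘
    -- The member of class 5 with least exponent is -2, where tri is 3; at 5 itself it is already
    -- 10.
    γ-cancel = lead (- + 2) 3 refl (on _ refl) λ
      { (+ zero) → inj₂ (inj₁ (off _)) ; (+ suc zero) → inj₂ (inj₁ (off _)) ; (+ suc (suc zero)) → inj₂ (inj₁ (off _)) ; (+ suc (suc (suc zero))) → inj₂ (inj₁ (off _))
      ; (+ suc (suc (suc (suc n)))) → inj₂ (inj₂ (big n)) ; -[1+ zero ] → inj₂ (inj₁ (off _)) ; -[1+ suc zero ] → inj₁ refl ; -[1+ suc (suc n) ] → inj₂ (inj₂ (big n)) }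

    M-cancel : ∀ {g} → M ⊗ g ≈ 𝟘 → g ≈ 𝟘
    M-cancel {g} p = γ-cancel (β-cancel (α-cancel (≈-trans (solve 4 (λ a b c g → a :* (b :* (c :* g)) := a :* (b :* c) :* g) ≈-refl α β γ g) p)))

    X≈0 : X ≈ 𝟘
    X≈0 = M-cancel (M-cancel (M-cancel M³X≈0))

  -- The congruence modulo 7.

  module SevenTheorem where
    open Classes 7
    open Families 7
    open Periodic 7
    open Odd 3 using (tri-cong)
    open SevenClasses

    E⁷-Off : Off (+ 0) (E ^ˢ 7)
    E⁷-Off = frobenius λ x → ≈-trans
      (solve 1 (λ x → let y = κ (+ 1) :- x in y :* (y :* (y :* (y :* (y :* (y :* (y :* κ (+ 1)))))))
        := (κ (+ 1) :- x :* (x :* (x :* (x :* (x :* (x :* (x :* κ (+ 1)))))))) :+ κ (+ 7) :* (x :* (κ (- + 1) :+ x :* (κ (+ 3) :+ x :* (κ (- + 5) :+ x :* (κ (+ 5) :+ x :* (κ (- + 3) :+ x))))))) ≈-refl x)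
      (≈-trans (⊕-cong ≈-refl (⊗-cong (con-congr (+ 1 by refl)) ≈-refl)) (solve 2 (λ a b → a :+ κ (+ 0) :* b := a) ≈-refl (𝟙 ⊕ ⊖ (x ^ˢ 7))
        (x ⊗ (con (- + 1) ⊕ x ⊗ (con (+ 3) ⊕ x ⊗ (con (- + 5) ⊕ x ⊗ (con (+ 5) ⊕ x ⊗ (con (- + 3) ⊕ x))))))))

    E≈ : E ≈ e 0 ⊕ e 1 ⊕ e 2 ⊕ e 5
    E≈ = ≈-trans (Decompose.single 7 {f = λ _ → + 1} {sgn} {EU} {S = U} (λ _ → rrefl) (toWitness {a? = all? λ r → _ ℤ.≟ _} _)
        (sumM-cong {w = sgn} {λ i → + 1 * sgn i} {EU} {EU} (λ j → sym (ℤP.*-identityˡ (sgn j))) (λ _ → refl) pentagonal) sumU)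
      (solve 7 (λ u0 u1 u2 u3 u4 u5 w → κ (+ 1) :* u0 :+ (κ (+ 1) :* u1 :+ (κ (+ 1) :* u2 :+ (κ (+ 1) :* u3 :+ (κ (+ 1) :* u4 :+ (κ (+ 1) :* u5 :+ (κ (+ 1) :* w :+ κ (+ 0)))))))
        := (u0 :+ u5) :+ (u1 :+ u4) :+ w :+ (u2 :+ u3)) ≈-refl u0 u1 u2 u3 u4 u5 w)

    -- The substitution j ↦ -j turns the exponent tri j + j² + j into the pentagonal one and T_j
    -- into tri j, so the pieces `U` of E serve here too.
    D≈ : ⊖ (E ⊗ E ⊗ gf 3) ≈ d0 ⊕ d1 ⊕ d2 ⊕ d5
    D≈ = ≈-trans (Decompose.single 7 {f = tri-w} {sgn} {EU} {S = U} tri-cong (toWitness {a? = all? λ r → _ ℤ.≟ _} _) reindexed sumU)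
      (solve 7 (λ u0 u1 u2 u3 u4 u5 w → κ (+ 0) :* u0 :+ (κ (+ 0) :* u1 :+ (κ (+ 1) :* u2 :+ (κ (+ 3) :* u3 :+ (κ (+ 6) :* u4 :+ (κ (+ 10) :* u5 :+ (κ (+ 15) :* w :+ κ (+ 0)))))))
        := κ (+ 10) :* u5 :+ κ (+ 6) :* u4 :+ κ (+ 15) :* w :+ (κ (+ 1) :* u2 :+ κ (+ 3) :* u3)) ≈-refl u0 u1 u2 u3 u4 u5 w)
      where
      negate : ℤ ≃ ℤ
      negate = bij -_ -_ ℤP.neg-involutive ℤP.neg-involutive
      tri-neg : ∀ j → tri (- j + + 1) ≡ tri j
      tri-neg j = trans (cong tri (ℤP.+-comm (- j) (+ 1))) (tri-reflect j)
      reindexed : SumM (λ j → tri-w j * sgn j) EU (⊖ (E ⊗ E ⊗ gf 3))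
      reindexed = sumM-cong {w = λ j → T-w (- j) * sgn (- j)} {λ j → tri-w j * sgn j} {λ j → + tri (- j) + (- j * - j + - j)} {EU}
        (λ j → cong₂ _*_ (cong ℤ.+_ (tri-neg j)) (sgn-neg j))
        (λ j → trans (cong (_+ (- j * - j + - j)) (tri-eq (- j) j j (l₁ j))) (l₂ (+ tri j) j)) (sumS-bij negate gf₃)
        where
        l₁ : ∀ j → - j * - j - - j ≡ j * j - j + + 2 * j
        l₁ = solve-∀
        l₂ : ∀ t j → t + j + (- j * - j + - j) ≡ t + j * j
        l₂ = solve-∀

    -- Jacobi's series again: reflection pairs the classes 0, 1 and 2, 6 and 3, 5 and kills the
    -- class 4, leaving 1, 6 - 2 and 3 - 5 as coefficients.
    E³≈ : E ⊗ E ⊗ E ≈ α ⊕ con (+ 4) ⊗ β ⊕ con (- + 2) ⊗ γ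
    E³≈ = ≈-trans (solve 1 (λ e → e := :- (:- e)) ≈-refl (E ⊗ E ⊗ E)) (≈-trans (⊖-cong
        (≈-trans (Decompose.single 7 {f = id} {sgn} {EL} {S = L} id (toWitness {a? = all? λ r → _ ℤ.≟ _} _) jacobi sumL′)
        (⊕-cong ≈-refl (⊕-cong (⊗-cong ≈-refl (lift 7 (L-reflect (+ 0)))) (⊕-cong ≈-refl (⊕-cong (⊗-cong ≈-refl (lift 7 L3)) (⊕-cong (⊗-cong ≈-refl (lift 7 L4))
          (⊕-cong ≈-refl (⊕-cong (⊗-cong ≈-refl (lift 7 L6)) ≈-refl)))))))))
      (solve 3 (λ a b c → :- (κ (+ 0) :* a :+ (κ (+ 1) :* :- a :+ (κ (+ 2) :* b :+ (κ (+ 3) :* :- c :+ (κ (+ 4) :* κ (+ 0) :+ (κ (+ 5) :* c :+ (κ (+ 6) :* :- b :+ κ (+ 0))))))))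
        := a :+ κ (+ 4) :* b :+ κ (- + 2) :* c) ≈-refl α β γ))
      where
      L3 : L (+ 3) ≗ ⊖ γ
      L3 = Ex.≈-trans (L-per { - + 4} {+ 3} (+ 1) refl) (L-reflect (+ 5))
      L4 : L (+ 4) ≗ 𝟘
      L4 = double-zero (Ex.≈-trans (Ex.≈-sym (L-per {+ 4} { - + 3} (- + 1) refl)) (L-reflect (+ 4)))
      L6 : L (+ 6) ≗ ⊖ β
      L6 = Ex.≈-trans (L-per { - + 1} {+ 6} (+ 1) refl) (L-reflect (+ 2))

    private
      one-class : ∀ {ν c} {ex : ℤ → ℤ} {s} → (∀ {x r} → Cong 7 x r → Cong 7 (ex x) (ex r)) → True (cong? 7 (ex ν) c) →
        SumM (λ x → cls 7 ν x * sgn x) ex s → Off c s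
      one-class {ν} {c} {ex} ec t S = sum-Off S λ x → go x (cong? 7 x ν)
        where
        go : ∀ x → Dec (Cong 7 x ν) → cls 7 ν x * sgn x ≡ + 0 ⊎ Cong 7 (ex x) c
        go x (yes p) = inj₂ (rtrans (ec p) (toWitness t))
        go x (no n)  = inj₁ (cong (_* sgn x) (¬Cong⇒cls 7 n))

    L-Off : ∀ ν {c} → True (cong? 7 (+ tri ν) c) → Off c (L ν)
    L-Off ν t = one-class {ν} {ex = EL} tri-cong t (sumL′ ν)

    U-Off : ∀ j {c} → True (cong? 7 (EU j) c) → Off c (U j)
    U-Off j t = one-class {j} {ex = EU} (λ p → r+ (tri-cong p) (r* p p)) t (sumU j)

    𝟘-Off : ∀ {c} → Off c 𝟘
    𝟘-Off m _ = Cong-≡ (con0 m)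

    e-Off : ∀ i → Off (+ i) (e i)
    e-Off 0 = Off-⊕ (U-Off (+ 0) _) (U-Off (+ 5) _)
    e-Off 1 = Off-⊕ (U-Off (+ 1) _) (U-Off (+ 4) _)
    e-Off 2 = U-Off (+ 6) _
    e-Off 5 = Off-⊕ (U-Off (+ 2) _) (U-Off (+ 3) _)
    e-Off 3 = 𝟘-Off
    e-Off 4 = 𝟘-Off
    e-Off (suc (suc (suc (suc (suc (suc _)))))) = 𝟘-Off

    InClass : ℤ → Monomial → Set
    InClass s (c , i , j) = Σ ℤ λ d → Off d c × Cong 7 (d + (+ i + + j)) s

    quadratic-Off : ∀ {s ts} → All.All (InClass s) ts → Off s (quadratic ts e)
    quadratic-Off All.[] = 𝟘-Off
    quadratic-Off {s} {(c , i , j) ∷ ts} ((d , o , p) All.∷ h) = Off-⊕ (λ m n → Off-⊗ {d} {+ i + + j} o (Off-⊗ {+ i} {+ j} (e-Off i) (e-Off j)) m (λ q → n (rtrans q p))) (quadratic-Off h)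

    αc : ∀ k i j {s} → True (cong? 7 (+ 0 + (+ i + + j)) s) → InClass s (con k ⊗ α , i , j)
    αc k i j t = + 0 , Off-c⊗ k (L-Off (+ 0) _) , toWitness t
    βc : ∀ k i j {s} → True (cong? 7 (+ 1 + (+ i + + j)) s) → InClass s (con k ⊗ β , i , j)
    βc k i j t = + 1 , Off-c⊗ k (L-Off (+ 2) _) , toWitness t
    γc : ∀ k i j {s} → True (cong? 7 (+ 3 + (+ i + + j)) s) → InClass s (con k ⊗ γ , i , j)
    γc k i j t = + 3 , Off-c⊗ k (L-Off (+ 5) _) , toWitness t

    q : ℕ → Ser
    q 0 = quadratic t0 e
    q 1 = quadratic t1 e
    q 2 = quadratic t2 e
    q 3 = quadratic t3 e
    q 4 = quadratic t4 e
    q 5 = quadratic t5 e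
    q _ = quadratic t6 e

    q0-Off : Off (+ 0) (q 0)
    q0-Off = quadratic-Off {ts = t0} (αc (+ 1) 0 0 _ All.∷ αc (+ 2) 5 2 _ All.∷ βc (+ 8) 1 5 _ All.∷ γc (- + 2) 2 2 _ All.∷ All.[])
    q1-Off : Off (+ 1) (q 1)
    q1-Off = quadratic-Off {ts = t1} (αc (+ 2) 0 1 _ All.∷ βc (+ 4) 0 0 _ All.∷ βc (+ 8) 5 2 _ All.∷ γc (- + 4) 0 5 _ All.∷ All.[])
    q2-Off : Off (+ 2) (q 2)
    q2-Off = quadratic-Off {ts = t2} (αc (+ 2) 0 2 _ All.∷ αc (+ 1) 1 1 _ All.∷ βc (+ 8) 0 1 _ All.∷ γc (- + 4) 1 5 _ All.∷ All.[])
    q3-Off : Off (+ 3) (q 3)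
    q3-Off = quadratic-Off {ts = t3} (αc (+ 2) 1 2 _ All.∷ αc (+ 1) 5 5 _ All.∷ βc (+ 8) 0 2 _ All.∷ βc (+ 4) 1 1 _ All.∷ γc (- + 2) 0 0 _ All.∷ γc (- + 4) 5 2 _ All.∷ All.[])
    q4-Off : Off (+ 4) (q 4)
    q4-Off = quadratic-Off {ts = t4} (αc (+ 1) 2 2 _ All.∷ βc (+ 8) 1 2 _ All.∷ βc (+ 4) 5 5 _ All.∷ γc (- + 4) 0 1 _ All.∷ All.[])
    q5-Off : Off (+ 5) (q 5)
    q5-Off = quadratic-Off {ts = t5} (αc (+ 2) 0 5 _ All.∷ βc (+ 4) 2 2 _ All.∷ γc (- + 4) 0 2 _ All.∷ γc (- + 2) 1 1 _ All.∷ All.[])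
    q6-Off : Off (+ 6) (q 6)
    q6-Off = quadratic-Off {ts = t6} (αc (+ 2) 1 5 _ All.∷ βc (+ 8) 0 5 _ All.∷ γc (- + 4) 1 2 _ All.∷ γc (- + 2) 5 5 _ All.∷ All.[])

    Q≈ : E ⊗ E ⊗ (E ⊗ E ⊗ E) ≈ q 0 ⊕ q 1 ⊕ q 2 ⊕ q 3 ⊕ q 4 ⊕ q 5 ⊕ q 6
    Q≈ = ≈-trans (⊗-cong (⊗-cong E≈ E≈) E³≈) (solve 7 (λ e0 e1 e2 e5 a b c → (e0 :+ e1 :+ e2 :+ e5) :* (e0 :+ e1 :+ e2 :+ e5) :* (a :+ κ (+ 4) :* b :+ κ (- + 2) :* c)
      := (κ (+ 1) :* a :* (e0 :* e0) :+ (κ (+ 2) :* a :* (e5 :* e2) :+ (κ (+ 8) :* b :* (e1 :* e5) :+ (κ (- + 2) :* c :* (e2 :* e2) :+ (κ (+ 0)))))) :+ (κ (+ 2) :* a :* (e0 :* e1) :+ (κ (+ 4) :* b :* (e0 :* e0) :+ (κ (+ 8) :* b :* (e5 :* e2) :+ (κ (- + 4) :* c :* (e0 :* e5) :+ (κ (+ 0)))))) :+ (κ (+ 2) :* a :* (e0 :* e2) :+ (κ (+ 1) :* a :* (e1 :* e1) :+ (κ (+ 8) :* b :* (e0 :* e1) :+ (κ (- + 4) :* c :* (e1 :* e5) :+ (κ (+ 0)))))) :+ (κ (+ 2) :* a :* (e1 :* e2) :+ (κ (+ 1) :* a :* (e5 :* e5) :+ (κ (+ 8) :* b :* (e0 :*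 e2) :+ (κ (+ 4) :* b :* (e1 :* e1) :+ (κ (- + 2) :* c :* (e0 :* e0) :+ (κ (- + 4) :* c :* (e5 :* e2) :+ (κ (+ 0)))))))) :+ (κ (+ 1) :* a :* (e2 :* e2) :+ (κ (+ 8) :* b :* (e1 :* e2) :+ (κ (+ 4) :* b :* (e5 :* e5) :+ (κ (- + 4) :* c :* (e0 :* e1) :+ (κ (+ 0)))))) :+ (κ (+ 2) :* a :* (e0 :* e5) :+ (κ (+ 4) :* b :* (e2 :* e2) :+ (κ (- + 4) :* c :* (e0 :* e2) :+ (κ (- + 2) :* c :* (e1 :* e1) :+ (κ (+ 0)))))) :+ (κ (+ 2) :* a :* (e1 :* e5) :+ (κ (+ 8) :* b :* (e0 :* e5) :+ (κ (- + 4) :* c :* (e1 :* e2) :+ (κ (- + 2) :* c :* (e5 :* e5) :+ (κ (+ 0))))))) ≈-refl (e 0) (e 1) (e 2) (e 5) α β γ)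

    apart : ∀ {c d f} → False (cong? 7 d c) → Off c f → Van d f
    apart n = Off⇒Van (toWitnessFalse n)

    -- E^7 P_3 is -1 times the product of -E² P_3 and E^5. Grading by classes modulo 7 leaves only
    -- `X` in class 1.
    gf₃-Van : Van (+ 1) (gf 3)
    gf₃-Van = Van-unit (E ^ˢ 7) refl E⁷-Off (Van-≈ (≈-sym expand) (Van-⊖ (Van-⊕ (Van-⊕ (Van-⊕ (Van-⊕ (λ m _ → rtrans (at X≈0 m) (Cong-≡ (con0 m)))
        (Off-Van-⊗ {+ 0} {+ 1} (Off-c⊗ (+ 10) (U-Off (+ 5) _)) (Van-⊕ (Van-⊕ (Van-⊕ (Van-⊕ (Van-⊕ (apart _ q0-Off) (apart _ q2-Off)) (apart _ q3-Off)) (apart _ q4-Off)) (apart _ q5-Off)) (apart _ q6-Off))))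
        (Off-Van-⊗ {+ 1} {+ 0} (Off-c⊗ (+ 6) (U-Off (+ 4) _)) (Van-⊕ (Van-⊕ (Van-⊕ (Van-⊕ (Van-⊕ (apart _ q1-Off) (apart _ q2-Off)) (apart _ q3-Off)) (apart _ q4-Off)) (apart _ q5-Off)) (apart _ q6-Off))))
        (Off-Van-⊗ {+ 5} { - + 4} (Off-⊕ (Off-c⊗ (+ 1) (U-Off (+ 2) _)) (Off-c⊗ (+ 3) (U-Off (+ 3) _))) (Van-⊕ (Van-⊕ (Van-⊕ (Van-⊕ (Van-⊕ (apart _ q0-Off) (apart _ q1-Off)) (apart _ q2-Off)) (apart _ q4-Off)) (apart _ q5-Off)) (apart _ q6-Off))))
        (Off-Van-⊗ {+ 2} { - + 1} (Off-c⊗ (+ 15) (U-Off (+ 6) _)) (Van-⊕ (Van-⊕ (Van-⊕ (Van-⊕ (Van-⊕ (apart _ q0-Off) (apart _ q1-Off)) (apart _ q2-Off)) (apart _ q3-Off)) (apart _ q4-Off)) (apart _ q5-Off))))))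
      where
      expand : E ^ˢ 7 ⊗ gf 3 ≈ ⊖ (X ⊕ d0 ⊗ (q 0 ⊕ q 2 ⊕ q 3 ⊕ q 4 ⊕ q 5 ⊕ q 6) ⊕ d1 ⊗ (q 1 ⊕ q 2 ⊕ q 3 ⊕ q 4 ⊕ q 5 ⊕ q 6) ⊕ d5 ⊗ (q 0 ⊕ q 1 ⊕ q 2 ⊕ q 4 ⊕ q 5 ⊕ q 6) ⊕ d2 ⊗ (q 0 ⊕ q 1 ⊕ q 2 ⊕ q 3 ⊕ q 4 ⊕ q 5))
      expand = ≈-trans (solve 2 (λ e p → e :* (e :* (e :* (e :* (e :* (e :* (e :* κ (+ 1))))))) :* p := :- (:- (e :* e :* p) :* (e :* e :* (e :* e :* e)))) ≈-refl E (gf 3))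
        (⊖-cong (≈-trans (⊗-cong D≈ Q≈) (solve 11 (λ d0 d1 d2 d5 q0 q1 q2 q3 q4 q5 q6 → (d0 :+ d1 :+ d2 :+ d5) :* (q0 :+ q1 :+ q2 :+ q3 :+ q4 :+ q5 :+ q6)
          := (d0 :* q1 :+ d1 :* q0 :+ d5 :* q3 :+ d2 :* q6) :+ d0 :* (q0 :+ q2 :+ q3 :+ q4 :+ q5 :+ q6) :+ d1 :* (q1 :+ q2 :+ q3 :+ q4 :+ q5 :+ q6) :+ d5 :* (q0 :+ q1 :+ q2 :+ q4 :+ q5 :+ q6) :+ d2 :* (q0 :+ q1 :+ q2 :+ q3 :+ q4 :+ q5)) ≈-refl d0 d1 d2 d5 (q 0) (q 1) (q 2) (q 3) (q 4) (q 5) (q 6))))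

  progression : ∀ ℓ n r → Cong ℓ (+ (ℓ ℕ.* n ℕ.+ r)) (+ r)
  progression ℓ n r = + n by trans (cong (_+ + r) (trans (ℤP.pos-* ℓ n) (ℤP.*-comm (+ ℓ) (+ n)))) (ℤP.+-comm (+ n * + ℓ) (+ r))

  multiples : ∀ ℓ n → Cong ℓ (+ (ℓ ℕ.* n)) (+ 0)
  multiples ℓ n = subst (λ m → Cong ℓ (+ m) (+ 0)) (ℕP.+-identityʳ (ℓ ℕ.* n)) (progression ℓ n 0)

open import Defs
open import Data.Nat using (ℕ; _+_; _*_)
open import Data.Nat.Divisibility using (_∣_)
open import Data.Product using (_×_; _,_)

theorem1 : (n : ℕ) → (3 ∣ pp 1 (3 * n)) × (3 ∣ pp 2 (3 * n + 1)) × (5 ∣ pp 2 (5 * n + 1)) × (5 ∣ pp 3 (5 * n + 4)) × (7 ∣ pp 3 (7 * n + 1)) × (5 ∣ pp 4 (5 * n + 4))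
theorem1 n =
    Classes.Van⇒∣ 3 {1} Three.gf₁-Van (3 * n) (multiples 3 n)
  , Classes.Van⇒∣ 3 {2} Three.gf₂-Van (3 * n + 1) (progression 3 n 1)
  , Classes.Van⇒∣ 5 {2} FiveClasses.gf₂-Van (5 * n + 1) (progression 5 n 1)
  , Classes.Van⇒∣ 5 {3} FiveClasses.gf₃-Van (5 * n + 4) (progression 5 n 4)
  , Classes.Van⇒∣ 7 {3} SevenTheorem.gf₃-Van (7 * n + 1) (progression 7 n 1)
  , Classes.Van⇒∣ 5 {4} FiveClasses.gf₄-Van (5 * n + 4) (progression 5 n 4)
  where open Proof using (multiples; progression; module Classes; module Three; module FiveClasses; module SevenTheorem)
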